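{- Let $G$ be the $xy$-sum of connected graphs $G_1,G_2\in\mathcal G_{xy}^\circ$. The subgraph $G_1$ is $\widehat g^+$-tight in $G$ if and only if $G_1\in\mathcal C^\circ(\widehat g^+)$.
   Context: All graphs are finite and simple; after contracting an edge, parallel edges are replaced by single edges. The Euler genus $\widehat g(G)$ is the minimum Euler genus of a surface into which $G$ embeds. $\mathcal G_{xy}$ is the class of simple graphs with two distinguished vertices $x,y$ (terminals); $\mathcal G_{xy}^\circ$ the subclass with $x,y$ non-adjacent. The set $\mathcal M(G)$ of minor-operations consists of deletion of any edge and contraction of any edge other than $xy$ (contracting an edge incident with a terminal yields a terminal); $\mu G$ is the result. For a subgraph $H$ of $G$, $\mathcal M(H)$ are the minor-operations on edges of $H$. $G^+$ is $G$ with edge $xy$ added and $\widehat g^+(G)=\widehat g(G^+)$. For $G_1,G_2\in\mathcal G_{xy}$ with $V(G_1)\cap V(G_2)=\{x,y\}$, their $xy$-sum has vertex set $V(G_1)\cup V(G_2)$, edge set $E(G_1)\cup E(G_2)$ and terminals $x,y$. A subgraph $H$ of $G$ is $\widehat g^+$-tight if $\widehat g^+(\mu G)<\widehat g^+(G)$ for every $\mu\in\mathcal M(H)$. $\mathcal C^\circ(\widehat g^+)$ is the class of $G\in\mathcal G_{xy}^\circ$ with $\widehat g^+(\mu G)<\widehat g^+(G)$ for all $\mu\in\mathcal M(G)$. -}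

module Defs where

open import Data.Bool using (Bool; true; false; _∧_; _∨_; not; if_then_else_; T; _xor_)
open import Data.Nat using (ℕ; zero; suc; _+_; _*_; _∸_; _≤_; _<_; _≤ᵇ_; _<ᵇ_; ⌊_/2⌋)
open import Data.Fin using (Fin; toℕ; punchOut)
open import Data.Fin.Properties using (_≟_)
open import Data.Product using (Σ; ∃; _×_; _,_; proj₁; proj₂)
open import Data.Sum using (_⊎_)
open import Relation.Nullary using (¬_; yes; no)
open import Relation.Nullary.Decidable using (⌊_⌋)
open import Relation.Binary.PropositionalEquality using (_≡_; _≢_; refl; sym)

anyFin : ∀ {m} → (Fin m → Bool) → Bool
anyFin {zero}  f = false
anyFin {suc m} f = f Fin.zero ∨ anyFin (λ i → f (Fin.suc i))

allFin : ∀ {m} → (Fin m → Bool) → Bool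
allFin {zero}  f = true
allFin {suc m} f = f Fin.zero ∧ allFin (λ i → f (Fin.suc i))

sumFin : ∀ {m} → (Fin m → ℕ) → ℕ
sumFin {zero}  f = 0
sumFin {suc m} f = f Fin.zero + sumFin (λ i → f (Fin.suc i))

countFin : ∀ {m} → (Fin m → Bool) → ℕ
countFin f = sumFin (λ i → if f i then 1 else 0)

allBelow : ℕ → (ℕ → Bool) → Bool
allBelow zero    p = true
allBelow (suc N) p = allBelow N p ∧ p N

iter : ∀ {A : Set} → ℕ → (A → A) → A → A
iter zero    f a = a
iter (suc k) f a = f (iter k f a)

_=ᶠ_ : ∀ {m} → Fin m → Fin m → Bool
i =ᶠ j = ⌊ i ≟ j ⌋

samePair : ∀ {m} → Fin m → Fin m → Fin m → Fin m → Bool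
samePair a b u v = (a =ᶠ u ∧ b =ᶠ v) ∨ (a =ᶠ v ∧ b =ᶠ u)

-- Graphs with two terminals (class G_xy).
-- Vertex set Fin n; the raw relation adj is symmetrised and loops are
-- discarded, so every TGraph denotes a finite simple graph.

record TGraph : Set where
  constructor tgraph
  field
    n   : ℕ
    adj : Fin n → Fin n → Bool
    x   : Fin n
    y   : Fin n
open TGraph public

EdgeRaw : ∀ {m} → (Fin m → Fin m → Bool) → Fin m → Fin m → Bool
EdgeRaw adj i j = not (i =ᶠ j) ∧ (adj i j ∨ adj j i)

Edge : (G : TGraph) → Fin (n G) → Fin (n G) → Bool
Edge G = EdgeRaw (adj G)

InGxy° : TGraph → Set
InGxy° G = (x G ≢ y G) × ¬ T (Edge G (x G) (y G))

plus : TGraph → TGraph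
plus G = tgraph (n G) (λ i j → adj G i j ∨ samePair i j (x G) (y G)) (x G) (y G)

deleteEdge : (G : TGraph) → Fin (n G) → Fin (n G) → TGraph
deleteEdge G u v =
  tgraph (n G) (λ i j → Edge G i j ∧ not (samePair i j u v)) (x G) (y G)

squash : ∀ {k} → Fin (suc k) → Fin k → Fin (suc k) → Fin k
squash v u' w with w ≟ v
... | yes _   = u'
... | no w≢v  = punchOut {i = v} {j = w} (λ eq → w≢v (sym eq))

contractRaw : (k : ℕ) → (Fin (suc k) → Fin (suc k) → Bool) →
              (x y u v : Fin (suc k)) → u ≢ v → TGraph
contractRaw k adj x y u v u≢v =
  tgraph k
    (λ a b → anyFin λ a' → anyFin λ b' →
       (sq a' =ᶠ a) ∧ (sq b' =ᶠ b) ∧ EdgeRaw adj a' b')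
    (sq x) (sq y)
  where
    u' : Fin k
    u' = punchOut {i = v} {j = u} (λ eq → u≢v (sym eq))
    sq : Fin (suc k) → Fin k
    sq = squash v u'

-- contract edge uv (v is merged into u; the merged vertex is a terminal
-- if u or v was one; loops removed, parallel edges merged)
contract : (G : TGraph) → (u v : Fin (n G)) → u ≢ v → TGraph
contract (tgraph zero    adj () y) u v p
contract (tgraph (suc k) adj x y) u v p = contractRaw k adj x y u v p

edge⇒≢ : ∀ {m} {u v : Fin m} {b : Bool} → T (not ⌊ u ≟ v ⌋ ∧ b) → u ≢ v
edge⇒≢ {u = u} {v} t eq with u ≟ v
... | yes _ = t
... | no ne = ne eq

data MinorOp (G : TGraph) : Set where
  deleteOp   : (u v : Fin (n G)) → T (Edge G u v) → MinorOp G
  contractOp : (u v : Fin (n G)) → T (Edge G u v) →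
               T (not (samePair u v (x G) (y G))) → MinorOp G

opEdge : {G : TGraph} → MinorOp G → Fin (n G) × Fin (n G)
opEdge (deleteOp u v _)     = u , v
opEdge (contractOp u v _ _) = u , v

applyOp : (G : TGraph) → MinorOp G → TGraph
applyOp G (deleteOp u v _)     = deleteEdge G u v
applyOp G (contractOp u v e _) = contract G u v (edge⇒≢ e)

data Walk (G : TGraph) : Fin (n G) → Fin (n G) → Set where
  here : ∀ {a} → Walk G a a
  step : ∀ {a b c} → T (Edge G a b) → Walk G b c → Walk G a c

Connected : TGraph → Set
Connected G = ∀ a b → Walk G a b

reachIter : (G : TGraph) → ℕ → Fin (n G) → Fin (n G) → Bool
reachIter G zero    a b = a =ᶠ b
reachIter G (suc k) a b =
  reachIter G k a b ∨ anyFin (λ c → reachIter G k a c ∧ Edge G c b)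

reachᵇ : (G : TGraph) → Fin (n G) → Fin (n G) → Bool
reachᵇ G = reachIter G (n G)

-- a component is counted via its least vertex
components : TGraph → ℕ
components G =
  countFin (λ a → allFin (λ b → not (reachᵇ G a b) ∨ (toℕ a ≤ᵇ toℕ b)))

isolatedVertices : TGraph → ℕ
isolatedVertices G = countFin (λ a → not (anyFin (Edge G a)))

edgeCount : TGraph → ℕ
edgeCount G = sumFin (λ a → countFin (λ b → (toℕ a <ᵇ toℕ b) ∧ Edge G a b))

-- Embedding schemes (generalised rotation systems: a local rotation at
-- each vertex plus an edge signature), the combinatorial description of
-- 2-cell embeddings of a graph in (orientable or non-orientable) surfaces.

Dart : TGraph → Set
Dart G = Fin (n G) × Fin (n G)   -- (tail , head)

IsDart : (G : TGraph) → Dart G → Set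
IsDart G (a , b) = T (Edge G a b)

record Scheme (G : TGraph) : Set where
  field
    ρ        : Dart G → Dart G
    σ        : Dart G → Dart G
    sig      : Fin (n G) → Fin (n G) → Bool   -- true = twisted edge
    ρ-dart   : ∀ d → IsDart G d → IsDart G (ρ d)
    σ-dart   : ∀ d → IsDart G d → IsDart G (σ d)
    ρ-tail   : ∀ d → IsDart G d → proj₁ (ρ d) ≡ proj₁ d
    σρ       : ∀ d → IsDart G d → σ (ρ d) ≡ d
    ρσ       : ∀ d → IsDart G d → ρ (σ d) ≡ d
    ρ-cyclic : ∀ d d' → IsDart G d → IsDart G d' → proj₁ d ≡ proj₁ d' →
               ∃ λ k → iter k ρ d ≡ d'
    sig-sym  : ∀ a b → T (Edge G a b) → sig a b ≡ sig b a

module _ {G : TGraph} (S : Scheme G) where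
  open Scheme S

  -- face-tracing step on (dart , current local orientation)
  faceStep : Dart G × Bool → Dart G × Bool
  faceStep ((a , b) , s) =
    let s' = s xor sig a b in
    ((if s' then ρ (b , a) else σ (b , a)) , s')

  key : Dart G × Bool → ℕ
  key ((a , b) , s) = (toℕ a * n G + toℕ b) * 2 + (if s then 1 else 0)

  isRep : Dart G × Bool → Bool
  isRep st = allBelow (4 * n G * n G) (λ k → key st ≤ᵇ key (iter k faceStep st))

  -- number of orbits of faceStep on darts × {±}; each face gives two
  faceOrbits : ℕ
  faceOrbits = sumFin λ a → sumFin λ b →
    if Edge G a b
    then (if isRep ((a , b) , true) then 1 else 0)
       + (if isRep ((a , b) , false) then 1 else 0)
    else 0

  faces : ℕ
  faces = ⌊ faceOrbits /2⌋ + isolatedVertices G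

  -- Euler genus of the embedding: 2c - V + E - F
  schemeGenus : ℕ
  schemeGenus = (2 * components G + edgeCount G) ∸ (n G + faces)

EulerGenus : TGraph → ℕ → Set
EulerGenus G k = (Σ (Scheme G) λ S → schemeGenus {G} S ≡ k) × (∀ S → k ≤ schemeGenus {G} S)

EulerGenus⁺ : TGraph → ℕ → Set
EulerGenus⁺ G k = EulerGenus (plus G) k

Plus-genus-< : TGraph → TGraph → Set
Plus-genus-< H G = ∀ a b → EulerGenus⁺ H a → EulerGenus⁺ G b → a < b

InC° : TGraph → Set
InC° G = InGxy° G × (∀ (μ : MinorOp G) → Plus-genus-< (applyOp G μ) G)

record IsXYSum (G G₁ G₂ : TGraph) : Set where
  field
    f₁    : Fin (n G₁) → Fin (n G)
    f₂    : Fin (n G₂) → Fin (n G)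
    f₁-inj : ∀ a b → f₁ a ≡ f₁ b → a ≡ b
    f₂-inj : ∀ a b → f₂ a ≡ f₂ b → a ≡ b
    f₁x   : f₁ (x G₁) ≡ x G
    f₁y   : f₁ (y G₁) ≡ y G
    f₂x   : f₂ (x G₂) ≡ x G
    f₂y   : f₂ (y G₂) ≡ y G
    cover : ∀ v → (∃ λ a → f₁ a ≡ v) ⊎ (∃ λ b → f₂ b ≡ v)
    overlap₁₂ : ∀ a b → f₁ a ≡ f₂ b →
              (a ≡ x G₁ × b ≡ x G₂) ⊎ (a ≡ y G₁ × b ≡ y G₂)
    edge→ : ∀ u v → T (Edge G u v) →
            (∃ λ a → ∃ λ b → f₁ a ≡ u × f₁ b ≡ v × T (Edge G₁ a b)) ⊎
            (∃ λ a → ∃ λ b → f₂ a ≡ u × f₂ b ≡ v × T (Edge G₂ a b))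
    edge₁ : ∀ a b → T (Edge G₁ a b) → T (Edge G (f₁ a) (f₁ b))
    edge₂ : ∀ a b → T (Edge G₂ a b) → T (Edge G (f₂ a) (f₂ b))

InG₁ : ∀ {G G₁ G₂} → IsXYSum G G₁ G₂ → Fin (n G) × Fin (n G) → Set
InG₁ {G₁ = G₁} s (u , v) =
  ∃ λ a → ∃ λ b → IsXYSum.f₁ s a ≡ u × IsXYSum.f₁ s b ≡ v × T (Edge G₁ a b)

G₁-Tight : ∀ {G G₁ G₂} → IsXYSum G G₁ G₂ → Set
G₁-Tight {G} s = ∀ (μ : MinorOp G) → InG₁ s (opEdge μ) → Plus-genus-< (applyOp G μ) G

{-# OPTIONS --safe #-}
-- The heart of the matter is that ĝ⁺ is additive over xy-sums; both conditions
-- then compare ĝ⁺ of a minor of G₁ with ĝ⁺(G₁), up to the constant ĝ⁺(G₂).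
--
-- The number of faces of an embedding is the largest number of colours that can
-- be given to the sides of the darts (flags) so that colours are constant along
-- face boundaries.  Embeddings of G₁⁺ and G₂⁺ are glued along xy by concatenating
-- the rotations at x and at y, cut open at xy, and this loses one colour.
-- Conversely, given an embedding of G⁺, keep it away from x and y and forget the
-- rotations at x and y.  Following the faces through the inside of G₁ pairs the
-- flags at the terminals into strands.  A strand joining two flags at the same
-- terminal can be removed together with one dart, which changes the number of
-- colours by at most one, and by exactly one if the dart is put back next to its
-- partner.  Once every strand joins x to y, every colour is seen at x, so there
-- are at most as many colours as corners at x, and by induction some rotations
-- attain this.  The resulting bound for G⁺ is the sum of the values attained on
-- the two sides minus one, since the corner cut open at xy is counted twice.
--
-- Because ∸ truncates, one also needs V + F ≤ 2c + E for every scheme: merge all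
-- vertices into one, first one vertex of each component (identifying colours),
-- then the others along edges, and finally delete the loops.
module Submission where

open import Defs
open import Data.Bool using (Bool; true; false; _∧_; _∨_; not; if_then_else_; T; _xor_)
open import Data.Bool.Properties using (T?; not-involutive; not-¬) renaming (_≟_ to _≟ᵇ_)
open import Data.Empty using (⊥; ⊥-elim)
open import Data.Fin using (Fin; zero; suc; toℕ; punchOut; punchIn; combine; splitAt; _↑ˡ_; _↑ʳ_)
open import Data.Fin.Properties as Finₚ using () renaming (_≟_ to _≟ᶠ_)
open import Data.List using (List; []; _∷_; _++_; map; length; filter; lookup; applyUpTo)
open import Data.List.Properties using (++-assoc; ++-identityʳ; length-++; length-map; map-++)
open import Data.List.Membership.Propositional using (_∈_; _∉_)
open import Data.List.Membership.Propositional.Properties as Memₚ using (∈-++⁺ˡ; ∈-++⁺ʳ; ∈-++⁻; ∈-map⁺; ∈-map⁻; ∈-∃++; ∈-filter⁺; ∈-filter⁻)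
open import Data.List.Relation.Binary.Permutation.Propositional using (_↭_; prep; swap; ↭-refl; ↭-sym; ↭-trans; ↭-reflexive)
open import Data.List.Relation.Binary.Permutation.Propositional.Properties using (∈-resp-↭; All-resp-↭; ↭-length; ++⁺ˡ; ++⁺ʳ; ++⁺; shift; drop-∷; ++-comm) renaming (map⁺ to ↭-map⁺)
open import Data.List.Relation.Unary.All as All using (All; []; _∷_)
open import Data.List.Relation.Unary.All.Properties using () renaming (++⁺ to All-++⁺; ++⁻ˡ to All-++⁻ˡ; ++⁻ʳ to All-++⁻ʳ)
open import Data.List.Relation.Unary.AllPairs using ([]; _∷_)
open import Data.List.Relation.Unary.Any as Any using (here; there)
open import Data.List.Relation.Unary.Any.Properties using (lookup-index)
open import Data.List.Relation.Unary.Unique.Propositional using (Unique)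
open import Data.List.Relation.Unary.Unique.Propositional.Properties as Uniqₚ using ()
open import Data.Nat using (ℕ; zero; suc; _+_; _*_; _∸_; _≤_; _<_; _≤ᵇ_; _<ᵇ_; ⌊_/2⌋; z≤n; s≤s; _<?_)
open import Data.Nat.Properties as ℕₚ using (≤-trans; ≤-refl; ≤-reflexive; n≤1+n)
open import Data.Product using (Σ; ∃; _×_; _,_; proj₁; proj₂)
open import Data.Product.Properties using (≡-dec)
open import Data.Nat.DivMod using (_%_; _/_; m%n<n; m≡m%n+[m/n]*n)
open import Data.Sum using (_⊎_; inj₁; inj₂; [_,_]′)
open import Data.Unit using (tt)
open import Function using (_∘_; id)
open import Relation.Binary.Definitions using (DecidableEquality; tri<; tri≈; tri>)
open import Relation.Binary.PropositionalEquality using (_≡_; _≢_; refl; sym; trans; cong; cong₂; subst; subst₂; module ≡-Reasoning)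
open import Relation.Nullary using (¬_; Dec; yes; no)
open import Relation.Nullary.Decidable using (⌊_⌋; toWitness; fromWitness; decidable-stable; _×-dec_; ¬?)

-- Lists and unordered pairs

-- Faces are orbits, and orbits are hard to follow through surgery on rotations: a local change can
-- merge or split faces far away. Colourings make both estimates local. A lower bound on the number
-- of faces is one colouring in which all colours occur; an upper bound is a list that contains
-- every colour. The conditions on a colouring mention only the two ends of an edge side and the two
-- flags at a corner, so an operation is checked at the few flags it touches. In an embedding of the
-- sum, darts of the two sides may interleave at x and y. Upper bounds for one side are therefore
-- carried through the reduction in the presence of arbitrary further strands and darts. Signs
-- matter: a dart is put back beside its partner with whichever orientation the place demands. This
-- freedom exists because edges may be twisted, so non-orientable surfaces are essential to the
-- argument. Genera are given by a relation whose values are only shown not to be absent. The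
-- conclusions are inequalities between natural numbers, which are decidable, so double negations
-- can be removed at the end.

unique-↭ : ∀ {A : Set} {xs ys : List A} → xs ↭ ys → Unique xs → Unique ys
unique-↭ _↭_.refl u = u
unique-↭ (prep x p) (a ∷ u) = All-resp-↭ p a ∷ unique-↭ p u
unique-↭ (swap x y p) ((x≢y ∷ a) ∷ b ∷ u) =
  ((x≢y ∘ sym) ∷ All-resp-↭ p b) ∷ All-resp-↭ p a ∷ unique-↭ p u
unique-↭ (_↭_.trans p q) u = unique-↭ q (unique-↭ p u)

unique-head : ∀ {A : Set} {x : A} {xs} → Unique (x ∷ xs) → x ∉ xs
unique-head = Uniqₚ.Unique[x∷xs]⇒x∉xs

unique-tail : ∀ {A : Set} {x : A} {xs} → Unique (x ∷ xs) → Unique xs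
unique-tail (_ ∷ u) = u

unique-++ˡ : ∀ {A : Set} (xs : List A) {ys} → Unique (xs ++ ys) → Unique xs
unique-++ˡ [] u = []
unique-++ˡ (x ∷ xs) (a ∷ u) = All-++⁻ˡ xs a ∷ unique-++ˡ xs u

unique-++ʳ : ∀ {A : Set} (xs : List A) {ys} → Unique (xs ++ ys) → Unique ys
unique-++ʳ [] u = u
unique-++ʳ (x ∷ xs) (_ ∷ u) = unique-++ʳ xs u

unique-++-disjoint : ∀ {A : Set} (xs : List A) {ys} {z : A} →
  Unique (xs ++ ys) → z ∈ xs → z ∉ ys
unique-++-disjoint (x ∷ xs) u (here refl) q = unique-head u (∈-++⁺ʳ xs q)
unique-++-disjoint (x ∷ xs) (_ ∷ u) (there p) q = unique-++-disjoint xs u p q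

extract : ∀ {A : Set} {x : A} {xs} → x ∈ xs → ∃ λ ys → xs ↭ x ∷ ys
extract p with ∈-∃++ p
... | ys , zs , refl = ys ++ zs , shift _ ys zs

unique-⊆⇒length≤ : ∀ {A : Set} {xs ys : List A} → Unique xs →
  (∀ {z} → z ∈ xs → z ∈ ys) → length xs ≤ length ys
unique-⊆⇒length≤ {xs = []} u s = z≤n
unique-⊆⇒length≤ {xs = x ∷ xs} {ys} (a ∷ u) s with extract (s (here refl))
... | zs , p = ≤-trans (s≤s (unique-⊆⇒length≤ u sub)) (≤-reflexive (sym (↭-length p)))
  where
  sub : ∀ {z} → z ∈ xs → z ∈ zs
  sub q with ∈-resp-↭ p (s (there q))
  ... | here refl = ⊥-elim (unique-head (a ∷ u) q)
  ... | there r = r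

unique-set⇒length≡ : ∀ {A : Set} {xs ys : List A} → Unique xs → Unique ys →
  (∀ {z} → z ∈ xs → z ∈ ys) → (∀ {z} → z ∈ ys → z ∈ xs) → length xs ≡ length ys
unique-set⇒length≡ u v s t = ℕₚ.≤-antisym (unique-⊆⇒length≤ u s) (unique-⊆⇒length≤ v t)

unique-set⇒↭ : ∀ {A : Set} {xs ys : List A} → Unique xs → Unique ys →
  (∀ {z} → z ∈ xs → z ∈ ys) → (∀ {z} → z ∈ ys → z ∈ xs) → xs ↭ ys
unique-set⇒↭ {xs = []} {[]} u v s t = ↭-refl
unique-set⇒↭ {xs = []} {y ∷ ys} u v s t with t (here refl)
... | ()
unique-set⇒↭ {xs = x ∷ xs} {ys} u v s t with extract (s (here refl))
... | zs , p = ↭-trans (prep x (unique-set⇒↭ (unique-tail u) (unique-tail v') to from)) (↭-sym p)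
  where
  v' : Unique (x ∷ zs)
  v' = unique-↭ p v
  to : ∀ {z} → z ∈ xs → z ∈ zs
  to q with ∈-resp-↭ p (s (there q))
  ... | here refl = ⊥-elim (unique-head u q)
  ... | there r = r
  from : ∀ {z} → z ∈ zs → z ∈ xs
  from q with t (∈-resp-↭ (↭-sym p) (there q))
  ... | here refl = ⊥-elim (unique-head v' q)
  ... | there r = r

-- Counts come out doubled: a dart has two flags and an edge has two darts.
double-injective : ∀ a b → a + a ≡ b + b → a ≡ b
double-injective zero zero _ = refl
double-injective (suc a) (suc b) eq = cong suc (double-injective a b
  (ℕₚ.suc-injective (trans (sym (ℕₚ.+-suc a a)) (trans (ℕₚ.suc-injective eq) (ℕₚ.+-suc b b)))))

-- Distinct colours occupy distinct positions. Upper bounds on numbers of colours end with this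
-- step.
covered⇒≤ : ∀ {k} (xs : List (Fin k)) → (∀ i → i ∈ xs) → k ≤ length xs
covered⇒≤ xs cov = Finₚ.injective⇒≤ {f = λ i → Any.index (cov i)} inj
  where
  inj : ∀ {i j} → Any.index (cov i) ≡ Any.index (cov j) → i ≡ j
  inj {i} {j} eq = trans (lookup-index (cov i))
    (trans (cong (lookup xs) eq) (sym (lookup-index (cov j))))

-- Surgeries that fuse two corners identify their colours through `h`. Surjectivity of `h` keeps all
-- remaining colours in use, and nothing is lost if the two colours already agree.
merge : ∀ {k} (i j : Fin k) → ∃ λ k' → (k ≤ suc k') ×
  Σ (Fin k → Fin k') λ h → (h i ≡ h j) × (∀ l → ∃ λ m → h m ≡ l)
merge {k} i j with i ≟ᶠ j
... | yes refl = k , n≤1+n k , id , refl , λ l → l , refl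
merge {suc k} i j | no i≢j = k , ≤-refl , h , trans hi (sym hj) , sur
  where
  j' : Fin k
  j' = punchOut {i = i} {j = j} i≢j
  h : Fin (suc k) → Fin k
  h = squash i j'
  hi : h i ≡ j'
  hi with i ≟ᶠ i
  ... | yes _ = refl
  ... | no ne = ⊥-elim (ne refl)
  hj : h j ≡ j'
  hj with j ≟ᶠ i
  ... | yes _ = refl
  ... | no ne = Finₚ.punchOut-cong i refl
  sur : ∀ l → ∃ λ m → h m ≡ l
  sur l = punchIn i l , lem
    where
    lem : h (punchIn i l) ≡ l
    lem with punchIn i l ≟ᶠ i
    ... | yes eq = ⊥-elim (Finₚ.punchInᵢ≢i i l eq)
    ... | no ne = Finₚ.punchOut-punchIn i

nodes : ∀ {A : Set} → List (A × A) → List A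
nodes [] = []
nodes ((u , v) ∷ M) = u ∷ v ∷ nodes M

nodes-++ : ∀ {A : Set} (M N : List (A × A)) → nodes (M ++ N) ≡ nodes M ++ nodes N
nodes-++ [] N = refl
nodes-++ (_ ∷ M) N = cong (λ z → _ ∷ _ ∷ z) (nodes-++ M N)

length-nodes : ∀ {A : Set} (M : List (A × A)) → length (nodes M) ≡ length M + length M
length-nodes [] = refl
length-nodes (_ ∷ M) = cong suc (trans (cong suc (length-nodes M)) (sym (ℕₚ.+-suc _ _)))

AllPair : ∀ {A : Set} → (A → A → Set) → List (A × A) → Set
AllPair P = All (λ p → P (proj₁ p) (proj₂ p))

-- Equality of lists of unordered pairs up to order.
record _≋_ {A : Set} (M N : List (A × A)) : Set₁ where
  field
    nodes↭ : nodes M ↭ nodes N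
    length≡ : length M ≡ length N
    to   : ∀ (P : A → A → Set) → (∀ {u v} → P u v → P v u) → AllPair P M → AllPair P N
    from : ∀ (P : A → A → Set) → (∀ {u v} → P u v → P v u) → AllPair P N → AllPair P M

≋-refl : ∀ {A : Set} {M : List (A × A)} → M ≋ M
≋-refl = record { nodes↭ = ↭-refl ; length≡ = refl ; to = λ _ _ x → x ; from = λ _ _ x → x }

≋-under : ∀ {A : Set} {a b u v : A} {M N} → M ≋ ((u , v) ∷ N) →
  ((a , b) ∷ M) ≋ ((u , v) ∷ (a , b) ∷ N)
≋-under {a = a} {b} {u} {v} {N = N} e = record
  { nodes↭ = ↭-trans (prep _ (prep _ (nodes↭ e)))
      (++⁺ʳ (nodes N) (++-comm (a ∷ b ∷ []) (u ∷ v ∷ [])))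
  ; length≡ = cong suc (length≡ e)
  ; to = λ { P s (p ∷ ps) → back p (to e P s ps) }
  ; from = λ { P s (p ∷ q ∷ ps) → q ∷ from e P s (p ∷ ps) } }
  where
  open _≋_
  back : ∀ {P : _ → _ → Set} {u v} {L} → P a b → AllPair P ((u , v) ∷ L) → AllPair P ((u , v) ∷ (a , b) ∷ L)
  back p (q ∷ qs) = q ∷ p ∷ qs

node-extract : ∀ {A : Set} {u : A} {M} → u ∈ nodes M → ∃ λ g → Σ (List (A × A)) λ N → M ≋ ((u , g) ∷ N)
node-extract {M = (a , b) ∷ M} (here refl) = b , M , ≋-refl
node-extract {M = (a , b) ∷ M} (there (here refl)) = a , M , record
  { nodes↭ = swap _ _ ↭-refl ; length≡ = refl
  ; to = λ { _ s (p ∷ ps) → s p ∷ ps } ; from = λ { _ s (p ∷ ps) → s p ∷ ps } }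
node-extract {M = (a , b) ∷ M} (there (there q)) with node-extract q
... | g , N , e = g , (a , b) ∷ N , ≋-under e

-- The involution is cut into its two-element orbits. Removing `z` together with its partner does
-- not leave a structural tail, hence the length bound `N`. The lemma serves to pair the two
-- traversals of a face, the two ends of an edge side, and the two darts of an edge.
pairing : ∀ {A : Set} (θ : A → A) (Z : List A) → Unique Z →
  (∀ {z} → z ∈ Z → θ z ∈ Z) → (∀ {z} → z ∈ Z → θ (θ z) ≡ z) → (∀ {z} → z ∈ Z → θ z ≢ z) →
  Σ (List (A × A)) λ P → (nodes P ↭ Z) × AllPair (λ u v → v ≡ θ u) P
pairing {A} θ Z = go (length Z) Z ≤-refl
  where
  go : ∀ N Z → length Z ≤ N → Unique Z →
    (∀ {z} → z ∈ Z → θ z ∈ Z) → (∀ {z} → z ∈ Z → θ (θ z) ≡ z) → (∀ {z} → z ∈ Z → θ z ≢ z) →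
    Σ (List (A × A)) λ P → (nodes P ↭ Z) × AllPair (λ u v → v ≡ θ u) P
  go N [] _ u cl inv ff = [] , ↭-refl , []
  go (suc N) (z ∷ Z) (s≤s le) u cl inv ff with cl (here refl)
  ... | here eq = ⊥-elim (ff (here refl) eq)
  ... | there q with extract q
  ... | Y , p with go N Y (≤-trans (≤-trans (n≤1+n _) (≤-reflexive (sym (↭-length p)))) le)
                     (unique-tail (unique-tail u')) cl' (inv ∘ inY) (ff ∘ inY)
    where
    u' : Unique (z ∷ θ z ∷ Y)
    u' = unique-↭ (prep z p) u
    inY : ∀ {w} → w ∈ Y → w ∈ z ∷ Z
    inY r = there (∈-resp-↭ (↭-sym p) (there r))
    cl' : ∀ {w} → w ∈ Y → θ w ∈ Y
    cl' {w} r with ∈-resp-↭ (prep z p) (cl (inY r))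
    ... | here eq = ⊥-elim (unique-head (unique-tail u')
            (subst (_∈ Y) (trans (sym (inv (inY r))) (cong θ eq)) r))
    ... | there (here eq) = ⊥-elim (unique-head u' (there (subst (_∈ Y)
            (trans (sym (inv (inY r))) (trans (cong θ eq) (inv (here refl)))) r)))
    ... | there (there s) = s
  ... | P , n↭ , al = (z , θ z) ∷ P , ↭-trans (prep z (prep _ n↭)) (prep z (↭-sym p)) , refl ∷ al

-- Rotations and colourings

module Strands {F : Set} (_≟_ : DecidableEquality F) (flip : F → F)
               (flip-flip : ∀ f → flip (flip f) ≡ f) where

  -- A list entry fixes the side at which its dart is entered. Listing both sides makes
  -- `flags L ↭ flags L'` say that the same darts occur, with order and orientation forgotten: `L`
  -- and `L'` are then two rotations of the same darts.
  flags : List F → List F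
  flags [] = []
  flags (f ∷ L) = f ∷ flip f ∷ flags L

  flags-++ : ∀ A B → flags (A ++ B) ≡ flags A ++ flags B
  flags-++ [] B = refl
  flags-++ (f ∷ A) B = cong (λ z → f ∷ flip f ∷ z) (flags-++ A B)

  flags-↭ : ∀ {L L'} → L ↭ L' → flags L ↭ flags L'
  flags-↭ _↭_.refl = ↭-refl
  flags-↭ (prep f p) = prep _ (prep _ (flags-↭ p))
  flags-↭ (swap {xs} {ys} f g p) = ↭-trans (prep _ (prep _ (prep _ (prep _ (flags-↭ p)))))
    (++⁺ʳ (flags ys) (++-comm (f ∷ flip f ∷ []) (g ∷ flip g ∷ [])))
  flags-↭ (_↭_.trans p q) = ↭-trans (flags-↭ p) (flags-↭ q)

  length-flags : ∀ L → length (flags L) ≡ length L + length L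
  length-flags [] = refl
  length-flags (_ ∷ L) = cong suc (trans (cong suc (length-flags L)) (sym (ℕₚ.+-suc _ _)))

  flags-↭⇒length : ∀ L L' → flags L ↭ flags L' → length L ≡ length L'
  flags-↭⇒length L L' p = double-injective (length L) (length L')
    (trans (sym (length-flags L)) (trans (↭-length p) (length-flags L')))

  flags-mid : ∀ A f B → flags (A ++ f ∷ B) ↭ f ∷ flip f ∷ flags (A ++ B)
  flags-mid [] f B = ↭-refl
  flags-mid (a ∷ A) f B = ↭-trans (prep _ (prep _ (flags-mid A f B)))
    (++⁺ʳ (flags (A ++ B)) (++-comm (a ∷ flip a ∷ []) (f ∷ flip f ∷ [])))

  flags-split : ∀ {v} L → v ∈ flags L → ∃ λ A → ∃ λ f → ∃ λ B →
    (L ≡ A ++ f ∷ B) × (v ≡ f ⊎ v ≡ flip f)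
  flags-split (f ∷ L) (here eq) = [] , f , L , refl , inj₁ eq
  flags-split (f ∷ L) (there (here eq)) = [] , f , L , refl , inj₂ eq
  flags-split (f ∷ L) (there (there p)) with flags-split L p
  ... | A , g , B , refl , o = f ∷ A , g , B , refl , o

  flags-mid′ : ∀ A f B {v} → v ≡ f ⊎ v ≡ flip f →
    flags (A ++ f ∷ B) ↭ v ∷ flip v ∷ flags (A ++ B)
  flags-mid′ A f B (inj₁ refl) = flags-mid A f B
  flags-mid′ A f B (inj₂ refl) rewrite flip-flip f = ↭-trans (flags-mid A f B) (swap _ _ ↭-refl)

  ∈-flags : ∀ {f L} → f ∈ L → f ∈ flags L
  ∈-flags (here eq) = here eq
  ∈-flags (there p) = there (there (∈-flags p))

  flip-∈-flags : ∀ {f} L → f ∈ flags L → flip f ∈ flags L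
  flip-∈-flags (g ∷ L) (here refl) = there (here refl)
  flip-∈-flags (g ∷ L) (there (here refl)) = here (flip-flip g)
  flip-∈-flags (g ∷ L) (there (there p)) = there (there (flip-∈-flags L p))

  flags-drop : ∀ {v Z Z'} → v ∷ flip v ∷ Z ↭ v ∷ flip v ∷ Z' → Z ↭ Z'
  flags-drop p = drop-∷ (drop-∷ p)

  -- A list of flags is a linear rotation whose darts are entered at the listed
  -- flag and left at the flipped one; α and β colour the two outer corners.
  run : {C : Set} → (F → C) → C → List F → C → Set
  run c α [] β = α ≡ β
  run c α (f ∷ L) β = (α ≡ c f) × run c (c (flip f)) L β

  module _ {C : Set} {c : F → C} where

    run-++ : ∀ {α β γ} A {B} → run c α A γ → run c γ B β → run c α (A ++ B) β
    run-++ [] refl r = r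
    run-++ (f ∷ A) (e , r) s = e , run-++ A r s

    run-split : ∀ {α β} A {B} → run c α (A ++ B) β → ∃ λ γ → run c α A γ × run c γ B β
    run-split [] r = _ , refl , r
    run-split (f ∷ A) (e , r) with run-split A r
    ... | γ , r₁ , r₂ = γ , (e , r₁) , r₂

    -- The closing corner lies beside the side at which the last dart is left. This is how the
    -- colour of an outer corner is found again at a flag.
    run-end : ∀ {α γ} A → run c α A γ → γ ≡ α ⊎ ∃ λ w → (w ∈ flags A) × (c w ≡ γ)
    run-end [] refl = inj₁ refl
    run-end (f ∷ A) (e , r) with run-end A r
    ... | inj₁ refl = inj₂ (flip f , there (here refl) , refl)
    ... | inj₂ (w , p , q) = inj₂ (w , there (there p) , q)

    -- Taking a dart away fuses the corners on its two sides, which is harmless when they already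
    -- share a colour.
    run-remove : ∀ {α β} A {f B} → c f ≡ c (flip f) → run c α (A ++ f ∷ B) β → run c α (A ++ B) β
    run-remove [] eq (e , r) = subst (λ z → run c z _ _) (sym (trans e eq)) r
    run-remove (g ∷ A) eq (e , r) = e , run-remove A eq r

    run-lift : {C' : Set} {c' : F → C'} (h : C → C') → ∀ {α β} A →
      (∀ {f} → f ∈ flags A → c' f ≡ h (c f)) → run c α A β → run c' (h α) A (h β)
    run-lift h [] eq r = cong h r
    run-lift {c' = c'} h (f ∷ A) eq (e , r) = trans (cong h e) (sym (eq (here refl))) ,
      subst (λ z → run c' z A _) (sym (eq (there (here refl)))) (run-lift h A (λ p → eq (there (there p))) r)

  -- Read backwards, a rotation enters each dart at the side at which it used to be left.
  rev : List F → List F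
  rev [] = []
  rev (f ∷ L) = rev L ++ flip f ∷ []

  run-rev : {C : Set} {c : F → C} → ∀ {α β} L → run c α L β → run c β (rev L) α
  run-rev [] r = sym r
  run-rev {c = c} (f ∷ L) (e , r) = run-++ (rev L) (run-rev L r) (refl , trans (cong c (flip-flip f)) (sym e))

  flags-rev : ∀ L → flags (rev L) ↭ flags L
  flags-rev [] = ↭-refl
  flags-rev (f ∷ L) rewrite flags-++ (rev L) (flip f ∷ []) | flip-flip f =
    ↭-trans (++-comm (flags (rev L)) (flip f ∷ f ∷ [])) (swap _ _ (flags-rev L))

  -- The colours of the corners in order, both outer corners included, so there is one more than
  -- there are darts. This is the origin of the `suc` in the optimal number of colours.
  gaps : {C : Set} → (F → C) → C → List F → List C
  gaps c α [] = α ∷ []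
  gaps c α (f ∷ L) = α ∷ gaps c (c (flip f)) L

  length-gaps : {C : Set} (c : F → C) → ∀ α L → length (gaps c α L) ≡ suc (length L)
  length-gaps c α [] = refl
  length-gaps c α (f ∷ L) = cong suc (length-gaps c _ L)

  gap-start : {C : Set} {c : F → C} → ∀ {α} L → α ∈ gaps c α L
  gap-start [] = here refl
  gap-start (_ ∷ _) = here refl

  gap-flag : {C : Set} {c : F → C} → ∀ {α β v} L → run c α L β → v ∈ flags L → c v ∈ gaps c α L
  gap-flag (f ∷ L) (e , r) (here refl) = here (sym e)
  gap-flag (f ∷ L) (e , r) (there (here refl)) = there (gap-start L)
  gap-flag (f ∷ L) (e , r) (there (there p)) = there (gap-flag L r p)

  -- The corner in front of the dart has the same colour and survives: it belongs to the previous
  -- dart or is the outer corner `α`. The last component records this, so that the colour stays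
  -- covered.
  remove-dart : {C : Set} {c : F → C} → ∀ {α β v} L → v ∈ flags L → c v ≡ c (flip v) → run c α L β →
    ∃ λ L° → (flags L ↭ v ∷ flip v ∷ flags L°) × run c α L° β ×
      (c v ≡ α ⊎ ∃ λ w → (w ∈ flags L°) × (c w ≡ c v))
  remove-dart {c = c} {α} {β} {v} L p eq r with flags-split L p
  ... | A , f , B , refl , o = A ++ B , flags-mid′ A f B o , run-remove A (eqf o) r , seen
    where
    eqf : v ≡ f ⊎ v ≡ flip f → c f ≡ c (flip f)
    eqf (inj₁ refl) = eq
    eqf (inj₂ refl) = sym (trans eq (cong c (flip-flip f)))
    vf : v ≡ f ⊎ v ≡ flip f → c v ≡ c f
    vf (inj₁ refl) = refl
    vf (inj₂ refl) = sym (eqf o)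
    seen : c v ≡ α ⊎ ∃ λ w → (w ∈ flags (A ++ B)) × (c w ≡ c v)
    seen with run-split A r
    ... | γ , r₁ , (e , _) with run-end A r₁
    ... | inj₁ q = inj₁ (trans (vf o) (trans (sym e) q))
    ... | inj₂ (w , w∈ , q) = inj₂ (w , subst (w ∈_) (sym (flags-++ A B)) (∈-++⁺ˡ w∈) ,
            trans q (trans e (sym (vf o))))

  -- The dart of `v` goes beside the flag `u`: in front of it and reversed if `u` is where its own
  -- dart is entered, behind it if `u` is where its dart is left. The new corner between `u` and `v`
  -- receives the fresh colour `zero`. The former corner at `u` now ends at `flip v`, which takes
  -- over the shifted colour of `u`.
  insert-dart : ∀ L u v → u ∈ flags L → Unique (flags L) →
    ∃ λ L⁺ → (flags L⁺ ↭ v ∷ flip v ∷ flags L) ×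
      (∀ {k} (c : F → Fin k) (c⁺ : F → Fin (suc k)) {α β} →
        c⁺ u ≡ zero → c⁺ v ≡ zero → c⁺ (flip v) ≡ suc (c u) →
        (∀ {f} → f ∈ flags L → f ≢ u → c⁺ f ≡ suc (c f)) →
        run c α L β → run c⁺ (suc α) L⁺ (suc β))
  insert-dart L u v p uq with flags-split L p
  ... | A , f , B , refl , inj₁ refl = A ++ flip v ∷ f ∷ B , perm , go
    where
    perm : flags (A ++ flip v ∷ f ∷ B) ↭ v ∷ flip v ∷ flags (A ++ f ∷ B)
    perm = flags-mid′ A (flip v) (f ∷ B) (inj₂ (sym (flip-flip v)))
    uq' : Unique (f ∷ flip f ∷ flags (A ++ B))
    uq' = unique-↭ (flags-mid A f B) uq
    go : ∀ {k} (c : F → Fin k) (c⁺ : F → Fin (suc k)) {α β} →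
        c⁺ f ≡ zero → c⁺ v ≡ zero → c⁺ (flip v) ≡ suc (c f) →
        (∀ {g} → g ∈ flags (A ++ f ∷ B) → g ≢ f → c⁺ g ≡ suc (c g)) →
        run c α (A ++ f ∷ B) β → run c⁺ (suc α) (A ++ flip v ∷ f ∷ B) (suc β)
    go c c⁺ u0 v0 fv oth r with run-split A r
    ... | γ , r₁ , (e , r₂) = run-++ A
        (run-lift suc A (λ q → rest (subst (_ ∈_) (sym (flags-++ A B)) (∈-++⁺ˡ q))) r₁)
        (trans (cong suc e) (sym fv) , trans (cong c⁺ (flip-flip v)) (trans v0 (sym u0)) ,
          subst (λ z → run c⁺ z B _) (sym (oth (∈-resp-↭ (↭-sym (flags-mid A f B)) (there (here refl)))
              λ eq → unique-head uq' (here (sym eq))))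
            (run-lift suc B (λ q → rest (subst (_ ∈_) (sym (flags-++ A B)) (∈-++⁺ʳ (flags A) q))) r₂))
      where
      rest : ∀ {g} → g ∈ flags (A ++ B) → c⁺ g ≡ suc (c g)
      rest q = oth (∈-resp-↭ (↭-sym (flags-mid A f B)) (there (there q)))
        λ { refl → unique-head uq' (there q) }
  ... | A , f , B , refl , inj₂ refl = A ++ f ∷ v ∷ B , perm , go
    where
    perm : flags (A ++ f ∷ v ∷ B) ↭ v ∷ flip v ∷ flags (A ++ f ∷ B)
    perm = ↭-trans (↭-reflexive (cong flags (sym (++-assoc A (f ∷ []) (v ∷ B)))))
      (↭-trans (flags-mid (A ++ f ∷ []) v B)
        (prep _ (prep _ (↭-reflexive (cong flags (++-assoc A (f ∷ []) B))))))
    uq' : Unique (f ∷ flip f ∷ flags (A ++ B))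
    uq' = unique-↭ (flags-mid A f B) uq
    go : ∀ {k} (c : F → Fin k) (c⁺ : F → Fin (suc k)) {α β} →
        c⁺ (flip f) ≡ zero → c⁺ v ≡ zero → c⁺ (flip v) ≡ suc (c (flip f)) →
        (∀ {g} → g ∈ flags (A ++ f ∷ B) → g ≢ flip f → c⁺ g ≡ suc (c g)) →
        run c α (A ++ f ∷ B) β → run c⁺ (suc α) (A ++ f ∷ v ∷ B) (suc β)
    go c c⁺ u0 v0 fv oth r with run-split A r
    ... | γ , r₁ , (e , r₂) = run-++ A
        (run-lift suc A (λ q → rest (subst (_ ∈_) (sym (flags-++ A B)) (∈-++⁺ˡ q))) r₁)
        (trans (cong suc e) (sym (oth (∈-resp-↭ (↭-sym (flags-mid A f B)) (here refl))
              λ eq → unique-head uq' (here eq))) ,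
          trans u0 (sym v0) ,
          subst (λ z → run c⁺ z B _) (sym fv)
            (run-lift suc B (λ q → rest (subst (_ ∈_) (sym (flags-++ A B)) (∈-++⁺ʳ (flags A) q))) r₂))
      where
      rest : ∀ {g} → g ∈ flags (A ++ B) → c⁺ g ≡ suc (c g)
      rest q = oth (∈-resp-↭ (↭-sym (flags-mid A f B)) (there (there q)))
        λ { refl → unique-head (unique-tail uq') q }

-- Maps with two terminals

module Core {F : Set} (_≟_ : DecidableEquality F) (flip : F → F)
            (flip-flip : ∀ f → flip (flip f) ≡ f) where

  open Strands _≟_ flip flip-flip

  upd : {C : Set} → (F → C) → F → C → F → C
  upd c a x f with f ≟ a
  ... | yes _ = x
  ... | no _ = c f

  upd-≡ : {C : Set} (c : F → C) → ∀ a x → upd c a x a ≡ x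
  upd-≡ c a x with a ≟ a
  ... | yes _ = refl
  ... | no ne = ⊥-elim (ne refl)

  upd-≢ : {C : Set} (c : F → C) → ∀ {a x f} → f ≢ a → upd c a x f ≡ c f
  upd-≢ c {a} {x} {f} ne with f ≟ a
  ... | yes eq = ⊥-elim (ne eq)
  ... | no _ = refl

  Mono : {C : Set} → (F → C) → List (F × F) → Set
  Mono c = AllPair (λ u v → c u ≡ c v)

  mono-lift : {C C' : Set} {c : F → C} {c' : F → C'} (h : C → C') → ∀ M →
    (∀ {w} → w ∈ nodes M → c' w ≡ h (c w)) → Mono c M → Mono c' M
  mono-lift h [] eq [] = []
  mono-lift h ((u , v) ∷ M) eq (p ∷ ps) =
    trans (eq (here refl)) (trans (cong h p) (sym (eq (there (here refl))))) ∷
    mono-lift h M (λ q → eq (there (there q))) ps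

  -- A two-vertex map: the pairs M are the strands joining flags away from the
  -- terminals, Lx and Ly the rotations at the terminals cut open at the edge xy,
  -- whose two sides have colours α and β.
  record Coloured (k : ℕ) (M : List (F × F)) (Lx Ly : List F) (extra : List (Fin k)) : Set where
    field
      c     : F → Fin k
      α β   : Fin k
      mono  : Mono c M
      runx  : run c α Lx β
      runy  : run c α Ly β
      cover : ∀ i → i ≡ α ⊎ (∃ λ v → (v ∈ flags Lx ++ flags Ly) × (c v ≡ i)) ⊎ i ∈ extra

  -- The list `extra` is meant for the colours of closed strands, which never reach a terminal. The
  -- number `w` bounds only what the terminals contribute, whatever the rotations there are.
  Bounded : List (F × F) → List F → List F → ℕ → Set
  Bounded M X Y w = ∀ {k} Lx Ly extra → flags Lx ↭ flags X → flags Ly ↭ flags Y →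
    Coloured k M Lx Ly extra → k ≤ w + length extra

  Achieved : List (F × F) → List F → List F → ℕ → Set
  Achieved M X Y w = ∃ λ Lx → ∃ λ Ly → (flags Lx ↭ flags X) × (flags Ly ↭ flags Y) ×
    Coloured w M Lx Ly []

  coloured-swap : ∀ {k M Lx Ly extra} → Coloured k M Lx Ly extra → Coloured k M Ly Lx extra
  coloured-swap {Lx = Lx} {Ly} C = record
    { c = c ; α = α ; β = β ; mono = mono ; runx = runy ; runy = runx ; cover = cov }
    where
    open Coloured C
    cov : ∀ i → _
    cov i with cover i
    ... | inj₁ e = inj₁ e
    ... | inj₂ (inj₁ (v , p , q)) = inj₂ (inj₁ (v , ∈-resp-↭ (++-comm (flags Lx) (flags Ly)) p , q))
    ... | inj₂ (inj₂ e) = inj₂ (inj₂ e)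

  bounded-swap : ∀ {M X Y w} → Bounded M Y X w → Bounded M X Y w
  bounded-swap b Lx Ly ex p q C = b Ly Lx ex q p (coloured-swap C)

  achieved-swap : ∀ {M X Y w} → Achieved M Y X w → Achieved M X Y w
  achieved-swap (Lx , Ly , p , q , C) = Ly , Lx , q , p , coloured-swap C

  Matches : List (F × F) → List F → List F → Set
  Matches M X Y = (nodes M ↭ flags X ++ flags Y) × Unique (flags X ++ flags Y)

  matches-swap : ∀ {M X Y} → Matches M X Y → Matches M Y X
  matches-swap {M} {X} {Y} (p , u) = ↭-trans p (++-comm (flags X) (flags Y)) ,
    unique-↭ (++-comm (flags X) (flags Y)) u

  -- The optimal number of colours drops by `r` on passing to the smaller configuration. Only `down`
  -- carries a context `M'`, `X'`, `Y'`: in a common embedding the darts of the other side are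
  -- interleaved with these at the terminals, whereas good rotations of one side are built on their
  -- own.
  record Step (M : List (F × F)) (X Y : List F) : Set where
    field
      M° : List (F × F)
      X° : List F
      r  : ℕ
      shorter : length M° < length M
      matches : Matches M° X° Y
      up   : ∀ w → Achieved M° X° Y w → Achieved M X Y (r + w)
      down : ∀ M' X' Y' w → Bounded (M° ++ M') (X° ++ X') (Y ++ Y') w →
             Bounded (M ++ M') (X ++ X') (Y ++ Y') (r + w)

  recolour : ∀ {k k' M Lx Ly extra} (h : Fin k → Fin k') → (∀ l → ∃ λ m → h m ≡ l) →
    Coloured k M Lx Ly extra → Coloured k' M Lx Ly (map h extra)
  recolour {M = M} {Lx} {Ly} h sur C = record
    { c = h ∘ c ; α = h α ; β = h β
    ; mono = mono-lift h M (λ _ → refl) mono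
    ; runx = run-lift h Lx (λ _ → refl) runx
    ; runy = run-lift h Ly (λ _ → refl) runy
    ; cover = cov }
    where
    open Coloured C
    cov : ∀ i → _
    cov i with sur i
    ... | m , refl with cover m
    ... | inj₁ e = inj₁ (cong h e)
    ... | inj₂ (inj₁ (v , p , q)) = inj₂ (inj₁ (v , p , cong h q))
    ... | inj₂ (inj₂ e) = inj₂ (inj₂ (∈-map⁺ h e))

  -- The colouring itself does not change, as the final equation records, so a caller can delete a
  -- further dart on the strength of what it knows about the old colours.
  delete : ∀ {k M M° Lx Ly extra v} → (C : Coloured k M Lx Ly extra) →
    v ∈ flags Lx → Coloured.c C v ≡ Coloured.c C (flip v) → Mono (Coloured.c C) M° →
    ∃ λ Lx° → (flags Lx ↭ v ∷ flip v ∷ flags Lx°) ×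
      Σ (Coloured k M° Lx° Ly extra) λ C° → Coloured.c C° ≡ Coloured.c C
  delete {Lx = Lx} {Ly} {v = v} C v∈ eq mo with remove-dart Lx v∈ eq (Coloured.runx C)
  ... | Lx° , p , r , seen = Lx° , p , record
    { c = c ; α = α ; β = β ; mono = mo ; runx = r ; runy = runy ; cover = cov } , refl
    where
    open Coloured C
    vseen : ∀ {i} → c v ≡ i → i ≡ α ⊎ (∃ λ w → (w ∈ flags Lx° ++ flags Ly) × (c w ≡ i)) ⊎ i ∈ _
    vseen refl = [ inj₁ , (λ { (w , w∈ , e) → inj₂ (inj₁ (w , ∈-++⁺ˡ w∈ , e)) }) ]′ seen
    cov : ∀ i → i ≡ α ⊎ (∃ λ w → (w ∈ flags Lx° ++ flags Ly) × (c w ≡ i)) ⊎ i ∈ _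
    cov i with cover i
    ... | inj₁ e = inj₁ e
    ... | inj₂ (inj₂ e) = inj₂ (inj₂ e)
    ... | inj₂ (inj₁ (w , w∈ , e)) with ∈-++⁻ (flags Lx) w∈
    ... | inj₂ q = inj₂ (inj₁ (w , ∈-++⁺ʳ (flags Lx°) q , e))
    ... | inj₁ q with ∈-resp-↭ p q
    ... | here refl = vseen e
    ... | there (here refl) = vseen (trans eq e)
    ... | there (there q') = inj₂ (inj₁ (w , ∈-++⁺ˡ q' , e))

  -- Both ends `u` and `v` of the strand are at x, and the dart of `v` is removed. If the strand
  -- joins the two sides of this dart, they have one colour anyway and `r` is 0. Otherwise a second
  -- strand leads from `flip v` to some `g`. Identifying the colours of `v` and `flip v` permits the
  -- removal, links the two strands into one from `u` to `g`, and costs at most one colour, so `r`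
  -- is 1.
  stepX : ∀ {M X Y u v M₀} → Matches M X Y → M ≋ ((u , v) ∷ M₀) → v ∈ flags X → u ∈ flags X → Step M X Y
  stepX {M} {X} {Y} {u} {v} {M₀} (n↭ , uq) M≋ v∈ u∈ with flags-split X v∈
  ... | A , f , B , refl , o = res
    where
    X° = A ++ B
    Z = flags X° ++ flags Y
    X↭ : flags X ↭ v ∷ flip v ∷ flags X°
    X↭ = flags-mid′ A f B o
    XY↭ : flags X ++ flags Y ↭ v ∷ flip v ∷ Z
    XY↭ = ++⁺ʳ (flags Y) X↭
    uvM : u ∷ nodes M₀ ↭ flip v ∷ Z
    uvM = drop-∷ (↭-trans (swap v u ↭-refl) (↭-trans (↭-sym (_≋_.nodes↭ M≋)) (↭-trans n↭ XY↭)))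
    uqZ : Unique (v ∷ flip v ∷ Z)
    uqZ = unique-↭ XY↭ uq
    v∉Z : v ∉ Z
    v∉Z q = unique-head uqZ (there q)
    fv∉Z : flip v ∉ Z
    fv∉Z q = unique-head (unique-tail uqZ) q
    v≢fv : v ≢ flip v
    v≢fv e = unique-head uqZ (here e)
    ctx : ∀ {X' Lx Lx°} → flags Lx ↭ flags (X ++ X') → flags Lx ↭ v ∷ flip v ∷ flags Lx° →
      flags Lx° ↭ flags (X° ++ X')
    ctx {X'} {Lx} {Lx°} p q = flags-drop (↭-trans (↭-sym q) (↭-trans p
      (↭-trans (↭-reflexive (flags-++ X X')) (↭-trans (++⁺ʳ (flags X') X↭)
        (prep _ (prep _ (↭-reflexive (sym (flags-++ X° X')))))))))
    v∈ctx : ∀ {X' Lx} → flags Lx ↭ flags (X ++ X') → v ∈ flags Lx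
    v∈ctx {X'} p = ∈-resp-↭ (↭-sym p) (subst (v ∈_) (sym (flags-++ X X')) (∈-++⁺ˡ v∈))
    monoM : ∀ {C : Set} {c : F → C} {M'} → Mono c (M ++ M') → (c u ≡ c v) × Mono c M₀ × Mono c M'
    monoM {c = c} mo with _≋_.to M≋ (λ a b → c a ≡ c b) sym (All-++⁻ˡ M mo)
    ... | e ∷ es = e , es , All-++⁻ʳ M mo
    res : Step M X Y
    res with flip v ≟ u
    ... | yes refl = record
      { M° = M₀ ; X° = X° ; r = 0
      ; shorter = ≤-reflexive (sym (_≋_.length≡ M≋))
      ; matches = drop-∷ uvM , unique-tail (unique-tail uqZ)
      ; up = upw ; down = dn }
      where
      dn : ∀ M' X' Y' w → Bounded (M₀ ++ M') (X° ++ X') (Y ++ Y') w → Bounded (M ++ M') (X ++ X') (Y ++ Y') w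
      dn M' X' Y' w b Lx Ly ex p q C with monoM (Coloured.mono C)
      ... | e , m₀ , m' with delete C (v∈ctx p) (sym e) (All-++⁺ m₀ m')
      ... | Lx° , p° , C° , _ = b Lx° Ly ex (ctx {Lx = Lx} p p°) q C°
      upw : ∀ w → Achieved M₀ X° Y w → Achieved M X Y w
      -- The position is arbitrary: both sides of the dart take the colour of the corner it is put
      -- into, here the outer corner `α`.
      upw w (Lx , Ly , p , q , C) = v ∷ Lx , Ly , ↭-trans (prep _ (prep _ p)) (↭-sym X↭) , q , record
        { c = c⁺ ; α = α ; β = β
        ; mono = _≋_.from M≋ (λ a b → c⁺ a ≡ c⁺ b) sym
            (trans cfv (sym cv) ∷ mono-lift id M₀ (λ r → coth (∈-resp-↭ (drop-∷ uvM) r)) mono)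
        ; runx = sym cv , subst (λ z → run c⁺ z Lx β) (sym cfv)
            (run-lift id Lx (λ r → coth (∈-++⁺ˡ (∈-resp-↭ p r))) runx)
        ; runy = run-lift id Ly (λ r → coth (∈-++⁺ʳ (flags X°) (∈-resp-↭ q r))) runy
        ; cover = cov }
        where
        open Coloured C
        c⁺ : F → Fin w
        c⁺ = upd (upd c v α) (flip v) α
        cfv : c⁺ (flip v) ≡ α
        cfv = upd-≡ _ _ _
        cv : c⁺ v ≡ α
        cv = trans (upd-≢ _ v≢fv) (upd-≡ _ _ _)
        coth : ∀ {g} → g ∈ Z → c⁺ g ≡ c g
        coth g∈ = trans (upd-≢ _ λ { refl → fv∉Z g∈ }) (upd-≢ _ λ { refl → v∉Z g∈ })
        cov : ∀ i → _
        cov i with cover i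
        ... | inj₁ e = inj₁ e
        ... | inj₂ (inj₁ (g , g∈ , e)) = inj₂ (inj₁ (g , there (there g∈) ,
              trans (coth (∈-resp-↭ (++⁺ p q) g∈)) e))
    ... | no fv≢u with node-extract {M = M₀} fv∈M₀
      where
      fv∈M₀ : flip v ∈ nodes M₀
      fv∈M₀ with ∈-resp-↭ (↭-sym uvM) (here refl)
      ... | here e = ⊥-elim (fv≢u e)
      ... | there q = q
    ... | g , M₁ , M₀≋ = record
      { M° = (u , g) ∷ M₁ ; X° = X° ; r = 1
      ; shorter = ≤-reflexive (trans (cong suc (sym (_≋_.length≡ M₀≋))) (sym (_≋_.length≡ M≋)))
      ; matches = ugM , unique-tail (unique-tail uqZ)
      ; up = upw ; down = dn }
      where
      ugM : u ∷ g ∷ nodes M₁ ↭ Z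
      ugM = drop-∷ (↭-trans (swap _ _ ↭-refl) (↭-trans (prep u (↭-sym (_≋_.nodes↭ M₀≋))) uvM))
      uq₁ : Unique (u ∷ g ∷ nodes M₁)
      uq₁ = unique-↭ (↭-sym ugM) (unique-tail (unique-tail uqZ))
      u≢v : u ≢ v
      u≢v refl = v∉Z (∈-resp-↭ ugM (here refl))
      u∈X° : u ∈ flags X°
      u∈X° with ∈-resp-↭ X↭ u∈
      ... | here e = ⊥-elim (u≢v e)
      ... | there (here e) = ⊥-elim (fv≢u (sym e))
      ... | there (there q) = q
      dn : ∀ M' X' Y' w → Bounded ((u , g) ∷ M₁ ++ M') (X° ++ X') (Y ++ Y') w →
        Bounded (M ++ M') (X ++ X') (Y ++ Y') (suc w)
      dn M' X' Y' w b {k} Lx Ly ex p q C with monoM (Coloured.mono C)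
      ... | e , m₀ , m' with _≋_.to M₀≋ (λ a b → Coloured.c C a ≡ Coloured.c C b) sym m₀
      ... | e' ∷ m₁ with merge (Coloured.c C v) (Coloured.c C (flip v))
      ... | k' , k≤ , h , hv , sur with delete (recolour h sur C) (v∈ctx p) hv
              (trans (cong h e) (trans hv (cong h e')) ∷
               All-++⁺ (mono-lift h M₁ (λ _ → refl) m₁) (mono-lift h M' (λ _ → refl) m'))
      ... | Lx° , p° , C° , _ = ≤-trans k≤ (s≤s (≤-trans (b Lx° Ly (map h ex) (ctx {Lx = Lx} p p°) q C°)
              (≤-reflexive (cong (w +_) (length-map h ex)))))
      upw : ∀ w → Achieved ((u , g) ∷ M₁) X° Y w → Achieved M X Y (suc w)
      upw w (Lx , Ly , p , q , C) with insert-dart Lx u v (∈-resp-↭ (↭-sym p) u∈X°)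
            (unique-↭ (↭-sym p) (unique-++ˡ (flags X°) (unique-tail (unique-tail uqZ))))
      ... | L⁺ , p⁺ , ins = L⁺ , Ly , ↭-trans p⁺ (↭-trans (prep _ (prep _ p)) (↭-sym X↭)) , q , record
        { c = c⁺ ; α = suc α ; β = suc β
        ; mono = _≋_.from M≋ (λ a b → c⁺ a ≡ c⁺ b) sym (trans cu (sym cv) ∷
            _≋_.from M₀≋ (λ a b → c⁺ a ≡ c⁺ b) sym
              (trans cfv (trans (cong suc (All.head mono)) (sym (coth (∈-resp-↭ ugM (there (here refl)))
                  λ { refl → unique-head uq₁ (here refl) }))) ∷
               mono-lift suc M₁ (λ r → coth (∈-resp-↭ ugM (there (there r)))
                  λ { refl → unique-head uq₁ (there r) }) (All.tail mono)))
        ; runx = ins c c⁺ cu cv cfv (λ r → coth (∈-++⁺ˡ (∈-resp-↭ p r))) runx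
        ; runy = run-lift suc Ly (λ r → coth (∈-++⁺ʳ (flags X°) (∈-resp-↭ q r))
            λ { refl → unique-++-disjoint (flags X°) (unique-tail (unique-tail uqZ)) u∈X° (∈-resp-↭ q r) }) runy
        ; cover = cov }
        where
        open Coloured C
        c⁺ : F → Fin (suc w)
        -- The strand from `u` to `v` gets the new colour `zero`. The flag `flip v` inherits the old
        -- colour of `u`, which is also that of `g`, so the second strand stays unicoloured.
        c⁺ = upd (upd (upd (suc ∘ c) (flip v) (suc (c u))) v zero) u zero
        cu : c⁺ u ≡ zero
        cu = upd-≡ _ _ _
        cv : c⁺ v ≡ zero
        cv = trans (upd-≢ _ (u≢v ∘ sym)) (upd-≡ _ _ _)
        cfv : c⁺ (flip v) ≡ suc (c u)
        cfv = trans (upd-≢ _ fv≢u) (trans (upd-≢ _ (v≢fv ∘ sym)) (upd-≡ _ _ _))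
        coth : ∀ {t} → t ∈ Z → t ≢ u → c⁺ t ≡ suc (c t)
        coth t∈ t≢ = trans (upd-≢ _ t≢) (trans (upd-≢ _ λ { refl → v∉Z t∈ }) (upd-≢ _ λ { refl → fv∉Z t∈ }))
        cov : ∀ i → _
        cov zero = inj₂ (inj₁ (v , ∈-++⁺ˡ (∈-resp-↭ (↭-sym p⁺) (here refl)) , cv))
        cov (suc i) with cover i
        ... | inj₁ e = inj₁ (cong suc e)
        ... | inj₂ (inj₁ (t , t∈ , e)) with t ≟ u
        -- The old colour of `u` is no longer seen at `u`, but it is seen at `flip v`.
        ... | yes refl = inj₂ (inj₁ (flip v , ∈-++⁺ˡ (∈-resp-↭ (↭-sym p⁺) (there (here refl))) ,
              trans cfv (cong suc e)))
        ... | no t≢ = inj₂ (inj₁ (t , ∈-resp-↭ (++⁺ʳ (flags Ly) (↭-sym p⁺)) (there (there t∈)) ,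
              trans (coth (∈-resp-↭ (++⁺ p q) t∈) t≢) (cong suc e)))

-- Reduction to strands between the terminals

module Bound {F : Set} (_≟_ : DecidableEquality F) (flip : F → F)
             (flip-flip : ∀ f → flip (flip f) ≡ f) where

  open Strands _≟_ flip flip-flip
  open Core _≟_ flip flip-flip

  Alt : List F → List F → F → F → Set
  Alt X Y u v = (u ∈ flags X × v ∈ flags Y) ⊎ (u ∈ flags Y × v ∈ flags X)

  alt-sym : ∀ {X Y u v} → Alt X Y u v → Alt X Y v u
  alt-sym (inj₁ (p , q)) = inj₂ (q , p)
  alt-sym (inj₂ (p , q)) = inj₁ (q , p)

  alternating? : ∀ X Y N → (∀ {w} → w ∈ nodes N → w ∈ flags X ⊎ w ∈ flags Y) →
    AllPair (Alt X Y) N ⊎ ∃ λ u → ∃ λ v → Σ (List (F × F)) λ N₀ → (N ≋ ((u , v) ∷ N₀)) ×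
      ((u ∈ flags X × v ∈ flags X) ⊎ (u ∈ flags Y × v ∈ flags Y))
  alternating? X Y [] lab = inj₁ []
  alternating? X Y ((u , v) ∷ N) lab with lab (here refl) | lab (there (here refl))
  ... | inj₁ p | inj₁ q = inj₂ (u , v , N , ≋-refl , inj₁ (p , q))
  ... | inj₂ p | inj₂ q = inj₂ (u , v , N , ≋-refl , inj₂ (p , q))
  ... | inj₁ p | inj₂ q with alternating? X Y N (λ r → lab (there (there r)))
  ...   | inj₁ a = inj₁ (inj₁ (p , q) ∷ a)
  ...   | inj₂ (u' , v' , N₀ , e , b) = inj₂ (u' , v' , (u , v) ∷ N₀ , ≋-under e , b)
  alternating? X Y ((u , v) ∷ N) lab | inj₂ p | inj₁ q with alternating? X Y N (λ r → lab (there (there r)))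
  ...   | inj₁ a = inj₁ (inj₂ (p , q) ∷ a)
  ...   | inj₂ (u' , v' , N₀ , e , b) = inj₂ (u' , v' , (u , v) ∷ N₀ , ≋-under e , b)

  record Reduced (M : List (F × F)) (X Y : List F) : Set where
    field
      M°    : List (F × F)
      X° Y° : List F
      r     : ℕ
      matches : Matches M° X° Y°
      alternating : AllPair (Alt X° Y°) M°
      up   : ∀ w → Achieved M° X° Y° w → Achieved M X Y (r + w)
      down : ∀ M' X' Y' w → Bounded (M° ++ M') (X° ++ X') (Y° ++ Y') w →
             Bounded (M ++ M') (X ++ X') (Y ++ Y') (r + w)

  reduced-swap : ∀ {M X Y} → Reduced M Y X → Reduced M X Y
  reduced-swap R = record
    { M° = M° ; X° = Y° ; Y° = X° ; r = r
    ; matches = matches-swap {X = X°} {Y = Y°} matches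
    ; alternating = All.map (λ { (inj₁ p) → inj₂ p ; (inj₂ p) → inj₁ p }) alternating
    ; up = λ w a → achieved-swap (up w (achieved-swap a))
    ; down = λ M' X' Y' w b → bounded-swap (down M' Y' X' w (bounded-swap b)) }
    where open Reduced R

  step-reduced : ∀ {M X Y} (S : Step M X Y) → Reduced (Step.M° S) (Step.X° S) Y → Reduced M X Y
  step-reduced {M} {X} {Y} S R = record
    { M° = R.M° ; X° = R.X° ; Y° = R.Y° ; r = S.r + R.r ; matches = R.matches ; alternating = R.alternating
    ; up = λ w a → subst (Achieved M X Y) (sym (ℕₚ.+-assoc S.r R.r w)) (S.up _ (R.up w a))
    ; down = λ M' X' Y' w b → subst (Bounded _ _ _) (sym (ℕₚ.+-assoc S.r R.r w))
        (S.down M' X' Y' _ (R.down M' X' Y' w b)) }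
    where
    module S = Step S
    module R = Reduced R

  -- `N` bounds the number of strands, which every step lowers. A strand with both ends at y is
  -- treated by exchanging the terminals.
  reduce : ∀ N M X Y → length M ≤ N → Matches M X Y → Reduced M X Y
  reduce N M X Y le m with alternating? X Y M (λ q → ∈-++⁻ (flags X) (∈-resp-↭ (proj₁ m) q))
  ... | inj₁ a = record
    { M° = M ; X° = X ; Y° = Y ; r = 0 ; matches = m ; alternating = a
    ; up = λ _ x → x ; down = λ _ _ _ _ b → b }
  reduce zero [] X Y le m | inj₂ (u , v , N₀ , e , b) with _≋_.length≡ e
  ... | ()
  reduce (suc N) M X Y le m | inj₂ (u , v , N₀ , e , inj₁ (p , q)) =
    step-reduced S (reduce N _ _ _ (ℕₚ.≤-pred (≤-trans (Step.shorter S) le)) (Step.matches S))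
    where S = stepX {Y = Y} m e q p
  reduce (suc N) M X Y le m | inj₂ (u , v , N₀ , e , inj₂ (p , q)) =
    reduced-swap (step-reduced S (reduce N _ _ _ (ℕₚ.≤-pred (≤-trans (Step.shorter S) le)) (Step.matches S)))
    where S = stepX {Y = X} (matches-swap {X = X} {Y = Y} m) e q p

  alternating-partner : ∀ {M X Y f} → Matches M X Y → AllPair (Alt X Y) M → f ∈ flags Y →
    ∃ λ g → (g ∈ flags X) × (∀ {C : Set} (c : F → C) → Mono c M → c f ≡ c g)
  alternating-partner {M} {X} {Y} {f} (n↭ , uq) a f∈
    with node-extract {M = M} (∈-resp-↭ (↭-sym n↭) (∈-++⁺ʳ (flags X) f∈))
  ... | g , N , e with _≋_.to e (Alt X Y) alt-sym a
  ... | inj₁ (p , _) ∷ _ = ⊥-elim (unique-++-disjoint (flags X) uq p f∈)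
  ... | inj₂ (_ , q) ∷ _ = g , q , λ c mo → All.head (_≋_.to e (λ u v → c u ≡ c v) sym mo)

  -- Every colour is seen at a corner of x, and there are |X| + 1 of those.
  alternating-bounded : ∀ {M X Y} →
    (∀ {f} → f ∈ flags Y → ∃ λ g → (g ∈ flags X) × (∀ {C : Set} (c : F → C) → Mono c M → c f ≡ c g)) →
    Bounded M X Y (suc (length X))
  alternating-bounded {M} {X} {Y} partner Lx Ly ex p q C =
    ≤-trans (covered⇒≤ (gaps c α Lx ++ ex) cov)
      (≤-reflexive (trans (length-++ (gaps c α Lx)) (cong (_+ length ex)
        (trans (length-gaps c α Lx) (cong suc (flags-↭⇒length Lx X p))))))
    where
    open Coloured C
    cov : ∀ i → i ∈ gaps c α Lx ++ ex
    cov i with cover i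
    ... | inj₁ refl = ∈-++⁺ˡ (gap-start Lx)
    ... | inj₂ (inj₂ e) = ∈-++⁺ʳ (gaps c α Lx) e
    ... | inj₂ (inj₁ (v , v∈ , refl)) with ∈-++⁻ (flags Lx) v∈
    ... | inj₁ v∈x = ∈-++⁺ˡ (gap-flag Lx runx v∈x)
    ... | inj₂ v∈y with partner (∈-resp-↭ q v∈y)
    ... | g , g∈ , e = ∈-++⁺ˡ (subst (_∈ gaps c α Lx) (sym (e c mono)) (gap-flag Lx runx (∈-resp-↭ (↭-sym p) g∈)))

  private
    shift₂ : ∀ (W : List F) a b V → W ++ a ∷ b ∷ V ↭ a ∷ b ∷ W ++ V
    shift₂ W a b V = ↭-trans (shift a W (b ∷ V)) (prep a (shift b W V))

  -- The strand from `f` leads to a flag `y` at the other terminal, the one from `flip f` to `w`. If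
  -- `w` is `flip y`, the two darts are parallel and each is put first in its rotation, with a new
  -- corner in front. Otherwise the strand from `flip y` leads to some `z` at x. Without the two
  -- darts a single strand from `w` to `z` remains, and the induction hypothesis applies. Then
  -- `flip f` is put beside `z` and `flip y` beside `w`. The two new corners share the colour
  -- `zero`, as the strands from `flip f` to `w` and from `flip y` to `z` require; `f` and `y` take
  -- over the old colours of `z` and `w`, which agree.
  alternating-step : ∀ f X₀ →
    (∀ M Y → Matches M X₀ Y → AllPair (Alt X₀ Y) M → Achieved M X₀ Y (suc (length X₀))) →
    ∀ M Y → Matches M (f ∷ X₀) Y → AllPair (Alt (f ∷ X₀) Y) M → Achieved M (f ∷ X₀) Y (suc (suc (length X₀)))
  alternating-step f X₀ IH M Y (n↭ , uq) alt with node-extract {M = M} (∈-resp-↭ (↭-sym n↭) (here refl))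
  ... | y , M₀ , M≋ with _≋_.to M≋ (Alt (f ∷ X₀) Y) alt-sym alt
  ... | inj₂ (f∈Y , _) ∷ _ = ⊥-elim (unique-++-disjoint (flags (f ∷ X₀)) uq (here refl) f∈Y)
  ... | inj₁ (_ , y∈Y) ∷ alt₀ with node-extract {M = M₀} ff∈
    where
    ff∈ : flip f ∈ nodes M₀
    ff∈ with ∈-resp-↭ (↭-sym (drop-∷ (↭-trans (↭-sym (_≋_.nodes↭ M≋)) n↭))) (here refl)
    ... | here refl = ⊥-elim (unique-++-disjoint (flags (f ∷ X₀)) uq (there (here refl)) y∈Y)
    ... | there q = q
  ... | w , M₁ , M₀≋ with _≋_.to M₀≋ (Alt (f ∷ X₀) Y) alt-sym alt₀
  ... | inj₂ (ff∈Y , _) ∷ _ = ⊥-elim (unique-++-disjoint (flags (f ∷ X₀)) uq (there (here refl)) ff∈Y)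
  ... | inj₁ (_ , w∈Y) ∷ alt₁ with flags-split Y y∈Y
  ... | A , yf , B , refl , o = res
    where
    X Y° : List F
    X = f ∷ X₀
    Y° = A ++ B
    Z = flags X₀ ++ flags Y°
    Y↭ : flags Y ↭ y ∷ flip y ∷ flags Y°
    Y↭ = flags-mid′ A yf B o
    XY↭ : flags X₀ ++ flags Y ↭ y ∷ flip y ∷ Z
    XY↭ = ↭-trans (++⁺ˡ (flags X₀) Y↭) (shift₂ (flags X₀) y (flip y) (flags Y°))
    wM₁ : w ∷ nodes M₁ ↭ flip y ∷ Z
    wM₁ = drop-∷ (↭-trans (drop-∷ (↭-trans (swap _ _ ↭-refl) (↭-trans (prep y (↭-sym (_≋_.nodes↭ M₀≋)))
      (drop-∷ (↭-trans (↭-sym (_≋_.nodes↭ M≋)) n↭))))) XY↭)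
    uqA : Unique (f ∷ flip f ∷ y ∷ flip y ∷ Z)
    uqA = unique-↭ (prep f (prep _ XY↭)) uq
    f≢ff : f ≢ flip f
    f≢ff e = unique-head uqA (here e)
    f≢y : f ≢ y
    f≢y e = unique-head uqA (there (here e))
    f≢fy : f ≢ flip y
    f≢fy e = unique-head uqA (there (there (here e)))
    f∉ : f ∉ Z
    f∉ q = unique-head uqA (there (there (there q)))
    ff≢y : flip f ≢ y
    ff≢y e = unique-head (unique-tail uqA) (here e)
    ff≢fy : flip f ≢ flip y
    ff≢fy e = unique-head (unique-tail uqA) (there (here e))
    ff∉ : flip f ∉ Z
    ff∉ q = unique-head (unique-tail uqA) (there (there q))
    y≢fy : y ≢ flip y
    y≢fy e = unique-head (unique-tail (unique-tail uqA)) (here e)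
    y∉ : y ∉ Z
    y∉ q = unique-head (unique-tail (unique-tail uqA)) (there q)
    uqfy : Unique (flip y ∷ Z)
    uqfy = unique-tail (unique-tail (unique-tail uqA))
    fy∉ : flip y ∉ Z
    fy∉ = unique-head uqfy
    uqZ : Unique Z
    uqZ = unique-tail uqfy
    inX₀ : ∀ {t} → t ∈ Z → t ∈ flags X → t ∈ flags X₀
    inX₀ t∈ (here refl) = ⊥-elim (f∉ t∈)
    inX₀ t∈ (there (here refl)) = ⊥-elim (ff∉ t∈)
    inX₀ t∈ (there (there p)) = p
    inY° : ∀ {t} → t ∈ Z → t ∈ flags Y → t ∈ flags Y°
    inY° t∈ p with ∈-resp-↭ Y↭ p
    ... | here refl = ⊥-elim (y∉ t∈)
    ... | there (here refl) = ⊥-elim (fy∉ t∈)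
    ... | there (there p') = p'
    restrict : ∀ N → (∀ {t} → t ∈ nodes N → t ∈ Z) → AllPair (Alt X Y) N → AllPair (Alt X₀ Y°) N
    restrict [] _ [] = []
    restrict ((a , b) ∷ N) s (inj₁ (p , q) ∷ al) =
      inj₁ (inX₀ (s (here refl)) p , inY° (s (there (here refl))) q) ∷ restrict N (λ r → s (there (there r))) al
    restrict ((a , b) ∷ N) s (inj₂ (p , q) ∷ al) =
      inj₂ (inY° (s (here refl)) p , inX₀ (s (there (here refl))) q) ∷ restrict N (λ r → s (there (there r))) al
    res : Achieved M X Y (suc (suc (length X₀)))
    res with flip y ≟ w
    ... | yes refl with IH M₁ Y° (drop-∷ wM₁ , uqZ)
                         (restrict M₁ (λ q → ∈-resp-↭ (drop-∷ wM₁) q) alt₁)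
    ... | Lx , Ly , p , q , C = f ∷ Lx , y ∷ Ly , prep _ (prep _ p) , ↭-trans (prep _ (prep _ q)) (↭-sym Y↭) , record
      -- The old outer colour `α` is now the corner behind the new darts, and `zero` is the corner
      -- in front of them.
      { c = c⁺ ; α = zero ; β = suc β
      ; mono = _≋_.from M≋ (λ a b → c⁺ a ≡ c⁺ b) sym (trans cf (sym cy) ∷
          _≋_.from M₀≋ (λ a b → c⁺ a ≡ c⁺ b) sym (trans cff (sym cfy) ∷
            mono-lift suc M₁ (λ r → coth (∈-resp-↭ (drop-∷ wM₁) r)) mono))
      ; runx = sym cf , subst (λ z → run c⁺ z Lx _) (sym cff)
          (run-lift suc Lx (λ r → coth (∈-++⁺ˡ (∈-resp-↭ p r))) runx)
      ; runy = sym cy , subst (λ z → run c⁺ z Ly _) (sym cfy)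
          (run-lift suc Ly (λ r → coth (∈-++⁺ʳ (flags X₀) (∈-resp-↭ q r))) runy)
      ; cover = cov }
      where
      open Coloured C
      c⁺ : F → Fin _
      c⁺ = upd (upd (upd (upd (suc ∘ c) f zero) (flip f) (suc α)) y zero) (flip y) (suc α)
      cf : c⁺ f ≡ zero
      cf = trans (upd-≢ _ f≢fy) (trans (upd-≢ _ f≢y) (trans (upd-≢ _ f≢ff) (upd-≡ _ _ _)))
      cff : c⁺ (flip f) ≡ suc α
      cff = trans (upd-≢ _ ff≢fy) (trans (upd-≢ _ ff≢y) (upd-≡ _ _ _))
      cy : c⁺ y ≡ zero
      cy = trans (upd-≢ _ y≢fy) (upd-≡ _ _ _)
      cfy : c⁺ (flip y) ≡ suc α
      cfy = upd-≡ _ _ _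
      coth : ∀ {t} → t ∈ Z → c⁺ t ≡ suc (c t)
      coth t∈ = trans (upd-≢ _ λ { refl → fy∉ t∈ }) (trans (upd-≢ _ λ { refl → y∉ t∈ })
        (trans (upd-≢ _ λ { refl → ff∉ t∈ }) (upd-≢ _ λ { refl → f∉ t∈ })))
      cov : ∀ i → _
      cov zero = inj₁ refl
      cov (suc i) with cover i
      ... | inj₁ refl = inj₂ (inj₁ (flip f , there (here refl) , cff))
      ... | inj₂ (inj₁ (t , t∈ , e)) = inj₂ (inj₁ (t ,
            ∈-resp-↭ (prep f (prep _ (↭-sym (shift₂ (flags Lx) y (flip y) (flags Ly)))))
              (there (there (there (there t∈)))) ,
            trans (coth (∈-resp-↭ (++⁺ p q) t∈)) (cong suc e)))
    res | no fy≢w with node-extract {M = M₁} fy∈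
      where
      fy∈ : flip y ∈ nodes M₁
      fy∈ with ∈-resp-↭ (↭-sym wM₁) (here refl)
      ... | here e = ⊥-elim (fy≢w e)
      ... | there r = r
    ... | z , M₂ , M₁≋ with _≋_.to M₁≋ (Alt X Y) alt-sym alt₁
    ... | inj₁ (fy∈X , _) ∷ _ =
          ⊥-elim (unique-++-disjoint (flags X) uq fy∈X (∈-resp-↭ (↭-sym Y↭) (there (here refl))))
    ... | inj₂ (_ , z∈X) ∷ alt₂ = grow (IH ((w , z) ∷ M₂) Y° (wzM , uqZ)
          (inj₂ (w∈Y° , z∈X₀) ∷ restrict M₂ (λ r → ∈-resp-↭ wzM (there (there r))) alt₂))
      where
      wzM : w ∷ z ∷ nodes M₂ ↭ Z
      wzM = drop-∷ (↭-trans (swap _ _ ↭-refl) (↭-trans (prep w (↭-sym (_≋_.nodes↭ M₁≋))) wM₁))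
      uqM : Unique (w ∷ z ∷ nodes M₂)
      uqM = unique-↭ (↭-sym wzM) uqZ
      w∈Y° : w ∈ flags Y°
      w∈Y° = inY° (∈-resp-↭ wzM (here refl)) w∈Y
      z∈X₀ : z ∈ flags X₀
      z∈X₀ = inX₀ (∈-resp-↭ wzM (there (here refl))) z∈X
      w∈Z : w ∈ Z
      w∈Z = ∈-++⁺ʳ (flags X₀) w∈Y°
      z∈Z : z ∈ Z
      z∈Z = ∈-++⁺ˡ z∈X₀
      grow : Achieved ((w , z) ∷ M₂) X₀ Y° (suc (length X₀)) → Achieved M X Y (suc (suc (length X₀)))
      grow (Lx , Ly , p , q , C)
        with insert-dart Lx z (flip f) (∈-resp-↭ (↭-sym p) z∈X₀) (unique-↭ (↭-sym p) (unique-++ˡ (flags X₀) uqZ))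
           | insert-dart Ly w (flip y) (∈-resp-↭ (↭-sym q) w∈Y°) (unique-↭ (↭-sym q) (unique-++ʳ (flags X₀) uqZ))
      ... | Lx⁺ , p⁺ , insx | Ly⁺ , q⁺ , insy = Lx⁺ , Ly⁺ , ↭-trans px (prep _ (prep _ p)) ,
              ↭-trans qy (↭-trans (prep _ (prep _ q)) (↭-sym Y↭)) , record
        { c = c⁺ ; α = suc α ; β = suc β
        ; mono = _≋_.from M≋ (λ a b → c⁺ a ≡ c⁺ b) sym
            (trans cf (trans (cong suc (sym (All.head mono))) (sym cy)) ∷
            _≋_.from M₀≋ (λ a b → c⁺ a ≡ c⁺ b) sym (trans cff (sym cw) ∷
              _≋_.from M₁≋ (λ a b → c⁺ a ≡ c⁺ b) sym (trans cfy (sym cz) ∷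
                mono-lift suc M₂ (λ r → coth (∈-resp-↭ wzM (there (there r)))
                  (λ { refl → unique-head uqM (there r) }) (λ { refl → unique-head (unique-tail uqM) r }))
                  (All.tail mono))))
        ; runx = insx c c⁺ cz cff (trans (cong c⁺ (flip-flip f)) cf)
            (λ r t≢z → coth (∈-++⁺ˡ (∈-resp-↭ p r))
              (λ { refl → unique-++-disjoint (flags X₀) uqZ (∈-resp-↭ p r) w∈Y° }) t≢z) runx
        ; runy = insy c c⁺ cw cfy (trans (cong c⁺ (flip-flip y)) cy)
            (λ r t≢w → coth (∈-++⁺ʳ (flags X₀) (∈-resp-↭ q r)) t≢w
              (λ { refl → unique-++-disjoint (flags X₀) uqZ z∈X₀ (∈-resp-↭ q r) })) runy
        ; cover = cov }
        where
        open Coloured C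
        px : flags Lx⁺ ↭ f ∷ flip f ∷ flags Lx
        px = ↭-trans p⁺ (↭-trans (swap _ _ ↭-refl) (↭-reflexive (cong (λ t → t ∷ flip f ∷ flags Lx) (flip-flip f))))
        qy : flags Ly⁺ ↭ y ∷ flip y ∷ flags Ly
        qy = ↭-trans q⁺ (↭-trans (swap _ _ ↭-refl) (↭-reflexive (cong (λ t → t ∷ flip y ∷ flags Ly) (flip-flip y))))
        c⁺ : F → Fin _
        c⁺ = upd (upd (upd (upd (upd (upd (suc ∘ c) f (suc (c z))) y (suc (c w))) (flip f) zero) (flip y) zero) w zero) z zero
        cz : c⁺ z ≡ zero
        cz = upd-≡ _ _ _
        cw : c⁺ w ≡ zero
        cw = trans (upd-≢ _ λ { refl → unique-head uqM (here refl) }) (upd-≡ _ _ _)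
        cfy : c⁺ (flip y) ≡ zero
        cfy = trans (upd-≢ _ λ { refl → fy∉ z∈Z }) (trans (upd-≢ _ fy≢w) (upd-≡ _ _ _))
        cff : c⁺ (flip f) ≡ zero
        cff = trans (upd-≢ _ λ { refl → ff∉ z∈Z }) (trans (upd-≢ _ λ { refl → ff∉ w∈Z })
          (trans (upd-≢ _ ff≢fy) (upd-≡ _ _ _)))
        cy : c⁺ y ≡ suc (c w)
        cy = trans (upd-≢ _ λ { refl → y∉ z∈Z }) (trans (upd-≢ _ λ { refl → y∉ w∈Z })
          (trans (upd-≢ _ y≢fy) (trans (upd-≢ _ (ff≢y ∘ sym)) (upd-≡ _ _ _))))
        cf : c⁺ f ≡ suc (c z)
        cf = trans (upd-≢ _ λ { refl → f∉ z∈Z }) (trans (upd-≢ _ λ { refl → f∉ w∈Z })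
          (trans (upd-≢ _ f≢fy) (trans (upd-≢ _ f≢ff) (trans (upd-≢ _ f≢y) (upd-≡ _ _ _)))))
        coth : ∀ {t} → t ∈ Z → t ≢ w → t ≢ z → c⁺ t ≡ suc (c t)
        coth t∈ t≢w t≢z = trans (upd-≢ _ t≢z) (trans (upd-≢ _ t≢w) (trans (upd-≢ _ λ { refl → fy∉ t∈ })
          (trans (upd-≢ _ λ { refl → ff∉ t∈ }) (trans (upd-≢ _ λ { refl → y∉ t∈ }) (upd-≢ _ λ { refl → f∉ t∈ })))))
        inx : ∀ {t} → t ∈ f ∷ flip f ∷ flags Lx → t ∈ flags Lx⁺ ++ flags Ly⁺
        inx r = ∈-++⁺ˡ (∈-resp-↭ (↭-sym px) r)
        iny : ∀ {t} → t ∈ y ∷ flip y ∷ flags Ly → t ∈ flags Lx⁺ ++ flags Ly⁺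
        iny r = ∈-++⁺ʳ (flags Lx⁺) (∈-resp-↭ (↭-sym qy) r)
        old : ∀ {t} → t ∈ flags Lx ++ flags Ly → t ∈ flags Lx⁺ ++ flags Ly⁺
        old r = [ (λ s → inx (there (there s))) , (λ s → iny (there (there s))) ]′ (∈-++⁻ (flags Lx) r)
        cov : ∀ i → _
        cov zero = inj₂ (inj₁ (flip f , inx (there (here refl)) , cff))
        cov (suc i) with cover i
        ... | inj₁ e = inj₁ (cong suc e)
        ... | inj₂ (inj₁ (t , t∈ , e)) with t ≟ w | t ≟ z
        ... | yes refl | _ = inj₂ (inj₁ (y , iny (here refl) , trans cy (cong suc e)))
        ... | no _ | yes refl = inj₂ (inj₁ (f , inx (here refl) , trans cf (cong suc e)))
        ... | no t≢w | no t≢z = inj₂ (inj₁ (t , old t∈ ,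
              trans (coth (∈-resp-↭ (++⁺ p q) t∈) t≢w t≢z) (cong suc e)))

  alternating-achieved : ∀ X M Y → Matches M X Y → AllPair (Alt X Y) M → Achieved M X Y (suc (length X))
  alternating-achieved [] ((u , v) ∷ M) Y m (inj₁ (() , _) ∷ _)
  alternating-achieved [] ((u , v) ∷ M) Y m (inj₂ (_ , ()) ∷ _)
  alternating-achieved [] [] (f ∷ Y) (n↭ , _) a with ↭-length n↭
  ... | ()
  alternating-achieved [] [] [] m a = [] , [] , ↭-refl , ↭-refl , record
    { c = λ _ → zero ; α = zero ; β = zero ; mono = [] ; runx = refl ; runy = refl
    ; cover = λ { zero → inj₁ refl } }
  alternating-achieved (f ∷ X₀) M Y m alt = alternating-step f X₀ (alternating-achieved X₀) M Y m alt

  bounded-comm : ∀ M N X X' Y Y' {w} → Bounded (M ++ N) (X ++ X') (Y ++ Y') w → Bounded (N ++ M) (X' ++ X) (Y' ++ Y) w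
  bounded-comm M N X X' Y Y' b Lx Ly ex p q C = b Lx Ly ex (↭-trans p (comm X X')) (↭-trans q (comm Y Y')) record
    { c = c ; α = α ; β = β ; mono = All-++⁺ (All-++⁻ʳ N mono) (All-++⁻ˡ N mono)
    ; runx = runx ; runy = runy ; cover = cover }
    where
    open Coloured C
    comm : ∀ A B → flags (B ++ A) ↭ flags (A ++ B)
    comm A B rewrite flags-++ A B | flags-++ B A = ++-comm (flags B) (flags A)

  -- The first side is reduced with the second as context, then the second with the remainder of the
  -- first as context. The two remainders together still alternate, so one count of corners at x
  -- bounds them jointly, while each remainder attains its own count when taken alone.
  two-terminal-additivity : ∀ {M₁ X₁ Y₁ M₂ X₂ Y₂} → Matches M₁ X₁ Y₁ → Matches M₂ X₂ Y₂ →
    ∃ λ w₁ → ∃ λ w₂ → ∃ λ w → Achieved M₁ X₁ Y₁ w₁ × Achieved M₂ X₂ Y₂ w₂ ×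
      Bounded (M₁ ++ M₂) (X₁ ++ X₂) (Y₁ ++ Y₂) w × (suc w ≡ w₁ + w₂)
  two-terminal-additivity {M₁} {X₁} {Y₁} {M₂} {X₂} {Y₂} m₁ m₂ =
    R₁.r + suc a₁ , R₂.r + suc a₂ , R₁.r + (R₂.r + suc (length (R₂.X° ++ R₁.X°))) ,
    R₁.up _ (alternating-achieved R₁.X° R₁.M° R₁.Y° R₁.matches R₁.alternating) ,
    R₂.up _ (alternating-achieved R₂.X° R₂.M° R₂.Y° R₂.matches R₂.alternating) ,
    R₁.down M₂ X₂ Y₂ _ (bounded-comm M₂ R₁.M° X₂ R₁.X° Y₂ R₁.Y°
      (R₂.down R₁.M° R₁.X° R₁.Y° _ (alternating-bounded {R₂.M° ++ R₁.M°} {R₂.X° ++ R₁.X°} {R₂.Y° ++ R₁.Y°} partner))) ,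
    arith
    where
    module R₁ = Reduced (reduce (length M₁) M₁ X₁ Y₁ ≤-refl m₁)
    module R₂ = Reduced (reduce (length M₂) M₂ X₂ Y₂ ≤-refl m₂)
    a₁ = length R₁.X°
    a₂ = length R₂.X°
    partner : ∀ {f} → f ∈ flags (R₂.Y° ++ R₁.Y°) → ∃ λ g → (g ∈ flags (R₂.X° ++ R₁.X°)) ×
      (∀ {C : Set} (c : F → C) → Mono c (R₂.M° ++ R₁.M°) → c f ≡ c g)
    partner {f} f∈ rewrite flags-++ R₂.Y° R₁.Y° | flags-++ R₂.X° R₁.X° with ∈-++⁻ (flags R₂.Y°) f∈
    ... | inj₁ p with alternating-partner {X = R₂.X°} {R₂.Y°} R₂.matches R₂.alternating p
    ...   | g , g∈ , e = g , ∈-++⁺ˡ g∈ , λ c mo → e c (All-++⁻ˡ R₂.M° mo)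
    partner {f} f∈ | inj₂ p with alternating-partner {X = R₁.X°} {R₁.Y°} R₁.matches R₁.alternating p
    ...   | g , g∈ , e = g , ∈-++⁺ʳ (flags R₂.X°) g∈ , λ c mo → e c (All-++⁻ʳ R₂.M° mo)
    open ≡-Reasoning
    arith : suc (R₁.r + (R₂.r + suc (length (R₂.X° ++ R₁.X°)))) ≡ R₁.r + suc a₁ + (R₂.r + suc a₂)
    arith = begin
      suc (R₁.r + (R₂.r + suc (length (R₂.X° ++ R₁.X°)))) ≡⟨ cong (λ z → suc (R₁.r + (R₂.r + suc z))) (length-++ R₂.X°) ⟩
      suc (R₁.r + (R₂.r + suc (a₂ + a₁))) ≡⟨ solve 4 (λ r s a b → con 1 :+ (r :+ (s :+ (con 1 :+ (b :+ a)))) := r :+ (con 1 :+ a) :+ (s :+ (con 1 :+ b))) refl R₁.r R₂.r a₁ a₂ ⟩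
      R₁.r + suc a₁ + (R₂.r + suc a₂) ∎
      where open import Data.Nat.Solver using (module +-*-Solver)
            open +-*-Solver

  -- Tracing strands through interior corners

  Extension : {C : Set} {ℓ : ℕ} → (Θ Φ : List (F × F)) → List F → (F → C) → (Fin ℓ → C) → Set
  Extension {C} Θ Φ Z c γ = Σ (F → C) λ c⁺ →
    Mono c⁺ Θ × Mono c⁺ Φ × (∀ {f} → f ∈ Z → c⁺ f ≡ c f) × (∀ j → ∃ λ f → (f ∈ nodes Φ) × (c⁺ f ≡ γ j))

  -- Tracing strands through interior corners Φ of the pairs Θ leaves a pairing M
  -- of the remaining flags Z together with ℓ closed strands.
  record Eliminated (Θ Φ : List (F × F)) (Z : List F) : Set₁ where
    field
      M : List (F × F)
      ℓ : ℕ
      nodes-M : nodes M ↭ Z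
      fwd : ∀ {C : Set} (c : F → C) → Mono c Θ → Mono c Φ → Mono c M ×
        Σ (List C) λ loops → (length loops ≡ ℓ) ×
          (∀ {f} → f ∈ nodes Φ → (∃ λ g → (g ∈ Z) × (c g ≡ c f)) ⊎ c f ∈ loops)
      bwd : ∀ {C : Set} (c : F → C) (γ : Fin ℓ → C) → Mono c M → Extension Θ Φ Z c γ

  -- The corner glues the strand ending at `f` to the one ending at `g`. If these are the same
  -- strand, it closes up, `ℓ` increases, and its colour is free of all other constraints. Otherwise
  -- the two are concatenated into a strand from `a` to `b`. Backwards, `f` and `g` get the
  -- prescribed colour `γ zero` in the first case and the colour of `a` in the second.
  eliminate-corner : ∀ f g Φ Θ Z → Unique (nodes ((f , g) ∷ Φ) ++ Z) → Eliminated Θ Φ (f ∷ g ∷ Z) →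
    Eliminated Θ ((f , g) ∷ Φ) Z
  eliminate-corner f g Φ Θ Z uq E with node-extract {M = Eliminated.M E} (∈-resp-↭ (↭-sym (Eliminated.nodes-M E)) (here refl))
  ... | a , N , M≋ = res
    where
    module E = Eliminated E
    uqZ : Unique (f ∷ g ∷ Z)
    uqZ = unique-++ʳ (nodes Φ) (unique-↭ (↭-sym (shift₂ (nodes Φ) f g Z)) uq)
    f≢g : f ≢ g
    f≢g e = unique-head uqZ (here e)
    f∉ : f ∉ Z
    f∉ q = unique-head uqZ (there q)
    g∉ : g ∉ Z
    g∉ = unique-head (unique-tail uqZ)
    aN : a ∷ nodes N ↭ g ∷ Z
    aN = drop-∷ (↭-trans (↭-sym (_≋_.nodes↭ M≋)) E.nodes-M)
    res : Eliminated Θ ((f , g) ∷ Φ) Z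
    res with a ≟ g
    ... | yes refl = record
      { M = N ; ℓ = suc E.ℓ ; nodes-M = drop-∷ aN ; fwd = fw ; bwd = bw }
      where
      fw : ∀ {C : Set} (c : F → C) → Mono c Θ → Mono c ((f , g) ∷ Φ) → Mono c N ×
        Σ (List C) λ loops → (length loops ≡ suc E.ℓ) ×
          (∀ {t} → t ∈ f ∷ g ∷ nodes Φ → (∃ λ s → (s ∈ Z) × (c s ≡ c t)) ⊎ c t ∈ loops)
      fw c mo (e ∷ mo') with E.fwd c mo mo'
      ... | moM , loops , len , cov = All.tail (_≋_.to M≋ (λ u v → c u ≡ c v) sym moM) ,
              c f ∷ loops , cong suc len , cov'
        where
        cov' : ∀ {t} → t ∈ f ∷ g ∷ nodes Φ → (∃ λ s → (s ∈ Z) × (c s ≡ c t)) ⊎ c t ∈ c f ∷ loops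
        cov' (here refl) = inj₂ (here refl)
        cov' (there (here refl)) = inj₂ (here (sym e))
        cov' (there (there q)) with cov q
        ... | inj₂ r = inj₂ (there r)
        ... | inj₁ (s , here refl , es) = inj₂ (here (sym es))
        ... | inj₁ (s , there (here refl) , es) = inj₂ (here (trans (sym es) (sym e)))
        ... | inj₁ (s , there (there s∈) , es) = inj₁ (s , s∈ , es)
      bw : ∀ {C : Set} (c : F → C) (γ : Fin (suc E.ℓ) → C) → Mono c N → Extension Θ ((f , g) ∷ Φ) Z c γ
      bw {C} c γ mo = fin (E.bwd c₁ (γ ∘ suc) (_≋_.from M≋ (λ u v → c₁ u ≡ c₁ v) sym
          (trans c₁f (sym c₁g) ∷ mono-lift id N (λ r → c₁Z (∈-resp-↭ (drop-∷ aN) r)) mo)))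
        where
        c₁ : F → C
        c₁ = upd (upd c f (γ zero)) g (γ zero)
        c₁g : c₁ g ≡ γ zero
        c₁g = upd-≡ _ _ _
        c₁f : c₁ f ≡ γ zero
        c₁f = trans (upd-≢ _ f≢g) (upd-≡ _ _ _)
        c₁Z : ∀ {t} → t ∈ Z → c₁ t ≡ c t
        c₁Z t∈ = trans (upd-≢ _ λ { refl → g∉ t∈ }) (upd-≢ _ λ { refl → f∉ t∈ })
        fin : Extension Θ Φ (f ∷ g ∷ Z) c₁ (γ ∘ suc) → Extension Θ ((f , g) ∷ Φ) Z c γ
        fin (c⁺ , moΘ , moΦ , agree , hit) = c⁺ , moΘ ,
          (trans (agree (here refl)) (trans c₁f (sym (trans (agree (there (here refl))) c₁g))) ∷ moΦ) ,
          (λ t∈ → trans (agree (there (there t∈))) (c₁Z t∈)) ,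
          λ { zero → f , here refl , trans (agree (here refl)) c₁f
            ; (suc j) → let (t , t∈ , e) = hit j in t , there (there t∈) , e }
    ... | no a≢g with node-extract {M = N} g∈N
      where
      g∈N : g ∈ nodes N
      g∈N with ∈-resp-↭ (↭-sym aN) (here refl)
      ... | here e = ⊥-elim (a≢g (sym e))
      ... | there r = r
    ... | b , N' , N≋ = record
      { M = (a , b) ∷ N' ; ℓ = E.ℓ ; nodes-M = abN ; fwd = fw ; bwd = bw }
      where
      abN : a ∷ b ∷ nodes N' ↭ Z
      abN = drop-∷ (↭-trans (swap _ _ ↭-refl) (↭-trans (prep a (↭-sym (_≋_.nodes↭ N≋))) aN))
      fw : ∀ {C : Set} (c : F → C) → Mono c Θ → Mono c ((f , g) ∷ Φ) → Mono c ((a , b) ∷ N') ×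
        Σ (List C) λ loops → (length loops ≡ E.ℓ) ×
          (∀ {t} → t ∈ f ∷ g ∷ nodes Φ → (∃ λ s → (s ∈ Z) × (c s ≡ c t)) ⊎ c t ∈ loops)
      fw c mo (e ∷ mo') with E.fwd c mo mo'
      ... | moM , loops , len , cov with _≋_.to M≋ (λ u v → c u ≡ c v) sym moM
      ... | fa ∷ moN with _≋_.to N≋ (λ u v → c u ≡ c v) sym moN
      ... | gb ∷ moN' = (trans (sym fa) (trans e gb) ∷ moN') , loops , len , cov'
        where
        a∈ : a ∈ Z
        a∈ = ∈-resp-↭ abN (here refl)
        cov' : ∀ {t} → t ∈ f ∷ g ∷ nodes Φ → (∃ λ s → (s ∈ Z) × (c s ≡ c t)) ⊎ c t ∈ loops
        cov' (here refl) = inj₁ (a , a∈ , sym fa)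
        cov' (there (here refl)) = inj₁ (a , a∈ , trans (sym fa) e)
        cov' (there (there q)) with cov q
        ... | inj₂ r = inj₂ r
        ... | inj₁ (s , here refl , es) = inj₁ (a , a∈ , trans (sym fa) es)
        ... | inj₁ (s , there (here refl) , es) = inj₁ (a , a∈ , trans (sym fa) (trans e es))
        ... | inj₁ (s , there (there s∈) , es) = inj₁ (s , s∈ , es)
      bw : ∀ {C : Set} (c : F → C) (γ : Fin E.ℓ → C) → Mono c ((a , b) ∷ N') → Extension Θ ((f , g) ∷ Φ) Z c γ
      bw {C} c γ (ab ∷ mo) = fin (E.bwd c₁ γ (_≋_.from M≋ (λ u v → c₁ u ≡ c₁ v) sym
          (trans c₁f (sym (c₁Z (∈-resp-↭ abN (here refl)))) ∷
           _≋_.from N≋ (λ u v → c₁ u ≡ c₁ v) sym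
             (trans c₁g (trans ab (sym (c₁Z (∈-resp-↭ abN (there (here refl)))))) ∷
              mono-lift id N' (λ r → c₁Z (∈-resp-↭ abN (there (there r)))) mo))))
        where
        c₁ : F → C
        c₁ = upd (upd c f (c a)) g (c a)
        c₁g : c₁ g ≡ c a
        c₁g = upd-≡ _ _ _
        c₁f : c₁ f ≡ c a
        c₁f = trans (upd-≢ _ f≢g) (upd-≡ _ _ _)
        c₁Z : ∀ {t} → t ∈ Z → c₁ t ≡ c t
        c₁Z t∈ = trans (upd-≢ _ λ { refl → g∉ t∈ }) (upd-≢ _ λ { refl → f∉ t∈ })
        fin : Extension Θ Φ (f ∷ g ∷ Z) c₁ γ → Extension Θ ((f , g) ∷ Φ) Z c γ
        fin (c⁺ , moΘ , moΦ , agree , hit) = c⁺ , moΘ ,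
          (trans (agree (here refl)) (trans c₁f (sym (trans (agree (there (here refl))) c₁g))) ∷ moΦ) ,
          (λ t∈ → trans (agree (there (there t∈))) (c₁Z t∈)) ,
          λ j → let (t , t∈ , e) = hit j in t , there (there t∈) , e

  eliminate : ∀ Φ Θ Z → nodes Θ ↭ nodes Φ ++ Z → Unique (nodes Φ ++ Z) → Eliminated Θ Φ Z
  eliminate [] Θ Z p uq = record
    { M = Θ ; ℓ = 0 ; nodes-M = p
    ; fwd = λ c mo _ → mo , [] , refl , λ ()
    ; bwd = λ c γ mo → c , mo , [] , (λ _ → refl) , λ () }
  eliminate ((f , g) ∷ Φ) Θ Z p uq = eliminate-corner f g Φ Θ Z uq (eliminate Φ Θ (f ∷ g ∷ Z)
    (↭-trans p (↭-sym (shift₂ (nodes Φ) f g Z))) (unique-↭ (↭-sym (shift₂ (nodes Φ) f g Z)) uq))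

-- Finite graphs: components and darts

T⇒≡ : ∀ {b} → T b → b ≡ true
T⇒≡ {true} _ = refl

≡⇒T : ∀ {b} → b ≡ true → T b
≡⇒T refl = tt

¬T⇒≡ : ∀ {b} → ¬ T b → b ≡ false
¬T⇒≡ {true} h = ⊥-elim (h tt)
¬T⇒≡ {false} _ = refl

∧⁺ : ∀ {a b} → T a → T b → T (a ∧ b)
∧⁺ {true} _ q = q

∧⁻ˡ : ∀ {a b} → T (a ∧ b) → T a
∧⁻ˡ {true} _ = tt

∧⁻ʳ : ∀ {a b} → T (a ∧ b) → T b
∧⁻ʳ {true} q = q

∨⁺ˡ : ∀ {a b} → T a → T (a ∨ b)
∨⁺ˡ {true} _ = tt

∨⁺ʳ : ∀ {a b} → T b → T (a ∨ b)
∨⁺ʳ {true} _ = tt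
∨⁺ʳ {false} q = q

∨⁻ : ∀ {a b} → T (a ∨ b) → T a ⊎ T b
∨⁻ {true} _ = inj₁ tt
∨⁻ {false} q = inj₂ q

not⁺ : ∀ {a} → ¬ T a → T (not a)
not⁺ {true} h = h tt
not⁺ {false} _ = tt

not⁻ : ∀ {a} → T (not a) → ¬ T a
not⁻ {false} _ ()

=ᶠ⁺ : ∀ {m} {i j : Fin m} → i ≡ j → T (i =ᶠ j)
=ᶠ⁺ e = fromWitness e

=ᶠ⁻ : ∀ {m} {i j : Fin m} → T (i =ᶠ j) → i ≡ j
=ᶠ⁻ t = toWitness t

anyFin⁺ : ∀ {m} {f : Fin m → Bool} i → T (f i) → T (anyFin f)
anyFin⁺ zero t = ∨⁺ˡ t
anyFin⁺ {f = f} (suc i) t = ∨⁺ʳ {f zero} (anyFin⁺ i t)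

anyFin⁻ : ∀ {m} {f : Fin m → Bool} → T (anyFin f) → ∃ λ i → T (f i)
anyFin⁻ {suc m} {f} t with ∨⁻ {f zero} t
... | inj₁ p = zero , p
... | inj₂ q = let (i , r) = anyFin⁻ q in suc i , r

allFin⁻ : ∀ {m} {f : Fin m → Bool} → T (allFin f) → ∀ i → T (f i)
allFin⁻ {suc m} {f} t zero = ∧⁻ˡ t
allFin⁻ {suc m} {f} t (suc i) = allFin⁻ {m} (∧⁻ʳ {f zero} t) i

¬allFin⇒∃ : ∀ {m} {f : Fin m → Bool} → ¬ T (allFin f) → ∃ λ i → ¬ T (f i)
¬allFin⇒∃ {zero} h = ⊥-elim (h tt)
¬allFin⇒∃ {suc m} {f} h with T? (f zero)
... | no q = zero , q
... | yes q = let (i , r) = ¬allFin⇒∃ {m} (λ t → h (∧⁺ q t)) in suc i , r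

-- The counterpart of `sumFin` with lists for numbers: counts become lengths, and equations between
-- counts reduce to comparing duplicate-free lists as sets.
collect : ∀ {m} {A : Set} → (Fin m → List A) → List A
collect {zero} g = []
collect {suc m} g = g zero ++ collect (g ∘ suc)

sumFin-cong : ∀ {m} {f g : Fin m → ℕ} → (∀ i → f i ≡ g i) → sumFin f ≡ sumFin g
sumFin-cong {zero} h = refl
sumFin-cong {suc m} h = cong₂ _+_ (h zero) (sumFin-cong (h ∘ suc))

length-collect : ∀ {m} {A : Set} (g : Fin m → List A) → length (collect g) ≡ sumFin (length ∘ g)
length-collect {zero} g = refl
length-collect {suc m} g = trans (length-++ (g zero)) (cong (length (g zero) +_) (length-collect (g ∘ suc)))

∈-collect⁺ : ∀ {m} {A : Set} (g : Fin m → List A) {z} i → z ∈ g i → z ∈ collect g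
∈-collect⁺ g zero p = ∈-++⁺ˡ p
∈-collect⁺ g (suc i) p = ∈-++⁺ʳ (g zero) (∈-collect⁺ (g ∘ suc) i p)

∈-collect⁻ : ∀ {m} {A : Set} (g : Fin m → List A) {z} → z ∈ collect g → ∃ λ i → z ∈ g i
∈-collect⁻ {suc m} g p with ∈-++⁻ (g zero) p
... | inj₁ q = zero , q
... | inj₂ q = let (i , r) = ∈-collect⁻ (g ∘ suc) q in suc i , r

unique-collect : ∀ {m} {A : Set} (g : Fin m → List A) → (∀ i → Unique (g i)) →
  (∀ i j {z} → z ∈ g i → z ∈ g j → i ≡ j) → Unique (collect g)
unique-collect {zero} g u d = []
unique-collect {suc m} g u d = Uniqₚ.++⁺ (u zero)
  (unique-collect (g ∘ suc) (u ∘ suc) (λ i j p q → Finₚ.suc-injective (d _ _ p q)))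
  λ { (p , q) → let (i , r) = ∈-collect⁻ (g ∘ suc) q in disj i (d zero (suc i) p r) }
  where
  disj : ∀ {m} (i : Fin m) → zero ≢ suc i
  disj i ()

select : ∀ {m} → (Fin m → Bool) → List (Fin m)
select p = collect λ i → if p i then i ∷ [] else []

guard : {A : Set} → Bool → A → List A
guard b z = if b then z ∷ [] else []

∈-guard⁺ : {A : Set} {b : Bool} {z : A} → T b → z ∈ guard b z
∈-guard⁺ {b = true} _ = here refl

∈-guard⁻ : {A : Set} {b : Bool} {z w : A} → w ∈ guard b z → T b × (w ≡ z)
∈-guard⁻ {b = true} (here e) = tt , e

unique-guard : {A : Set} (b : Bool) (z : A) → Unique (guard b z)
unique-guard true z = [] ∷ []
unique-guard false z = []

length-guard : {A : Set} (b : Bool) (z : A) → length (guard b z) ≡ (if b then 1 else 0)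
length-guard true z = refl
length-guard false z = refl

length-select : ∀ {m} (p : Fin m → Bool) → length (select p) ≡ countFin p
length-select p = trans (length-collect λ i → guard (p i) i) (sumFin-cong λ i → length-guard (p i) i)

∈-select⁺ : ∀ {m} (p : Fin m → Bool) {i} → T (p i) → i ∈ select p
∈-select⁺ p {i} t = ∈-collect⁺ _ i (∈-guard⁺ t)

∈-select⁻ : ∀ {m} (p : Fin m → Bool) {i} → i ∈ select p → T (p i)
∈-select⁻ p q with ∈-collect⁻ (λ i → guard (p i) i) q
... | j , r with ∈-guard⁻ {b = p j} r
... | t , refl = t

unique-select : ∀ {m} (p : Fin m → Bool) → Unique (select p)
unique-select p = unique-collect _ (λ i → unique-guard (p i) i)
  λ i j r s → trans (sym (proj₂ (∈-guard⁻ {b = p i} r))) (proj₂ (∈-guard⁻ {b = p j} s))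

everyFin : ∀ m → List (Fin m)
everyFin m = select (λ _ → true)

length-everyFin : ∀ m → length (everyFin m) ≡ m
length-everyFin m = trans (length-select {m} (λ _ → true)) (ones m)
  where
  ones : ∀ m → sumFin {m} (λ _ → 1) ≡ m
  ones zero = refl
  ones (suc m) = cong suc (ones m)

unique-lookup : ∀ {A : Set} {xs : List A} → Unique xs → ∀ i j → lookup xs i ≡ lookup xs j → i ≡ j
unique-lookup {xs = x ∷ xs} u zero zero e = refl
unique-lookup {xs = x ∷ xs} u zero (suc j) e = ⊥-elim (unique-head u (subst (_∈ xs) (sym e) (Memₚ.∈-lookup j)))
unique-lookup {xs = x ∷ xs} u (suc i) zero e = ⊥-elim (unique-head u (subst (_∈ xs) e (Memₚ.∈-lookup i)))
unique-lookup {xs = x ∷ xs} (_ ∷ u) (suc i) (suc j) e = cong suc (unique-lookup u i j e)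

-- Walks, components and darts

module _ (G : TGraph) where

  edge-sym : ∀ {a b} → T (Edge G a b) → T (Edge G b a)
  edge-sym {a} {b} t = ∧⁺ (not⁺ λ e → edge⇒≢ {b = adj G a b ∨ adj G b a} t (sym (=ᶠ⁻ e)))
    ([ ∨⁺ʳ {adj G b a} , ∨⁺ˡ ]′ (∨⁻ {adj G a b} (∧⁻ʳ {not (a =ᶠ b)} t)))

  edge-≢ : ∀ {a b} → T (Edge G a b) → a ≢ b
  edge-≢ {a} {b} t = edge⇒≢ {b = adj G a b ∨ adj G b a} t

  walk-++ : ∀ {a b c} → Walk G a b → Walk G b c → Walk G a c
  walk-++ here w = w
  walk-++ (step e v) w = step e (walk-++ v w)

  walk-sym : ∀ {a b} → Walk G a b → Walk G b a
  walk-sym here = here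
  walk-sym (step e w) = walk-++ (walk-sym w) (step (edge-sym e) here)

  walk-invariant : {A : Set} (κ : Fin (n G) → A) → (∀ {a b} → T (Edge G a b) → κ a ≡ κ b) →
    ∀ {a b} → Walk G a b → κ a ≡ κ b
  walk-invariant κ inv here = refl
  walk-invariant κ inv (step e w) = trans (inv e) (walk-invariant κ inv w)

  reach-sound : ∀ k {a b} → T (reachIter G k a b) → Walk G a b
  reach-sound zero t with =ᶠ⁻ t
  ... | refl = here
  reach-sound (suc k) {a} {b} t with ∨⁻ {reachIter G k a b} t
  ... | inj₁ p = reach-sound k p
  ... | inj₂ q with anyFin⁻ q
  ... | c , r = walk-++ (reach-sound k (∧⁻ˡ r)) (step (∧⁻ʳ {reachIter G k a c} r) here)

  reach-left : ∀ k {a b c} → T (Edge G a b) → T (reachIter G k b c) → T (reachIter G (suc k) a c)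
  reach-left zero {a} {b} {c} e t with =ᶠ⁻ t
  ... | refl = ∨⁺ʳ {a =ᶠ c} (anyFin⁺ a (∧⁺ (=ᶠ⁺ {i = a} refl) e))
  reach-left (suc k) {a} {b} {c} e t with ∨⁻ {reachIter G k b c} t
  ... | inj₁ p = ∨⁺ˡ (reach-left k e p)
  ... | inj₂ q with anyFin⁻ q
  ... | d , r = ∨⁺ʳ {reachIter G (suc k) a c}
          (anyFin⁺ d (∧⁺ {reachIter G (suc k) a d} (reach-left k e (∧⁻ˡ r)) (∧⁻ʳ {reachIter G k b d} r)))

  reach-mono : ∀ j k {a b} → T (reachIter G k a b) → T (reachIter G (j + k) a b)
  reach-mono zero k t = t
  reach-mono (suc j) k t = ∨⁺ˡ (reach-mono j k t)

  Chain : Fin (n G) → List (Fin (n G)) → Fin (n G) → Set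
  Chain a [] b = a ≡ b
  Chain a (v ∷ vs) b = T (Edge G a v) × Chain v vs b

  chain-cut : ∀ {a b c} vs → a ∈ b ∷ vs → Unique (b ∷ vs) → Chain b vs c →
    ∃ λ vs' → Unique (a ∷ vs') × Chain a vs' c
  chain-cut vs (here refl) u ch = vs , u , ch
  chain-cut (v ∷ vs) (there p) u (e , ch) = chain-cut vs p (unique-tail u) ch

  open import Data.List.Membership.DecPropositional (_≟ᶠ_ {n G}) using (_∈?_)

  simple : ∀ {a b} → Walk G a b → ∃ λ vs → Unique (a ∷ vs) × Chain a vs b
  simple here = [] , [] ∷ [] , refl
  simple {a} (step {b = b} e w) with simple w
  ... | vs , u , ch with a ∈? (b ∷ vs)
  ... | yes p = chain-cut vs p u ch
  ... | no q = b ∷ vs , All.tabulate (λ { r refl → q r }) ∷ u , e , ch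

  chain-reach : ∀ {a b} vs → Chain a vs b → T (reachIter G (length vs) a b)
  chain-reach [] e = =ᶠ⁺ e
  chain-reach (v ∷ vs) (e , ch) = reach-left (length vs) e (chain-reach vs ch)

  -- A walk can be shortened until no vertex repeats. The number of its steps is then within the
  -- iteration bound of `reachᵇ`, and `reach-mono` makes up the difference.
  reach-complete : ∀ {a b} → Walk G a b → T (reachᵇ G a b)
  reach-complete {a} {b} w with simple w
  ... | vs , u , ch = subst (λ k → T (reachIter G k a b)) (ℕₚ.m∸n+n≡m len)
          (reach-mono (n G ∸ length vs) (length vs) (chain-reach vs ch))
    where
    len : length vs ≤ n G
    len = ≤-trans (n≤1+n _) (≤-trans (unique-⊆⇒length≤ {ys = everyFin (n G)} u (λ _ → ∈-select⁺ _ tt))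
      (≤-reflexive (length-everyFin (n G))))

  isRoot : Fin (n G) → Bool
  isRoot a = allFin (λ b → not (reachᵇ G a b) ∨ (toℕ a ≤ᵇ toℕ b))

  roots : List (Fin (n G))
  roots = select isRoot

  length-roots : length roots ≡ components G
  length-roots = length-select isRoot

  root-of : ∀ v → ∃ λ r → (r ∈ roots) × Walk G v r
  root-of v = go (toℕ v) v ≤-refl
    where
    go : ∀ N v → toℕ v ≤ N → ∃ λ r → (r ∈ roots) × Walk G v r
    go N v le with T? (isRoot v)
    ... | yes t = v , ∈-select⁺ isRoot t , here
    ... | no h with ¬allFin⇒∃ h
    ... | b , q with T? (reachᵇ G v b)
    ... | no nr = ⊥-elim (q (∨⁺ˡ (not⁺ nr)))
    ... | yes rb = next N le
      where
      b<v : toℕ b < toℕ v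
      b<v = ℕₚ.≰⇒> λ l → q (∨⁺ʳ {not (reachᵇ G v b)} (ℕₚ.≤⇒≤ᵇ l))
      next : ∀ N → toℕ v ≤ N → ∃ λ r → (r ∈ roots) × Walk G v r
      next zero le = ⊥-elim (ℕₚ.n≮0 (≤-trans b<v le))
      next (suc N) le = let (r , r∈ , w) = go N b (ℕₚ.≤-pred (≤-trans b<v le)) in
        r , r∈ , walk-++ (reach-sound (n G) rb) w

  root-≤ : ∀ {r s} → r ∈ roots → Walk G r s → toℕ r ≤ toℕ s
  root-≤ {r} {s} p w with ∨⁻ {not (reachᵇ G r s)} (allFin⁻ (∈-select⁻ isRoot p) s)
  ... | inj₁ h = ⊥-elim (not⁻ h (reach-complete w))
  ... | inj₂ l = ℕₚ.≤ᵇ⇒≤ _ _ l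

  root-unique : ∀ {r s} → r ∈ roots → s ∈ roots → Walk G r s → r ≡ s
  root-unique p q w = Finₚ.toℕ-injective (ℕₚ.≤-antisym (root-≤ p w) (root-≤ q (walk-sym w)))

  -- A vertex is coloured by the position of its root. Together with `components-≥` this makes
  -- `components G` the largest number of colours constant along edges, so components are compared
  -- by colourings, just as faces are.
  component-colouring : Σ (Fin (n G) → Fin (components G)) λ κ →
    (∀ {a b} → T (Edge G a b) → κ a ≡ κ b) × (∀ i → ∃ λ a → κ a ≡ i)
  component-colouring = subst (λ k → Σ (Fin (n G) → Fin k) λ κ →
      (∀ {a b} → T (Edge G a b) → κ a ≡ κ b) × (∀ i → ∃ λ a → κ a ≡ i)) length-roots
    (κ , inv , sur)
    where
    κ : Fin (n G) → Fin (length roots)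
    κ a = Any.index (proj₁ (proj₂ (root-of a)))
    κ-root : ∀ a → proj₁ (root-of a) ≡ lookup roots (κ a)
    κ-root a = lookup-index (proj₁ (proj₂ (root-of a)))
    inv : ∀ {a b} → T (Edge G a b) → κ a ≡ κ b
    inv {a} {b} e = unique-lookup (unique-select isRoot) _ _ (trans (sym (κ-root a))
      (trans (root-unique (proj₁ (proj₂ (root-of a))) (proj₁ (proj₂ (root-of b)))
        (walk-++ (walk-sym (proj₂ (proj₂ (root-of a)))) (step e (proj₂ (proj₂ (root-of b)))))) (κ-root b)))
    sur : ∀ i → ∃ λ a → κ a ≡ i
    sur i = lookup roots i , unique-lookup (unique-select isRoot) _ _
      (trans (sym (κ-root _)) (sym (root-unique (Memₚ.∈-lookup i) (proj₁ (proj₂ (root-of (lookup roots i))))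
        (proj₂ (proj₂ (root-of (lookup roots i)))))))

  components-≥ : ∀ {k} (κ : Fin (n G) → Fin k) → (∀ {a b} → T (Edge G a b) → κ a ≡ κ b) →
    (∀ i → ∃ λ a → κ a ≡ i) → k ≤ components G
  components-≥ κ inv sur = ≤-trans (covered⇒≤ (map κ roots) cov)
    (≤-reflexive (trans (length-map κ roots) length-roots))
    where
    cov : ∀ i → i ∈ map κ roots
    cov i with sur i
    ... | a , refl = let (r , r∈ , w) = root-of a in
      subst (_∈ map κ roots) (sym (walk-invariant κ inv w)) (∈-map⁺ κ r∈)

  pairsWhere : (Fin (n G) → Fin (n G) → Bool) → List (Dart G)
  pairsWhere p = collect λ a → collect λ b → guard (p a b) (a , b)

  ∈-pairsWhere⁺ : ∀ p {a b} → T (p a b) → (a , b) ∈ pairsWhere p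
  ∈-pairsWhere⁺ p {a} {b} t = ∈-collect⁺ _ a (∈-collect⁺ _ b (∈-guard⁺ t))

  ∈-pairsWhere⁻ : ∀ p {a b} → (a , b) ∈ pairsWhere p → T (p a b)
  ∈-pairsWhere⁻ p q with ∈-collect⁻ (λ a → collect λ b → guard (p a b) (a , b)) q
  ... | a' , q' with ∈-collect⁻ (λ b → guard (p a' b) (a' , b)) q'
  ... | b' , q'' with ∈-guard⁻ {b = p a' b'} q''
  ... | t , refl = t

  unique-pairsWhere : ∀ p → Unique (pairsWhere p)
  unique-pairsWhere p = unique-collect _
    (λ a → unique-collect _ (λ b → unique-guard (p a b) (a , b))
      λ i j r s → cong proj₂ (trans (sym (proj₂ (∈-guard⁻ {b = p a i} r))) (proj₂ (∈-guard⁻ {b = p a j} s))))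
    λ i j r s → trans (sym (tail i r)) (tail j s)
    where
    tail : ∀ a {z} → z ∈ collect (λ b → guard (p a b) (a , b)) → proj₁ z ≡ a
    tail a r with ∈-collect⁻ (λ b → guard (p a b) (a , b)) r
    ... | b , s with ∈-guard⁻ {b = p a b} s
    ... | _ , refl = refl

  length-pairsWhere : ∀ p → length (pairsWhere p) ≡ sumFin (λ a → countFin (p a))
  length-pairsWhere p = trans (length-collect λ a → collect λ b → guard (p a b) (a , b)) (sumFin-cong λ a → trans (length-collect λ b → guard (p a b) (a , b))
    (sumFin-cong λ b → length-guard (p a b) (a , b)))

  darts : List (Dart G)
  darts = pairsWhere (Edge G)

  length-darts : length darts ≡ edgeCount G + edgeCount G
  length-darts = trans (↭-length (unique-set⇒↭ (unique-pairsWhere (Edge G)) uq to from))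
    (trans (length-++ up) (cong₂ _+_ (length-pairsWhere _) (trans (length-map rev up) (length-pairsWhere _))))
    where
    below : Fin (n G) → Fin (n G) → Bool
    below a b = (toℕ a <ᵇ toℕ b) ∧ Edge G a b
    up : List (Dart G)
    up = pairsWhere below
    rev : Dart G → Dart G
    rev (a , b) = b , a
    below-< : ∀ {a b} → (a , b) ∈ up → toℕ a < toℕ b
    below-< {a} {b} q = ℕₚ.<ᵇ⇒< _ _ (∧⁻ˡ (∈-pairsWhere⁻ below q))
    uq : Unique (up ++ map rev up)
    uq = Uniqₚ.++⁺ (unique-pairsWhere below)
      (Uniqₚ.map⁺ (λ { {a , b} {.a , .b} refl → refl }) (unique-pairsWhere below))
      λ { {a , b} (p , q) → disj p q }
      where
      disj : ∀ {a b} → (a , b) ∈ up → (a , b) ∈ map rev up → ⊥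
      disj p q with ∈-map⁻ rev q
      ... | (_ , _) , q' , refl = ℕₚ.<-asym (below-< p) (below-< q')
    to : ∀ {z} → z ∈ darts → z ∈ up ++ map rev up
    to {a , b} p with ∈-pairsWhere⁻ (Edge G) p
    ... | e with ℕₚ.<-cmp (toℕ a) (toℕ b)
    ... | tri< l _ _ = ∈-++⁺ˡ (∈-pairsWhere⁺ below (∧⁺ (ℕₚ.<⇒<ᵇ l) e))
    ... | tri≈ _ l _ = ⊥-elim (edge-≢ e (Finₚ.toℕ-injective l))
    ... | tri> _ _ l =
          ∈-++⁺ʳ up (∈-map⁺ rev (∈-pairsWhere⁺ below (∧⁺ (ℕₚ.<⇒<ᵇ l) (edge-sym e))))
    from : ∀ {z} → z ∈ up ++ map rev up → z ∈ darts
    from {a , b} p with ∈-++⁻ up p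
    ... | inj₁ q = ∈-pairsWhere⁺ (Edge G) (∧⁻ʳ {toℕ a <ᵇ toℕ b} (∈-pairsWhere⁻ below q))
    ... | inj₂ q with ∈-map⁻ rev q
    ... | (_ , _) , q' , refl = ∈-pairsWhere⁺ (Edge G) (edge-sym (∧⁻ʳ {toℕ b <ᵇ toℕ a} (∈-pairsWhere⁻ below q')))

-- Faces of an embedding scheme

module Cyclic {A : Set} (_≟_ : DecidableEquality A) where

  open import Data.List using (reverse)
  open import Data.List.Properties using (reverse-++; reverse-involutive; unfold-reverse)
  open import Data.List.Relation.Binary.Permutation.Propositional.Properties using (↭-reverse)
  open import Data.List.Membership.DecPropositional _≟_ using (_∈?_)

  first : A → List A → A
  first a [] = a
  first a (x ∷ _) = x

  split-unique : ∀ {d : A} (B : List A) {C : List A} B' {C'} → Unique (B ++ d ∷ C) → B ++ d ∷ C ≡ B' ++ d ∷ C' → (B ≡ B') × (C ≡ C')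
  split-unique [] [] u refl = refl , refl
  split-unique [] (b ∷ B') u refl = ⊥-elim (unique-head u (∈-++⁺ʳ B' (here refl)))
  split-unique (b ∷ B) [] u refl = ⊥-elim (unique-head u (∈-++⁺ʳ B (here refl)))
  split-unique (b ∷ B) (b' ∷ B') (_ ∷ u) e with split-unique B B' u (cong tail e)
    where
    tail : List A → List A
    tail [] = []
    tail (_ ∷ xs) = xs
  split-unique (b ∷ B) (b ∷ B) (_ ∷ u) refl | refl , refl = refl , refl

  abstract
    -- Later arguments use only `next-split`. Which occurrence the membership test finds does not
    -- matter, since a duplicate-free list splits at `d` in just one way.
    next : List A → A → A
    next xs d with d ∈? xs
    ... | no _ = d
    ... | yes p with ∈-∃++ p
    ... | B , C , _ = first d (C ++ B)

    next-split : ∀ (B : List A) (d : A) (C : List A) → Unique (B ++ d ∷ C) → next (B ++ d ∷ C) d ≡ first d (C ++ B)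
    next-split B d C u with d ∈? (B ++ d ∷ C)
    ... | no h = ⊥-elim (h (∈-++⁺ʳ B (here refl)))
    ... | yes p with ∈-∃++ p
    ... | B' , C' , e = let (e₁ , e₂) = split-unique B B' u e in
          cong₂ (λ y z → first d (z ++ y)) (sym e₁) (sym e₂)

  first-∈ : ∀ d (xs : List A) {ys : List A} → d ∈ ys → (∀ {z} → z ∈ xs → z ∈ ys) → first d xs ∈ ys
  first-∈ d [] p _ = p
  first-∈ d (x ∷ xs) _ s = s (here refl)

  next-∈ : ∀ {xs : List A} {d : A} → Unique xs → d ∈ xs → next xs d ∈ xs
  next-∈ {xs} {d} u p with ∈-∃++ p
  ... | B , C , refl = subst (_∈ B ++ d ∷ C) (sym (next-split B d C u)) (first-∈ d (C ++ B) p sub)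
    where
    sub : ∀ {z} → z ∈ C ++ B → z ∈ B ++ d ∷ C
    sub q = [ (λ r → ∈-++⁺ʳ B (there r)) , ∈-++⁺ˡ ]′ (∈-++⁻ C q)

  prev : List A → A → A
  prev xs = next (reverse xs)

  unique-reverse : ∀ {xs : List A} → Unique xs → Unique (reverse xs)
  unique-reverse {xs} u = unique-↭ (↭-sym (↭-reverse xs)) u

  reverse-split : ∀ (B : List A) (d : A) (C : List A) → reverse (B ++ d ∷ C) ≡ reverse C ++ d ∷ reverse B
  reverse-split B d C = trans (reverse-++ B (d ∷ C)) (trans (cong (_++ reverse B) (unfold-reverse d C))
    (++-assoc (reverse C) (d ∷ []) (reverse B)))

  prev-split : ∀ (B : List A) (d : A) (C : List A) → Unique (B ++ d ∷ C) → prev (B ++ d ∷ C) d ≡ first d (reverse B ++ reverse C)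
  prev-split B d C u = go (reverse (B ++ d ∷ C)) (reverse-split B d C) (unique-reverse u)
    where
    go : ∀ zs → zs ≡ reverse C ++ d ∷ reverse B → Unique zs → next zs d ≡ first d (reverse B ++ reverse C)
    go _ refl v = next-split (reverse C) d (reverse B) v

  first-snoc : ∀ (a : A) (B : List A) (e : A) (C : List A) → first a (reverse (B ++ e ∷ []) ++ C) ≡ e
  first-snoc a B e C rewrite reverse-++ B (e ∷ []) = refl

  -- Three cases: `d` has an entry behind it, `d` is alone, or `d` is last and its successor wraps
  -- round to the head.
  prev-next : ∀ {xs : List A} {d : A} → Unique xs → d ∈ xs → prev xs (next xs d) ≡ d
  prev-next {xs} {d} u p with ∈-∃++ p
  ... | B , e ∷ C , refl = trans (cong (prev (B ++ d ∷ e ∷ C)) (next-split B d (e ∷ C) u))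
        (trans (cong (λ z → prev z e) (sym (++-assoc B (d ∷ []) (e ∷ C))))
          (trans (prev-split (B ++ d ∷ []) e C (subst Unique (sym (++-assoc B (d ∷ []) (e ∷ C))) u))
            (first-snoc e B d (reverse C))))
  ... | [] , [] , refl = trans (cong (prev (d ∷ [])) (next-split [] d [] u)) (prev-split [] d [] u)
  ... | e ∷ B , [] , refl = trans (cong (prev (e ∷ B ++ d ∷ [])) (next-split (e ∷ B) d [] u))
        (trans (prev-split [] e (B ++ d ∷ []) u)
          (trans (cong (first e) (sym (++-identityʳ (reverse (B ++ d ∷ []))))) (first-snoc e B d [])))

  next-prev : ∀ {xs : List A} {d : A} → Unique xs → d ∈ xs → next xs (prev xs d) ≡ d
  next-prev {xs} {d} u p = subst (λ z → next z (prev xs d) ≡ d) (reverse-involutive xs)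
    (prev-next (unique-reverse u) (∈-resp-↭ (↭-sym (↭-reverse xs)) p))

iter-+ : ∀ {A : Set} (f : A → A) j k a → iter (j + k) f a ≡ iter j f (iter k f a)
iter-+ f zero k a = refl
iter-+ f (suc j) k a = cong f (iter-+ f j k a)

iter-suc : ∀ {A : Set} (f : A → A) k a → iter (suc k) f a ≡ iter k f (f a)
iter-suc f zero a = refl
iter-suc f (suc k) a = cong f (iter-suc f k a)

iter-multiple : ∀ {A : Set} (f : A → A) m {a} → iter m f a ≡ a → ∀ q → iter (q * m) f a ≡ a
iter-multiple f m e zero = refl
iter-multiple f m {a} e (suc q) = trans (iter-+ f m (q * m) a) (trans (cong (iter m f) (iter-multiple f m e q)) e)

module CyclicReach {A : Set} (_≟_ : DecidableEquality A) where

  open Cyclic _≟_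

  Reaches : List A → A → A → Set
  Reaches xs d e = ∃ λ k → iter k (next xs) d ≡ e

  reaches-trans : ∀ {xs a b c} → Reaches xs a b → Reaches xs b c → Reaches xs a c
  reaches-trans {xs} {a} (j , refl) (k , refl) = k + j , iter-+ (next xs) k j a

  reaches-later : ∀ (B : List A) (d : A) (C : List A) {e : A} → Unique (B ++ d ∷ C) → e ∈ d ∷ C → Reaches (B ++ d ∷ C) d e
  reaches-later B d C u (here refl) = 0 , refl
  reaches-later B d (c ∷ C) u (there p) = reaches-trans {B ++ d ∷ c ∷ C} {d} {c} (1 , next-split B d (c ∷ C) u)
    (subst (λ z → Reaches z c _) (++-assoc B (d ∷ []) (c ∷ C))
      (reaches-later (B ++ d ∷ []) c C (subst Unique (sym (++-assoc B (d ∷ []) (c ∷ C))) u) p))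

  reaches-head : ∀ (h : A) (T : List A) (d : A) → Unique (h ∷ T) → d ∈ h ∷ T → Reaches (h ∷ T) d h
  reaches-head h T d u p with ∈-∃++ p
  ... | B , C , e = go B d C e (subst Unique e u)
    where
    go : ∀ (B : List A) (d : A) (C : List A) → h ∷ T ≡ B ++ d ∷ C → Unique (B ++ d ∷ C) → Reaches (h ∷ T) d h
    go [] d C refl u = 0 , refl
    go (b ∷ B) d [] refl u = 1 , next-split (b ∷ B) d [] u
    go (b ∷ B) d (c ∷ C) refl u = reaches-trans {b ∷ B ++ d ∷ c ∷ C} {d} {c} (1 , next-split (b ∷ B) d (c ∷ C) u)
      (go (b ∷ B ++ d ∷ []) c C (cong (b ∷_) (sym (++-assoc B (d ∷ []) (c ∷ C))))
        (subst Unique (cong (b ∷_) (sym (++-assoc B (d ∷ []) (c ∷ C)))) u))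

  reaches : ∀ {xs : List A} {d e : A} → Unique xs → d ∈ xs → e ∈ xs → Reaches xs d e
  reaches {h ∷ T} {d} u p q = reaches-trans {h ∷ T} {d} {h} (reaches-head h T d u p) (reaches-later [] h T u q)

-- Flags and the orbits of face tracing

Flag : TGraph → Set
Flag G = Dart G × Bool

_≟ᵈ_ : ∀ {G} → DecidableEquality (Dart G)
_≟ᵈ_ = ≡-dec _≟ᶠ_ _≟ᶠ_

_≟ᶠˡ_ : ∀ {G} → DecidableEquality (Flag G)
_≟ᶠˡ_ {G} = ≡-dec (_≟ᵈ_ {G}) _≟ᵇ_

flip : ∀ {G} → Flag G → Flag G
flip (d , s) = d , not s

flip-flip : ∀ {G} (f : Flag G) → flip {G} (flip {G} f) ≡ f
flip-flip (d , s) = cong (d ,_) (not-involutive s)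

-- The state ((a , b) , s) of the face tracing stands for the side of the dart ab
-- facing its predecessor (s = true) or its successor in the rotation at a;
-- opposite follows that side of the edge to its other end.
opposite : ∀ {G} → (Fin (n G) → Fin (n G) → Bool) → Flag G → Flag G
opposite sig ((a , b) , s) = (b , a) , not (s xor sig a b)

opposite-involutive : ∀ {G} (sig : Fin (n G) → Fin (n G) → Bool) a b s → sig a b ≡ sig b a →
  opposite {G} sig (opposite {G} sig ((a , b) , s)) ≡ ((a , b) , s)
opposite-involutive sig a b s e = cong ((a , b) ,_) (lem s (sig a b) (sig b a) e)
  where
  lem : ∀ s p q → p ≡ q → not (not (s xor p) xor q) ≡ s
  lem true true true refl = refl
  lem true false false refl = refl
  lem false true true refl = refl
  lem false false false refl = refl

module FaceClasses {G : TGraph} (S : Scheme G) where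

  open Scheme S

  record DF (f : Flag G) : Set where
    constructor dart
    field isDart : IsDart G (proj₁ f)

  θ φ F : Flag G → Flag G
  θ = opposite {G} sig
  φ (d , true) = σ d , false
  φ (d , false) = ρ d , true
  F = faceStep S

  -- A face step runs along one side of the edge (`θ`) and then turns the corner to the neighbouring
  -- dart (`φ`). On flags of darts both are involutions without fixed points, and all properties of
  -- the orbits of `F` come from this factorisation.
  F≡φθ : ∀ f → F f ≡ φ (θ f)
  F≡φθ ((a , b) , s) with s xor sig a b
  ... | true = refl
  ... | false = refl

  θ-DF : ∀ {f} → DF f → DF (θ f)
  θ-DF {(a , b) , s} (dart e) = dart (edge-sym G e)

  φ-DF : ∀ {f} → DF f → DF (φ f)
  φ-DF {d , true} (dart e) = dart (σ-dart d e)
  φ-DF {d , false} (dart e) = dart (ρ-dart d e)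

  F-DF : ∀ {f} → DF f → DF (F f)
  F-DF {f} e = subst DF (sym (F≡φθ f)) (φ-DF (θ-DF {f} e))

  θθ : ∀ {f} → DF f → θ (θ f) ≡ f
  θθ {(a , b) , s} (dart e) = opposite-involutive {G} sig a b s (sig-sym a b e)

  φφ : ∀ {f} → DF f → φ (φ f) ≡ f
  φφ {d , true} (dart e) = cong (_, true) (ρσ d e)
  φφ {d , false} (dart e) = cong (_, false) (σρ d e)

  θ≢ : ∀ {f} → DF f → θ f ≢ f
  θ≢ {(a , b) , s} (dart e) q = edge-≢ G e (sym (cong (proj₁ ∘ proj₁) q))

  φ≢ : ∀ f → φ f ≢ f
  φ≢ (d , true) q with cong proj₂ q
  ... | ()
  φ≢ (d , false) q with cong proj₂ q
  ... | ()

  -- Since `F` is a product of two involutions of which `θ` is one, `θ` conjugates `F` to its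
  -- inverse. Thus `θ` exchanges the two traversals of a face.
  FθF : ∀ {f} → DF f → F (θ (F f)) ≡ θ f
  FθF {f} e = trans (F≡φθ (θ (F f))) (trans (cong φ (θθ (F-DF {f} e)))
    (trans (cong φ (F≡φθ f)) (φφ (θ-DF {f} e))))

  iter-DF : ∀ k {f} → DF f → DF (iter k F f)
  iter-DF zero e = e
  iter-DF (suc k) {f} e = F-DF {iter k F f} (iter-DF k e)

  F-injective : ∀ {f g} → DF f → DF g → F f ≡ F g → f ≡ g
  F-injective {f} {g} df dg e = trans (sym (θθ df)) (trans (cong θ
    (trans (sym (FθF df)) (trans (cong (F ∘ θ) e) (FθF dg)))) (θθ dg))

  iter-injective : ∀ k {f g} → DF f → DF g → iter k F f ≡ iter k F g → f ≡ g
  iter-injective zero df dg e = e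
  iter-injective (suc k) df dg e = iter-injective k df dg (F-injective (iter-DF k df) (iter-DF k dg) e)

  -- F is a product of two fixed-point-free involutions, so the two traversals of a
  -- face never lie in the same orbit.
  orbit≢opposite : ∀ k {f} → DF f → iter k F f ≢ θ f
  orbit≢opposite zero {f} df e = θ≢ {f} df (sym e)
  orbit≢opposite (suc zero) {f} df e = φ≢ (θ f) (trans (sym (F≡φθ f)) e)
  orbit≢opposite (suc (suc k)) {f} df e = orbit≢opposite k {F f} (F-DF {f} df)
    (F-injective (iter-DF k (F-DF {f} df)) (θ-DF {F f} (F-DF {f} df))
      (trans (sym (cong F (iter-suc F k f))) (trans e (sym (FθF {f} df)))))

  bit : Bool → Fin 2
  bit true = suc zero
  bit false = zero

  keyFin : Flag G → Fin (n G * n G * 2)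
  keyFin ((a , b) , s) = combine (combine a b) (bit s)

  keyFin-injective : ∀ {f g} → keyFin f ≡ keyFin g → f ≡ g
  keyFin-injective {(a , b) , s} {(a' , b') , s'} e with Finₚ.combine-injective (combine a b) (bit s) (combine a' b') (bit s') e
  ... | e₁ , e₂ with Finₚ.combine-injective a b a' b' e₁ | bit-injective s s' e₂
    where
    bit-injective : ∀ s s' → bit s ≡ bit s' → s ≡ s'
    bit-injective true true _ = refl
    bit-injective false false _ = refl
  ... | refl , refl | refl = refl

  key≡ : ∀ f → key S f ≡ toℕ (keyFin f)
  key≡ ((a , b) , s) = sym (trans (Finₚ.toℕ-combine (combine a b) (bit s))
    (cong₂ _+_ (trans (ℕₚ.*-comm 2 (toℕ (combine a b))) (cong (_* 2) (trans (Finₚ.toℕ-combine a b) (cong (_+ toℕ b) (ℕₚ.*-comm (n G) (toℕ a))))))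
      (toℕ-bit s)))
    where
    toℕ-bit : ∀ s → toℕ (bit s) ≡ (if s then 1 else 0)
    toℕ-bit true = refl
    toℕ-bit false = refl

  key-injective : ∀ {f g} → key S f ≡ key S g → f ≡ g
  key-injective {f} {g} e = keyFin-injective (Finₚ.toℕ-injective (trans (sym (key≡ f)) (trans e (key≡ g))))

  N : ℕ
  N = 4 * n G * n G

  2nn≤N : n G * n G * 2 ≤ N
  2nn≤N = ≤-trans (≤-reflexive (ℕₚ.*-comm (n G * n G) 2))
    (≤-trans (ℕₚ.*-monoˡ-≤ (n G * n G) (s≤s (s≤s (z≤n {2})))) (≤-reflexive (sym (ℕₚ.*-assoc 4 (n G) (n G)))))

  -- There are `2 n²` keys, so an orbit closes up within that many steps. The scan length `4 n²` of
  -- `isRep` therefore covers whole orbits.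
  period : ∀ {f} → DF f → ∃ λ m → (suc m ≤ N) × (iter (suc m) F f ≡ f)
  period {f} df with Finₚ.pigeonhole (ℕₚ.n<1+n (n G * n G * 2)) (λ i → keyFin (iter (toℕ i) F f))
  ... | i , j , i<j , e = toℕ j ∸ suc (toℕ i) , ≤-trans (≤-trans (≤-reflexive eq)
        (≤-trans (ℕₚ.m∸n≤m (toℕ j) (toℕ i)) (ℕₚ.≤-pred (Finₚ.toℕ<n j)))) 2nn≤N ,
        trans (cong (λ z → iter z F f) eq)
          (sym (iter-injective (toℕ i) df (iter-DF (toℕ j ∸ toℕ i) df)
            (trans (keyFin-injective e) (trans (cong (λ z → iter z F f) (sym (ℕₚ.m+[n∸m]≡n (ℕₚ.<⇒≤ i<j))))
              (iter-+ F (toℕ i) (toℕ j ∸ toℕ i) f)))))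
    where
    eq : suc (toℕ j ∸ suc (toℕ i)) ≡ toℕ j ∸ toℕ i
    eq = sym (ℕₚ.+-∸-assoc 1 i<j)

  _⇝_ : Flag G → Flag G → Set
  f ⇝ g = ∃ λ k → iter k F f ≡ g

  ⇝-trans : ∀ {f g h} → f ⇝ g → g ⇝ h → f ⇝ h
  ⇝-trans {f} (j , refl) (k , refl) = k + j , iter-+ F k j f

  ⇝-sym : ∀ {f g} → DF f → f ⇝ g → g ⇝ f
  ⇝-sym {f} df (k , refl) with period df
  ... | m , _ , e = k * m , trans (sym (iter-+ F (k * m) k f))
        (trans (cong (λ z → iter z F f) (trans (ℕₚ.+-comm (k * m) k) (sym (ℕₚ.*-suc k m))))
          (iter-multiple F (suc m) e k))

  ⇝-DF : ∀ {f g} → DF f → f ⇝ g → DF g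
  ⇝-DF df (k , refl) = iter-DF k df

  ⇝-bounded : ∀ {f g} → DF f → f ⇝ g → ∃ λ k → (k < N) × (iter k F f ≡ g)
  ⇝-bounded {f} df (k , refl) with period df
  ... | m , le , e = k % suc m , ≤-trans (m%n<n k (suc m)) le , sym (begin
      iter k F f                                        ≡⟨ cong (λ z → iter z F f) (m≡m%n+[m/n]*n k (suc m)) ⟩
      iter (k % suc m + (k / suc m) * suc m) F f        ≡⟨ iter-+ F (k % suc m) _ f ⟩
      iter (k % suc m) F (iter ((k / suc m) * suc m) F f) ≡⟨ cong (iter (k % suc m) F) (iter-multiple F (suc m) e (k / suc m)) ⟩
      iter (k % suc m) F f                              ∎)
    where open ≡-Reasoning

  allBelow⁻ : ∀ {M p} → T (allBelow M p) → ∀ {k} → k < M → T (p k)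
  allBelow⁻ {suc M} {p} t {k} (s≤s le) with ℕₚ.m≤n⇒m<n∨m≡n le
  ... | inj₁ lt = allBelow⁻ {M} {p} (∧⁻ˡ t) lt
  ... | inj₂ refl = ∧⁻ʳ {allBelow M p} t

  ¬allBelow⇒∃ : ∀ {M p} → ¬ T (allBelow M p) → ∃ λ k → ¬ T (p k)
  ¬allBelow⇒∃ {zero} h = ⊥-elim (h tt)
  ¬allBelow⇒∃ {suc M} {p} h with T? (p M)
  ... | no q = M , q
  ... | yes q = ¬allBelow⇒∃ {M} {p} (λ t → h (∧⁺ t q))

  Rep : Flag G → Set
  Rep f = T (isRep S f)

  rep? : ∀ f → Rep f ⊎ ∃ λ k → key S (iter k F f) < key S f
  rep? f = decide (T? (isRep S f))
    where
    decide : Dec (Rep f) → Rep f ⊎ ∃ λ k → key S (iter k F f) < key S f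
    decide (yes t) = inj₁ t
    decide (no h) = let (k , q) = ¬allBelow⇒∃ {N} {λ k → key S f ≤ᵇ key S (iter k F f)} h in
      inj₂ (k , ℕₚ.≰⇒> λ l → q (ℕₚ.≤⇒≤ᵇ l))

  representative-below : ∀ M f → key S f < M → ∃ λ r → (f ⇝ r) × Rep r
  representative-below (suc M) f (s≤s le) = decide (rep? f)
    where
    decide : Rep f ⊎ (∃ λ k → key S (iter k F f) < key S f) → ∃ λ r → (f ⇝ r) × Rep r
    decide (inj₁ t) = f , (0 , refl) , t
    decide (inj₂ (k , lt)) = let (r , p , t) = representative-below M (iter k F f) (≤-trans lt le) in
      r , ⇝-trans (k , refl) p , t

  abstract
    representative : ∀ f → ∃ λ r → (f ⇝ r) × Rep r
    representative f = representative-below (suc (key S f)) f ≤-refl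

  rep-≤ : ∀ {f g} → DF f → Rep f → f ⇝ g → key S f ≤ key S g
  rep-≤ df t p with ⇝-bounded df p
  ... | k , k<N , refl = ℕₚ.≤ᵇ⇒≤ _ _ (allBelow⁻ {N} t k<N)

  rep-unique : ∀ {f r s} → DF f → f ⇝ r → f ⇝ s → Rep r → Rep s → r ≡ s
  rep-unique {f} {r} {s} df p q tr ts = key-injective (ℕₚ.≤-antisym (rep-≤ (⇝-DF df p) tr r⇝s)
      (rep-≤ (⇝-DF df q) ts (⇝-sym (⇝-DF df p) r⇝s)))
    where
    r⇝s : r ⇝ s
    r⇝s = ⇝-trans (⇝-sym df p) q

  rep : Flag G → Flag G
  rep f = proj₁ (representative f)

  rep-⇝ : ∀ {f g} → DF f → f ⇝ g → rep f ≡ rep g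
  rep-⇝ {f} {g} df p = rep-unique df (proj₁ (proj₂ (representative f)))
    (⇝-trans p (proj₁ (proj₂ (representative g)))) (proj₂ (proj₂ (representative f))) (proj₂ (proj₂ (representative g)))

  θ-⇝ : ∀ {f g} → DF f → f ⇝ g → θ g ⇝ θ f
  θ-⇝ {f} df (k , refl) = k , back k
    where
    back : ∀ k → iter k F (θ (iter k F f)) ≡ θ f
    back zero = refl
    back (suc k) = trans (iter-suc F k _) (trans (cong (iter k F) (FθF (iter-DF k df))) (back k))

  cell : Fin (n G) → Fin (n G) → List (Flag G)
  cell a b = if Edge G a b
    then guard (isRep S ((a , b) , true)) ((a , b) , true) ++ guard (isRep S ((a , b) , false)) ((a , b) , false)
    else []

  reps : List (Flag G)
  reps = collect λ a → collect (cell a)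

  length-reps : length reps ≡ faceOrbits S
  length-reps = trans (length-collect (λ a → collect (cell a)))
      (sumFin-cong λ a → trans (length-collect (cell a)) (sumFin-cong λ b → one a b))
    where
    one : ∀ a b → length (cell a b) ≡ (if Edge G a b
      then (if isRep S ((a , b) , true) then 1 else 0) + (if isRep S ((a , b) , false) then 1 else 0)
      else 0)
    one a b with Edge G a b
    ... | false = refl
    ... | true = trans (length-++ (guard (isRep S ((a , b) , true)) _))
          (cong₂ _+_ (length-guard (isRep S ((a , b) , true)) _) (length-guard (isRep S ((a , b) , false)) _))

  private
    ∈-cell⁺ : ∀ {a b s} → T (Edge G a b) → Rep ((a , b) , s) → ((a , b) , s) ∈ cell a b
    ∈-cell⁺ {a} {b} {s} e t with Edge G a b
    ∈-cell⁺ {a} {b} {true} e t | true = ∈-++⁺ˡ (∈-guard⁺ t)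
    ∈-cell⁺ {a} {b} {false} e t | true = ∈-++⁺ʳ (guard (isRep S ((a , b) , true)) _) (∈-guard⁺ t)

    ∈-cell⁻ : ∀ {a b f} → f ∈ cell a b → (proj₁ f ≡ (a , b)) × DF f × Rep f
    ∈-cell⁻ {a} {b} {f} p with Edge G a b in eq
    ... | true with ∈-++⁻ (guard (isRep S ((a , b) , true)) _) p
    ...   | inj₁ q with ∈-guard⁻ {b = isRep S ((a , b) , true)} q
    ...     | t , refl = refl , dart (≡⇒T eq) , t
    ∈-cell⁻ {a} {b} {f} p | true | inj₂ q with ∈-guard⁻ {b = isRep S ((a , b) , false)} q
    ...     | t , refl = refl , dart (≡⇒T eq) , t

    unique-cell : ∀ a b → Unique (cell a b)
    unique-cell a b with Edge G a b
    ... | false = []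
    ... | true = Uniqₚ.++⁺ (unique-guard (isRep S ((a , b) , true)) _) (unique-guard (isRep S ((a , b) , false)) _)
        λ { (p , q) → differ (trans (sym (proj₂ (∈-guard⁻ {b = isRep S ((a , b) , true)} p)))
                              (proj₂ (∈-guard⁻ {b = isRep S ((a , b) , false)} q))) }
      where
      differ : ((a , b) , true) ≡ ((a , b) , false) → ⊥
      differ ()

  ∈-reps⁺ : ∀ {f} → DF f → Rep f → f ∈ reps
  ∈-reps⁺ {(a , b) , s} (dart e) t = ∈-collect⁺ _ a (∈-collect⁺ _ b (∈-cell⁺ e t))

  ∈-reps⁻ : ∀ {f} → f ∈ reps → DF f × Rep f
  ∈-reps⁻ p with ∈-collect⁻ (λ a → collect (cell a)) p
  ... | a , q with ∈-collect⁻ (cell a) q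
  ... | b , r = proj₂ (∈-cell⁻ {a} {b} r)

  unique-reps : Unique reps
  unique-reps = unique-collect _ (λ a → unique-collect _ (unique-cell a)
      λ b b' p q → cong proj₂ (trans (sym (proj₁ (∈-cell⁻ {a} {b} p))) (proj₁ (∈-cell⁻ {a} {b'} q))))
    λ a a' p q → trans (sym (tail a p)) (tail a' q)
    where
    tail : ∀ a {f} → f ∈ collect (cell a) → proj₁ (proj₁ f) ≡ a
    tail a p with ∈-collect⁻ (cell a) p
    ... | b , q = cong proj₁ (proj₁ (∈-cell⁻ {a} {b} q))

  rep∈reps : ∀ {f} → DF f → rep f ∈ reps
  rep∈reps {f} df = ∈-reps⁺ (⇝-DF df (proj₁ (proj₂ (representative f)))) (proj₂ (proj₂ (representative f)))

  -- The action of `θ` on orbits, expressed on representatives. By `orbit≢opposite` it fixes no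
  -- representative, so its pairs are the faces that contain a dart.
  τ : Flag G → Flag G
  τ f = rep (θ f)

  τ-rep : ∀ {f} → DF f → τ (rep f) ≡ rep (θ f)
  τ-rep {f} df = rep-⇝ (θ-DF {rep f} (⇝-DF df p)) (θ-⇝ df p)
    where p = proj₁ (proj₂ (representative f))

  rep-fixed : ∀ {f} → DF f → Rep f → rep f ≡ f
  rep-fixed {f} df t = rep-unique df (proj₁ (proj₂ (representative f))) (0 , refl)
    (proj₂ (proj₂ (representative f))) t

  abstract
    facePairs : Σ (List (Flag G × Flag G)) λ P → (nodes P ↭ reps) × AllPair (λ u v → v ≡ τ u) P
    facePairs = pairing τ reps unique-reps (λ p → rep∈reps (θ-DF (proj₁ (∈-reps⁻ p))))
      (λ {z} p → let (df , t) = ∈-reps⁻ p in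
        trans (τ-rep (θ-DF {z} df)) (trans (cong rep (θθ df)) (rep-fixed df t)))
      λ {z} p e → let (df , t) = ∈-reps⁻ p
                      (k , q) = proj₁ (proj₂ (representative (θ z))) in
        orbit≢opposite k {θ z} (θ-DF {z} df) (trans q (trans e (sym (θθ df))))

  P : List (Flag G × Flag G)
  P = proj₁ facePairs

  -- The representatives come in pairs, so the halving in `faces` is exact.
  length-P : length P ≡ ⌊ faceOrbits S /2⌋
  length-P = trans (ℕₚ.n≡⌊n+n/2⌋ (length P)) (cong ⌊_/2⌋
    (trans (sym (length-nodes P)) (trans (↭-length (proj₁ (proj₂ facePairs))) length-reps)))

  pair-of : ∀ {t} (Q : List (Flag G × Flag G)) → t ∈ nodes Q → Fin (length Q)
  pair-of (_ ∷ Q) (here _) = zero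
  pair-of (_ ∷ Q) (there (here _)) = zero
  pair-of (_ ∷ Q) (there (there p)) = suc (pair-of Q p)

  pair-of-cong : ∀ {t t'} Q (p : t ∈ nodes Q) (p' : t' ∈ nodes Q) → Unique (nodes Q) → t ≡ t' →
    pair-of Q p ≡ pair-of Q p'
  pair-of-cong (_ ∷ Q) (here refl) (here _) u e = refl
  pair-of-cong (_ ∷ Q) (here refl) (there (here _)) u e = refl
  pair-of-cong (_ ∷ Q) (here refl) (there (there p')) u refl = ⊥-elim (unique-head u (there p'))
  pair-of-cong (_ ∷ Q) (there (here refl)) (here _) u e = refl
  pair-of-cong (_ ∷ Q) (there (here refl)) (there (here _)) u e = refl
  pair-of-cong (_ ∷ Q) (there (here refl)) (there (there p')) u refl = ⊥-elim (unique-head (unique-tail u) p')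
  pair-of-cong (_ ∷ Q) (there (there p)) (here refl) u refl = ⊥-elim (unique-head u (there p))
  pair-of-cong (_ ∷ Q) (there (there p)) (there (here refl)) u refl = ⊥-elim (unique-head (unique-tail u) p)
  pair-of-cong (_ ∷ Q) (there (there p)) (there (there p')) u e =
    cong suc (pair-of-cong Q p p' (unique-tail (unique-tail u)) e)

  pair-of-τ : ∀ {t t'} Q (p : t ∈ nodes Q) (p' : t' ∈ nodes Q) → Unique (nodes Q) →
    AllPair (λ u v → v ≡ τ u) Q → (∀ {u} → u ∈ nodes Q → τ (τ u) ≡ u) → t' ≡ τ t → pair-of Q p ≡ pair-of Q p'
  pair-of-τ ((u , v) ∷ Q) (here refl) p' un (e ∷ _) inv e' =
    pair-of-cong ((u , v) ∷ Q) (there (here refl)) p' un (trans e (sym e'))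
  pair-of-τ ((u , v) ∷ Q) (there (here refl)) p' un (e ∷ _) inv e' =
    pair-of-cong ((u , v) ∷ Q) (here refl) p' un (trans (sym (inv (here refl))) (trans (cong τ (sym e)) (sym e')))
  pair-of-τ ((u , v) ∷ Q) (there (there p)) (there (there p')) un (_ ∷ a) inv e' =
    cong suc (pair-of-τ Q p p' (unique-tail (unique-tail un)) a (λ q → inv (there (there q))) e')
  pair-of-τ ((u , v) ∷ Q) (there (there p)) (here refl) un (e ∷ _) inv e' =
    ⊥-elim (unique-head (unique-tail un) (subst (_∈ nodes Q)
      (trans (sym (inv (there (there p)))) (trans (cong τ (sym e')) (sym e))) p))
  pair-of-τ ((u , v) ∷ Q) (there (there p)) (there (here refl)) un (e ∷ _) inv e' =
    ⊥-elim (unique-head un (there (subst (_∈ nodes Q)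
      (trans (sym (inv (there (there p)))) (trans (cong τ (trans (sym e') e)) (inv (here refl)))) p)))

  unique-P : Unique (nodes P)
  unique-P = unique-↭ (↭-sym (proj₁ (proj₂ facePairs))) unique-reps

  rep∈P : ∀ {f} → DF f → rep f ∈ nodes P
  rep∈P df = ∈-resp-↭ (↭-sym (proj₁ (proj₂ facePairs))) (rep∈reps df)

  P-DF : ∀ {f} → f ∈ nodes P → DF f × Rep f
  P-DF p = ∈-reps⁻ (∈-resp-↭ (proj₁ (proj₂ facePairs)) p)

  class : ∀ f → DF f → Fin (length P)
  class f df = pair-of P (rep∈P {f} df)

  class-F : ∀ f (df : DF f) (df' : DF (F f)) → class (F f) df' ≡ class f df
  class-F f df df' = pair-of-cong P _ _ unique-P (sym (rep-⇝ df (1 , refl)))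

  class-θ : ∀ f (df : DF f) (df' : DF (θ f)) → class (θ f) df' ≡ class f df
  class-θ f df df' = sym (pair-of-τ P _ _ unique-P (proj₂ (proj₂ facePairs))
    (λ {u} p → let (du , t) = P-DF p in trans (τ-rep (θ-DF {u} du)) (trans (cong rep (θθ du)) (rep-fixed du t)))
    (sym (τ-rep df)))

  class-φ : ∀ f (df : DF f) (df' : DF (φ f)) → class (φ f) df' ≡ class f df
  class-φ f df df' = trans (same (φ f) (F (θ f)) df' (F-DF {θ f} (θ-DF {f} df)) (sym (trans (F≡φθ (θ f)) (cong φ (θθ df)))))
    (trans (class-F (θ f) (θ-DF {f} df) _) (class-θ f df _))
    where
    same : ∀ g h (dg : DF g) (dh : DF h) → g ≡ h → class g dg ≡ class h dh
    same g h dg dh e = pair-of-cong P _ _ unique-P (cong rep e)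

  class-surjective : ∀ i → ∃ λ f → Σ (DF f) λ df → class f df ≡ i
  class-surjective i = f , df , trans (pair-of-cong P _ f∈ unique-P (rep-fixed df (proj₂ (P-DF f∈)))) (at-index P i)
    where
    at : ∀ Q (i : Fin (length Q)) → proj₁ (lookup Q i) ∈ nodes Q
    at (q ∷ Q) zero = here refl
    at (q ∷ Q) (suc i) = there (there (at Q i))
    at-index : ∀ Q i → pair-of Q (at Q i) ≡ i
    at-index (q ∷ Q) zero = refl
    at-index (q ∷ Q) (suc i) = cong suc (at-index Q i)
    f = proj₁ (lookup P i)
    f∈ = at P i
    df = proj₁ (P-DF f∈)

  module _ {C : Set} (c : Flag G → C) (cθ : ∀ {f} → DF f → c (θ f) ≡ c f) (cF : ∀ {f} → DF f → c (F f) ≡ c f) where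

    private
      c-iter : ∀ k {f} → DF f → c (iter k F f) ≡ c f
      c-iter zero df = refl
      c-iter (suc k) df = trans (cF (iter-DF k df)) (c-iter k df)

      c-rep : ∀ {f} → DF f → c f ≡ c (rep f)
      c-rep {f} df = let (k , e) = proj₁ (proj₂ (representative f)) in
        trans (sym (c-iter k df)) (cong c e)

      search : ∀ Q {t} → t ∈ nodes Q → AllPair (λ u v → c u ≡ c v) Q → c t ∈ map (c ∘ proj₁) Q
      search (q ∷ Q) (here refl) _ = here refl
      search (q ∷ Q) (there (here refl)) (e ∷ _) = here (sym e)
      search (q ∷ Q) (there (there p)) (_ ∷ a) = there (search Q p a)

      mono : ∀ Q → (∀ {u} → u ∈ nodes Q → DF u) → AllPair (λ u v → v ≡ τ u) Q → AllPair (λ u v → c u ≡ c v) Q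
      mono [] d [] = []
      mono ((u , v) ∷ Q) d (e ∷ a) = trans (sym (cθ (d (here refl))))
        (trans (c-rep (θ-DF {u} (d (here refl)))) (cong c (sym e))) ∷ mono Q (λ p → d (there (there p))) a

    -- An invariant colouring takes one value on both orbits of a pair, so the first members of the
    -- pairs already show every colour of a dart.
    colours-in-P : ∀ {f} → DF f → c f ∈ map (c ∘ proj₁) P
    colours-in-P {f} df = subst (_∈ map (c ∘ proj₁) P) (sym (c-rep df))
      (search P (rep∈P df) (mono P (λ p → proj₁ (P-DF p)) (proj₂ (proj₂ facePairs))))

-- Signed rotation lists and their colourings

module _ (G : TGraph) where

  open Strands (_≟ᶠˡ_ {G}) (flip {G}) (flip-flip {G})

  -- An embedding scheme given by signed rotation lists: a dart listed with sign
  -- false has its two sides exchanged at its tail.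
  record LScheme : Set where
    field
      L   : Fin (n G) → List (Flag G)
      sig : Fin (n G) → Fin (n G) → Bool
      sig-sym    : ∀ a b → T (Edge G a b) → sig a b ≡ sig b a
      L-unique   : ∀ v → Unique (flags (L v))
      L-sound    : ∀ v {f} → f ∈ flags (L v) → (proj₁ (proj₁ f) ≡ v) × IsDart G (proj₁ f)
      L-complete : ∀ {a b} s → T (Edge G a b) → ((a , b) , s) ∈ flags (L a)

  -- `π v` is the colour of the corner at which the cyclic rotation of `v` is cut into a list. At an
  -- isolated vertex it is unconstrained, in accordance with the face that `faces` counts for such a
  -- vertex.
  record Colouring (ls : LScheme) (k : ℕ) : Set where
    open LScheme ls
    field
      c : Flag G → Fin k
      π : Fin (n G) → Fin k
      opposite-inv : ∀ {a b} s → T (Edge G a b) → c (opposite {G} sig ((a , b) , s)) ≡ c ((a , b) , s)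
      runs  : ∀ v → run c (π v) (L v) (π v)
      cover : ∀ i → (∃ λ v → π v ≡ i) ⊎ (∃ λ f → IsDart G (proj₁ f) × (c f ≡ i))

  isolated : List (Fin (n G))
  isolated = select (λ a → not (anyFin (Edge G a)))

  same-dart : ∀ (f g : Flag G) → proj₁ f ≡ proj₁ g → g ≡ f ⊎ g ≡ flip {G} f
  same-dart (d , true) (_ , true) refl = inj₁ refl
  same-dart (d , true) (_ , false) refl = inj₂ refl
  same-dart (d , false) (_ , true) refl = inj₂ refl
  same-dart (d , false) (_ , false) refl = inj₁ refl

  unique-darts : ∀ L → Unique (flags L) → Unique (map proj₁ L)
  unique-darts [] u = []
  unique-darts (f ∷ L) u = All.tabulate (λ {d} d∈ e → absurd d∈ e) ∷ unique-darts L (unique-tail (unique-tail u))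
    where
    absurd : ∀ {d} → d ∈ map proj₁ L → proj₁ f ≡ d → ⊥
    absurd d∈ e with ∈-map⁻ proj₁ d∈
    ... | g , g∈ , e' with same-dart f g (trans e e')
    ... | inj₁ refl = unique-head u (there (∈-flags g∈))
    ... | inj₂ refl = unique-head (unique-tail u) (∈-flags g∈)

  flags⇒∈ : ∀ {f} L → f ∈ flags L → f ∈ L ⊎ flip {G} f ∈ L
  flags⇒∈ (g ∷ L) (here refl) = inj₁ (here refl)
  flags⇒∈ (g ∷ L) (there (here refl)) = inj₂ (here (flip-flip {G} g))
  flags⇒∈ (g ∷ L) (there (there p)) with flags⇒∈ L p
  ... | inj₁ q = inj₁ (there q)
  ... | inj₂ q = inj₂ (there q)

  not-both : ∀ {f} L → Unique (flags L) → f ∈ L → flip {G} f ∉ L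
  not-both {f} (g ∷ L) u (here refl) (here e) = unique-head u (here (sym e))
  not-both (g ∷ L) u (here refl) (there q) = unique-head (unique-tail u) (∈-flags q)
  not-both {f} (g ∷ L) u (there p) (here refl) = unique-head (unique-tail u)
    (subst (_∈ flags L) (sym (flip-flip {G} f)) (∈-flags p))
  not-both (g ∷ L) u (there p) (there q) = not-both L (unique-tail (unique-tail u)) p q

  module _ (ls : LScheme) where

    open LScheme ls
    open Cyclic (_≟ᵈ_ {G})
    open CyclicReach (_≟ᵈ_ {G})
    open import Data.List.Membership.DecPropositional (_≟ᶠˡ_ {G}) using (_∈?_)

    private
      D : Fin (n G) → List (Dart G)
      D v = map proj₁ (L v)

      D-unique : ∀ v → Unique (D v)
      D-unique v = unique-darts (L v) (L-unique v)

      D-complete : ∀ d → IsDart G d → d ∈ D (proj₁ d)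
      D-complete (a , b) e with flags⇒∈ (L a) (L-complete true e)
      ... | inj₁ p = ∈-map⁺ proj₁ p
      ... | inj₂ p = ∈-map⁺ proj₁ p

      D-sound : ∀ v {d} → d ∈ D v → (proj₁ d ≡ v) × IsDart G d
      D-sound v d∈ with ∈-map⁻ proj₁ d∈
      ... | f , f∈ , refl = L-sound v (∈-flags f∈)

      sgn : Dart G → Bool
      sgn d = ⌊ (d , true) ∈? L (proj₁ d) ⌋

      sgn-∈ : ∀ v f → f ∈ L v → f ≡ (proj₁ f , sgn (proj₁ f))
      sgn-∈ v (d , s) f∈ with proj₁ (L-sound v (∈-flags f∈))
      sgn-∈ _ (d , true) f∈ | refl with (d , true) ∈? L (proj₁ d)
      ... | yes _ = refl
      ... | no h = ⊥-elim (h f∈)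
      sgn-∈ _ (d , false) f∈ | refl with (d , true) ∈? L (proj₁ d)
      ... | yes q = ⊥-elim (not-both (L (proj₁ d)) (L-unique (proj₁ d)) f∈ q)
      ... | no _ = refl

      -- Switching: a `Scheme` has no signs at darts, so the signs at both ends of an edge are moved
      -- into its signature.
      sig' : Fin (n G) → Fin (n G) → Bool
      sig' a b = sig a b xor (not (sgn (a , b)) xor not (sgn (b , a)))

      xor-comm′ : ∀ p q → p xor q ≡ q xor p
      xor-comm′ true true = refl
      xor-comm′ true false = refl
      xor-comm′ false true = refl
      xor-comm′ false false = refl

      ρ' σ' : Dart G → Dart G
      ρ' d = next (D (proj₁ d)) d
      σ' d = prev (D (proj₁ d)) d

      ρ'-∈ : ∀ d → IsDart G d → ρ' d ∈ D (proj₁ d)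
      ρ'-∈ d e = next-∈ (D-unique _) (D-complete d e)

      σ'-∈ : ∀ d → IsDart G d → σ' d ∈ D (proj₁ d)
      σ'-∈ d e = ∈-resp-↭ (↭-reverse (D (proj₁ d)))
          (next-∈ (unique-reverse (D-unique _)) (∈-resp-↭ (↭-sym (↭-reverse _)) (D-complete d e)))
        where open import Data.List.Relation.Binary.Permutation.Propositional.Properties using (↭-reverse)

    toScheme : Scheme G
    toScheme = record
      { ρ = ρ' ; σ = σ' ; sig = sig'
      ; ρ-dart = λ d e → proj₂ (D-sound _ (ρ'-∈ d e))
      ; σ-dart = λ d e → proj₂ (D-sound _ (σ'-∈ d e))
      ; ρ-tail = λ d e → proj₁ (D-sound _ (ρ'-∈ d e))
      ; σρ = λ d e → trans (cong (λ v → prev (D v) (ρ' d)) (proj₁ (D-sound _ (ρ'-∈ d e))))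
          (prev-next (D-unique _) (D-complete d e))
      ; ρσ = λ d e → trans (cong (λ v → next (D v) (σ' d)) (proj₁ (D-sound _ (σ'-∈ d e))))
          (next-prev (D-unique _) (D-complete d e))
      ; ρ-cyclic = cyc
      ; sig-sym = λ a b e → cong₂ _xor_ (sig-sym a b e) (xor-comm′ (not (sgn (a , b))) (not (sgn (b , a)))) }
      where
      iter-ρ : ∀ v k d → d ∈ D v → (iter k ρ' d ≡ iter k (next (D v)) d) × iter k ρ' d ∈ D v
      iter-ρ v zero d p = refl , p
      iter-ρ v (suc k) d p with iter-ρ v k d p
      ... | e , q = eq , subst (_∈ D v) (sym (trans eq (cong (next (D v)) (sym e)))) (next-∈ (D-unique v) q)
        where
        eq : ρ' (iter k ρ' d) ≡ next (D v) (iter k (next (D v)) d)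
        eq = trans (cong (λ w → next (D w) (iter k ρ' d)) (proj₁ (D-sound v q))) (cong (next (D v)) e)
      cyc : ∀ d d' → IsDart G d → IsDart G d' → proj₁ d ≡ proj₁ d' → ∃ λ k → iter k ρ' d ≡ d'
      cyc d d' e e' t with reaches (D-unique (proj₁ d)) (D-complete d e)
          (subst (λ v → d' ∈ D v) (sym t) (D-complete d' e'))
      ... | k , q = k , trans (proj₁ (iter-ρ (proj₁ d) k d (D-complete d e))) q

    private
      first-map : ∀ f (xs : List (Flag G)) → first (proj₁ f) (map proj₁ xs) ≡ proj₁ (Cyclic.first (_≟ᶠˡ_ {G}) f xs)
      first-map f [] = refl
      first-map f (x ∷ xs) = refl

      run-next : ∀ {C : Set} {c : Flag G → C} {π} A f B → run c π (A ++ f ∷ B) π →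
        c (flip {G} f) ≡ c (Cyclic.first (_≟ᶠˡ_ {G}) f (B ++ A))
      run-next A f (g ∷ B) r with run-split A r
      ... | γ , r₁ , (e , e' , r₂) = e'
      run-next [] f [] (e , e') = trans e' e
      run-next (h ∷ A) f [] (e , r) with run-split A r
      ... | γ , r₁ , (e₁ , e₂) = trans e₂ e

      corner : ∀ {C : Set} {c : Flag G → C} {π} d → IsDart G d → run c π (L (proj₁ d)) π →
        c (d , not (sgn d)) ≡ c (ρ' d , sgn (ρ' d))
      corner {c = c} {π} d e r with ∈-map⁻ proj₁ (D-complete d e)
      ... | f , f∈ , refl with ∈-∃++ f∈
      ... | A , B , eq = trans (cong (c ∘ flip {G}) (sym (sgn-∈ v f f∈)))
            (trans (run-next A f B (subst (λ l → run c π l π) eq r))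
              (trans (cong c (sgn-∈ v g g∈)) (cong (λ d → c (d , sgn d)) (sym ρ≡))))
        where
        v = proj₁ (proj₁ f)
        g = Cyclic.first (_≟ᶠˡ_ {G}) f (B ++ A)
        g∈ : g ∈ L v
        g∈ = subst (g ∈_) (sym eq) (Cyclic.first-∈ (_≟ᶠˡ_ {G}) f (B ++ A) (∈-++⁺ʳ A (here refl))
          λ q → [ (λ z → ∈-++⁺ʳ A (there z)) , ∈-++⁺ˡ ]′ (∈-++⁻ B q))
        D≡ : D v ≡ map proj₁ A ++ proj₁ f ∷ map proj₁ B
        D≡ = trans (cong (map proj₁) eq) (map-++ proj₁ A (f ∷ B))
        ρ≡ : ρ' (proj₁ f) ≡ proj₁ g
        ρ≡ = trans (cong (λ l → next l (proj₁ f)) D≡)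
          (trans (next-split (map proj₁ A) (proj₁ f) (map proj₁ B) (subst Unique D≡ (D-unique v)))
            (trans (cong (first (proj₁ f)) (sym (map-++ proj₁ B A))) (first-map f (B ++ A))))

    -- After the same switching the colouring, now called `c'`, is constant along face tracing. Each
    -- colour is then seen at a pair of orbits or, for an isolated vertex, as its `π`.
    colours≤faces : ∀ {k} → Colouring ls k → k ≤ faces toScheme
    colours≤faces {k} col = ≤-trans (covered⇒≤ (map (c' ∘ proj₁) P ++ map π isolated) cov)
        (≤-reflexive (trans (length-++ (map (c' ∘ proj₁) P)) (cong₂ _+_
          (trans (length-map (c' ∘ proj₁) P) length-P) (trans (length-map π isolated) (length-select (λ a → not (anyFin (Edge G a))))))))
      where
      open Colouring col
      open FaceClasses toScheme
      c' : Flag G → Fin k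
      c' (d , t) = c (d , t xor not (sgn d))
      xor-lemma₁ : ∀ t p q g → not (t xor (g xor (p xor q))) xor q ≡ not ((t xor p) xor g)
      xor-lemma₁ true true true true = refl
      xor-lemma₁ true true true false = refl
      xor-lemma₁ true true false true = refl
      xor-lemma₁ true true false false = refl
      xor-lemma₁ true false true true = refl
      xor-lemma₁ true false true false = refl
      xor-lemma₁ true false false true = refl
      xor-lemma₁ true false false false = refl
      xor-lemma₁ false true true true = refl
      xor-lemma₁ false true true false = refl
      xor-lemma₁ false true false true = refl
      xor-lemma₁ false true false false = refl
      xor-lemma₁ false false true true = refl
      xor-lemma₁ false false true false = refl
      xor-lemma₁ false false false true = refl
      xor-lemma₁ false false false false = refl
      xor-lemma₂ : ∀ s q → (s xor q) xor q ≡ s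
      xor-lemma₂ true true = refl
      xor-lemma₂ true false = refl
      xor-lemma₂ false true = refl
      xor-lemma₂ false false = refl
      c'θ : ∀ {f} → DF f → c' (θ f) ≡ c' f
      c'θ {(a , b) , t} (dart e) = trans
        (cong (λ z → c ((b , a) , z)) (xor-lemma₁ t (not (sgn (a , b))) (not (sgn (b , a))) (sig a b)))
        (opposite-inv (t xor not (sgn (a , b))) e)
      c'ρ : ∀ d → IsDart G d → c' (d , false) ≡ c' (ρ' d , true)
      c'ρ d e = trans (corner d e (runs (proj₁ d))) (cong (λ z → c (ρ' d , z)) (sym (not-involutive (sgn (ρ' d)))))
      c'φ : ∀ {f} → DF f → c' (φ f) ≡ c' f
      c'φ {d , false} (dart e) = sym (c'ρ d e)
      c'φ {d , true} (dart e) = trans (c'ρ (σ' d) (Scheme.σ-dart toScheme d e))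
        (cong (λ z → c' (z , true)) (Scheme.ρσ toScheme d e))
      c'F : ∀ {f} → DF f → c' (F f) ≡ c' f
      c'F {f} df = trans (cong c' (F≡φθ f)) (trans (c'φ (θ-DF df)) (c'θ df))
      flag-cov : ∀ f → IsDart G (proj₁ f) → c f ∈ map (c' ∘ proj₁) P ++ map π isolated
      flag-cov (d , s) e = ∈-++⁺ˡ (subst (_∈ map (c' ∘ proj₁) P) (cong (λ z → c (d , z)) (xor-lemma₂ s (not (sgn d))))
        (colours-in-P c' c'θ c'F {d , s xor not (sgn d)} (dart e)))
      vertex-cov : ∀ v l → L v ≡ l → run c (π v) l (π v) → π v ∈ map (c' ∘ proj₁) P ++ map π isolated
      vertex-cov v [] eq r = ∈-++⁺ʳ (map (c' ∘ proj₁) P) (∈-map⁺ π (∈-select⁺ (λ a → not (anyFin (Edge G a)))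
        (not⁺ λ t → let (b , e) = anyFin⁻ {f = Edge G v} t in
          nil (subst (λ l → ((v , b) , true) ∈ flags l) eq (L-complete {v} {b} true e)))))
        where
        nil : ∀ {f : Flag G} → f ∈ [] → ⊥
        nil ()
      vertex-cov v (f ∷ l) eq (e , r) = subst (_∈ map (c' ∘ proj₁) P ++ map π isolated) (sym e)
        (flag-cov f (proj₂ (L-sound v (subst (λ l → f ∈ flags l) (sym eq) (here refl)))))
      cov : ∀ i → i ∈ map (c' ∘ proj₁) P ++ map π isolated
      cov i = [ (λ (v , e) → subst (_∈ map (c' ∘ proj₁) P ++ map π isolated) e (vertex-cov v (L v) refl (runs v)))
              , (λ (f , d , e) → subst (_∈ map (c' ∘ proj₁) P ++ map π isolated) e (flag-cov f d)) ]′ (cover i)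

-- Signed rotation lists from an embedding scheme

module _ (G : TGraph) where

  open Strands (_≟ᶠˡ_ {G}) (flip {G}) (flip-flip {G})

  least : (P : ℕ → Set) → (∀ j → Dec (P j)) → ∀ k → P k → ∃ λ m → P m × (∀ {j} → j < m → ¬ P j)
  least P P? zero p = zero , p , λ ()
  least P P? (suc k) p with P? zero
  ... | yes q = zero , q , λ ()
  ... | no h with least (P ∘ suc) (P? ∘ suc) k p
  ... | m , q , min = suc m , q , λ { {zero} _ → h ; {suc j} (s≤s lt) → min lt }

  module _ (S : Scheme G) where

    open Scheme S

    private
      record Rotation (v : Fin (n G)) : Set₁ where
        field
          list     : List (Flag G)
          unique   : Unique (flags list)
          sound    : ∀ {f} → f ∈ flags list → (proj₁ (proj₁ f) ≡ v) × IsDart G (proj₁ f)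
          complete : ∀ {b} s → T (Edge G v b) → ((v , b) , s) ∈ flags list
          -- `z` is the colour wanted at an isolated vertex. At any other vertex `π` is determined
          -- by the rotation.
          closed   : ∀ {C : Set} (c : Flag G → C) → (∀ {d} → IsDart G d → c (d , false) ≡ c (ρ d , true)) →
                     ∀ z → ∃ λ π → run c π list π × ((∀ b → ¬ T (Edge G v b)) → π ≡ z)

      positive : List (Dart G) → List (Flag G)
      positive = map (_, true)

      ∈-positive⁺ : ∀ {d s} xs → d ∈ xs → (d , s) ∈ flags (positive xs)
      ∈-positive⁺ {s = true} (x ∷ xs) (here refl) = here refl
      ∈-positive⁺ {s = false} (x ∷ xs) (here refl) = there (here refl)
      ∈-positive⁺ (x ∷ xs) (there p) = there (there (∈-positive⁺ xs p))

      ∈-positive⁻ : ∀ {f} xs → f ∈ flags (positive xs) → proj₁ f ∈ xs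
      ∈-positive⁻ (x ∷ xs) (here refl) = here refl
      ∈-positive⁻ (x ∷ xs) (there (here refl)) = here refl
      ∈-positive⁻ (x ∷ xs) (there (there p)) = there (∈-positive⁻ xs p)

      unique-positive : ∀ {xs} → Unique xs → Unique (flags (positive xs))
      unique-positive {[]} u = []
      unique-positive {x ∷ xs} u =
        ((λ ()) ∷ All.tabulate (λ p e → unique-head u (subst (_∈ xs) (sym (cong proj₁ e)) (∈-positive⁻ xs p)))) ∷
        All.tabulate (λ p e → unique-head u (subst (_∈ xs) (sym (cong proj₁ e)) (∈-positive⁻ xs p))) ∷
        unique-positive (unique-tail u)

      iter-dart : ∀ k {d} → IsDart G d → IsDart G (iter k ρ d)
      iter-dart zero e = e
      iter-dart (suc k) {d} e = ρ-dart (iter k ρ d) (iter-dart k e)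

      iter-tail : ∀ k {d} → IsDart G d → proj₁ (iter k ρ d) ≡ proj₁ d
      iter-tail zero e = refl
      iter-tail (suc k) {d} e = trans (ρ-tail (iter k ρ d) (iter-dart k e)) (iter-tail k e)

      ρ-cancel : ∀ k {d d'} → IsDart G d → IsDart G d' → iter k ρ d ≡ iter k ρ d' → d ≡ d'
      ρ-cancel zero e e' q = q
      ρ-cancel (suc k) e e' q = ρ-cancel k e e' (trans (sym (σρ _ (iter-dart k e)))
        (trans (cong σ q) (σρ _ (iter-dart k e'))))

      run-sequence : ∀ {C : Set} (c : Flag G → C) (f : ℕ → Dart G) m →
        (∀ i → c (f i , false) ≡ c (f (suc i) , true)) →
        run c (c (f 0 , true)) (positive (applyUpTo f m)) (c (f m , true))
      run-sequence c f zero h = refl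
      run-sequence c f (suc m) h = refl , subst (λ z → run c z (positive (applyUpTo (f ∘ suc) m)) (c (f (suc m) , true)))
        (sym (h 0)) (run-sequence c (f ∘ suc) m (h ∘ suc))

      rotation : ∀ v → Rotation v
      rotation v with T? (anyFin (Edge G v))
      ... | no h = record
        { list = [] ; unique = [] ; sound = λ () ; complete = λ {b} s e → ⊥-elim (h (anyFin⁺ {f = Edge G v} b e))
        ; closed = λ c _ z → z , refl , λ _ → refl }
      ... | yes t with anyFin⁻ {f = Edge G v} t
      ... | b₀ , e₀ with ρ-cyclic (ρ (v , b₀)) (v , b₀) (ρ-dart _ e₀) e₀ (ρ-tail _ e₀)
      -- Some positive period exists because `ρ` is cyclic at `v`. The least one is taken so that
      -- the orbit lists no dart twice.
      ... | k₀ , q₀ with least (λ j → iter (suc j) ρ (v , b₀) ≡ (v , b₀)) (λ j → _≟ᵈ_ {G} _ _) k₀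
                           (trans (iter-suc ρ k₀ (v , b₀)) q₀)
      ... | m , per , min = record
        { list = positive orb
        ; unique = unique-positive (Uniqₚ.applyUpTo⁺₁ seq (suc m) distinct)
        ; sound = λ {f} p → snd (∈-positive⁻ orb p)
        ; complete = λ {b} s e → ∈-positive⁺ orb (reach b e)
        ; closed = λ c h z → c (d₀ , true) ,
            subst (run c _ (positive orb)) (cong (λ z → c (z , true)) per)
              (run-sequence c seq (suc m) (λ i → h (iter-dart i e₀))) ,
            λ none → ⊥-elim (none b₀ e₀) }
        where
        d₀ = (v , b₀)
        seq : ℕ → Dart G
        seq i = iter i ρ d₀
        orb : List (Dart G)
        orb = applyUpTo seq (suc m)
        distinct : ∀ {i j} → i < j → j < suc m → seq i ≢ seq j
        distinct {i} {suc j} (s≤s i≤j) (s≤s j<m) e = min {j ∸ i} (ℕₚ.≤-trans (s≤s (ℕₚ.m∸n≤m j i)) j<m)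
          (sym (ρ-cancel i e₀ (iter-dart (suc (j ∸ i)) e₀)
            (trans e (trans (cong (λ z → iter z ρ d₀) (sym (trans (ℕₚ.+-suc i (j ∸ i)) (cong suc (ℕₚ.m+[n∸m]≡n i≤j)))))
              (iter-+ ρ i (suc (j ∸ i)) d₀)))))
        snd : ∀ {d} → d ∈ orb → (proj₁ d ≡ v) × IsDart G d
        snd p with Memₚ.∈-applyUpTo⁻ seq p
        ... | i , _ , refl = iter-tail i e₀ , iter-dart i e₀
        reach : ∀ b → T (Edge G v b) → (v , b) ∈ orb
        reach b e with ρ-cyclic d₀ (v , b) e₀ e refl
        ... | k , q = subst (_∈ orb) (trans (sym (begin
              iter k ρ d₀                                              ≡⟨ cong (λ z → iter z ρ d₀) (m≡m%n+[m/n]*n k (suc m)) ⟩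
              iter (k % suc m + (k / suc m) * suc m) ρ d₀              ≡⟨ iter-+ ρ (k % suc m) _ d₀ ⟩
              iter (k % suc m) ρ (iter ((k / suc m) * suc m) ρ d₀)     ≡⟨ cong (iter (k % suc m) ρ) (iter-multiple ρ (suc m) per (k / suc m)) ⟩
              iter (k % suc m) ρ d₀                                    ∎)) q)
              (Memₚ.∈-applyUpTo⁺ seq (m%n<n k (suc m)))
          where open ≡-Reasoning

    open FaceClasses S

    -- All darts get the sign true. The colours are the faces containing darts, followed by one
    -- colour for each isolated vertex, so every face becomes a colour.
    fromScheme : Σ (LScheme G) λ ls → Colouring G ls (faces S)
    fromScheme = ls , subst (Colouring G ls) (cong₂ _+_ length-P (length-select (λ a → not (anyFin (Edge G a))))) col
      where
      ls : LScheme G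
      ls = record
        { L = λ v → Rotation.list (rotation v) ; sig = sig ; sig-sym = sig-sym
        ; L-unique = λ v → Rotation.unique (rotation v)
        ; L-sound = λ v → Rotation.sound (rotation v)
        ; L-complete = λ {a} s e → Rotation.complete (rotation a) s e }
      K = length P + length (isolated G)
      isolated-index : ∀ v → T (not (anyFin (Edge G v))) → Fin (length (isolated G))
      isolated-index v t = Any.index (∈-select⁺ (λ a → not (anyFin (Edge G a))) t)
      vcol : ∀ v → Dec (T (not (anyFin (Edge G v)))) → Fin K
      vcol v (yes t) = length P ↑ʳ isolated-index v t
      vcol v (no h) = decide (T? (anyFin (Edge G v)))
        where
        decide : Dec (T (anyFin (Edge G v))) → Fin K
        decide (yes t) = let (b , e) = anyFin⁻ {f = Edge G v} t in class ((v , b) , true) (dart e) ↑ˡ length (isolated G)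
        decide (no h') = ⊥-elim (h (not⁺ h'))
      default : Fin (n G) → Fin K
      default v = vcol v (T? (not (anyFin (Edge G v))))
      colour : ∀ f → Dec (IsDart G (proj₁ f)) → Fin K
      colour f (yes e) = class f (dart e) ↑ˡ length (isolated G)
      -- A value for flags that are no darts, which no condition inspects. The terminal guarantees
      -- that a vertex, and with it a colour, is at hand.
      colour f (no _) = default (x G)
      c : Flag G → Fin K
      c f = colour f (T? (Edge G (proj₁ (proj₁ f)) (proj₂ (proj₁ f))))
      c-dart : ∀ {f} (df : DF f) → c f ≡ class f df ↑ˡ length (isolated G)
      c-dart {f} df = decided (T? (Edge G (proj₁ (proj₁ f)) (proj₂ (proj₁ f))))
        where
        decided : ∀ z → colour f z ≡ class f df ↑ˡ length (isolated G)
        decided (no h) = ⊥-elim (h (DF.isDart df))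
        decided (yes e') = cong (_↑ˡ length (isolated G)) (pair-of-cong P _ _ unique-P refl)
      c-corner : ∀ {d} → IsDart G d → c (d , false) ≡ c (ρ d , true)
      c-corner {d} e = trans (c-dart {d , false} (dart e)) (trans (cong (_↑ˡ length (isolated G))
        (sym (class-φ (d , false) (dart e) (φ-DF {d , false} (dart e))))) (sym (c-dart (φ-DF {d , false} (dart e)))))
      clo : ∀ v → _
      clo v = Rotation.closed (rotation v) c c-corner (default v)
      cov : ∀ i → (∃ λ v → proj₁ (clo v) ≡ i) ⊎ (∃ λ f → IsDart G (proj₁ f) × (c f ≡ i))
      cov i = by-side (splitAt (length P) i) refl
        where
        by-side : ∀ z → splitAt (length P) i ≡ z →
          (∃ λ v → proj₁ (clo v) ≡ i) ⊎ (∃ λ f → IsDart G (proj₁ f) × (c f ≡ i))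
        by-side (inj₁ j) eq = let (f , df , e) = class-surjective j in
          inj₂ (f , DF.isDart df , trans (c-dart df) (trans (cong (_↑ˡ length (isolated G)) e) (Finₚ.splitAt⁻¹-↑ˡ eq)))
        by-side (inj₂ j) eq = inj₁ (v , trans (proj₂ (proj₂ (clo v)) none)
            (trans (vcol-iso (T? (not (anyFin (Edge G v))))) (Finₚ.splitAt⁻¹-↑ʳ eq)))
          where
          v = lookup (isolated G) j
          t₀ : T (not (anyFin (Edge G v)))
          t₀ = ∈-select⁻ (λ a → not (anyFin (Edge G a))) (Memₚ.∈-lookup j)
          none : ∀ b → ¬ T (Edge G v b)
          none b e = not⁻ t₀ (anyFin⁺ {f = Edge G v} b e)
          vcol-iso : ∀ d → vcol v d ≡ length P ↑ʳ j
          vcol-iso (no h) = ⊥-elim (h t₀)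
          vcol-iso (yes t) = cong (length P ↑ʳ_) (unique-lookup (unique-select (λ a → not (anyFin (Edge G a)))) _ _
            (sym (lookup-index (∈-select⁺ (λ a → not (anyFin (Edge G a))) t))))
      col : Colouring G ls K
      col = record
        { c = c ; π = λ v → proj₁ (clo v)
        ; opposite-inv = λ {a} {b} s e → trans (c-dart (θ-DF {(a , b) , s} (dart e)))
            (trans (cong (_↑ˡ length (isolated G)) (class-θ ((a , b) , s) (dart e) _)) (sym (c-dart (dart e))))
        ; runs = λ v → proj₁ (proj₂ (clo v))
        ; cover = cov }

-- Euler's inequality

module EulerInequality (G : TGraph) (ls : LScheme G) where

  open Strands (_≟ᶠˡ_ {G}) (flip {G}) (flip-flip {G})
  open Core (_≟ᶠˡ_ {G}) (flip {G}) (flip-flip {G})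
  open LScheme ls
  open import Data.List.Membership.DecPropositional (_≟ᶠ_ {n G}) using (_∈?_)
  open import Data.List.Relation.Binary.Permutation.Propositional.Properties using (filter-↭)

  reverseDart : Dart G → Dart G
  reverseDart (a , b) = b , a

  Edges : List (Dart G × Dart G) → Set
  Edges = AllPair (λ d d' → (d' ≡ reverseDart d) × IsDart G d)

  edges-sym : ∀ {d d'} → (d' ≡ reverseDart d) × IsDart G d → (d ≡ reverseDart d') × IsDart G d'
  edges-sym {a , b} (refl , e) = refl , edge-sym G {a} {b} e

  tails : List (Flag G) → List (Dart G)
  tails = map proj₁

  dart⇒flag : ∀ {d} L → d ∈ tails L → ∃ λ s → (d , s) ∈ L
  dart⇒flag L p with ∈-map⁻ proj₁ p
  ... | (d , s) , q , refl = s , q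

  dart⇒flags : ∀ {d} L s → d ∈ tails L → (d , s) ∈ flags L
  dart⇒flags L s p with dart⇒flag L p
  dart⇒flags L true p | true , q = ∈-flags q
  dart⇒flags L false p | false , q = ∈-flags q
  dart⇒flags L true p | false , q = flip-∈-flags L (∈-flags q)
  dart⇒flags L false p | true , q = flip-∈-flags L (∈-flags q)

  flags⇒dart : ∀ {f} L → f ∈ flags L → proj₁ f ∈ tails L
  flags⇒dart L p with flags⇒∈ G L p
  ... | inj₁ q = ∈-map⁺ proj₁ q
  ... | inj₂ q = ∈-map⁺ proj₁ q

  -- The positive flags form one flag for each dart.
  flags-↭⇒tails-↭ : ∀ L L' → flags L ↭ flags L' → tails L ↭ tails L'
  flags-↭⇒tails-↭ L L' q = ↭-trans (↭-reflexive (sym (positive L)))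
    (↭-trans (↭-map⁺ proj₁ (filter-↭ (λ f → T? (proj₂ f)) q)) (↭-reflexive (positive L')))
    where
    positive : ∀ L → map proj₁ (filter (λ f → T? (proj₂ f)) (flags L)) ≡ tails L
    positive [] = refl
    positive ((d , true) ∷ L) = cong (d ∷_) (positive L)
    positive ((d , false) ∷ L) = cong (d ∷_) (positive L)

  OppositeInv : ∀ {k} → (Flag G → Fin k) → Set
  OppositeInv c = ∀ {a b} s → T (Edge G a b) → c (opposite {G} sig ((a , b) , s)) ≡ c ((a , b) , s)

  -- A single vertex with loops, written as a two-terminal configuration with nothing at the second
  -- terminal, which forces `α` and `β` to agree. Deleting a loop first identifies the colours of
  -- its two sides, at the price of at most one. By invariance under `opposite` the other dart of
  -- the loop then has equal sides too and goes for free. Without loops one colour is left.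
  bouquet-bound : ∀ Es {k} B → nodes Es ↭ tails B → Edges Es →
    (C : Coloured k [] B [] []) → OppositeInv (Coloured.c C) → k ≤ suc (length Es)
  bouquet-bound [] (f ∷ B) p E C inv with ↭-length p
  ... | ()
  bouquet-bound [] [] p E C inv = covered⇒≤ (α ∷ []) cov
    where
    open Coloured C
    cov : ∀ i → i ∈ α ∷ []
    cov i with cover i
    ... | inj₁ e = here e
    ... | inj₂ (inj₁ (_ , () , _))
    ... | inj₂ (inj₂ ())
  bouquet-bound (((a , b) , d') ∷ Es) {k} B p ((refl , ed) ∷ E) C inv
    with merge (Coloured.c C ((a , b) , true)) (Coloured.c C ((a , b) , false))
  ... | k' , k≤ , h , hd , sur with delete {M° = []} {v = (a , b) , true} (recolour h sur C)
                                     (dart⇒flags B true (∈-resp-↭ p (here refl))) hd []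
  ... | B₁ , p₁ , C₁ , refl with delete {M° = []} {v = (b , a) , true} C₁
          (dart⇒flags B₁ true (∈-resp-↭ (drop-∷ (↭-trans p (flags-↭⇒tails-↭ B (((a , b) , true) ∷ B₁) p₁))) (here refl)))
          (both (sig a b) refl) []
    where
    c₁ : Flag G → Fin k'
    c₁ = Coloured.c C₁
    both : ∀ z → sig a b ≡ z → c₁ ((b , a) , true) ≡ c₁ ((b , a) , false)
    both true e = trans (cong (λ z → c₁ ((b , a) , not (true xor z))) (sym e)) (trans (cong h (inv true ed))
      (trans hd (trans (sym (cong h (inv false ed))) (cong (λ z → c₁ ((b , a) , not (false xor z))) e))))
    both false e = trans (cong (λ z → c₁ ((b , a) , not (false xor z))) (sym e)) (trans (cong h (inv false ed))
      (trans (sym hd) (trans (sym (cong h (inv true ed))) (cong (λ z → c₁ ((b , a) , not (true xor z))) e))))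
  ... | B₂ , p₂ , C₂ , refl = ≤-trans k≤ (s≤s (bouquet-bound Es B₂
          (drop-∷ (↭-trans (drop-∷ (↭-trans p (flags-↭⇒tails-↭ B (((a , b) , true) ∷ B₁) p₁)))
            (flags-↭⇒tails-↭ B₁ (((b , a) , true) ∷ B₂) p₂)))
          E C₂ (λ s e → cong h (inv s e))))

  lists : List (Fin (n G)) → List (Flag G)
  lists [] = []
  lists (v ∷ Vs) = L v ++ lists Vs

  ∈-lists⁺ : ∀ {f v Vs} → v ∈ Vs → f ∈ flags (L v) → f ∈ flags (lists Vs)
  ∈-lists⁺ {f} {v} {_ ∷ Vs} (here refl) p = subst (f ∈_) (sym (flags-++ (L v) (lists Vs))) (∈-++⁺ˡ p)
  ∈-lists⁺ {f} {v} {w ∷ Vs} (there q) p = subst (f ∈_) (sym (flags-++ (L w) (lists Vs))) (∈-++⁺ʳ (flags (L w)) (∈-lists⁺ q p))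

  ∈-lists⁻ : ∀ {f} Vs → f ∈ flags (lists Vs) → ∃ λ v → (v ∈ Vs) × f ∈ flags (L v)
  ∈-lists⁻ (v ∷ Vs) p with ∈-++⁻ (flags (L v)) (subst (_ ∈_) (flags-++ (L v) (lists Vs)) p)
  ... | inj₁ q = v , here refl , q
  ... | inj₂ q = let (w , w∈ , r) = ∈-lists⁻ Vs q in w , there w∈ , r

  ∈-tails-lists⁻ : ∀ {d} Vs → d ∈ tails (lists Vs) → (proj₁ d ∈ Vs) × d ∈ tails (L (proj₁ d))
  ∈-tails-lists⁻ {d} Vs p with ∈-lists⁻ Vs (dart⇒flags (lists Vs) true p)
  ... | v , v∈ , q with proj₁ (L-sound v q)
  ... | refl = v∈ , flags⇒dart (L v) q

  lists-↭ : ∀ {Vs Ws} → Vs ↭ Ws → tails (lists Vs) ↭ tails (lists Ws)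
  lists-↭ _↭_.refl = ↭-refl
  lists-↭ (prep {xs} {ys} v p) rewrite map-++ proj₁ (L v) (lists xs) | map-++ proj₁ (L v) (lists ys) =
    ++⁺ˡ (tails (L v)) (lists-↭ p)
  lists-↭ (swap {xs} {ys} v w p)
    rewrite map-++ proj₁ (L v) (L w ++ lists xs) | map-++ proj₁ (L w) (lists xs)
          | map-++ proj₁ (L w) (L v ++ lists ys) | map-++ proj₁ (L v) (lists ys) =
    ↭-trans (↭-reflexive (sym (++-assoc (tails (L v)) (tails (L w)) _)))
      (↭-trans (++⁺ (++-comm (tails (L v)) (tails (L w))) (lists-↭ p))
        (↭-reflexive (++-assoc (tails (L w)) (tails (L v)) _)))
  lists-↭ (_↭_.trans p q) = ↭-trans (lists-↭ p) (lists-↭ q)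

  unique-lists : ∀ {Vs} → Unique Vs → Unique (tails (lists Vs))
  unique-lists {[]} u = []
  unique-lists {v ∷ Vs} u rewrite map-++ proj₁ (L v) (lists Vs) =
    Uniqₚ.++⁺ (unique-darts G (L v) (L-unique v)) (unique-lists (unique-tail u))
      λ { (p , q) → unique-head u (subst (_∈ Vs) (proj₁ (L-sound v (dart⇒flags (L v) true p))) (proj₁ (∈-tails-lists⁻ Vs q))) }

  -- The vertices outside Vs have been merged into a single vertex with rotation B.
  record Blob (k : ℕ) (B : List (Flag G)) (Vs : List (Fin (n G))) : Set where
    field
      c  : Flag G → Fin k
      π₀ : Fin k
      π  : Fin (n G) → Fin k
      inv  : OppositeInv c
      runB : run c π₀ B π₀
      runV : ∀ {v} → v ∈ Vs → run c (π v) (L v) (π v)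
      cover : ∀ i → i ≡ π₀ ⊎ (∃ λ v → (v ∈ Vs) × (π v ≡ i)) ⊎
              (∃ λ f → (f ∈ flags B ⊎ f ∈ flags (lists Vs)) × (c f ≡ i))

  -- The rotation at `b`, opened at the dart to `a`, takes the place of the dart from `a` to `b`. No
  -- colour is lost: those of the two sides of the edge remain visible at the corners around the
  -- inserted piece `W`.
  contract-edge : ∀ {k B a b Vs Vs'} → Blob k B Vs → Vs ↭ b ∷ Vs' → T (Edge G a b) →
    (a , b) ∈ tails B → (b , a) ∈ tails (L b) →
    ∃ λ B' → Blob k B' Vs' × (tails B ++ tails (L b) ↭ (a , b) ∷ (b , a) ∷ tails B')
  contract-edge {k} {B} {a} {b} {Vs} {Vs'} Bl Vs↭ ed d∈ d'∈ with dart⇒flag B d∈ | dart⇒flag (L b) d'∈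
  ... | s , f∈ | s' , f'∈ with ∈-∃++ f∈ | ∈-∃++ f'∈
  ... | A , C , refl | A' , C' , Lb≡ = A ++ W ++ C , blob , perm
    where
    open Blob Bl
    f f' : Flag G
    f = (a , b) , s
    f' = (b , a) , s'
    b∈Vs : b ∈ Vs
    b∈Vs = ∈-resp-↭ (↭-sym Vs↭) (here refl)
    runb : run c (π b) (A' ++ f' ∷ C') (π b)
    runb = subst (λ l → run c (π b) l (π b)) Lb≡ (runV b∈Vs)
    splitB = run-split A runB
    γ = proj₁ splitB
    runA : run c π₀ A γ
    runA = proj₁ (proj₂ splitB)
    γ≡ : γ ≡ c f
    γ≡ = proj₁ (proj₂ (proj₂ splitB))
    runC : run c (c (flip {G} f)) C π₀
    runC = proj₂ (proj₂ (proj₂ splitB))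
    splitb = run-split A' runb
    runA' : run c (π b) A' (c f')
    runA' = subst (run c (π b) A') (proj₁ (proj₂ (proj₂ splitb))) (proj₁ (proj₂ splitb))
    runC' : run c (c (flip {G} f')) C' (π b)
    runC' = proj₂ (proj₂ (proj₂ splitb))
    around : run c (c (flip {G} f')) (C' ++ A') (c f')
    around = run-++ C' runC' runA'
    Turned : List (Flag G) → Set
    Turned W = run c (c f) W (c (flip {G} f)) × (flags W ↭ flags (C' ++ A')) ×
      (c f' ≡ c f ⊎ c f' ≡ c (flip {G} f)) × (c (flip {G} f') ≡ c f ⊎ c (flip {G} f') ≡ c (flip {G} f))
    opp : ∀ t → c ((b , a) , not (t xor sig a b)) ≡ c ((a , b) , t)
    opp t = inv t ed
    -- Both signs and the signature decide how the sides of the edge correspond. In the second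
    -- alternative the rotation at `b` has to be inserted backwards.
    turn : ∀ s s' z → sig a b ≡ z →
      ((c ((b , a) , not s') ≡ c ((a , b) , s)) × (c ((b , a) , s') ≡ c ((a , b) , not s))) ⊎
      ((c ((b , a) , s') ≡ c ((a , b) , s)) × (c ((b , a) , not s') ≡ c ((a , b) , not s)))
    turn s s' z e with opp true | opp false
    turn true true true e | o | o' rewrite e = inj₂ (o , o')
    turn true true false e | o | o' rewrite e = inj₁ (o , o')
    turn true false true e | o | o' rewrite e = inj₁ (o , o')
    turn true false false e | o | o' rewrite e = inj₂ (o , o')
    turn false true true e | o | o' rewrite e = inj₁ (o' , o)
    turn false true false e | o | o' rewrite e = inj₂ (o' , o)
    turn false false true e | o | o' rewrite e = inj₂ (o' , o)
    turn false false false e | o | o' rewrite e = inj₁ (o' , o)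
    turned : Σ (List (Flag G)) Turned
    turned with turn s s' (sig a b) refl
    ... | inj₁ (e₁ , e₂) = C' ++ A' , subst (run c _ (C' ++ A')) e₂ (subst (λ z → run c z (C' ++ A') (c f')) e₁ around) ,
            ↭-refl , inj₂ e₂ , inj₁ e₁
    ... | inj₂ (e₁ , e₂) = rev (C' ++ A') ,
            subst (run c _ (rev (C' ++ A'))) e₂ (subst (λ z → run c z (rev (C' ++ A')) (c (flip {G} f'))) e₁ (run-rev (C' ++ A') around)) ,
            flags-rev (C' ++ A') , inj₁ e₁ , inj₂ e₂
    W = proj₁ turned
    runW = proj₁ (proj₂ turned)
    W↭ = proj₁ (proj₂ (proj₂ turned))
    B' = A ++ W ++ C
    Seen : Fin k → Set
    Seen i = i ≡ π₀ ⊎ (∃ λ v → (v ∈ Vs') × (π v ≡ i)) ⊎ (∃ λ g → (g ∈ flags B' ⊎ g ∈ flags (lists Vs')) × (c g ≡ i))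
    B'≡ : flags B' ≡ flags A ++ flags W ++ flags C
    B'≡ = trans (flags-++ A (W ++ C)) (cong (flags A ++_) (flags-++ W C))
    inA : ∀ {g} → g ∈ flags A → g ∈ flags B'
    inA p = subst (_ ∈_) (sym B'≡) (∈-++⁺ˡ p)
    inW : ∀ {g} → g ∈ flags W → g ∈ flags B'
    inW p = subst (_ ∈_) (sym B'≡) (∈-++⁺ʳ (flags A) (∈-++⁺ˡ p))
    inC : ∀ {g} → g ∈ flags C → g ∈ flags B'
    inC p = subst (_ ∈_) (sym B'≡) (∈-++⁺ʳ (flags A) (∈-++⁺ʳ (flags W) p))
    inCA : ∀ {g} → g ∈ flags C' ⊎ g ∈ flags A' → g ∈ flags B'
    inCA p = inW (∈-resp-↭ (↭-sym W↭) (subst (_ ∈_) (sym (flags-++ C' A'))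
      ([ ∈-++⁺ˡ , ∈-++⁺ʳ (flags C') ]′ p)))
    seen-f : Seen (c f)
    seen-f = [ (λ e → inj₁ (trans (sym γ≡) e)) , (λ (w , w∈ , e) → inj₂ (inj₂ (w , inj₁ (inA w∈) , trans e γ≡))) ]′ (run-end A runA)
    seen-ff : Seen (c (flip {G} f))
    seen-ff = [ (λ e → subst Seen (sym e) seen-f) , (λ (w , w∈ , e) → inj₂ (inj₂ (w , inj₁ (inW w∈) , e))) ]′ (run-end W runW)
    seen-f' : Seen (c f')
    seen-f' = [ (λ e → subst Seen (sym e) seen-f) , (λ e → subst Seen (sym e) seen-ff) ]′ (proj₁ (proj₂ (proj₂ (proj₂ turned))))
    seen-ff' : Seen (c (flip {G} f'))
    seen-ff' = [ (λ e → subst Seen (sym e) seen-f) , (λ e → subst Seen (sym e) seen-ff) ]′ (proj₂ (proj₂ (proj₂ (proj₂ turned))))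
    seen-π : Seen (π b)
    seen-π = [ (λ e → subst Seen (sym e) seen-ff') , (λ (w , w∈ , e) → inj₂ (inj₂ (w , inj₁ (inCA (inj₁ w∈)) , e))) ]′ (run-end C' runC')
    seen-b : ∀ {g} → g ∈ flags (L b) → Seen (c g)
    seen-b {g} p with ∈-resp-↭ (flags-mid A' f' C') (subst (λ l → g ∈ flags l) Lb≡ p)
    ... | here refl = seen-f'
    ... | there (here refl) = seen-ff'
    ... | there (there q) = inj₂ (inj₂ (g , inj₁ (inCA ([ inj₂ , inj₁ ]′ (∈-++⁻ (flags A') (subst (g ∈_) (flags-++ A' C') q)))) , refl))
    seen-B : ∀ {g} → g ∈ flags (A ++ f ∷ C) → Seen (c g)
    seen-B {g} p with ∈-resp-↭ (flags-mid A f C) p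
    ... | here refl = seen-f
    ... | there (here refl) = seen-ff
    ... | there (there q) = inj₂ (inj₂ (g , inj₁ ([ inA , inC ]′ (∈-++⁻ (flags A) (subst (g ∈_) (flags-++ A C) q))) , refl))
    cov : ∀ i → Seen i
    cov i with cover i
    ... | inj₁ e = inj₁ e
    ... | inj₂ (inj₁ (v , v∈ , refl)) with ∈-resp-↭ Vs↭ v∈
    ...   | here refl = seen-π
    ...   | there q = inj₂ (inj₁ (v , q , refl))
    cov i | inj₂ (inj₂ (g , inj₁ p , refl)) = seen-B p
    cov i | inj₂ (inj₂ (g , inj₂ p , refl)) with ∈-lists⁻ Vs p
    ...   | v , v∈ , q with ∈-resp-↭ Vs↭ v∈
    ...     | here refl = seen-b q
    ...     | there r = inj₂ (inj₂ (g , inj₂ (∈-lists⁺ r q) , refl))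
    blob : Blob k B' Vs'
    blob = record
      { c = c ; π₀ = π₀ ; π = π ; inv = inv
      ; runB = run-++ A (subst (run c π₀ A) γ≡ runA) (run-++ W runW runC)
      ; runV = λ v∈ → runV (∈-resp-↭ (↭-sym Vs↭) (there v∈))
      ; cover = cov }
    tA = tails A
    tC = tails C
    tA' = tails A'
    tC' = tails C'
    Q↭ : tails A' ++ tails C' ↭ tails W
    Q↭ = ↭-trans (++-comm tA' tC') (↭-trans (↭-reflexive (sym (map-++ proj₁ C' A')))
      (↭-sym (flags-↭⇒tails-↭ W (C' ++ A') W↭)))
    perm : tails (A ++ f ∷ C) ++ tails (L b) ↭ (a , b) ∷ (b , a) ∷ tails B'
    perm = ↭-trans (++⁺ (↭-trans (↭-reflexive (map-++ proj₁ A (f ∷ C))) (shift (a , b) tA tC))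
                        (↭-trans (↭-reflexive (trans (cong tails Lb≡) (map-++ proj₁ A' (f' ∷ C')))) (shift (b , a) tA' tC')))
      (prep _ (↭-trans (shift (b , a) (tA ++ tC) (tA' ++ tC'))
        (prep _ (↭-trans (↭-reflexive (++-assoc tA tC (tA' ++ tC')))
          (↭-trans (++⁺ˡ tA (↭-trans (++-comm tC (tA' ++ tC')) (++⁺ʳ tC Q↭)))
            (↭-reflexive (sym (trans (map-++ proj₁ A (W ++ C)) (cong (tA ++_) (map-++ proj₁ W C))))))))))

  crossing : ∀ {r v} Vs → r ∉ Vs → v ∈ Vs → Walk G r v →
    ∃ λ a → ∃ λ b → (a ∉ Vs) × (b ∈ Vs) × T (Edge G a b)
  crossing Vs r∉ v∈ here = ⊥-elim (r∉ v∈)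
  crossing Vs r∉ v∈ (step {a} {b} e w) with b ∈? Vs
  ... | yes b∈ = a , b , r∉ , b∈ , e
  ... | no b∉ = crossing Vs b∉ v∈ w

  -- As long as a vertex is left, its walk to the root of its component leaves `Vs`, so some edge
  -- joins `Vs` to the merged vertex. Contracting it uses up one vertex and one edge and no colour,
  -- and at the end a bouquet remains.
  contract-all : ∀ N Vs → length Vs ≤ N → ∀ Es {k} B → nodes Es ↭ tails B ++ tails (lists Vs) → Edges Es →
    (∀ {v} → v ∈ Vs → v ∉ roots G) → Blob k B Vs → k + length Vs ≤ suc (length Es)
  contract-all N [] le Es {k} B p E nr Bl = ≤-trans (≤-reflexive (ℕₚ.+-identityʳ k))
      (bouquet-bound Es B (↭-trans p (↭-reflexive (++-identityʳ (tails B)))) E C inv)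
    where
    open Blob Bl
    cov : ∀ i → i ≡ π₀ ⊎ (∃ λ v → (v ∈ flags B ++ []) × (c v ≡ i)) ⊎ i ∈ []
    cov i with cover i
    ... | inj₁ e = inj₁ e
    ... | inj₂ (inj₁ (_ , () , _))
    ... | inj₂ (inj₂ (f , inj₁ q , e)) = inj₂ (inj₁ (f , ∈-++⁺ˡ q , e))
    ... | inj₂ (inj₂ (f , inj₂ () , e))
    C : Coloured k [] B [] []
    C = record { c = c ; α = π₀ ; β = π₀ ; mono = [] ; runx = runB ; runy = refl ; cover = cov }
  contract-all (suc N) Vs@(v₀ ∷ _) le Es {k} B p E nr Bl with root-of G v₀
  ... | r , r∈ , w with crossing Vs (λ q → nr q r∈) (here refl) (walk-sym G w)
  ... | a , b , a∉ , b∈ , ed with extract b∈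
  ... | Vs' , Vs↭ = go (contract-edge Bl Vs↭ ed ab∈B ba∈L)
    where
    ba∈L : (b , a) ∈ tails (L b)
    ba∈L = flags⇒dart (L b) (L-complete true (edge-sym G {a} {b} ed))
    ab∈nodes : ∀ {Es'} → nodes Es ↭ (b , a) ∷ (a , b) ∷ nodes Es' → (a , b) ∈ tails B ++ tails (lists Vs)
    ab∈nodes q = ∈-resp-↭ p (∈-resp-↭ (↭-sym q) (there (here refl)))
    ba∈nodes : (b , a) ∈ nodes Es
    ba∈nodes = ∈-resp-↭ (↭-sym p) (∈-++⁺ʳ (tails B)
      (flags⇒dart (lists Vs) (∈-lists⁺ b∈ (dart⇒flags (L b) true ba∈L))))
    found : Σ (List (Dart G × Dart G)) λ Es' → (nodes Es ↭ (b , a) ∷ (a , b) ∷ nodes Es') × Edges Es' ×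
      (length Es ≡ suc (length Es'))
    found with node-extract {M = Es} ba∈nodes
    ... | g , Es' , e with _≋_.to e (λ d d' → (d' ≡ reverseDart d) × IsDart G d) edges-sym E
    ... | (refl , _) ∷ E' = Es' , _≋_.nodes↭ e , E' , _≋_.length≡ e
    ab∈B : (a , b) ∈ tails B
    ab∈B = [ id , (λ q → ⊥-elim (a∉ (proj₁ (∈-tails-lists⁻ Vs q)))) ]′ (∈-++⁻ (tails B) (ab∈nodes (proj₁ (proj₂ found))))
    go : (∃ λ B' → Blob k B' Vs' × (tails B ++ tails (L b) ↭ (a , b) ∷ (b , a) ∷ tails B')) →
      k + length Vs ≤ suc (length Es)
    go (B' , Bl' , q) = ≤-trans (≤-reflexive (trans (cong (k +_) (↭-length Vs↭)) (ℕₚ.+-suc k (length Vs'))))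
      (≤-trans (s≤s (contract-all N Vs' (ℕₚ.≤-pred (≤-trans (≤-reflexive (sym (↭-length Vs↭))) le)) (proj₁ found) B'
        (flip-drop (↭-trans (↭-sym (proj₁ (proj₂ found))) (↭-trans p all↭))) (proj₁ (proj₂ (proj₂ found)))
        (λ v∈ → nr (∈-resp-↭ (↭-sym Vs↭) (there v∈))) Bl'))
        (≤-reflexive (cong suc (sym (proj₂ (proj₂ (proj₂ found)))))))
      where
      flip-drop : ∀ {d d' : Dart G} {X Y} → d ∷ d' ∷ X ↭ d' ∷ d ∷ Y → X ↭ Y
      flip-drop z = drop-∷ (drop-∷ (↭-trans (swap _ _ ↭-refl) z))
      all↭ : tails B ++ tails (lists Vs) ↭ (a , b) ∷ (b , a) ∷ tails B' ++ tails (lists Vs')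
      all↭ = ↭-trans (++⁺ˡ (tails B) (↭-trans (lists-↭ Vs↭) (↭-reflexive (map-++ proj₁ (L b) (lists Vs')))))
        (↭-trans (↭-reflexive (sym (++-assoc (tails B) (tails (L b)) (tails (lists Vs')))))
          (++⁺ʳ (tails (lists Vs')) q))

  -- A root is joined to the merged vertex without using an edge, by concatenating the two
  -- rotations. For this the colours of the two cut corners must agree, which costs at most one
  -- colour for each root.
  absorb : ∀ rs Ws {k} B → Blob k B (rs ++ Ws) → ∃ λ k' → ∃ λ B' → (k ≤ length rs + k') × Blob k' B' Ws ×
    (tails B' ++ tails (lists Ws) ≡ tails B ++ tails (lists (rs ++ Ws)))
  absorb [] Ws {k} B Bl = k , B , ≤-refl , Bl , refl
  absorb (r ∷ rs) Ws {k} B Bl with merge (Blob.π₀ Bl) (Blob.π Bl r)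
  ... | k₁ , k≤ , h , he , sur with absorb rs Ws (B ++ L r) blob
    where
    open Blob Bl
    Vs = rs ++ Ws
    B₁ = B ++ L r
    cov : ∀ i → i ≡ h π₀ ⊎ (∃ λ v → (v ∈ Vs) × (h (π v) ≡ i)) ⊎
              (∃ λ f → (f ∈ flags B₁ ⊎ f ∈ flags (lists Vs)) × (h (c f) ≡ i))
    cov i with sur i
    ... | m , refl with cover m
    ... | inj₁ e = inj₁ (cong h e)
    ... | inj₂ (inj₁ (v , here refl , e)) = inj₁ (trans (cong h (sym e)) (sym he))
    ... | inj₂ (inj₁ (v , there v∈ , e)) = inj₂ (inj₁ (v , v∈ , cong h e))
    ... | inj₂ (inj₂ (f , inj₁ p , e)) = inj₂ (inj₂ (f , inj₁ (subst (f ∈_) (sym (flags-++ B (L r))) (∈-++⁺ˡ p)) , cong h e))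
    ... | inj₂ (inj₂ (f , inj₂ p , e)) with ∈-++⁻ (flags (L r)) (subst (f ∈_) (flags-++ (L r) (lists Vs)) p)
    ... | inj₁ q = inj₂ (inj₂ (f , inj₁ (subst (f ∈_) (sym (flags-++ B (L r))) (∈-++⁺ʳ (flags B) q)) , cong h e))
    ... | inj₂ q = inj₂ (inj₂ (f , inj₂ q , cong h e))
    blob : Blob k₁ B₁ Vs
    blob = record
      { c = h ∘ c ; π₀ = h π₀ ; π = h ∘ π ; inv = λ s e → cong h (inv s e)
      ; runB = run-++ B (run-lift h B (λ _ → refl) runB)
          (subst (λ z → run (h ∘ c) z (L r) z) (sym he) (run-lift h (L r) (λ _ → refl) (runV (here refl))))
      ; runV = λ {v} v∈ → run-lift h (L v) (λ _ → refl) (runV (there v∈))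
      ; cover = cov }
  ... | k' , B' , k₁≤ , Bl' , eq = k' , B' , ≤-trans k≤ (s≤s k₁≤) , Bl' ,
        trans eq (trans (cong (_++ tails (lists (rs ++ Ws))) (map-++ proj₁ B (L r)))
          (trans (++-assoc (tails B) (tails (L r)) _) (cong (tails B ++_) (sym (map-++ proj₁ (L r) (lists (rs ++ Ws)))))))

  euler-inequality : ∀ {k} → Colouring G ls k → k + n G ≤ 2 * components G + edgeCount G
  euler-inequality {k} col = conclude (absorb (roots G) Ws [] start)
    where
    open Colouring col
    Ws : List (Fin (n G))
    Ws = select (not ∘ isRoot G)
    Vs = roots G ++ Ws
    every : ∀ v → v ∈ Vs
    every v = [ (λ t → ∈-++⁺ˡ (∈-select⁺ (isRoot G) t)) , (λ h → ∈-++⁺ʳ (roots G) (∈-select⁺ (not ∘ isRoot G) (not⁺ h))) ]′ (decide (T? (isRoot G v)))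
      where
      decide : ∀ {X : Set} → Dec X → X ⊎ ¬ X
      decide (yes p) = inj₁ p
      decide (no h) = inj₂ h
    uqV : Unique Vs
    uqV = Uniqₚ.++⁺ (unique-select (isRoot G)) (unique-select (not ∘ isRoot G))
      λ { (p , q) → not⁻ (∈-select⁻ (not ∘ isRoot G) q) (∈-select⁻ (isRoot G) p) }
    n≡ : length (roots G) + length Ws ≡ n G
    n≡ = trans (sym (length-++ (roots G))) (trans (unique-set⇒length≡ uqV (unique-select {n G} (λ _ → true))
      (λ _ → ∈-select⁺ (λ _ → true) tt) (λ {z} _ → every z)) (length-everyFin (n G)))
    -- An artificial vertex with empty rotation and a colour of its own, `zero`, serves as the first
    -- merged vertex, so that all roots are absorbed alike. This explains the `suc`.
    start : Blob (suc k) [] Vs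
    start = record
      { c = suc ∘ c ; π₀ = zero ; π = suc ∘ π ; inv = λ s e → cong suc (opposite-inv s e)
      ; runB = refl ; runV = λ {v} _ → run-lift suc (L v) (λ _ → refl) (runs v)
      ; cover = cov }
      where
      cov : ∀ i → i ≡ zero ⊎ (∃ λ v → (v ∈ Vs) × (suc (π v) ≡ i)) ⊎
        (∃ λ f → (f ∈ flags [] ⊎ f ∈ flags (lists Vs)) × (suc (c f) ≡ i))
      cov zero = inj₁ refl
      cov (suc i) with cover i
      ... | inj₁ (v , e) = inj₂ (inj₁ (v , every v , cong suc e))
      ... | inj₂ (((a , b) , s) , d , e) = inj₂ (inj₂ (((a , b) , s) , inj₂ (∈-lists⁺ (every a) (L-complete s d)) , cong suc e))
    edges : Σ (List (Dart G × Dart G)) λ P → (nodes P ↭ darts G) × AllPair (λ u v → v ≡ reverseDart u) P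
    edges = pairing reverseDart (darts G) (unique-pairsWhere G (Edge G))
      (λ { {a , b} p → ∈-pairsWhere⁺ G (Edge G) (edge-sym G {a} {b} (∈-pairsWhere⁻ G (Edge G) p)) })
      (λ _ → refl)
      λ { {a , b} p e → edge-≢ G (∈-pairsWhere⁻ G (Edge G) p) (sym (cong proj₁ e)) }
    Es = proj₁ edges
    Es-edges : ∀ Q → (∀ {d} → d ∈ nodes Q → IsDart G d) → AllPair (λ u v → v ≡ reverseDart u) Q → Edges Q
    Es-edges [] h [] = []
    Es-edges (_ ∷ Q) h (e ∷ a) = (e , h (here refl)) ∷ Es-edges Q (λ p → h (there (there p))) a
    E : Edges Es
    E = Es-edges Es (λ { {a , b} p → ∈-pairsWhere⁻ G (Edge G) (∈-resp-↭ (proj₁ (proj₂ edges)) p) }) (proj₂ (proj₂ edges))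
    length-Es : length Es ≡ edgeCount G
    length-Es = double-injective _ _ (trans (sym (length-nodes Es)) (trans (↭-length (proj₁ (proj₂ edges))) (length-darts G)))
    all↭ : nodes Es ↭ tails (lists Vs)
    all↭ = ↭-trans (proj₁ (proj₂ edges)) (unique-set⇒↭ (unique-pairsWhere G (Edge G)) (unique-lists uqV)
      (λ { {a , b} p → flags⇒dart (lists Vs) (∈-lists⁺ (every a) (L-complete true (∈-pairsWhere⁻ G (Edge G) p))) })
      (λ { {a , b} p → ∈-pairsWhere⁺ G (Edge G) (proj₂ (L-sound a (dart⇒flags (L a) true (proj₂ (∈-tails-lists⁻ Vs p))))) }))
    conclude : (∃ λ k' → ∃ λ B' → (suc k ≤ length (roots G) + k') × Blob k' B' Ws ×
      (tails B' ++ tails (lists Ws) ≡ tails (lists Vs))) → k + n G ≤ 2 * components G + edgeCount G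
    conclude (k' , B' , k≤ , Bl , eq) = ≤-trans (≤-reflexive (cong (k +_) (trans (sym n≡) (cong (_+ w) (length-roots G)))))
        (arith (components G) k' (≤-trans k≤ (≤-reflexive (cong (_+ k') (length-roots G)))) inner)
      where
      w = length Ws
      inner : k' + w ≤ suc (edgeCount G)
      inner = ≤-trans (contract-all w Ws ≤-refl Es B' (↭-trans all↭ (↭-reflexive (sym eq))) E
        (λ p q → not⁻ (∈-select⁻ (not ∘ isRoot G) p) (∈-select⁻ (isRoot G) q)) Bl) (≤-reflexive (cong suc length-Es))
      -- There are `c` roots among the `c + w` vertices. Absorbing them costs at most `c` of the
      -- `k + 1` colours, and the edges bound what remains; the second `c` counts the roots as
      -- vertices.
      arith : ∀ c k' → suc k ≤ c + k' → k' + w ≤ suc (edgeCount G) → k + (c + w) ≤ 2 * c + edgeCount G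
      arith c k' p q = ℕₚ.≤-pred (begin
        suc (k + (c + w))            ≡⟨ solve 3 (λ k c w → con 1 :+ (k :+ (c :+ w)) := c :+ ((con 1 :+ k) :+ w)) refl k c w ⟩
        c + (suc k + w)              ≤⟨ ℕₚ.+-monoʳ-≤ c (ℕₚ.+-monoˡ-≤ w p) ⟩
        c + (c + k' + w)             ≡⟨ solve 3 (λ c k w → c :+ (c :+ k :+ w) := c :+ c :+ (k :+ w)) refl c k' w ⟩
        c + c + (k' + w)             ≤⟨ ℕₚ.+-monoʳ-≤ (c + c) q ⟩
        c + c + suc (edgeCount G)    ≡⟨ solve 2 (λ c e → c :+ c :+ (con 1 :+ e) := con 1 :+ (con 2 :* c :+ e)) refl c (edgeCount G) ⟩
        suc (2 * c + edgeCount G)    ∎)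
        where
        open ℕₚ.≤-Reasoning
        open import Data.Nat.Solver using (module +-*-Solver)
        open +-*-Solver

-- xy-sums

samePair⁺ : ∀ {m} {a b u v : Fin m} → (a ≡ u × b ≡ v) ⊎ (a ≡ v × b ≡ u) → T (samePair a b u v)
samePair⁺ {a = a} {b} (inj₁ (refl , refl)) = ∨⁺ˡ (∧⁺ (=ᶠ⁺ {i = a} refl) (=ᶠ⁺ {i = b} refl))
samePair⁺ {a = a} {b} {u} {v} (inj₂ (refl , refl)) =
  ∨⁺ʳ {(a =ᶠ u) ∧ (b =ᶠ v)} (∧⁺ (=ᶠ⁺ {i = a} refl) (=ᶠ⁺ {i = b} refl))

samePair⁻ : ∀ {m} {a b u v : Fin m} → T (samePair a b u v) → (a ≡ u × b ≡ v) ⊎ (a ≡ v × b ≡ u)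
samePair⁻ {a = a} {b} {u} {v} t with ∨⁻ {(a =ᶠ u) ∧ (b =ᶠ v)} t
... | inj₁ p = inj₁ (=ᶠ⁻ (∧⁻ˡ {a =ᶠ u} p) , =ᶠ⁻ (∧⁻ʳ {a =ᶠ u} p))
... | inj₂ p = inj₂ (=ᶠ⁻ (∧⁻ˡ {a =ᶠ v} p) , =ᶠ⁻ (∧⁻ʳ {a =ᶠ v} p))

samePair-sym : ∀ {m} (a b : Fin m) {u v} → T (samePair a b u v) → T (samePair b a u v)
samePair-sym a b t = samePair⁺ {a = b} ([ (λ (p , r) → inj₂ (r , p)) , (λ (p , r) → inj₁ (r , p)) ]′ (samePair⁻ {a = a} t))

samePair-map : ∀ {m k} (f : Fin m → Fin k) {u v u' v'} → f u ≡ u' → f v ≡ v' → ∀ a b →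
  T (samePair a b u v) → T (samePair (f a) (f b) u' v')
samePair-map f fu fv a b t = samePair⁺ {a = f a} ([ (λ (p , r) → inj₁ (trans (cong f p) fu , trans (cong f r) fv)) ,
  (λ (p , r) → inj₂ (trans (cong f p) fv , trans (cong f r) fu)) ]′ (samePair⁻ {a = a} t))

samePair-reflect : ∀ {m k} (f : Fin m → Fin k) → (∀ a b → f a ≡ f b → a ≡ b) → ∀ {u v u' v'} → f u ≡ u' → f v ≡ v' → ∀ a b →
  T (samePair (f a) (f b) u' v') → T (samePair a b u v)
samePair-reflect f inj fu fv a b t = samePair⁺ {a = a} ([
  (λ (p , r) → inj₁ (inj _ _ (trans p (sym fu)) , inj _ _ (trans r (sym fv)))) ,
  (λ (p , r) → inj₂ (inj _ _ (trans p (sym fv)) , inj _ _ (trans r (sym fu)))) ]′ (samePair⁻ {a = f a} t))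

xySum-sym : ∀ {G G₁ G₂} → IsXYSum G G₁ G₂ → IsXYSum G G₂ G₁
xySum-sym s = record
  { f₁ = f₂ ; f₂ = f₁ ; f₁-inj = f₂-inj ; f₂-inj = f₁-inj
  ; f₁x = f₂x ; f₁y = f₂y ; f₂x = f₁x ; f₂y = f₁y
  ; cover = λ v → [ inj₂ , inj₁ ]′ (cover v)
  ; overlap₁₂ = λ a b e → [ (λ (p , q) → inj₁ (q , p)) , (λ (p , q) → inj₂ (q , p)) ]′ (overlap₁₂ b a (sym e))
  ; edge→ = λ u v t → [ inj₂ , inj₁ ]′ (edge→ u v t)
  ; edge₁ = edge₂ ; edge₂ = edge₁ }
  where open IsXYSum s

XYEdge : TGraph → Set
XYEdge G = T (Edge G (x G) (y G))

-- Both summands contain `xy`, so the sum is an amalgamation along an edge: two vertices, one edge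
-- and one component are counted twice.
module SumCounts {H H₁ H₂ : TGraph} (s : IsXYSum H H₁ H₂) (e₁ : XYEdge H₁) (e₂ : XYEdge H₂) where

  open IsXYSum s

  x≢y : x H ≢ y H
  x≢y e = edge-≢ H₁ e₁ (f₁-inj _ _ (trans f₁x (trans e (sym f₁y))))

  xy-edge : XYEdge H
  xy-edge = subst₂ (λ a b → T (Edge H a b)) f₁x f₁y (edge₁ _ _ e₁)

  inner? : Fin (n H₂) → Bool
  inner? b = not (b =ᶠ x H₂) ∧ not (b =ᶠ y H₂)

  inner⁺ : ∀ {b} → b ≢ x H₂ → b ≢ y H₂ → T (inner? b)
  inner⁺ {b} p q = ∧⁺ (not⁺ λ t → p (=ᶠ⁻ t)) (not⁺ λ t → q (=ᶠ⁻ t))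

  inner⁻ : ∀ {b} → T (inner? b) → (b ≢ x H₂) × (b ≢ y H₂)
  inner⁻ {b} t = (λ e → not⁻ (∧⁻ˡ t) (=ᶠ⁺ e)) , (λ e → not⁻ (∧⁻ʳ {not (b =ᶠ x H₂)} t) (=ᶠ⁺ e))

  inner₂ : List (Fin (n H₂))
  inner₂ = select inner?

  vertex-count : suc (suc (n H)) ≡ n H₁ + n H₂
  vertex-count = trans (cong (λ z → suc (suc z)) nH) (trans (sym (trans (ℕₚ.+-suc (n H₁) _) (cong suc (ℕₚ.+-suc (n H₁) _))))
      (cong (n H₁ +_) n₂))
    where
    n₂ : suc (suc (length inner₂)) ≡ n H₂
    n₂ = trans (unique-set⇒length≡ {xs = x H₂ ∷ y H₂ ∷ inner₂} {everyFin (n H₂)}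
        ((edge-≢ H₂ e₂ ∷ All.tabulate (λ p e → proj₁ (inner⁻ (∈-select⁻ inner? p)) (sym e))) ∷
          All.tabulate (λ p e → proj₂ (inner⁻ (∈-select⁻ inner? p)) (sym e)) ∷ unique-select inner?)
        (unique-select {n H₂} (λ _ → true)) (λ _ → ∈-select⁺ (λ _ → true) tt) back)
      (length-everyFin (n H₂))
      where
      back : ∀ {z} → z ∈ everyFin (n H₂) → z ∈ x H₂ ∷ y H₂ ∷ inner₂
      back {z} _ with z ≟ᶠ x H₂ | z ≟ᶠ y H₂
      ... | yes e | _ = here e
      ... | no _ | yes e = there (here e)
      ... | no p | no q = there (there (∈-select⁺ inner? (inner⁺ p q)))
    uq : Unique (map f₁ (everyFin (n H₁)) ++ map f₂ inner₂)
    uq = Uniqₚ.++⁺ (Uniqₚ.map⁺ (λ {a} {b} → f₁-inj a b) (unique-select {n H₁} (λ _ → true)))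
      (Uniqₚ.map⁺ (λ {a} {b} → f₂-inj a b) (unique-select inner?)) λ (p , q) → disj p q
      where
      disj : ∀ {v} → v ∈ map f₁ (everyFin (n H₁)) → v ∈ map f₂ inner₂ → ⊥
      disj p q with ∈-map⁻ f₁ p | ∈-map⁻ f₂ q
      ... | a , _ , e | b , b∈ , e' with overlap₁₂ a b (trans (sym e) e')
      ... | inj₁ (_ , r) = proj₁ (inner⁻ (∈-select⁻ inner? b∈)) r
      ... | inj₂ (_ , r) = proj₂ (inner⁻ (∈-select⁻ inner? b∈)) r
    reach : ∀ {v} → v ∈ everyFin (n H) → v ∈ map f₁ (everyFin (n H₁)) ++ map f₂ inner₂
    reach {v} _ with cover v
    ... | inj₁ (a , refl) = ∈-++⁺ˡ (∈-map⁺ f₁ (∈-select⁺ (λ _ → true) tt))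
    ... | inj₂ (b , refl) with b ≟ᶠ x H₂ | b ≟ᶠ y H₂
    ...   | yes refl | _ = ∈-++⁺ˡ (subst (_∈ map f₁ (everyFin (n H₁))) (trans f₁x (sym f₂x)) (∈-map⁺ f₁ (∈-select⁺ (λ _ → true) tt)))
    ...   | no _ | yes refl = ∈-++⁺ˡ (subst (_∈ map f₁ (everyFin (n H₁))) (trans f₁y (sym f₂y)) (∈-map⁺ f₁ (∈-select⁺ (λ _ → true) tt)))
    ...   | no p | no q = ∈-++⁺ʳ (map f₁ (everyFin (n H₁))) (∈-map⁺ f₂ (∈-select⁺ inner? (inner⁺ p q)))
    nH : n H ≡ n H₁ + length inner₂
    nH = trans (sym (length-everyFin (n H))) (trans (unique-set⇒length≡ (unique-select {n H} (λ _ → true)) uq reach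
        (λ _ → ∈-select⁺ (λ _ → true) tt))
      (trans (length-++ (map f₁ (everyFin (n H₁)))) (cong₂ _+_
        (trans (length-map f₁ (everyFin (n H₁))) (length-everyFin (n H₁))) (length-map f₂ inner₂))))

  proper? : Fin (n H₂) → Fin (n H₂) → Bool
  proper? a b = Edge H₂ a b ∧ not (samePair a b (x H₂) (y H₂))

  -- Darts are counted in place of edges, and the equation is then halved. The two darts of `xy` are
  -- the only ones common to both summands.
  edge-count : suc (edgeCount H) ≡ edgeCount H₁ + edgeCount H₂
  edge-count = double-injective _ _ (begin
      suc (edgeCount H) + suc (edgeCount H)                 ≡⟨ cong suc (ℕₚ.+-suc _ _) ⟩
      suc (suc (edgeCount H + edgeCount H))                 ≡⟨ cong (λ z → suc (suc z)) (trans (sym (length-darts H)) dH) ⟩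
      suc (suc (length (darts H₁) + length D₂))             ≡⟨ sym (trans (ℕₚ.+-suc _ _) (cong suc (ℕₚ.+-suc _ _))) ⟩
      length (darts H₁) + suc (suc (length D₂))             ≡⟨ cong₂ _+_ (length-darts H₁) (trans d₂ (length-darts H₂)) ⟩
      (edgeCount H₁ + edgeCount H₁) + (edgeCount H₂ + edgeCount H₂) ≡⟨ solve 2 (λ a b → (a :+ a) :+ (b :+ b) := (a :+ b) :+ (a :+ b)) refl (edgeCount H₁) (edgeCount H₂) ⟩
      (edgeCount H₁ + edgeCount H₂) + (edgeCount H₁ + edgeCount H₂) ∎)
    where
    open ≡-Reasoning
    open import Data.Nat.Solver using (module +-*-Solver)
    open +-*-Solver
    D₂ : List (Dart H₂)
    D₂ = pairsWhere H₂ proper?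
    proper⁻ : ∀ {a b} → (a , b) ∈ D₂ → T (Edge H₂ a b) × ¬ T (samePair a b (x H₂) (y H₂))
    proper⁻ {a} {b} p = ∧⁻ˡ (∈-pairsWhere⁻ H₂ proper? p) , not⁻ (∧⁻ʳ {Edge H₂ a b} (∈-pairsWhere⁻ H₂ proper? p))
    d₂ : suc (suc (length D₂)) ≡ length (darts H₂)
    d₂ = unique-set⇒length≡ {xs = (x H₂ , y H₂) ∷ (y H₂ , x H₂) ∷ D₂}
        (((λ e → edge-≢ H₂ e₂ (cong proj₁ e)) ∷ All.tabulate (λ { {a , b} p refl → proj₂ (proper⁻ p) (samePair⁺ {a = x H₂} (inj₁ (refl , refl))) })) ∷
          All.tabulate (λ { {a , b} p refl → proj₂ (proper⁻ p) (samePair⁺ {a = y H₂} (inj₂ (refl , refl))) }) ∷ unique-pairsWhere H₂ proper?)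
        (unique-pairsWhere H₂ (Edge H₂)) to from
      where
      to : ∀ {z} → z ∈ (x H₂ , y H₂) ∷ (y H₂ , x H₂) ∷ D₂ → z ∈ darts H₂
      to (here refl) = ∈-pairsWhere⁺ H₂ (Edge H₂) e₂
      to (there (here refl)) = ∈-pairsWhere⁺ H₂ (Edge H₂) (edge-sym H₂ {x H₂} {y H₂} e₂)
      to {a , b} (there (there p)) = ∈-pairsWhere⁺ H₂ (Edge H₂) (proj₁ (proper⁻ p))
      from : ∀ {z} → z ∈ darts H₂ → z ∈ (x H₂ , y H₂) ∷ (y H₂ , x H₂) ∷ D₂
      from {a , b} p with T? (samePair a b (x H₂) (y H₂))
      ... | no h = there (there (∈-pairsWhere⁺ H₂ proper? (∧⁺ {Edge H₂ a b} (∈-pairsWhere⁻ H₂ (Edge H₂) p) (not⁺ h))))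
      ... | yes t with samePair⁻ {a = a} t
      ...   | inj₁ (refl , refl) = here refl
      ...   | inj₂ (refl , refl) = there (here refl)
    F₁ : Dart H₁ → Dart H
    F₁ (a , b) = f₁ a , f₁ b
    F₂ : Dart H₂ → Dart H
    F₂ (a , b) = f₂ a , f₂ b
    uq : Unique (map F₁ (darts H₁) ++ map F₂ D₂)
    uq = Uniqₚ.++⁺ (Uniqₚ.map⁺ (λ {p} {q} e → cong₂ _,_ (f₁-inj _ _ (cong proj₁ e)) (f₁-inj _ _ (cong proj₂ e))) (unique-pairsWhere H₁ (Edge H₁)))
      (Uniqₚ.map⁺ (λ {p} {q} e → cong₂ _,_ (f₂-inj _ _ (cong proj₁ e)) (f₂-inj _ _ (cong proj₂ e))) (unique-pairsWhere H₂ proper?))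
      λ (p , q) → disj p q
      where
      disj : ∀ {z} → z ∈ map F₁ (darts H₁) → z ∈ map F₂ D₂ → ⊥
      disj p q with ∈-map⁻ F₁ p | ∈-map⁻ F₂ q
      ... | (a , b) , _ , e | (a' , b') , q' , e'
          with overlap₁₂ a a' (cong proj₁ (trans (sym e) e')) | overlap₁₂ b b' (cong proj₂ (trans (sym e) e'))
      ... | inj₁ (_ , refl) | inj₁ (_ , refl) = edge-≢ H₂ (proj₁ (proper⁻ q')) refl
      ... | inj₂ (_ , refl) | inj₂ (_ , refl) = edge-≢ H₂ (proj₁ (proper⁻ q')) refl
      ... | inj₁ (_ , refl) | inj₂ (_ , refl) = proj₂ (proper⁻ q') (samePair⁺ {a = x H₂} (inj₁ (refl , refl)))
      ... | inj₂ (_ , refl) | inj₁ (_ , refl) = proj₂ (proper⁻ q') (samePair⁺ {a = y H₂} (inj₂ (refl , refl)))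
    to : ∀ {z} → z ∈ darts H → z ∈ map F₁ (darts H₁) ++ map F₂ D₂
    to {u , v} p with edge→ u v (∈-pairsWhere⁻ H (Edge H) p)
    ... | inj₁ (a , b , refl , refl , t) = ∈-++⁺ˡ (∈-map⁺ F₁ (∈-pairsWhere⁺ H₁ (Edge H₁) t))
    ... | inj₂ (a , b , refl , refl , t) with T? (samePair a b (x H₂) (y H₂))
    ...   | no h = ∈-++⁺ʳ (map F₁ (darts H₁)) (∈-map⁺ F₂ (∈-pairsWhere⁺ H₂ proper? (∧⁺ {Edge H₂ a b} t (not⁺ h))))
    ...   | yes t' with samePair⁻ {a = a} t'
    ...     | inj₁ (refl , refl) = ∈-++⁺ˡ (subst (_∈ map F₁ (darts H₁)) (cong₂ _,_ (trans f₁x (sym f₂x)) (trans f₁y (sym f₂y)))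
                (∈-map⁺ F₁ (∈-pairsWhere⁺ H₁ (Edge H₁) e₁)))
    ...     | inj₂ (refl , refl) = ∈-++⁺ˡ (subst (_∈ map F₁ (darts H₁)) (cong₂ _,_ (trans f₁y (sym f₂y)) (trans f₁x (sym f₂x)))
                (∈-map⁺ F₁ (∈-pairsWhere⁺ H₁ (Edge H₁) (edge-sym H₁ {x H₁} {y H₁} e₁))))
    from : ∀ {z} → z ∈ map F₁ (darts H₁) ++ map F₂ D₂ → z ∈ darts H
    from p with ∈-++⁻ (map F₁ (darts H₁)) p
    ... | inj₁ q with ∈-map⁻ F₁ q
    ...   | (a , b) , q' , refl = ∈-pairsWhere⁺ H (Edge H) (edge₁ a b (∈-pairsWhere⁻ H₁ (Edge H₁) q'))
    from p | inj₂ q with ∈-map⁻ F₂ q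
    ...   | (a , b) , q' , refl = ∈-pairsWhere⁺ H (Edge H) (edge₂ a b (proj₁ (proper⁻ q')))
    dH : length (darts H) ≡ length (darts H₁) + length D₂
    dH = trans (unique-set⇒length≡ (unique-pairsWhere H (Edge H)) uq to from)
      (trans (length-++ (map F₁ (darts H₁))) (cong₂ _+_ (length-map F₁ (darts H₁)) (length-map F₂ D₂)))

  -- Colour the components of the two graphs disjointly and identify the colours at x. The colours
  -- at y then agree as well, since `xy` is an edge on both sides.
  components-≤ : components H₁ + components H₂ ≤ suc (components H)
  components-≤ with component-colouring H₁ | component-colouring H₂
  ... | κ₁ , inv₁ , sur₁ | κ₂ , inv₂ , sur₂ with merge (κ₁ (x H₁) ↑ˡ components H₂) (components H₁ ↑ʳ κ₂ (x H₂))
  ... | k' , le , h , hx , sur = ≤-trans le (s≤s (components-≥ H κ inv onto))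
    where
    glue : ∀ v → (∃ λ a → f₁ a ≡ v) ⊎ (∃ λ b → f₂ b ≡ v) → Fin k'
    glue v (inj₁ (a , _)) = h (κ₁ a ↑ˡ components H₂)
    glue v (inj₂ (b , _)) = h (components H₁ ↑ʳ κ₂ b)
    κ : Fin (n H) → Fin k'
    κ v = glue v (cover v)
    agree : ∀ a b → f₁ a ≡ f₂ b → h (κ₁ a ↑ˡ components H₂) ≡ h (components H₁ ↑ʳ κ₂ b)
    agree a b e with overlap₁₂ a b e
    ... | inj₁ (refl , refl) = hx
    ... | inj₂ (refl , refl) = trans (cong (λ z → h (z ↑ˡ components H₂)) (sym (inv₁ e₁)))
          (trans hx (cong (λ z → h (components H₁ ↑ʳ z)) (inv₂ e₂)))
    glue₁ : ∀ a z → glue (f₁ a) z ≡ h (κ₁ a ↑ˡ components H₂)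
    glue₁ a (inj₁ (a' , e)) = cong (λ z → h (κ₁ z ↑ˡ components H₂)) (f₁-inj _ _ e)
    glue₁ a (inj₂ (b , e)) = sym (agree a b (sym e))
    glue₂ : ∀ b z → glue (f₂ b) z ≡ h (components H₁ ↑ʳ κ₂ b)
    glue₂ b (inj₁ (a , e)) = agree a b e
    glue₂ b (inj₂ (b' , e)) = cong (λ z → h (components H₁ ↑ʳ κ₂ z)) (f₂-inj _ _ e)
    inv : ∀ {u v} → T (Edge H u v) → κ u ≡ κ v
    inv {u} {v} t with edge→ u v t
    ... | inj₁ (a , b , refl , refl , t') = trans (glue₁ a (cover (f₁ a)))
          (trans (cong (λ z → h (z ↑ˡ components H₂)) (inv₁ t')) (sym (glue₁ b (cover (f₁ b)))))
    ... | inj₂ (a , b , refl , refl , t') = trans (glue₂ a (cover (f₂ a)))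
          (trans (cong (λ z → h (components H₁ ↑ʳ z)) (inv₂ t')) (sym (glue₂ b (cover (f₂ b)))))
    onto : ∀ i → ∃ λ v → κ v ≡ i
    onto i with sur i
    ... | m , refl with splitAt (components H₁) m in eq
    ... | inj₁ j = let (a , e) = sur₁ j in f₁ a , trans (glue₁ a (cover (f₁ a)))
          (cong h (trans (cong (_↑ˡ components H₂) e) (Finₚ.splitAt⁻¹-↑ˡ eq)))
    ... | inj₂ j = let (b , e) = sur₂ j in f₂ b , trans (glue₂ b (cover (f₂ b)))
          (cong h (trans (cong (components H₁ ↑ʳ_) e) (Finₚ.splitAt⁻¹-↑ʳ eq)))

  -- Every component of `H` contains the image of a root of a summand, and the root of the component
  -- of x in `H₂` can be spared because `H₁` already covers that component.
  components-≥′ : suc (components H) ≤ components H₁ + components H₂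
  components-≥′ with component-colouring H | root-of H₂ (x H₂)
  ... | κ , inv , sur | r , r∈ , wr with extract r∈
  ... | R , R↭ = ≤-trans (s≤s (covered⇒≤ (map (κ ∘ f₁) (roots H₁) ++ map (κ ∘ f₂) R) cov))
      (≤-reflexive (trans (cong suc (trans (length-++ (map (κ ∘ f₁) (roots H₁))) (cong₂ _+_
          (trans (length-map _ (roots H₁)) (length-roots H₁)) (length-map _ R))))
        (trans (sym (ℕₚ.+-suc (components H₁) (length R))) (cong (components H₁ +_) (trans (sym (↭-length R↭)) (length-roots H₂))))))
    where
    inv₁ : ∀ {a b} → T (Edge H₁ a b) → κ (f₁ a) ≡ κ (f₁ b)
    inv₁ {a} {b} t = inv (edge₁ a b t)
    inv₂ : ∀ {a b} → T (Edge H₂ a b) → κ (f₂ a) ≡ κ (f₂ b)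
    inv₂ {a} {b} t = inv (edge₂ a b t)
    cov₁ : ∀ a → κ (f₁ a) ∈ map (κ ∘ f₁) (roots H₁) ++ map (κ ∘ f₂) R
    cov₁ a = let (q , q∈ , w) = root-of H₁ a in
      ∈-++⁺ˡ (subst (_∈ map (κ ∘ f₁) (roots H₁)) (sym (walk-invariant H₁ (κ ∘ f₁) inv₁ w)) (∈-map⁺ (κ ∘ f₁) q∈))
    cov₂ : ∀ b → κ (f₂ b) ∈ map (κ ∘ f₁) (roots H₁) ++ map (κ ∘ f₂) R
    cov₂ b with root-of H₂ b
    ... | q , q∈ , w with ∈-resp-↭ R↭ q∈
    ... | there q∈R = ∈-++⁺ʳ (map (κ ∘ f₁) (roots H₁)) (subst (_∈ map (κ ∘ f₂) R)
            (sym (walk-invariant H₂ (κ ∘ f₂) inv₂ w)) (∈-map⁺ (κ ∘ f₂) q∈R))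
    ... | here refl = subst (_∈ map (κ ∘ f₁) (roots H₁) ++ map (κ ∘ f₂) R)
            (trans (cong κ (trans f₁x (sym f₂x))) (trans (walk-invariant H₂ (κ ∘ f₂) inv₂ wr)
              (sym (walk-invariant H₂ (κ ∘ f₂) inv₂ w)))) (cov₁ (x H₁))
    cov : ∀ i → i ∈ map (κ ∘ f₁) (roots H₁) ++ map (κ ∘ f₂) R
    cov i with sur i
    ... | v , refl with cover v
    ... | inj₁ (a , refl) = cov₁ a
    ... | inj₂ (b , refl) = cov₂ b

  component-count : suc (components H) ≡ components H₁ + components H₂
  component-count = ℕₚ.≤-antisym components-≥′ components-≤

-- Opening rotations and listing corners

module Rotations {F : Set} (_≟_ : DecidableEquality F) (flip : F → F)
                 (flip-flip : ∀ f → flip (flip f) ≡ f) where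

  open Strands _≟_ flip flip-flip
  open Core _≟_ flip flip-flip

  -- A closed rotation is opened at a dart and read from the side `v` round to the other side,
  -- backwards if the list enters the dart at `v`. The last component shows that the colour `π` of
  -- the old cutting point stays visible.
  cut : ∀ {C : Set} {c : F → C} {π v} L → run c π L π → v ∈ flags L →
    ∃ λ R → run c (c v) R (c (flip v)) × (flags L ↭ v ∷ flip v ∷ flags R) ×
      (π ≡ c v ⊎ π ≡ c (flip v) ⊎ (∃ λ w → (w ∈ flags R) × (c w ≡ π)))
  cut {c = c} {π} {v} L r v∈ with flags-split L v∈
  ... | A , f , B , refl , o with run-split A r
  ... | γ , rA , (γ≡ , rB) = result o
    where
    around : run c (c (flip f)) (B ++ A) (c f)
    around = run-++ B rB (subst (run c π A) γ≡ rA)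
    inBA : ∀ {w} → w ∈ flags B → w ∈ flags (B ++ A)
    inBA p = subst (_ ∈_) (sym (flags-++ B A)) (∈-++⁺ˡ p)
    mid : ∀ {R u} → flags R ↭ flags (B ++ A) → u ≡ f ⊎ u ≡ flip f → flags (A ++ f ∷ B) ↭ u ∷ flip u ∷ flags R
    mid q o = ↭-trans (flags-mid′ A f B o) (prep _ (prep _ (↭-trans (comm A B) (↭-sym q))))
      where
      comm : ∀ A B → flags (A ++ B) ↭ flags (B ++ A)
      comm A B rewrite flags-++ A B | flags-++ B A = ++-comm (flags A) (flags B)
    result : v ≡ f ⊎ v ≡ flip f → ∃ λ R → run c (c v) R (c (flip v)) × (flags (A ++ f ∷ B) ↭ v ∷ flip v ∷ flags R) ×
      (π ≡ c v ⊎ π ≡ c (flip v) ⊎ (∃ λ w → (w ∈ flags R) × (c w ≡ π)))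
    result (inj₁ refl) = rev (B ++ A) , run-rev (B ++ A) around , mid (flags-rev (B ++ A)) (inj₁ refl) ,
      [ (λ e → inj₂ (inj₁ e)) , (λ (w , w∈ , e) → inj₂ (inj₂ (w , ∈-resp-↭ (↭-sym (flags-rev (B ++ A))) (inBA w∈) , e))) ]′ (run-end B rB)
    result (inj₂ refl) = B ++ A , subst (λ z → run c (c (flip f)) (B ++ A) (c z)) (sym (flip-flip f)) around ,
      mid ↭-refl (inj₂ refl) ,
      [ inj₁ , (λ (w , w∈ , e) → inj₂ (inj₂ (w , inBA w∈ , e))) ]′ (run-end B rB)

  -- The corners of a cyclic rotation as pairs of flags facing each other. The flag `h` closes the
  -- cycle and is passed on unchanged while `f` moves along.
  corners : F → F → List F → List (F × F)
  corners h f [] = (flip f , h) ∷ []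
  corners h f (g ∷ L) = (flip f , g) ∷ corners h g L

  nodes-corners : ∀ h f L → nodes (corners h f L) ↭ h ∷ flip f ∷ flags L
  nodes-corners h f [] = swap _ _ ↭-refl
  nodes-corners h f (g ∷ L) = ↭-trans (prep _ (prep _ (nodes-corners h g L)))
    (↭-trans (prep _ (swap _ _ ↭-refl)) (swap _ _ ↭-refl))

  corners⇒run : ∀ {C : Set} {c : F → C} h f L → Mono c (corners h f L) → run c (c (flip f)) L (c h)
  corners⇒run h f [] (e ∷ []) = e
  corners⇒run h f (g ∷ L) (e ∷ m) = e , corners⇒run h g L m

  run⇒corners : ∀ {C : Set} {c : F → C} h f L → run c (c (flip f)) L (c h) → Mono c (corners h f L)
  run⇒corners h f [] e = e ∷ []
  run⇒corners h f (g ∷ L) (e , r) = e ∷ run⇒corners h g L r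

flagsOf : (G : TGraph) → List (Flag G) → List (Flag G)
flagsOf G = Strands.flags (_≟ᶠˡ_ {G}) (flip {G}) (flip-flip {G})

filter-partition : ∀ {A : Set} {P Q : A → Set} (P? : ∀ a → Dec (P a)) (Q? : ∀ a → Dec (Q a)) xs →
  (∀ {a} → a ∈ xs → (P a × ¬ Q a) ⊎ (¬ P a × Q a)) → xs ↭ filter P? xs ++ filter Q? xs
filter-partition P? Q? [] h = ↭-refl
filter-partition P? Q? (a ∷ xs) h with h (here refl) | P? a | Q? a
... | inj₁ (p , q) | yes _ | no _ = prep a (filter-partition P? Q? xs (h ∘ there))
... | inj₂ (p , q) | no _ | yes _ = ↭-trans (prep a (filter-partition P? Q? xs (h ∘ there)))
      (↭-sym (shift a (filter P? xs) (filter Q? xs)))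
... | inj₁ (p , q) | no p' | _ = ⊥-elim (p' p)
... | inj₁ (p , q) | yes _ | yes q' = ⊥-elim (q q')
... | inj₂ (p , q) | yes p' | _ = ⊥-elim (p p')
... | inj₂ (p , q) | no _ | no q' = ⊥-elim (q' q)

module Terminal {H : TGraph} (ls : LScheme H) (u v : Fin (n H)) (R : List (Flag H)) (t : Bool)
    (R↭ : flagsOf H (LScheme.L ls u) ↭ ((u , v) , t) ∷ ((u , v) , not t) ∷ flagsOf H R) where

  open Strands (_≟ᶠˡ_ {H}) (flip {H}) (flip-flip {H})
  open LScheme ls

  sound : ∀ {f} → f ∈ flags R → (proj₁ (proj₁ f) ≡ u) × (proj₂ (proj₁ f) ≢ v) × IsDart H (proj₁ f)
  sound {(a , b) , z} p = proj₁ ld , (λ e → clash (proj₁ ld) e z p) , proj₂ ld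
    where
    ld = L-sound u (∈-resp-↭ (↭-sym R↭) (there (there p)))
    uq : Unique (((u , v) , t) ∷ ((u , v) , not t) ∷ flags R)
    uq = unique-↭ R↭ (L-unique u)
    clash : a ≡ u → b ≡ v → ∀ z → ((a , b) , z) ∈ flags R → ⊥
    clash refl refl z p with same-dart H ((u , v) , t) ((u , v) , z) refl
    ... | inj₁ refl = unique-head uq (there p)
    ... | inj₂ refl = unique-head (unique-tail uq) p

  complete : ∀ {w z} → T (Edge H u w) → w ≢ v → ((u , w) , z) ∈ flags R
  complete {w} {z} e w≢ with ∈-resp-↭ R↭ (L-complete z e)
  ... | here q = ⊥-elim (w≢ (cong (proj₂ ∘ proj₁) q))
  ... | there (here q) = ⊥-elim (w≢ (cong (proj₂ ∘ proj₁) q))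
  ... | there (there q) = q

  unique : Unique (flags R)
  unique = unique-tail (unique-tail (unique-↭ R↭ (L-unique u)))

module Summand {H H₁ H₂ : TGraph} (s : IsXYSum H H₁ H₂) (e₁ : XYEdge H₁) (e₂ : XYEdge H₂) where

  open Strands (_≟ᶠˡ_ {H}) (flip {H}) (flip-flip {H})
  open IsXYSum s
  module R₁ = Strands (_≟ᶠˡ_ {H₁}) (flip {H₁}) (flip-flip {H₁})
  open SumCounts (xySum-sym s) e₂ e₁ using (inner?; inner⁺; inner⁻) renaming (inner₂ to inner₁)

  F₁ : Flag H₁ → Flag H
  F₁ ((a , b) , t) = (f₁ a , f₁ b) , t

  F₁-injective : ∀ {f g} → F₁ f ≡ F₁ g → f ≡ g
  F₁-injective {(a , b) , t} {(a' , b') , t'} e = cong₂ _,_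
    (cong₂ _,_ (f₁-inj _ _ (cong (proj₁ ∘ proj₁) e)) (f₁-inj _ _ (cong (proj₂ ∘ proj₁) e))) (cong proj₂ e)

  -- The edge `xy` is common to both summands; any other edge lies in exactly one of them.
  Proper : Fin (n H₁) → Fin (n H₁) → Set
  Proper a b = T (Edge H₁ a b) × ¬ T (samePair a b (x H₁) (y H₁))

  proper-sym : ∀ {a b} → Proper a b → Proper b a
  proper-sym {a} {b} (t , h) = edge-sym H₁ {a} {b} t ,
    λ q → h (samePair-sym b a q)

  In : Dart H → Set
  In (u , v) = ∃ λ a → ∃ λ b → (f₁ a ≡ u) × (f₁ b ≡ v) × T (Edge H₁ a b)

  In? : ∀ d → Dec (In d)
  In? (u , v) = Finₚ.any? λ a → Finₚ.any? λ b → (f₁ a ≟ᶠ u) ×-dec ((f₁ b ≟ᶠ v) ×-dec T? (Edge H₁ a b))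

  inner-∈ : ∀ {a} → a ≢ x H₁ → a ≢ y H₁ → a ∈ inner₁
  inner-∈ p q = ∈-select⁺ inner? (inner⁺ p q)

  inner-∉ : ∀ {a} → a ∈ inner₁ → (a ≢ x H₁) × (a ≢ y H₁)
  inner-∉ p = inner⁻ (∈-select⁻ inner? p)

  f₁≢x : ∀ {a} → a ≢ x H₁ → f₁ a ≢ x H
  f₁≢x h e = h (f₁-inj _ _ (trans e (sym f₁x)))

  f₁≢y : ∀ {a} → a ≢ y H₁ → f₁ a ≢ y H
  f₁≢y h e = h (f₁-inj _ _ (trans e (sym f₁y)))

  inner-edge : ∀ {a v} → a ∈ inner₁ → T (Edge H (f₁ a) v) → ∃ λ b → (f₁ b ≡ v) × T (Edge H₁ a b)
  inner-edge {a} {v} a∈ e with edge→ (f₁ a) v e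
  ... | inj₁ (a' , b , p , q , t) = b , q , subst (λ z → T (Edge H₁ z b)) (f₁-inj _ _ p) t
  ... | inj₂ (a' , b , p , q , t) with overlap₁₂ a a' (sym p)
  ...   | inj₁ (r , _) = ⊥-elim (proj₁ (inner-∉ a∈) r)
  ...   | inj₂ (r , _) = ⊥-elim (proj₂ (inner-∉ a∈) r)

  kind : ∀ a → a ≡ x H₁ ⊎ a ≡ y H₁ ⊎ a ∈ inner₁
  kind a with a ≟ᶠ x H₁ | a ≟ᶠ y H₁
  ... | yes e | _ = inj₁ e
  ... | no _ | yes e = inj₂ (inj₁ e)
  ... | no p | no q = inj₂ (inj₂ (inner-∈ p q))

  inner-proper : ∀ {a b} → a ∈ inner₁ → T (Edge H₁ a b) → Proper a b
  inner-proper {a} a∈ t = t , λ r → [ (λ (e , _) → proj₁ (inner-∉ a∈) e) , (λ (e , _) → proj₂ (inner-∉ a∈) e) ]′ (samePair⁻ {a = a} r)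

  flags-map : ∀ L' → flags (map F₁ L') ≡ map F₁ (R₁.flags L')
  flags-map [] = refl
  flags-map (g ∷ L') = cong (λ z → F₁ g ∷ flip {H} (F₁ g) ∷ z) (flags-map L')

  pulled⁺ : ∀ {L L' g} → map F₁ L' ≡ L → F₁ g ∈ flags L → g ∈ R₁.flags L'
  pulled⁺ {L' = L'} {g} refl p with ∈-map⁻ F₁ (subst (F₁ g ∈_) (flags-map L') p)
  ... | g' , q , e = subst (_∈ R₁.flags L') (sym (F₁-injective {g} {g'} e)) q

  pulled⁻ : ∀ {L L' g} → map F₁ L' ≡ L → g ∈ R₁.flags L' → F₁ g ∈ flags L
  pulled⁻ {L' = L'} {g} refl p = subst (F₁ g ∈_) (sym (flags-map L')) (∈-map⁺ F₁ p)

  unique-pulled : ∀ {L L'} → map F₁ L' ≡ L → Unique (flags L) → Unique (R₁.flags L')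
  unique-pulled {L' = L'} refl u = Uniqₚ.map⁻ (subst Unique (flags-map L') u)

  run-push : ∀ {C C' : Set} {c : Flag H → C'} {c' : Flag H₁ → C} (ι : C → C') {α β} L' →
    (∀ {g} → g ∈ R₁.flags L' → c (F₁ g) ≡ ι (c' g)) → R₁.run c' α L' β → run c (ι α) (map F₁ L') (ι β)
  run-push ι [] h r = cong ι r
  run-push {c = c} ι (g ∷ L') h (e , r) = trans (cong ι e) (sym (h (here refl))) ,
    subst (λ z → run c z (map F₁ L') _) (sym (h (there (here refl)))) (run-push ι L' (λ p → h (there (there p))) r)

  proper-image : ∀ {a b} → Proper a b → ¬ T (samePair (f₁ a) (f₁ b) (x H) (y H))
  proper-image {a} {b} (_ , h) q = h (samePair-reflect f₁ f₁-inj f₁x f₁y a b q)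

-- The part of an embedding of H that lies in the summand H₁: X and Y are the
-- rotations at the terminals cut open at the edge xy.
module Side {H H₁ H₂ : TGraph} (s : IsXYSum H H₁ H₂) (e₁ : XYEdge H₁) (e₂ : XYEdge H₂) (ls : LScheme H)
    (X Y : List (Flag H)) (tx ty : Bool)
    (X↭ : flagsOf H (LScheme.L ls (x H)) ↭ ((x H , y H) , tx) ∷ ((x H , y H) , not tx) ∷ flagsOf H X)
    (Y↭ : flagsOf H (LScheme.L ls (y H)) ↭ ((y H , x H) , ty) ∷ ((y H , x H) , not ty) ∷ flagsOf H Y) where

  open Strands (_≟ᶠˡ_ {H}) (flip {H}) (flip-flip {H})
  open Core (_≟ᶠˡ_ {H}) (flip {H}) (flip-flip {H})
  open Bound (_≟ᶠˡ_ {H}) (flip {H}) (flip-flip {H})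
  open Rotations (_≟ᶠˡ_ {H}) (flip {H}) (flip-flip {H})
  open IsXYSum s
  open LScheme ls
  open SumCounts (xySum-sym s) e₂ e₁ using (x≢y; inner?) renaming (inner₂ to inner₁)
  open Summand s e₁ e₂

  X₁ Y₁ : List (Flag H)
  X₁ = filter (In? ∘ proj₁) X
  Y₁ = filter (In? ∘ proj₁) Y

  flags-filter⁺ : ∀ {f} L → f ∈ flags L → In (proj₁ f) → f ∈ flags (filter (In? ∘ proj₁) L)
  flags-filter⁺ {f} L p i with flags⇒∈ H L p
  ... | inj₁ q = ∈-flags (∈-filter⁺ (In? ∘ proj₁) q i)
  ... | inj₂ q = subst (_∈ flags (filter (In? ∘ proj₁) L)) (flip-flip {H} f)
        (flip-∈-flags (filter (In? ∘ proj₁) L) (∈-flags (∈-filter⁺ (In? ∘ proj₁) q i)))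

  flags-filter⁻ : ∀ {f} L → f ∈ flags (filter (In? ∘ proj₁) L) → f ∈ flags L × In (proj₁ f)
  flags-filter⁻ {f} L p with flags⇒∈ H (filter (In? ∘ proj₁) L) p
  ... | inj₁ q = let (r , i) = ∈-filter⁻ (In? ∘ proj₁) {xs = L} q in ∈-flags r , i
  ... | inj₂ q = let (r , i) = ∈-filter⁻ (In? ∘ proj₁) {xs = L} q in
        subst (_∈ flags L) (flip-flip {H} f) (flip-∈-flags L (∈-flags r)) , i

  unique-flags-filter : ∀ L → Unique (flags L) → Unique (flags (filter (In? ∘ proj₁) L))
  unique-flags-filter L u = unique-++ˡ (flags (filter P? L)) (subst Unique (flags-++ (filter P? L) (filter Q? L))
      (unique-↭ (flags-↭ (filter-partition P? Q? L (λ {a} _ → either (P? a)))) u))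
    where
    P? : ∀ f → Dec (In (proj₁ f))
    P? = In? ∘ proj₁
    Q? : ∀ f → Dec (¬ In (proj₁ f))
    Q? f = ¬? (P? f)
    either : ∀ {Z : Set} → Dec Z → (Z × ¬ ¬ Z) ⊎ (¬ Z × ¬ Z)
    either (yes z) = inj₁ (z , λ h → h z)
    either (no z) = inj₂ (z , z)

  module TX = Terminal ls (x H) (y H) X tx X↭
  module TY = Terminal ls (y H) (x H) Y ty Y↭

  dummy : Fin (n H) → Flag H
  dummy v = (v , v) , true

  -- A pendant half-edge at every inner vertex makes isolated vertices bound a
  -- face like all others.
  block : Fin (n H₁) → List (Flag H)
  block a = dummy (f₁ a) ∷ L (f₁ a)

  blocks : List (Fin (n H₁)) → List (Flag H)
  blocks [] = []
  blocks (a ∷ as) = block a ++ blocks as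

  ∈-blocks⁺ : ∀ {f a as} → a ∈ as → f ∈ flags (block a) → f ∈ flags (blocks as)
  ∈-blocks⁺ {f} {as = a ∷ as} (here refl) p = subst (f ∈_) (sym (flags-++ (block a) (blocks as))) (∈-++⁺ˡ p)
  ∈-blocks⁺ {f} {as = a ∷ as} (there q) p = subst (f ∈_) (sym (flags-++ (block a) (blocks as)))
    (∈-++⁺ʳ (flags (block a)) (∈-blocks⁺ q p))

  ∈-blocks⁻ : ∀ {f} as → f ∈ flags (blocks as) → ∃ λ a → (a ∈ as) × f ∈ flags (block a)
  ∈-blocks⁻ {f} (a ∷ as) p with ∈-++⁻ (flags (block a)) (subst (f ∈_) (flags-++ (block a) (blocks as)) p)
  ... | inj₁ q = a , here refl , q
  ... | inj₂ q = let (b , b∈ , r) = ∈-blocks⁻ as q in b , there b∈ , r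

  block-tail : ∀ a {f} → f ∈ flags (block a) → proj₁ (proj₁ f) ≡ f₁ a
  block-tail a (here refl) = refl
  block-tail a (there (here refl)) = refl
  block-tail a (there (there p)) = proj₁ (L-sound (f₁ a) p)

  unique-block : ∀ a → Unique (flags (block a))
  unique-block a = ((λ ()) ∷ out true) ∷ out false ∷ L-unique (f₁ a)
    where
    out : ∀ z → All (((f₁ a , f₁ a) , z) ≢_) (flags (L (f₁ a)))
    out z = All.tabulate λ { p refl → edge-≢ H (proj₂ (L-sound (f₁ a) p)) refl }

  unique-blocks : ∀ {as} → Unique as → Unique (flags (blocks as))
  unique-blocks {[]} u = []
  unique-blocks {a ∷ as} u = subst Unique (sym (flags-++ (block a) (blocks as)))
    (Uniqₚ.++⁺ (unique-block a) (unique-blocks (unique-tail u)) λ (p , q) → disj p q)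
    where
    disj : ∀ {f} → f ∈ flags (block a) → f ∈ flags (blocks as) → ⊥
    disj p q with ∈-blocks⁻ as q
    ... | b , b∈ , r = unique-head u (subst (_∈ as) (f₁-inj _ _ (trans (sym (block-tail b r)) (block-tail a p))) b∈)

  -- The cyclic list of corners at an inner vertex starts and ends at its pendant half-edge, so even
  -- an isolated vertex has a corner.
  Φs : List (Fin (n H₁)) → List (Flag H × Flag H)
  Φs [] = []
  Φs (a ∷ as) = corners (dummy (f₁ a)) (dummy (f₁ a)) (L (f₁ a)) ++ Φs as

  nodes-Φs : ∀ as → nodes (Φs as) ↭ flags (blocks as)
  nodes-Φs [] = ↭-refl
  nodes-Φs (a ∷ as) = ↭-trans (↭-reflexive (nodes-++ (corners (dummy (f₁ a)) (dummy (f₁ a)) (L (f₁ a))) (Φs as)))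
    (↭-trans (++⁺ (nodes-corners (dummy (f₁ a)) (dummy (f₁ a)) (L (f₁ a))) (nodes-Φs as))
      (↭-reflexive (sym (flags-++ (block a) (blocks as)))))

  Φ : List (Flag H × Flag H)
  Φ = Φs inner₁

  XY Z : List (Flag H)
  XY = flags X₁ ++ flags Y₁
  Z = flags (blocks inner₁) ++ XY

  inX : ∀ {b} z → Proper (x H₁) b → F₁ ((x H₁ , b) , z) ∈ flags X₁
  inX {b} z (t , h) = flags-filter⁺ X
    (subst (λ u → ((u , f₁ b) , z) ∈ flags X) (sym f₁x)
      (TX.complete (subst (λ u → T (Edge H u (f₁ b))) f₁x (edge₁ _ _ t))
        (f₁≢y λ e → h (samePair⁺ {a = x H₁} (inj₁ (refl , e))))))
    (_ , _ , refl , refl , t)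

  inY : ∀ {b} z → Proper (y H₁) b → F₁ ((y H₁ , b) , z) ∈ flags Y₁
  inY {b} z (t , h) = flags-filter⁺ Y
    (subst (λ u → ((u , f₁ b) , z) ∈ flags Y) (sym f₁y)
      (TY.complete (subst (λ u → T (Edge H u (f₁ b))) f₁y (edge₁ _ _ t))
        (f₁≢x λ e → h (samePair⁺ {a = y H₁} (inj₂ (refl , e))))))
    (_ , _ , refl , refl , t)

  inZ : ∀ {a b} z → Proper a b → F₁ ((a , b) , z) ∈ Z
  inZ {a} {b} z pr = go a (kind a) pr
    where
    go : ∀ a → a ≡ x H₁ ⊎ a ≡ y H₁ ⊎ a ∈ inner₁ → Proper a b → F₁ ((a , b) , z) ∈ Z
    go a (inj₁ refl) pr = ∈-++⁺ʳ (flags (blocks inner₁)) (∈-++⁺ˡ (inX z pr))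
    go a (inj₂ (inj₁ refl)) pr = ∈-++⁺ʳ (flags (blocks inner₁)) (∈-++⁺ʳ (flags X₁) (inY z pr))
    go a (inj₂ (inj₂ a∈)) pr = ∈-++⁺ˡ (∈-blocks⁺ a∈ (there (there (L-complete z (edge₁ _ _ (proj₁ pr))))))

  outX : ∀ {f} → f ∈ flags X₁ → ∃ λ b → ∃ λ z → Proper (x H₁) b × (f ≡ F₁ ((x H₁ , b) , z))
  outX {(u , v) , z} p with flags-filter⁻ X p
  ... | q , (a , b , refl , refl , t) with f₁-inj _ _ (trans (proj₁ (TX.sound q)) (sym f₁x))
  ... | refl = b , z , (t , λ r → [ (λ (_ , e) → proj₁ (proj₂ (TX.sound q)) (trans (cong f₁ e) f₁y)) ,
          (λ (e , _) → edge-≢ H₁ e₁ e) ]′ (samePair⁻ {a = x H₁} r)) , refl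

  outY : ∀ {f} → f ∈ flags Y₁ → ∃ λ b → ∃ λ z → Proper (y H₁) b × (f ≡ F₁ ((y H₁ , b) , z))
  outY {(u , v) , z} p with flags-filter⁻ Y p
  ... | q , (a , b , refl , refl , t) with f₁-inj _ _ (trans (proj₁ (TY.sound q)) (sym f₁y))
  ... | refl = b , z , (t , λ r → [ (λ (e , _) → edge-≢ H₁ e₁ (sym e)) ,
          (λ (_ , e) → proj₁ (proj₂ (TY.sound q)) (trans (cong f₁ e) f₁x)) ]′ (samePair⁻ {a = y H₁} r)) , refl

  outL : ∀ {a f} → a ∈ inner₁ → f ∈ flags (L (f₁ a)) → ∃ λ b → ∃ λ z → Proper a b × (f ≡ F₁ ((a , b) , z))
  outL {a} {(u , v) , z} a∈ p with L-sound (f₁ a) p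
  ... | refl , e with inner-edge a∈ e
  ... | b , refl , t = b , z , inner-proper a∈ t , refl

  outZ : ∀ {f} → f ∈ Z → (∃ λ a → ∃ λ z → (a ∈ inner₁) × (f ≡ ((f₁ a , f₁ a) , z))) ⊎
    (∃ λ a → ∃ λ b → ∃ λ z → Proper a b × (f ≡ F₁ ((a , b) , z)))
  outZ p with ∈-++⁻ (flags (blocks inner₁)) p
  ... | inj₁ q with ∈-blocks⁻ inner₁ q
  ...   | a , a∈ , here e = inj₁ (a , true , a∈ , e)
  ...   | a , a∈ , there (here e) = inj₁ (a , false , a∈ , e)
  ...   | a , a∈ , there (there r) = inj₂ (a , outL a∈ r)
  outZ p | inj₂ q with ∈-++⁻ (flags X₁) q
  ...   | inj₁ r = inj₂ (_ , outX r)
  ...   | inj₂ r = inj₂ (_ , outY r)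

  unique-XY : Unique XY
  unique-XY = Uniqₚ.++⁺ (unique-flags-filter X TX.unique) (unique-flags-filter Y TY.unique)
    λ (p , q) → x≢y (trans (sym (proj₁ (TX.sound (proj₁ (flags-filter⁻ X p))))) (proj₁ (TY.sound (proj₁ (flags-filter⁻ Y q)))))

  unique-Z : Unique Z
  unique-Z = Uniqₚ.++⁺ (unique-blocks (unique-select inner?)) unique-XY λ (p , q) → disj p q
    where
    disj : ∀ {f} → f ∈ flags (blocks inner₁) → f ∈ XY → ⊥
    disj p q with ∈-blocks⁻ inner₁ p
    ... | a , a∈ , r with ∈-++⁻ (flags X₁) q
    ...   | inj₁ z = f₁≢x (proj₁ (inner-∉ a∈)) (trans (sym (block-tail a r)) (proj₁ (TX.sound (proj₁ (flags-filter⁻ X z)))))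
    ...   | inj₂ z = f₁≢y (proj₂ (inner-∉ a∈)) (trans (sym (block-tail a r)) (proj₁ (TY.sound (proj₁ (flags-filter⁻ Y z)))))

  -- A pendant half-edge is represented by the pair `(v , v)`, which is no dart. The value false on
  -- the diagonal makes `opposite` exchange its two sides, so that a strand passes around its free
  -- end.
  sig° : Fin (n H) → Fin (n H) → Bool
  sig° u v = if u =ᶠ v then false else sig u v

  sig°-diag : ∀ v → sig° v v ≡ false
  sig°-diag v = cong (if_then false else sig v v) (T⇒≡ {v =ᶠ v} (=ᶠ⁺ refl))

  sig°-≢ : ∀ {u v} → u ≢ v → sig° u v ≡ sig u v
  sig°-≢ {u} {v} h = cong (if_then false else sig u v) (¬T⇒≡ {u =ᶠ v} (λ t → h (=ᶠ⁻ t)))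

  θ' : Flag H → Flag H
  θ' = opposite {H} sig°

  θ'-dummy : ∀ v z → θ' ((v , v) , z) ≡ ((v , v) , not z)
  θ'-dummy v z = cong (λ b → (v , v) , not b) (trans (cong (z xor_) (sig°-diag v)) (xor-false z))
    where
    xor-false : ∀ z → z xor false ≡ z
    xor-false true = refl
    xor-false false = refl

  sig°-sym : ∀ {a b} → Proper a b → sig° (f₁ a) (f₁ b) ≡ sig° (f₁ b) (f₁ a)
  sig°-sym {a} {b} (t , _) = trans (sig°-≢ ne) (trans (sig-sym _ _ (edge₁ _ _ t)) (sym (sig°-≢ (ne ∘ sym))))
    where
    ne : f₁ a ≢ f₁ b
    ne = edge-≢ H (edge₁ _ _ t)

  abstract
    strands : Σ (List (Flag H × Flag H)) λ P → (nodes P ↭ Z) × AllPair (λ u v → v ≡ θ' u) P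
    strands = pairing θ' Z unique-Z closed invol nofix
      where
      closed : ∀ {f} → f ∈ Z → θ' f ∈ Z
      closed p with outZ p
      ... | inj₁ (a , true , a∈ , refl) = subst (_∈ Z) (sym (θ'-dummy (f₁ a) true)) (∈-++⁺ˡ (∈-blocks⁺ a∈ (there (here refl))))
      ... | inj₁ (a , false , a∈ , refl) = subst (_∈ Z) (sym (θ'-dummy (f₁ a) false)) (∈-++⁺ˡ (∈-blocks⁺ a∈ (here refl)))
      ... | inj₂ (a , b , z , pr , refl) = inZ _ (proper-sym pr)
      invol : ∀ {f} → f ∈ Z → θ' (θ' f) ≡ f
      invol p with outZ p
      ... | inj₁ (a , z , a∈ , refl) = trans (cong θ' (θ'-dummy (f₁ a) z)) (trans (θ'-dummy (f₁ a) (not z)) (flip-flip {H} _))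
      ... | inj₂ (a , b , z , pr , refl) = opposite-involutive {H} sig° (f₁ a) (f₁ b) z (sig°-sym pr)
      nofix : ∀ {f} → f ∈ Z → θ' f ≢ f
      nofix p e with outZ p
      ... | inj₁ (a , z , a∈ , refl) = not-¬ {z} refl (sym (cong proj₂ (trans (sym (θ'-dummy (f₁ a) z)) e)))
      ... | inj₂ (a , b , z , pr , refl) = edge-≢ H₁ (proj₁ pr) (sym (f₁-inj _ _ (cong (proj₁ ∘ proj₁) e)))

  Θ : List (Flag H × Flag H)
  Θ = proj₁ strands

  abstract
    elim : Eliminated Θ Φ XY
    elim = eliminate Φ Θ XY (↭-trans (proj₁ (proj₂ strands)) (++⁺ʳ XY (↭-sym (nodes-Φs inner₁))))
      (unique-↭ (++⁺ʳ XY (↭-sym (nodes-Φs inner₁))) unique-Z)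

  open Eliminated elim public using (M; ℓ)

  matches : Matches M X₁ Y₁
  matches = Eliminated.nodes-M elim , unique-XY

  mono⇒θ : ∀ {C : Set} {c : Flag H → C} → Mono c Θ → ∀ {f} → f ∈ Z → c (θ' f) ≡ c f
  mono⇒θ {c = c} mo {f} p = go Θ (proj₂ (proj₂ strands)) mo (λ q → ∈-resp-↭ (proj₁ (proj₂ strands)) q)
      (∈-resp-↭ (↭-sym (proj₁ (proj₂ strands))) p)
    where
    invol : ∀ {u} → u ∈ Z → θ' (θ' u) ≡ u
    invol p with outZ p
    ... | inj₁ (a , z , a∈ , refl) = trans (cong θ' (θ'-dummy (f₁ a) z)) (trans (θ'-dummy (f₁ a) (not z)) (flip-flip {H} _))
    ... | inj₂ (a , b , z , pr , refl) = opposite-involutive {H} sig° (f₁ a) (f₁ b) z (sig°-sym pr)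
    go : ∀ Q → AllPair (λ u v → v ≡ θ' u) Q → Mono c Q → (∀ {u} → u ∈ nodes Q → u ∈ Z) → f ∈ nodes Q → c (θ' f) ≡ c f
    go ((u , v) ∷ Q) (e ∷ _) (m ∷ _) inz (here refl) = trans (cong c (sym e)) (sym m)
    go ((u , v) ∷ Q) (e ∷ _) (m ∷ _) inz (there (here refl)) =
      trans (cong c (trans (cong θ' e) (invol (inz (here refl))))) m
    go ((u , v) ∷ Q) (_ ∷ a) (_ ∷ mo) inz (there (there q)) = go Q a mo (λ r → inz (there (there r))) q

  θ⇒mono : ∀ {C : Set} {c : Flag H → C} → (∀ {f} → f ∈ Z → c (θ' f) ≡ c f) → Mono c Θ
  θ⇒mono {c = c} h = go Θ (proj₂ (proj₂ strands)) (λ q → ∈-resp-↭ (proj₁ (proj₂ strands)) q)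
    where
    go : ∀ Q → AllPair (λ u v → v ≡ θ' u) Q → (∀ {u} → u ∈ nodes Q → u ∈ Z) → Mono c Q
    go [] [] _ = []
    go ((u , v) ∷ Q) (e ∷ a) inz = trans (sym (h (inz (here refl)))) (cong c (sym e)) ∷ go Q a (λ r → inz (there (there r)))

  module _ {C : Set} (c : Flag H → C)
      (opp : ∀ {a b} z → T (Edge H a b) → c (opposite {H} sig ((a , b) , z)) ≡ c ((a , b) , z))
      (dum : ∀ v → c ((v , v) , false) ≡ c ((v , v) , true))
      (runs : ∀ v → run c (c (dummy v)) (L v) (c (dummy v))) where

    -- A colouring of the whole embedding restricts to the strands. The colours in `loops` are those
    -- of closed strands inside `H₁`. Their number `ℓ` depends on the interior alone and counts
    -- equally in the sum and in the summand.
    forward : Mono c M × Σ (List C) λ loops → (length loops ≡ ℓ) ×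
      (∀ {a f} → a ∈ inner₁ → f ∈ flags (block a) → (∃ λ g → (g ∈ XY) × (c g ≡ c f)) ⊎ c f ∈ loops)
    forward = let (mo , loops , len , cov) = Eliminated.fwd elim c (θ⇒mono θ-inv) (monoΦ inner₁) in
      mo , loops , len , λ a∈ p → cov (∈-resp-↭ (↭-sym (nodes-Φs inner₁)) (∈-blocks⁺ a∈ p))
      where
      θ-inv : ∀ {f} → f ∈ Z → c (θ' f) ≡ c f
      θ-inv p with outZ p
      ... | inj₁ (a , true , a∈ , refl) = trans (cong c (θ'-dummy (f₁ a) true)) (dum (f₁ a))
      ... | inj₁ (a , false , a∈ , refl) = trans (cong c (θ'-dummy (f₁ a) false)) (sym (dum (f₁ a)))
      ... | inj₂ (a , b , z , pr , refl) = trans (cong (λ g → c ((f₁ b , f₁ a) , not (z xor g))) (sig°-≢ (edge-≢ H (edge₁ _ _ (proj₁ pr)))))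
            (opp z (edge₁ _ _ (proj₁ pr)))
      monoΦ : ∀ as → Mono c (Φs as)
      monoΦ [] = []
      monoΦ (a ∷ as) = All-++⁺ (run⇒corners (dummy (f₁ a)) (dummy (f₁ a)) (L (f₁ a))
        (subst (λ z → run c z (L (f₁ a)) (c (dummy (f₁ a)))) (sym (dum (f₁ a))) (runs (f₁ a)))) (monoΦ as)

  -- Rotations found in `H` that use only darts of `H₁` are carried back to the vertex set of `H₁`.
  pull : ∀ L → (∀ {f} → f ∈ L → ∃ λ g → f ≡ F₁ g) → ∃ λ L' → map F₁ L' ≡ L
  pull [] h = [] , refl
  pull (f ∷ L) h = let (g , e) = h (here refl)
                       (L' , e') = pull L (h ∘ there) in g ∷ L' , cong₂ _∷_ (sym e) e'

  run-pulled : ∀ {C : Set} {c : Flag H → C} {c' : Flag H₁ → C} {α β L} L' → map F₁ L' ≡ L →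
    (∀ {g} → g ∈ R₁.flags L' → c' g ≡ c (F₁ g)) → run c α L β → R₁.run c' α L' β
  run-pulled [] refl h r = r
  run-pulled {c' = c'} (g ∷ L') refl h (e , r) = trans e (sym (h (here refl))) ,
    subst (λ z → R₁.run c' z L' _) (sym (h (there (here refl)))) (run-pulled L' refl (λ p → h (there (there p))) r)

  -- The interior is kept as it is embedded in `H`, the achieved rotations replace those at the
  -- terminals, and `xy` is put back as the first dart at either end. Its side true gets the outer
  -- colour `β`, its side false the colour `α`.
  module Assembled {w : ℕ} (ach : Achieved M X₁ Y₁ w) where

    private
      Lx Ly : List (Flag H)
      Lx = proj₁ ach
      Ly = proj₁ (proj₂ ach)
      px : flags Lx ↭ flags X₁
      px = proj₁ (proj₂ (proj₂ ach))
      py : flags Ly ↭ flags Y₁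
      py = proj₁ (proj₂ (proj₂ (proj₂ ach)))
      module C = Coloured (proj₂ (proj₂ (proj₂ (proj₂ ach))))

      K : ℕ
      K = w + ℓ
      αK βK : Fin K
      αK = C.α ↑ˡ ℓ
      βK = C.β ↑ˡ ℓ

      abstract
        -- The first `w` colours come from the terminals; the closed strands receive `ℓ` new ones,
        -- each of which occurs.
        ext : Extension Θ Φ XY ((_↑ˡ ℓ) ∘ C.c) (w ↑ʳ_)
        ext = Eliminated.bwd elim ((_↑ˡ ℓ) ∘ C.c) (w ↑ʳ_) (mono-lift (_↑ˡ ℓ) M (λ _ → refl) C.mono)

      c⁺ : Flag H → Fin K
      c⁺ = proj₁ ext
      monoΘ : Mono c⁺ Θ
      monoΘ = proj₁ (proj₂ ext)
      monoΦ : Mono c⁺ Φ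
      monoΦ = proj₁ (proj₂ (proj₂ ext))
      agree : ∀ {f} → f ∈ XY → c⁺ f ≡ C.c f ↑ˡ ℓ
      agree = proj₁ (proj₂ (proj₂ (proj₂ ext)))
      hit : ∀ j → ∃ λ f → (f ∈ nodes Φ) × (c⁺ f ≡ w ↑ʳ j)
      hit = proj₂ (proj₂ (proj₂ (proj₂ ext)))

      pullx : ∃ λ L' → map F₁ L' ≡ Lx
      pullx = pull Lx λ p → let (b , z , _ , e) = outX (∈-resp-↭ px (∈-flags p)) in ((x H₁ , b) , z) , e
      pully : ∃ λ L' → map F₁ L' ≡ Ly
      pully = pull Ly λ p → let (b , z , _ , e) = outY (∈-resp-↭ py (∈-flags p)) in ((y H₁ , b) , z) , e
      pulli : ∀ {a} → a ∈ inner₁ → ∃ λ L' → map F₁ L' ≡ L (f₁ a)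
      pulli {a} a∈ = pull (L (f₁ a)) λ p → let (b , z , _ , e) = outL a∈ (∈-flags p) in ((a , b) , z) , e

      fromx : ∀ {g} → g ∈ R₁.flags (proj₁ pullx) → ∃ λ b → ∃ λ z → Proper (x H₁) b × (g ≡ ((x H₁ , b) , z))
      fromx {g} p = let (b , z , pr , e) = outX (∈-resp-↭ px (pulled⁻ {g = g} (proj₂ pullx) p)) in b , z , pr , F₁-injective e
      fromy : ∀ {g} → g ∈ R₁.flags (proj₁ pully) → ∃ λ b → ∃ λ z → Proper (y H₁) b × (g ≡ ((y H₁ , b) , z))
      fromy {g} p = let (b , z , pr , e) = outY (∈-resp-↭ py (pulled⁻ {g = g} (proj₂ pully) p)) in b , z , pr , F₁-injective e
      fromi : ∀ {a g} (a∈ : a ∈ inner₁) → g ∈ R₁.flags (proj₁ (pulli a∈)) → ∃ λ b → ∃ λ z → Proper a b × (g ≡ ((a , b) , z))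
      fromi {a} {g} a∈ p = let (b , z , pr , e) = outL a∈ (pulled⁻ {g = g} (proj₂ (pulli a∈)) p) in b , z , pr , F₁-injective e

      Kind : Fin (n H₁) → Set
      Kind a = a ≡ x H₁ ⊎ a ≡ y H₁ ⊎ a ∈ inner₁

      list : ∀ a → Kind a → List (Flag H₁)
      list a (inj₁ _) = ((x H₁ , y H₁) , true) ∷ proj₁ pullx
      list a (inj₂ (inj₁ _)) = ((y H₁ , x H₁) , true) ∷ proj₁ pully
      list a (inj₂ (inj₂ a∈)) = proj₁ (pulli a∈)

      xy-same : T (samePair (x H₁) (y H₁) (x H₁) (y H₁))
      xy-same = samePair⁺ {a = x H₁} (inj₁ (refl , refl))
      yx-same : T (samePair (y H₁) (x H₁) (x H₁) (y H₁))
      yx-same = samePair⁺ {a = y H₁} (inj₂ (refl , refl))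

      list-unique : ∀ a z → Unique (R₁.flags (list a z))
      list-unique a (inj₁ _) = ((λ ()) ∷ out true) ∷ out false ∷
          unique-pulled (proj₂ pullx) (unique-↭ (↭-sym px) (unique-++ˡ (flags X₁) unique-XY))
        where
        out : ∀ z → All (((x H₁ , y H₁) , z) ≢_) (R₁.flags (proj₁ pullx))
        out z = All.tabulate λ {g} p e → let (b , z' , pr , e') = fromx p in
          proj₂ pr (subst (λ b → T (samePair (x H₁) b (x H₁) (y H₁))) (cong (proj₂ ∘ proj₁) (trans e e')) xy-same)
      list-unique a (inj₂ (inj₁ _)) = ((λ ()) ∷ out true) ∷ out false ∷
          unique-pulled (proj₂ pully) (unique-↭ (↭-sym py) (unique-++ʳ (flags X₁) unique-XY))
        where
        out : ∀ z → All (((y H₁ , x H₁) , z) ≢_) (R₁.flags (proj₁ pully))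
        out z = All.tabulate λ {g} p e → let (b , z' , pr , e') = fromy p in
          proj₂ pr (subst (λ b → T (samePair (y H₁) b (x H₁) (y H₁))) (cong (proj₂ ∘ proj₁) (trans e e')) yx-same)
      list-unique a (inj₂ (inj₂ a∈)) = unique-pulled (proj₂ (pulli a∈)) (L-unique (f₁ a))

      e₁' : T (Edge H₁ (y H₁) (x H₁))
      e₁' = edge-sym H₁ {x H₁} {y H₁} e₁

      list-sound : ∀ a z {g} → g ∈ R₁.flags (list a z) → (proj₁ (proj₁ g) ≡ a) × IsDart H₁ (proj₁ g)
      list-sound a (inj₁ e) (here refl) = sym e , e₁
      list-sound a (inj₁ e) (there (here refl)) = sym e , e₁
      list-sound a (inj₁ e) (there (there p)) with fromx p
      ... | b , z , pr , refl = sym e , proj₁ pr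
      list-sound a (inj₂ (inj₁ e)) (here refl) = sym e , e₁'
      list-sound a (inj₂ (inj₁ e)) (there (here refl)) = sym e , e₁'
      list-sound a (inj₂ (inj₁ e)) (there (there p)) with fromy p
      ... | b , z , pr , refl = sym e , proj₁ pr
      list-sound a (inj₂ (inj₂ a∈)) p with fromi a∈ p
      ... | b , z , pr , refl = refl , proj₁ pr

      both-flags : ∀ {d} z (R : List (Flag H₁)) → (d , z) ∈ (d , true) ∷ (d , false) ∷ R
      both-flags true R = here refl
      both-flags false R = there (here refl)

      list-complete : ∀ {a b} k z → T (Edge H₁ a b) → Dec (T (samePair a b (x H₁) (y H₁))) → ((a , b) , z) ∈ R₁.flags (list a k)
      list-complete {a} {b} (inj₁ refl) z t (no h) = there (there (pulled⁺ (proj₂ pullx) (∈-resp-↭ (↭-sym px) (inX z (t , h)))))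
      list-complete {a} {b} (inj₁ refl) z t (yes q) with samePair⁻ {a = a} q
      ... | inj₁ (_ , refl) = both-flags z _
      ... | inj₂ (e , _) = ⊥-elim (edge-≢ H₁ e₁ e)
      list-complete {a} {b} (inj₂ (inj₁ refl)) z t (no h) = there (there (pulled⁺ (proj₂ pully) (∈-resp-↭ (↭-sym py) (inY z (t , h)))))
      list-complete {a} {b} (inj₂ (inj₁ refl)) z t (yes q) with samePair⁻ {a = a} q
      ... | inj₁ (e , _) = ⊥-elim (edge-≢ H₁ e₁ (sym e))
      ... | inj₂ (_ , refl) = both-flags z _
      list-complete {a} {b} (inj₂ (inj₂ a∈)) z t _ = pulled⁺ (proj₂ (pulli a∈)) (L-complete z (edge₁ _ _ t))

      -- At both terminals the side true of `xy` has colour `β` and the side false has colour `α`.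
      -- Sides with equal signs must therefore be opposite, which is what signature true provides.
      sig₁ : Fin (n H₁) → Fin (n H₁) → Bool
      sig₁ a b = if samePair a b (x H₁) (y H₁) then true else sig° (f₁ a) (f₁ b)

      sig₁-yes : ∀ {a b} → T (samePair a b (x H₁) (y H₁)) → sig₁ a b ≡ true
      sig₁-yes {a} {b} q = cong (if_then true else sig° (f₁ a) (f₁ b)) (T⇒≡ q)
      sig₁-no : ∀ {a b} → ¬ T (samePair a b (x H₁) (y H₁)) → sig₁ a b ≡ sig° (f₁ a) (f₁ b)
      sig₁-no {a} {b} q = cong (if_then true else sig° (f₁ a) (f₁ b)) (¬T⇒≡ q)

      sig₁-sym : ∀ {a b} → T (Edge H₁ a b) → Dec (T (samePair a b (x H₁) (y H₁))) → sig₁ a b ≡ sig₁ b a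
      sig₁-sym {a} {b} t (yes q) = trans (sig₁-yes {a} q) (sym (sig₁-yes {b} (samePair-sym a b q)))
      sig₁-sym {a} {b} t (no h) = trans (sig₁-no {a} h) (trans (sig°-sym (t , h)) (sym (sig₁-no {b} (proj₂ (proper-sym (t , h))))))

    scheme : LScheme H₁
    scheme = record
      { L = λ a → list a (kind a) ; sig = sig₁
      ; sig-sym = λ a b t → sig₁-sym {a} {b} t (T? (samePair a b (x H₁) (y H₁)))
      ; L-unique = λ a → list-unique a (kind a)
      ; L-sound = λ a → list-sound a (kind a)
      ; L-complete = λ {a} {b} z t → list-complete (kind a) z t (T? (samePair a b (x H₁) (y H₁))) }

    private
      end : Bool → Fin K
      end z = if z then βK else αK
      c₁ : Flag H₁ → Fin K
      c₁ ((a , b) , z) = if samePair a b (x H₁) (y H₁) then end z else c⁺ (F₁ ((a , b) , z))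

      c₁-yes : ∀ {a b} z → T (samePair a b (x H₁) (y H₁)) → c₁ ((a , b) , z) ≡ end z
      c₁-yes {a} {b} z q = cong (if_then end z else c⁺ (F₁ ((a , b) , z))) (T⇒≡ q)
      c₁-no : ∀ {a b} z → ¬ T (samePair a b (x H₁) (y H₁)) → c₁ ((a , b) , z) ≡ c⁺ (F₁ ((a , b) , z))
      c₁-no {a} {b} z q = cong (if_then end z else c⁺ (F₁ ((a , b) , z))) (¬T⇒≡ q)

      opp : ∀ {a b} z → T (Edge H₁ a b) → Dec (T (samePair a b (x H₁) (y H₁))) →
        c₁ (opposite {H₁} sig₁ ((a , b) , z)) ≡ c₁ ((a , b) , z)
      opp {a} {b} z t (yes q) = trans (cong (λ g → c₁ ((b , a) , not (z xor g))) (sig₁-yes {a} q))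
        (trans (c₁-yes {b} (not (z xor true)) (samePair-sym a b q)) (trans (cong end (twist z)) (sym (c₁-yes {a} z q))))
        where
        twist : ∀ z → not (z xor true) ≡ z
        twist true = refl
        twist false = refl
      opp {a} {b} z t (no h) = trans (cong (λ g → c₁ ((b , a) , not (z xor g))) (sig₁-no {a} h))
        (trans (c₁-no {b} _ (proj₂ (proper-sym (t , h)))) (trans (mono⇒θ monoΘ (inZ z (t , h))) (sym (c₁-no {a} z h))))

      c⁺-dummy : ∀ {a} → a ∈ inner₁ → c⁺ ((f₁ a , f₁ a) , false) ≡ c⁺ (dummy (f₁ a))
      c⁺-dummy {a} a∈ = trans (sym (cong c⁺ (θ'-dummy (f₁ a) true))) (mono⇒θ monoΘ (∈-++⁺ˡ (∈-blocks⁺ a∈ (here refl))))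

      mono-at : ∀ {a} as → a ∈ as → Mono c⁺ (Φs as) → Mono c⁺ (corners (dummy (f₁ a)) (dummy (f₁ a)) (L (f₁ a)))
      mono-at (a ∷ as) (here refl) m = All-++⁻ˡ (corners (dummy (f₁ a)) (dummy (f₁ a)) (L (f₁ a))) m
      mono-at (a ∷ as) (there p) m = mono-at as p (All-++⁻ʳ (corners (dummy (f₁ a)) (dummy (f₁ a)) (L (f₁ a))) m)

      π₁ : ∀ a → Kind a → Fin K
      π₁ a (inj₁ _) = βK
      π₁ a (inj₂ (inj₁ _)) = βK
      π₁ a (inj₂ (inj₂ _)) = c⁺ (dummy (f₁ a))

      proper-colour : ∀ {g a b z} → Proper a b → g ≡ ((a , b) , z) → c₁ g ≡ c⁺ (F₁ g)
      proper-colour {z = z} pr refl = c₁-no z (proj₂ pr)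

      runs₁ : ∀ a k → R₁.run c₁ (π₁ a k) (list a k) (π₁ a k)
      runs₁ a (inj₁ _) = sym (c₁-yes {x H₁} true xy-same) ,
        subst (λ z → R₁.run c₁ z (proj₁ pullx) βK) (sym (c₁-yes {x H₁} false xy-same))
          (run-pulled (proj₁ pullx) (proj₂ pullx) (λ p → let (_ , _ , pr , e) = fromx p in proper-colour pr e)
            (run-lift (_↑ˡ ℓ) Lx (λ p → agree (∈-++⁺ˡ (∈-resp-↭ px p))) C.runx))
      runs₁ a (inj₂ (inj₁ _)) = sym (c₁-yes {y H₁} true yx-same) ,
        subst (λ z → R₁.run c₁ z (proj₁ pully) βK) (sym (c₁-yes {y H₁} false yx-same))
          (run-pulled (proj₁ pully) (proj₂ pully) (λ p → let (_ , _ , pr , e) = fromy p in proper-colour pr e)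
            (run-lift (_↑ˡ ℓ) Ly (λ p → agree (∈-++⁺ʳ (flags X₁) (∈-resp-↭ py p))) C.runy))
      runs₁ a (inj₂ (inj₂ a∈)) = run-pulled (proj₁ (pulli a∈)) (proj₂ (pulli a∈))
        (λ p → let (_ , _ , pr , e) = fromi a∈ p in proper-colour pr e)
        (subst (λ z → run c⁺ z (L (f₁ a)) (c⁺ (dummy (f₁ a)))) (c⁺-dummy a∈)
          (corners⇒run (dummy (f₁ a)) (dummy (f₁ a)) (L (f₁ a)) (mono-at inner₁ a∈ monoΦ)))

      π₁-inner : ∀ {a} k → a ∈ inner₁ → π₁ a k ≡ c⁺ (dummy (f₁ a))
      π₁-inner (inj₁ e) a∈ = ⊥-elim (proj₁ (inner-∉ a∈) e)
      π₁-inner (inj₂ (inj₁ e)) a∈ = ⊥-elim (proj₂ (inner-∉ a∈) e)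
      π₁-inner (inj₂ (inj₂ _)) a∈ = refl

      Covered : Fin K → Set
      Covered i = (∃ λ v → π₁ v (kind v) ≡ i) ⊎ (∃ λ f → IsDart H₁ (proj₁ f) × (c₁ f ≡ i))

      cov-XY : ∀ {f j} → f ∈ XY → C.c f ≡ j → Covered (j ↑ˡ ℓ)
      cov-XY {f} p refl with ∈-++⁻ (flags X₁) p
      ... | inj₁ q with outX q
      ...   | b , z , pr , refl = inj₂ (((x H₁ , b) , z) , proj₁ pr , trans (c₁-no z (proj₂ pr)) (agree p))
      cov-XY {f} p refl | inj₂ q with outY q
      ...   | b , z , pr , refl = inj₂ (((y H₁ , b) , z) , proj₁ pr , trans (c₁-no z (proj₂ pr)) (agree p))

      cov-block : ∀ {a f i} → a ∈ inner₁ → f ∈ flags (block a) → c⁺ f ≡ i → Covered i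
      cov-block {a} a∈ (here refl) e = inj₁ (a , trans (π₁-inner (kind a) a∈) e)
      cov-block {a} a∈ (there (here refl)) e = inj₁ (a , trans (π₁-inner (kind a) a∈) (trans (sym (c⁺-dummy a∈)) e))
      cov-block {a} a∈ (there (there p)) e with outL a∈ p
      ... | b , z , pr , refl = inj₂ (((a , b) , z) , proj₁ pr , trans (c₁-no z (proj₂ pr)) e)

      cov-left : ∀ j → Covered (j ↑ˡ ℓ)
      cov-left j with C.cover j
      ... | inj₁ refl = inj₂ (((x H₁ , y H₁) , false) , e₁ , c₁-yes {x H₁} false xy-same)
      ... | inj₂ (inj₁ (f , p , e)) = cov-XY (∈-resp-↭ (++⁺ px py) p) e
      ... | inj₂ (inj₂ ())

      cov-right : ∀ j → Covered (w ↑ʳ j)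
      cov-right j = let (f , p , e) = hit j
                        (a , a∈ , q) = ∈-blocks⁻ inner₁ (∈-resp-↭ (nodes-Φs inner₁) p) in cov-block a∈ q e

      cov : ∀ i → Covered i
      cov i = by-side (splitAt w i) refl
        where
        by-side : ∀ z → splitAt w i ≡ z → Covered i
        by-side (inj₁ j) eq = subst Covered (Finₚ.splitAt⁻¹-↑ˡ eq) (cov-left j)
        by-side (inj₂ j) eq = subst Covered (Finₚ.splitAt⁻¹-↑ʳ eq) (cov-right j)

    colouring : Colouring H₁ scheme (w + ℓ)
    colouring = record
      { c = c₁ ; π = λ a → π₁ a (kind a)
      ; opposite-inv = λ {a} {b} z t → opp z t (T? (samePair a b (x H₁) (y H₁)))
      ; runs = λ a → runs₁ a (kind a)
      ; cover = cov }

-- Splitting and gluing embeddings of an xy-sum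

module Opened {G : TGraph} (e : XYEdge G) (ls : LScheme G) {k : ℕ} (col : Colouring G ls k) where

  open Strands (_≟ᶠˡ_ {G}) (flip {G}) (flip-flip {G})
  open Rotations (_≟ᶠˡ_ {G}) (flip {G}) (flip-flip {G})
  open LScheme ls
  open Colouring col

  xy yx : Dart G
  xy = x G , y G
  yx = y G , x G

  e' : T (Edge G (y G) (x G))
  e' = edge-sym G {x G} {y G} e

  α β : Fin k
  α = c (xy , false)
  β = c (xy , true)

  -- The side of `yx` opposite to the side false of `xy`, so that the rotation at y runs from `α` to
  -- `β` as well.
  ty : Bool
  ty = not (sig (x G) (y G))

  private
    cutx : ∃ λ R → run c α R β × (flags (L (x G)) ↭ (xy , false) ∷ (xy , true) ∷ flags R) ×
      (π (x G) ≡ α ⊎ π (x G) ≡ β ⊎ (∃ λ w → (w ∈ flags R) × (c w ≡ π (x G))))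
    cutx = cut (L (x G)) (runs (x G)) (L-complete false e)
    cuty : ∃ λ R → run c (c (yx , ty)) R (c (yx , not ty)) × (flags (L (y G)) ↭ (yx , ty) ∷ (yx , not ty) ∷ flags R) ×
      (π (y G) ≡ c (yx , ty) ⊎ π (y G) ≡ c (yx , not ty) ⊎ (∃ λ w → (w ∈ flags R) × (c w ≡ π (y G))))
    cuty = cut (L (y G)) (runs (y G)) (L-complete ty e')

    α≡ : c (yx , ty) ≡ α
    α≡ = opposite-inv false e
    β≡ : c (yx , not ty) ≡ β
    β≡ = opposite-inv true e

  X Y : List (Flag G)
  X = proj₁ cutx
  Y = proj₁ cuty

  X↭ : flags (L (x G)) ↭ (xy , false) ∷ (xy , true) ∷ flags X
  X↭ = proj₁ (proj₂ (proj₂ cutx))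
  Y↭ : flags (L (y G)) ↭ (yx , ty) ∷ (yx , not ty) ∷ flags Y
  Y↭ = proj₁ (proj₂ (proj₂ cuty))

  runX : run c α X β
  runX = proj₁ (proj₂ cutx)
  runY : run c α Y β
  runY = subst₂ (λ z w → run c z Y w) α≡ β≡ (proj₁ (proj₂ cuty))

  -- What is still visible at the terminals once `xy` has been cut out. The next lemmas show that no
  -- colour of a terminal disappears.
  Seen : Fin k → Set
  Seen i = i ≡ α ⊎ (∃ λ w → (w ∈ flags X ++ flags Y) × (c w ≡ i))

  seen-β : Seen β
  seen-β = [ inj₁ , (λ (w , p , q) → inj₂ (w , ∈-++⁺ˡ p , q)) ]′ (run-end X runX)

  seen-πx : Seen (π (x G))
  seen-πx = [ inj₁ , [ (λ q → subst Seen (sym q) seen-β) , (λ (w , p , q) → inj₂ (w , ∈-++⁺ˡ p , q)) ]′ ]′ (proj₂ (proj₂ (proj₂ cutx)))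

  seen-πy : Seen (π (y G))
  seen-πy = [ (λ q → inj₁ (trans q α≡)) , [ (λ q → subst Seen (sym (trans q β≡)) seen-β) ,
    (λ (w , p , q) → inj₂ (w , ∈-++⁺ʳ (flags X) p , q)) ]′ ]′ (proj₂ (proj₂ (proj₂ cuty)))

  seen-x : ∀ {f} → f ∈ flags (L (x G)) → Seen (c f)
  seen-x p with ∈-resp-↭ X↭ p
  ... | here refl = inj₁ refl
  ... | there (here refl) = seen-β
  ... | there (there q) = inj₂ (_ , ∈-++⁺ˡ q , refl)

  seen-y : ∀ {f} → f ∈ flags (L (y G)) → Seen (c f)
  seen-y p with ∈-resp-↭ Y↭ p
  ... | here refl = inj₁ α≡
  ... | there (here refl) = subst Seen (sym β≡) seen-β
  ... | there (there q) = inj₂ (_ , ∈-++⁺ʳ (flags X) q , refl)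

module Split {H H₁ H₂ : TGraph} (s : IsXYSum H H₁ H₂) (e₁ : XYEdge H₁) (e₂ : XYEdge H₂)
    (ls : LScheme H) {k : ℕ} (col : Colouring H ls k) where

  open Strands (_≟ᶠˡ_ {H}) (flip {H}) (flip-flip {H})
  open Core (_≟ᶠˡ_ {H}) (flip {H}) (flip-flip {H})
  open Bound (_≟ᶠˡ_ {H}) (flip {H}) (flip-flip {H})
  open IsXYSum s
  open LScheme ls
  open Colouring col renaming (cover to colour-cover)
  open SumCounts s e₁ e₂ using (xy-edge; x≢y)
  open Opened xy-edge ls col
  module A = Side s e₁ e₂ ls X Y false ty X↭ Y↭
  module B = Side (xySum-sym s) e₂ e₁ ls X Y false ty X↭ Y↭
  module SA = Summand s e₁ e₂
  module SB = Summand (xySum-sym s) e₂ e₁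
  module TX = Terminal ls (x H) (y H) X false X↭
  module TY = Terminal ls (y H) (x H) Y ty Y↭

  private
    exclusive : ∀ {u v} → T (Edge H u v) → v ≢ x H → v ≢ y H →
      (SA.In (u , v) × ¬ SB.In (u , v)) ⊎ (¬ SA.In (u , v) × SB.In (u , v))
    exclusive {u} {v} t v≢x v≢y = [ (λ i → inj₁ (i , λ j → clash i j)) , (λ j → inj₂ ((λ i → clash i j) , j)) ]′ (edge→ u v t)
      where
      clash : SA.In (u , v) → SB.In (u , v) → ⊥
      clash (a , b , _ , q , _) (a' , b' , _ , q' , _) with overlap₁₂ b b' (trans q (sym q'))
      ... | inj₁ (r , _) = v≢x (trans (sym q) (trans (cong f₁ r) f₁x))
      ... | inj₂ (r , _) = v≢y (trans (sym q) (trans (cong f₁ r) f₁y))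

    X-split : flags X ↭ flags (A.X₁ ++ B.X₁)
    X-split = flags-↭ (filter-partition (SA.In? ∘ proj₁) (SB.In? ∘ proj₁) X λ {f} p →
      let (u≡ , v≢ , d) = TX.sound (∈-flags p) in
      exclusive d (λ q → edge-≢ H d (trans u≡ (sym q))) v≢)

    Y-split : flags Y ↭ flags (A.Y₁ ++ B.Y₁)
    Y-split = flags-↭ (filter-partition (SA.In? ∘ proj₁) (SB.In? ∘ proj₁) Y λ {f} p →
      let (u≡ , v≢ , d) = TY.sound (∈-flags p) in
      exclusive d v≢ (λ q → edge-≢ H d (trans u≡ (sym q))))

    -- Pendant half-edges lie in the corner at which the rotation of their vertex is cut, and so
    -- take its colour.
    c° : Flag H → Fin k
    c° ((u , v) , z) = if u =ᶠ v then π u else c ((u , v) , z)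

    c°-diag : ∀ v z → c° ((v , v) , z) ≡ π v
    c°-diag v z = cong (if_then π v else c ((v , v) , z)) (T⇒≡ {v =ᶠ v} (=ᶠ⁺ refl))

    c°-dart : ∀ {f} → IsDart H (proj₁ f) → c° f ≡ c f
    c°-dart {(u , v) , z} d = cong (if_then π u else c ((u , v) , z)) (¬T⇒≡ {u =ᶠ v} (λ t → edge-≢ H d (=ᶠ⁻ t)))

    opp° : ∀ {a b} z → T (Edge H a b) → c° (opposite {H} sig ((a , b) , z)) ≡ c° ((a , b) , z)
    opp° {a} {b} z d = trans (c°-dart {opposite {H} sig ((a , b) , z)} (edge-sym H {a} {b} d)) (trans (opposite-inv z d) (sym (c°-dart {(a , b) , z} d)))

    runs° : ∀ v → run c° (c° (A.dummy v)) (L v) (c° (A.dummy v))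
    runs° v = subst (λ z → run c° z (L v) z) (sym (c°-diag v true))
      (run-lift id (L v) (λ {f} p → c°-dart {f} (proj₂ (L-sound v p))) (runs v))

    dum° : ∀ v → c° ((v , v) , false) ≡ c° ((v , v) , true)
    dum° v = trans (c°-diag v false) (sym (c°-diag v true))

    forwardA = A.forward c° opp° dum° runs°
    forwardB = B.forward c° opp° dum° runs°
    loopsA = proj₁ (proj₂ forwardA)
    loopsB = proj₁ (proj₂ forwardB)

    Covered : Fin k → Set
    Covered i = i ≡ α ⊎ (∃ λ v → (v ∈ flags X ++ flags Y) × (c° v ≡ i)) ⊎ i ∈ loopsA ++ loopsB

    terminal-dart : ∀ {f} → f ∈ flags X ++ flags Y → IsDart H (proj₁ f)
    terminal-dart p = [ (λ q → proj₂ (proj₂ (TX.sound q))) , (λ q → proj₂ (proj₂ (TY.sound q))) ]′ (∈-++⁻ (flags X) p)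

    from-seen : ∀ {i} → Seen i → Covered i
    from-seen (inj₁ q) = inj₁ q
    from-seen (inj₂ (w , p , q)) = inj₂ (inj₁ (w , p , trans (c°-dart {w} (terminal-dart p)) q))

    XY-A : ∀ {g} → g ∈ A.XY → g ∈ flags X ++ flags Y
    XY-A p = [ (λ q → ∈-++⁺ˡ (proj₁ (A.flags-filter⁻ X q))) , (λ q → ∈-++⁺ʳ (flags X) (proj₁ (A.flags-filter⁻ Y q))) ]′ (∈-++⁻ (flags A.X₁) p)
    XY-B : ∀ {g} → g ∈ B.XY → g ∈ flags X ++ flags Y
    XY-B p = [ (λ q → ∈-++⁺ˡ (proj₁ (B.flags-filter⁻ X q))) , (λ q → ∈-++⁺ʳ (flags X) (proj₁ (B.flags-filter⁻ Y q))) ]′ (∈-++⁻ (flags B.X₁) p)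

    from-A : ∀ {a f} → a ≢ x H₁ → a ≢ y H₁ → f ∈ flags (A.block a) → Covered (c° f)
    from-A p q r = [ (λ (g , g∈ , h) → inj₂ (inj₁ (g , XY-A g∈ , h))) , (λ l → inj₂ (inj₂ (∈-++⁺ˡ l))) ]′
      (proj₂ (proj₂ (proj₂ forwardA)) (SA.inner-∈ p q) r)
    from-B : ∀ {a f} → a ≢ x H₂ → a ≢ y H₂ → f ∈ flags (B.block a) → Covered (c° f)
    from-B p q r = [ (λ (g , g∈ , h) → inj₂ (inj₁ (g , XY-B g∈ , h))) , (λ l → inj₂ (inj₂ (∈-++⁺ʳ loopsA l))) ]′
      (proj₂ (proj₂ (proj₂ forwardB)) (SB.inner-∈ p q) r)

    from-inner : ∀ v → v ≢ x H → v ≢ y H → ∀ {f} → f ∈ flags (A.dummy v ∷ L v) → Covered (c° f)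
    from-inner v p q r with cover v
    ... | inj₁ (a , refl) = from-A (λ z → p (trans (cong f₁ z) f₁x)) (λ z → q (trans (cong f₁ z) f₁y)) r
    ... | inj₂ (b , refl) = from-B (λ z → p (trans (cong f₂ z) f₂x)) (λ z → q (trans (cong f₂ z) f₂y)) r

    cov-π : ∀ v → Covered (π v)
    cov-π v with v ≟ᶠ x H | v ≟ᶠ y H
    ... | yes refl | _ = from-seen seen-πx
    ... | no _ | yes refl = from-seen seen-πy
    ... | no p | no q = subst Covered (c°-diag v true) (from-inner v p q (here refl))

    cov-dart : ∀ u v z → T (Edge H u v) → Covered (c ((u , v) , z))
    cov-dart u v z d with u ≟ᶠ x H | u ≟ᶠ y H
    ... | yes refl | _ = from-seen (seen-x (L-complete z d))
    ... | no _ | yes refl = from-seen (seen-y (L-complete z d))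
    ... | no p | no q = subst Covered (c°-dart {(u , v) , z} d) (from-inner u p q (there (there (L-complete z d))))

    cov : ∀ i → Covered i
    cov i = [ (λ (v , q) → subst Covered q (cov-π v)) , (λ (f , d , q) → subst Covered q (cov-dart _ _ _ d)) ]′ (colour-cover i)

    terminals : Coloured k (A.M ++ B.M) X Y (loopsA ++ loopsB)
    terminals = record
      { c = c° ; α = α ; β = β ; mono = All-++⁺ (proj₁ forwardA) (proj₁ forwardB)
      ; runx = run-lift id X (λ {f} p → c°-dart {f} (proj₂ (proj₂ (TX.sound p)))) runX
      ; runy = run-lift id Y (λ {f} p → c°-dart {f} (proj₂ (proj₂ (TY.sound p)))) runY
      ; cover = cov }

  -- The colouring `terminals` feeds the given embedding into the bound. The closed strands
  -- contribute `A.ℓ + B.ℓ` on both sides of the inequality, so only the numbers belonging to the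
  -- terminals are compared.
  split : ∃ λ k₁ → ∃ λ k₂ → Σ (LScheme H₁) λ ls₁ → Σ (LScheme H₂) λ ls₂ →
    Colouring H₁ ls₁ k₁ × Colouring H₂ ls₂ k₂ × (suc k ≤ k₁ + k₂)
  split = conclude (two-terminal-additivity {M₁ = A.M} {A.X₁} {A.Y₁} {B.M} {B.X₁} {B.Y₁} A.matches B.matches)
    where
    conclude : (∃ λ w₁ → ∃ λ w₂ → ∃ λ w → Achieved A.M A.X₁ A.Y₁ w₁ × Achieved B.M B.X₁ B.Y₁ w₂ ×
      Bounded (A.M ++ B.M) (A.X₁ ++ B.X₁) (A.Y₁ ++ B.Y₁) w × (suc w ≡ w₁ + w₂)) → _
    conclude (w₁ , w₂ , w , ach₁ , ach₂ , bnd , eq) = w₁ + A.ℓ , w₂ + B.ℓ , A.Assembled.scheme ach₁ , B.Assembled.scheme ach₂ ,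
      A.Assembled.colouring ach₁ , B.Assembled.colouring ach₂ , (begin
        suc k                              ≤⟨ s≤s (bnd X Y (loopsA ++ loopsB) X-split Y-split terminals) ⟩
        suc w + length (loopsA ++ loopsB)  ≡⟨ cong₂ _+_ eq (trans (length-++ loopsA) (cong₂ _+_ (proj₁ (proj₂ (proj₂ forwardA))) (proj₁ (proj₂ (proj₂ forwardB))))) ⟩
        w₁ + w₂ + (A.ℓ + B.ℓ)              ≡⟨ solve 4 (λ a b c d → a :+ b :+ (c :+ d) := a :+ c :+ (b :+ d)) refl w₁ w₂ A.ℓ B.ℓ ⟩
        w₁ + A.ℓ + (w₂ + B.ℓ)              ∎)
      where
      open ℕₚ.≤-Reasoning
      open import Data.Nat.Solver using (module +-*-Solver)
      open +-*-Solver

module Glue {H H₁ H₂ : TGraph} (s : IsXYSum H H₁ H₂) (e₁ : XYEdge H₁) (e₂ : XYEdge H₂)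
    (ls₁ : LScheme H₁) {k₁ : ℕ} (col₁ : Colouring H₁ ls₁ k₁)
    (ls₂ : LScheme H₂) {k₂ : ℕ} (col₂ : Colouring H₂ ls₂ k₂) where

  open Strands (_≟ᶠˡ_ {H}) (flip {H}) (flip-flip {H})
  open IsXYSum s
  open SumCounts s e₁ e₂ using (xy-edge; x≢y)
  module A = Summand s e₁ e₂
  module B = Summand (xySum-sym s) e₂ e₁
  module O₁ = Opened e₁ ls₁ col₁
  module O₂ = Opened e₂ ls₂ col₂
  module L₁ = LScheme ls₁
  module L₂ = LScheme ls₂
  module C₁ = Colouring col₁
  module C₂ = Colouring col₂

  abstract
    -- Where the two rotations are concatenated, the last corner of the first meets the first corner
    -- of the second, with the same two colours at x and at y. A single identification serves both
    -- terminals and is the only loss.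
    merged : ∃ λ k → (k₁ + k₂ ≤ suc k) × Σ (Fin (k₁ + k₂) → Fin k) λ h →
      (h (O₁.β ↑ˡ k₂) ≡ h (k₁ ↑ʳ O₂.α)) × (∀ l → ∃ λ m → h m ≡ l)
    merged = merge (O₁.β ↑ˡ k₂) (k₁ ↑ʳ O₂.α)

  K : ℕ
  K = proj₁ merged

  private
    h : Fin (k₁ + k₂) → Fin K
    h = proj₁ (proj₂ (proj₂ merged))

    ι₁ : Fin k₁ → Fin K
    ι₁ j = h (j ↑ˡ k₂)
    ι₂ : Fin k₂ → Fin K
    ι₂ j = h (k₁ ↑ʳ j)

    β₁≡α₂ : ι₁ O₁.β ≡ ι₂ O₂.α
    β₁≡α₂ = proj₁ (proj₂ (proj₂ (proj₂ merged)))

    data Class : Set where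
      terminal : Class
      left     : Fin (n H₁) → Fin (n H₁) → Class
      right    : Fin (n H₂) → Fin (n H₂) → Class
      neither  : Class

    -- `xy` is tested first because it lies in both summands; among the remaining edges left and
    -- right exclude each other.
    decideClass : ∀ {u v} → Dec (T (samePair u v (x H) (y H))) → Dec (A.In (u , v)) → Dec (B.In (u , v)) → Class
    decideClass (yes _) _ _ = terminal
    decideClass (no _) (yes (a , b , _)) _ = left a b
    decideClass (no _) (no _) (yes (a , b , _)) = right a b
    decideClass (no _) (no _) (no _) = neither

    classify : Fin (n H) → Fin (n H) → Class
    classify u v = decideClass (T? (samePair u v (x H) (y H))) (A.In? (u , v)) (B.In? (u , v))

    decide-terminal : ∀ {u v} → T (samePair u v (x H) (y H)) → ∀ p q r → decideClass {u} {v} p q r ≡ terminal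
    decide-terminal t (yes _) q r = refl
    decide-terminal t (no h) q r = ⊥-elim (h t)

    decide-left : ∀ {a b} → A.Proper a b → ∀ p q r → decideClass {f₁ a} {f₁ b} p q r ≡ left a b
    decide-left pr (yes t) q r = ⊥-elim (A.proper-image pr t)
    decide-left pr (no _) (yes (a' , b' , p , q , t)) r = cong₂ left (f₁-inj _ _ p) (f₁-inj _ _ q)
    decide-left pr (no _) (no h) r = ⊥-elim (h (_ , _ , refl , refl , proj₁ pr))

    right-only : ∀ {a b} → B.Proper a b → ¬ A.In (f₂ a , f₂ b)
    right-only {a} {b} (t , h) (a' , b' , p , q , _) with overlap₁₂ a' a p | overlap₁₂ b' b q
    ... | inj₁ (_ , refl) | inj₁ (_ , refl) = edge-≢ H₂ t refl
    ... | inj₂ (_ , refl) | inj₂ (_ , refl) = edge-≢ H₂ t refl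
    ... | inj₁ (_ , refl) | inj₂ (_ , refl) = h (samePair⁺ {a = x H₂} (inj₁ (refl , refl)))
    ... | inj₂ (_ , refl) | inj₁ (_ , refl) = h (samePair⁺ {a = y H₂} (inj₂ (refl , refl)))

    decide-right : ∀ {a b} → B.Proper a b → ∀ p q r → decideClass {f₂ a} {f₂ b} p q r ≡ right a b
    decide-right pr (yes t) q r = ⊥-elim (B.proper-image pr t)
    decide-right pr (no _) (yes i) r = ⊥-elim (right-only pr i)
    decide-right pr (no _) (no _) (yes (a' , b' , p , q , t)) = cong₂ right (f₂-inj _ _ p) (f₂-inj _ _ q)
    decide-right pr (no _) (no _) (no h) = ⊥-elim (h (_ , _ , refl , refl , proj₁ pr))

    classify-terminal : ∀ {u v} → T (samePair u v (x H) (y H)) → classify u v ≡ terminal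
    classify-terminal {u} {v} t = decide-terminal {u} {v} t _ _ _
    classify-left : ∀ {a b} → A.Proper a b → classify (f₁ a) (f₁ b) ≡ left a b
    classify-left pr = decide-left pr _ _ _
    classify-right : ∀ {a b} → B.Proper a b → classify (f₂ a) (f₂ b) ≡ right a b
    classify-right pr = decide-right pr _ _ _

    Left Right : Fin (n H) → Fin (n H) → Set
    Left u v = ∃ λ a → ∃ λ b → A.Proper a b × (f₁ a ≡ u) × (f₁ b ≡ v)
    Right u v = ∃ λ a → ∃ λ b → B.Proper a b × (f₂ a ≡ u) × (f₂ b ≡ v)

    edge-class : ∀ {u v} → T (Edge H u v) → T (samePair u v (x H) (y H)) ⊎ Left u v ⊎ Right u v
    edge-class {u} {v} t with edge→ u v t
    ... | inj₁ (a , b , refl , refl , t') with T? (samePair a b (x H₁) (y H₁))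
    ...   | no q = inj₂ (inj₁ (a , b , (t' , q) , refl , refl))
    ...   | yes q = inj₁ (samePair-map f₁ f₁x f₁y a b q)
    edge-class {u} {v} t | inj₂ (a , b , refl , refl , t') with T? (samePair a b (x H₂) (y H₂))
    ...   | no q = inj₂ (inj₂ (a , b , (t' , q) , refl , refl))
    ...   | yes q = inj₁ (samePair-map f₂ f₂x f₂y a b q)

    -- The sides of `xy` take the outer corners of the concatenation: `α` of the first summand and
    -- `β` of the second.
    end : Bool → Fin K
    end z = if z then ι₂ O₂.β else ι₁ O₁.α

    colourOf : Class → Bool → Fin K
    colourOf terminal z = end z
    colourOf (left a b) z = ι₁ (C₁.c ((a , b) , z))
    colourOf (right a b) z = ι₂ (C₂.c ((a , b) , z))
    -- Not an edge of `H`, so the value is arbitrary.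
    colourOf neither z = end z

    sigOf : Class → Bool
    sigOf terminal = true
    sigOf (left a b) = L₁.sig a b
    sigOf (right a b) = L₂.sig a b
    sigOf neither = false

    c : Flag H → Fin K
    c ((u , v) , z) = colourOf (classify u v) z

    sig : Fin (n H) → Fin (n H) → Bool
    sig u v = sigOf (classify u v)

    c-terminal : ∀ {u v} z → T (samePair u v (x H) (y H)) → c ((u , v) , z) ≡ end z
    c-terminal {u} {v} z t = cong (λ l → colourOf l z) (classify-terminal {u} {v} t)
    c-left : ∀ {a b} z → A.Proper a b → c ((f₁ a , f₁ b) , z) ≡ ι₁ (C₁.c ((a , b) , z))
    c-left z pr = cong (λ l → colourOf l z) (classify-left pr)
    c-right : ∀ {a b} z → B.Proper a b → c ((f₂ a , f₂ b) , z) ≡ ι₂ (C₂.c ((a , b) , z))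
    c-right z pr = cong (λ l → colourOf l z) (classify-right pr)

    sig-sym : ∀ u v → T (Edge H u v) → sig u v ≡ sig v u
    sig-sym u v t with edge-class {u} {v} t
    ... | inj₁ q = trans (cong sigOf (classify-terminal {u} {v} q)) (sym (cong sigOf (classify-terminal {v} {u} (samePair-sym u v q))))
    ... | inj₂ (inj₁ (a , b , pr , refl , refl)) = trans (cong sigOf (classify-left pr))
          (trans (L₁.sig-sym a b (proj₁ pr)) (sym (cong sigOf (classify-left (A.proper-sym pr)))))
    ... | inj₂ (inj₂ (a , b , pr , refl , refl)) = trans (cong sigOf (classify-right pr))
          (trans (L₂.sig-sym a b (proj₁ pr)) (sym (cong sigOf (classify-right (B.proper-sym pr)))))

    opp : ∀ {u v} z → T (Edge H u v) → c (opposite {H} sig ((u , v) , z)) ≡ c ((u , v) , z)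
    opp {u} {v} z t with edge-class {u} {v} t
    ... | inj₁ q = trans (cong (λ g → c ((v , u) , not (z xor g))) (cong sigOf (classify-terminal {u} {v} q)))
          (trans (c-terminal {v} {u} _ (samePair-sym u v q)) (trans (cong end (twist z)) (sym (c-terminal {u} {v} z q))))
      where
      twist : ∀ z → not (z xor true) ≡ z
      twist true = refl
      twist false = refl
    ... | inj₂ (inj₁ (a , b , pr , refl , refl)) = trans (cong (λ g → c ((f₁ b , f₁ a) , not (z xor g))) (cong sigOf (classify-left pr)))
          (trans (c-left _ (A.proper-sym pr)) (trans (cong ι₁ (C₁.opposite-inv z (proj₁ pr))) (sym (c-left z pr))))
    ... | inj₂ (inj₂ (a , b , pr , refl , refl)) = trans (cong (λ g → c ((f₂ b , f₂ a) , not (z xor g))) (cong sigOf (classify-right pr)))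
          (trans (c-right _ (B.proper-sym pr)) (trans (cong ι₂ (C₂.opposite-inv z (proj₁ pr))) (sym (c-right z pr))))

    flags-sum : ∀ R R' → flags (map A.F₁ R ++ map B.F₁ R') ≡ map A.F₁ (A.R₁.flags R) ++ map B.F₁ (B.R₁.flags R')
    flags-sum R R' = trans (flags-++ (map A.F₁ R) (map B.F₁ R')) (cong₂ _++_ (A.flags-map R) (B.flags-map R'))

  -- One construction for both terminals: `u` is either of them and `v` the other. It is uniform
  -- because the opened rotations at x and at y all run from `α` to `β`.
  module AtTerminal (u v : Fin (n H)) (u₁ : Fin (n H₁)) (u₂ : Fin (n H₂)) (f₁u : f₁ u₁ ≡ u) (f₂u : f₂ u₂ ≡ u)
      (same : T (samePair u v (x H) (y H))) (only : ∀ {w} → T (samePair u w (x H) (y H)) → w ≡ v) (t : T (Edge H u v))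
      (R : List (Flag H₁)) (R' : List (Flag H₂))
      (uq : Unique (A.R₁.flags R)) (uq' : Unique (B.R₁.flags R'))
      (sound₁ : ∀ {g} → g ∈ A.R₁.flags R → ∃ λ b → ∃ λ z → A.Proper u₁ b × (g ≡ ((u₁ , b) , z)))
      (sound₂ : ∀ {g} → g ∈ B.R₁.flags R' → ∃ λ b → ∃ λ z → B.Proper u₂ b × (g ≡ ((u₂ , b) , z)))
      (complete₁ : ∀ {b} z → A.Proper u₁ b → ((u₁ , b) , z) ∈ A.R₁.flags R)
      (complete₂ : ∀ {b} z → B.Proper u₂ b → ((u₂ , b) , z) ∈ B.R₁.flags R')
      (run₁ : A.R₁.run C₁.c O₁.α R O₁.β) (run₂ : B.R₁.run C₂.c O₂.α R' O₂.β) where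

    rotation : List (Flag H)
    rotation = ((u , v) , true) ∷ (map A.F₁ R ++ map B.F₁ R')

    private
      fR : flags rotation ≡ ((u , v) , true) ∷ ((u , v) , false) ∷ map A.F₁ (A.R₁.flags R) ++ map B.F₁ (B.R₁.flags R')
      fR = cong (λ z → ((u , v) , true) ∷ ((u , v) , false) ∷ z) (flags-sum R R')

      data Origin (f : Flag H) : Set where
        root  : proj₁ f ≡ (u , v) → Origin f
        fromˡ : ∀ {b z} → A.Proper u₁ b → f ≡ A.F₁ ((u₁ , b) , z) → Origin f
        fromʳ : ∀ {b z} → B.Proper u₂ b → f ≡ B.F₁ ((u₂ , b) , z) → Origin f

      originˡ : ∀ {f} → f ∈ map A.F₁ (A.R₁.flags R) → ∃ λ b → ∃ λ z → A.Proper u₁ b × (f ≡ A.F₁ ((u₁ , b) , z))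
      originˡ p with ∈-map⁻ A.F₁ p
      ... | g , q , refl with sound₁ q
      ... | b , z , pr , refl = b , z , pr , refl

      originʳ : ∀ {f} → f ∈ map B.F₁ (B.R₁.flags R') → ∃ λ b → ∃ λ z → B.Proper u₂ b × (f ≡ B.F₁ ((u₂ , b) , z))
      originʳ p with ∈-map⁻ B.F₁ p
      ... | g , q , refl with sound₂ q
      ... | b , z , pr , refl = b , z , pr , refl

      origin : ∀ {f} → f ∈ flags rotation → Origin f
      origin {f} p with subst (f ∈_) fR p
      ... | here e = root (cong proj₁ e)
      ... | there (here e) = root (cong proj₁ e)
      ... | there (there q) with ∈-++⁻ (map A.F₁ (A.R₁.flags R)) q
      ...   | inj₁ r = let (b , z , pr , e) = originˡ r in fromˡ pr e
      ...   | inj₂ r = let (b , z , pr , e) = originʳ r in fromʳ pr e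

      not-same : ∀ {f} → f ∈ map A.F₁ (A.R₁.flags R) ++ map B.F₁ (B.R₁.flags R') → proj₁ f ≢ (u , v)
      not-same p e with ∈-++⁻ (map A.F₁ (A.R₁.flags R)) p
      ... | inj₁ r with originˡ r
      ...   | b , z , pr , refl = A.proper-image pr (subst₂ (λ a b → T (samePair a b (x H) (y H))) (sym (cong proj₁ e)) (sym (cong proj₂ e)) same)
      not-same p e | inj₂ r with originʳ r
      ...   | b , z , pr , refl = B.proper-image pr (subst₂ (λ a b → T (samePair a b (x H) (y H))) (sym (cong proj₁ e)) (sym (cong proj₂ e)) same)

    unique : Unique (flags rotation)
    unique = subst Unique (sym fR) (((λ ()) ∷ All.tabulate (λ p e → not-same p (sym (cong proj₁ e)))) ∷
        All.tabulate (λ p e → not-same p (sym (cong proj₁ e))) ∷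
        Uniqₚ.++⁺ (Uniqₚ.map⁺ A.F₁-injective uq) (Uniqₚ.map⁺ B.F₁-injective uq') λ (p , q) → disj p q)
      where
      disj : ∀ {f} → f ∈ map A.F₁ (A.R₁.flags R) → f ∈ map B.F₁ (B.R₁.flags R') → ⊥
      disj p q with originˡ p | originʳ q
      ... | b , z , pr , refl | b' , z' , pr' , e = right-only pr' (_ , _ , cong (proj₁ ∘ proj₁) e , cong (proj₂ ∘ proj₁) e , proj₁ pr)

    sound : ∀ {f} → f ∈ flags rotation → (proj₁ (proj₁ f) ≡ u) × IsDart H (proj₁ f)
    sound p with origin p
    ... | root refl = refl , t
    ... | fromˡ pr refl = f₁u , edge₁ _ _ (proj₁ pr)
    ... | fromʳ pr refl = f₂u , edge₂ _ _ (proj₁ pr)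

    complete : ∀ {w} z → T (Edge H u w) → ((u , w) , z) ∈ flags rotation
    complete {w} z d with edge-class {u} {w} d
    ... | inj₁ q = subst (λ w → ((u , w) , z) ∈ flags rotation) (sym (only q)) (both z)
      where
      both : ∀ z → ((u , v) , z) ∈ flags rotation
      both true = here refl
      both false = there (here refl)
    ... | inj₂ (inj₁ (a , b , pr , p , refl)) = subst₂ (λ a l → ((a , f₁ b) , z) ∈ l) f₁u (sym fR)
          (there (there (∈-++⁺ˡ (∈-map⁺ A.F₁ (complete₁ z (subst (λ a → A.Proper a b) (f₁-inj _ _ (trans p (sym f₁u))) pr))))))
    ... | inj₂ (inj₂ (a , b , pr , p , refl)) = subst₂ (λ a l → ((a , f₂ b) , z) ∈ l) f₂u (sym fR)
          (there (there (∈-++⁺ʳ (map A.F₁ (A.R₁.flags R)) (∈-map⁺ B.F₁ (complete₂ z (subst (λ a → B.Proper a b) (f₂-inj _ _ (trans p (sym f₂u))) pr))))))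

    closed : run c (end true) rotation (end true)
    closed = sym (c-terminal {u} {v} true same) , subst (λ z → run c z (map A.F₁ R ++ map B.F₁ R') (end true)) (sym (c-terminal {u} {v} false same))
      (run-++ (map A.F₁ R)
        (subst (run c (ι₁ O₁.α) (map A.F₁ R)) β₁≡α₂
          (A.run-push ι₁ R (λ p → colourˡ (sound₁ p)) run₁))
        (B.run-push ι₂ R' (λ p → colourʳ (sound₂ p)) run₂))
      where
      colourˡ : ∀ {g} → (∃ λ b → ∃ λ z → A.Proper u₁ b × (g ≡ ((u₁ , b) , z))) → c (A.F₁ g) ≡ ι₁ (C₁.c g)
      colourˡ (b , z , pr , refl) = c-left z pr
      colourʳ : ∀ {g} → (∃ λ b → ∃ λ z → B.Proper u₂ b × (g ≡ ((u₂ , b) , z))) → c (B.F₁ g) ≡ ι₂ (C₂.c g)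
      colourʳ (b , z , pr , refl) = c-right z pr

  private
    module TX₁ = Terminal ls₁ (x H₁) (y H₁) O₁.X false O₁.X↭
    module TY₁ = Terminal ls₁ (y H₁) (x H₁) O₁.Y O₁.ty O₁.Y↭
    module TX₂ = Terminal ls₂ (x H₂) (y H₂) O₂.X false O₂.X↭
    module TY₂ = Terminal ls₂ (y H₂) (x H₂) O₂.Y O₂.ty O₂.Y↭

    xy-same : T (samePair (x H) (y H) (x H) (y H))
    xy-same = samePair⁺ {a = x H} (inj₁ (refl , refl))
    yx-same : T (samePair (y H) (x H) (x H) (y H))
    yx-same = samePair⁺ {a = y H} (inj₂ (refl , refl))

    proper-x : ∀ {G : TGraph} {b} → XYEdge G → T (Edge G (x G) b) → b ≢ y G → ¬ T (samePair (x G) b (x G) (y G))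
    proper-x {G} e t b≢ q = [ (λ (_ , r) → b≢ r) , (λ (r , _) → edge-≢ G e r) ]′ (samePair⁻ {a = x G} q)
    proper-y : ∀ {G : TGraph} {b} → XYEdge G → T (Edge G (y G) b) → b ≢ x G → ¬ T (samePair (y G) b (x G) (y G))
    proper-y {G} e t b≢ q = [ (λ (r , _) → edge-≢ G e (sym r)) , (λ (_ , r) → b≢ r) ]′ (samePair⁻ {a = y G} q)
    head≢y : ∀ {G : TGraph} {b} → ¬ T (samePair (x G) b (x G) (y G)) → b ≢ y G
    head≢y {G} h e = h (samePair⁺ {a = x G} (inj₁ (refl , e)))
    head≢x : ∀ {G : TGraph} {b} → ¬ T (samePair (y G) b (x G) (y G)) → b ≢ x G
    head≢x {G} h e = h (samePair⁺ {a = y G} (inj₂ (refl , e)))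

    soundX₁ : ∀ {g} → g ∈ A.R₁.flags O₁.X → ∃ λ b → ∃ λ z → A.Proper (x H₁) b × (g ≡ ((x H₁ , b) , z))
    soundX₁ {(a , b) , z} p with TX₁.sound p
    ... | refl , b≢ , d = b , z , (d , proper-x {H₁} {b} e₁ d b≢) , refl
    soundY₁ : ∀ {g} → g ∈ A.R₁.flags O₁.Y → ∃ λ b → ∃ λ z → A.Proper (y H₁) b × (g ≡ ((y H₁ , b) , z))
    soundY₁ {(a , b) , z} p with TY₁.sound p
    ... | refl , b≢ , d = b , z , (d , proper-y {H₁} {b} e₁ d b≢) , refl
    soundX₂ : ∀ {g} → g ∈ B.R₁.flags O₂.X → ∃ λ b → ∃ λ z → B.Proper (x H₂) b × (g ≡ ((x H₂ , b) , z))
    soundX₂ {(a , b) , z} p with TX₂.sound p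
    ... | refl , b≢ , d = b , z , (d , proper-x {H₂} {b} e₂ d b≢) , refl
    soundY₂ : ∀ {g} → g ∈ B.R₁.flags O₂.Y → ∃ λ b → ∃ λ z → B.Proper (y H₂) b × (g ≡ ((y H₂ , b) , z))
    soundY₂ {(a , b) , z} p with TY₂.sound p
    ... | refl , b≢ , d = b , z , (d , proper-y {H₂} {b} e₂ d b≢) , refl

    onlyX : ∀ {w} → T (samePair (x H) w (x H) (y H)) → w ≡ y H
    onlyX q = [ proj₂ , (λ (r , _) → ⊥-elim (x≢y r)) ]′ (samePair⁻ {a = x H} q)
    onlyY : ∀ {w} → T (samePair (y H) w (x H) (y H)) → w ≡ x H
    onlyY q = [ (λ (r , _) → ⊥-elim (x≢y (sym r))) , proj₂ ]′ (samePair⁻ {a = y H} q)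
    completeX₁ : ∀ {b} z → A.Proper (x H₁) b → ((x H₁ , b) , z) ∈ A.R₁.flags O₁.X
    completeX₁ z pr = TX₁.complete (proj₁ pr) (head≢y {H₁} (proj₂ pr))
    completeX₂ : ∀ {b} z → B.Proper (x H₂) b → ((x H₂ , b) , z) ∈ B.R₁.flags O₂.X
    completeX₂ z pr = TX₂.complete (proj₁ pr) (head≢y {H₂} (proj₂ pr))
    completeY₁ : ∀ {b} z → A.Proper (y H₁) b → ((y H₁ , b) , z) ∈ A.R₁.flags O₁.Y
    completeY₁ z pr = TY₁.complete (proj₁ pr) (head≢x {H₁} (proj₂ pr))
    completeY₂ : ∀ {b} z → B.Proper (y H₂) b → ((y H₂ , b) , z) ∈ B.R₁.flags O₂.Y
    completeY₂ z pr = TY₂.complete (proj₁ pr) (head≢x {H₂} (proj₂ pr))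
    yx-edge : T (Edge H (y H) (x H))
    yx-edge = edge-sym H {x H} {y H} xy-edge

    module AX = AtTerminal (x H) (y H) (x H₁) (x H₂) f₁x f₂x xy-same onlyX xy-edge O₁.X O₂.X
      TX₁.unique TX₂.unique soundX₁ soundX₂ completeX₁ completeX₂ O₁.runX O₂.runX
    module AY = AtTerminal (y H) (x H) (y H₁) (y H₂) f₁y f₂y yx-same onlyY yx-edge O₁.Y O₂.Y
      TY₁.unique TY₂.unique soundY₁ soundY₂ completeY₁ completeY₂ O₁.runY O₂.runY

    Inner₁ Inner₂ : Fin (n H) → Set
    Inner₁ v = ∃ λ a → (a ≢ x H₁) × (a ≢ y H₁) × (f₁ a ≡ v)
    Inner₂ v = ∃ λ b → (b ≢ x H₂) × (b ≢ y H₂) × (f₂ b ≡ v)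

    Kind : Fin (n H) → Set
    Kind v = v ≡ x H ⊎ v ≡ y H ⊎ Inner₁ v ⊎ Inner₂ v

    kind : ∀ v → Kind v
    kind v with v ≟ᶠ x H | v ≟ᶠ y H
    ... | yes e | _ = inj₁ e
    ... | no _ | yes e = inj₂ (inj₁ e)
    ... | no p | no q with cover v
    ...   | inj₁ (a , e) = inj₂ (inj₂ (inj₁ (a , (λ r → p (trans (sym e) (trans (cong f₁ r) f₁x))) , (λ r → q (trans (sym e) (trans (cong f₁ r) f₁y))) , e)))
    ...   | inj₂ (b , e) = inj₂ (inj₂ (inj₂ (b , (λ r → p (trans (sym e) (trans (cong f₂ r) f₂x))) , (λ r → q (trans (sym e) (trans (cong f₂ r) f₂y))) , e)))

    list : ∀ v → Kind v → List (Flag H)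
    list v (inj₁ _) = AX.rotation
    list v (inj₂ (inj₁ _)) = AY.rotation
    list v (inj₂ (inj₂ (inj₁ (a , _)))) = map A.F₁ (L₁.L a)
    list v (inj₂ (inj₂ (inj₂ (b , _)))) = map B.F₁ (L₂.L b)

    list-unique : ∀ v k → Unique (flags (list v k))
    list-unique v (inj₁ _) = AX.unique
    list-unique v (inj₂ (inj₁ _)) = AY.unique
    list-unique v (inj₂ (inj₂ (inj₁ (a , _)))) = subst Unique (sym (A.flags-map (L₁.L a))) (Uniqₚ.map⁺ A.F₁-injective (L₁.L-unique a))
    list-unique v (inj₂ (inj₂ (inj₂ (b , _)))) = subst Unique (sym (B.flags-map (L₂.L b))) (Uniqₚ.map⁺ B.F₁-injective (L₂.L-unique b))

    list-sound : ∀ v k {f} → f ∈ flags (list v k) → (proj₁ (proj₁ f) ≡ v) × IsDart H (proj₁ f)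
    list-sound v (inj₁ refl) p = AX.sound p
    list-sound v (inj₂ (inj₁ refl)) p = AY.sound p
    list-sound v (inj₂ (inj₂ (inj₁ (a , _ , _ , e)))) {f} p with ∈-map⁻ A.F₁ (subst (f ∈_) (A.flags-map (L₁.L a)) p)
    ... | g , q , refl = trans (cong f₁ (proj₁ (L₁.L-sound a q))) e , edge₁ _ _ (proj₂ (L₁.L-sound a q))
    list-sound v (inj₂ (inj₂ (inj₂ (b , _ , _ , e)))) {f} p with ∈-map⁻ B.F₁ (subst (f ∈_) (B.flags-map (L₂.L b)) p)
    ... | g , q , refl = trans (cong f₂ (proj₁ (L₂.L-sound b q))) e , edge₂ _ _ (proj₂ (L₂.L-sound b q))

    list-complete : ∀ {v w} k z → T (Edge H v w) → ((v , w) , z) ∈ flags (list v k)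
    list-complete (inj₁ refl) z d = AX.complete z d
    list-complete (inj₂ (inj₁ refl)) z d = AY.complete z d
    list-complete {v} {w} (inj₂ (inj₂ (inj₁ (a , p , q , refl)))) z d with A.inner-edge (A.inner-∈ p q) d
    ... | b , refl , t = subst (((f₁ a , f₁ b) , z) ∈_) (sym (A.flags-map (L₁.L a))) (∈-map⁺ A.F₁ (L₁.L-complete {a} {b} z t))
    list-complete {v} {w} (inj₂ (inj₂ (inj₂ (a , p , q , refl)))) z d with B.inner-edge (B.inner-∈ p q) d
    ... | b , refl , t = subst (((f₂ a , f₂ b) , z) ∈_) (sym (B.flags-map (L₂.L a))) (∈-map⁺ B.F₁ (L₂.L-complete {a} {b} z t))

    πOf : ∀ v → Kind v → Fin K
    πOf v (inj₁ _) = end true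
    πOf v (inj₂ (inj₁ _)) = end true
    πOf v (inj₂ (inj₂ (inj₁ (a , _)))) = ι₁ (C₁.π a)
    πOf v (inj₂ (inj₂ (inj₂ (b , _)))) = ι₂ (C₂.π b)

    inner-colour₁ : ∀ {a g} → a ≢ x H₁ → a ≢ y H₁ → g ∈ A.R₁.flags (L₁.L a) → c (A.F₁ g) ≡ ι₁ (C₁.c g)
    inner-colour₁ {a} {(a' , b) , z} p q r with L₁.L-sound a r
    ... | refl , d = c-left z (A.inner-proper (A.inner-∈ p q) d)
    inner-colour₂ : ∀ {a g} → a ≢ x H₂ → a ≢ y H₂ → g ∈ B.R₁.flags (L₂.L a) → c (B.F₁ g) ≡ ι₂ (C₂.c g)
    inner-colour₂ {a} {(a' , b) , z} p q r with L₂.L-sound a r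
    ... | refl , d = c-right z (B.inner-proper (B.inner-∈ p q) d)

    closedOf : ∀ v k → run c (πOf v k) (list v k) (πOf v k)
    closedOf v (inj₁ _) = AX.closed
    closedOf v (inj₂ (inj₁ _)) = AY.closed
    closedOf v (inj₂ (inj₂ (inj₁ (a , p , q , _)))) = A.run-push ι₁ (L₁.L a) (λ r → inner-colour₁ p q r) (C₁.runs a)
    closedOf v (inj₂ (inj₂ (inj₂ (b , p , q , _)))) = B.run-push ι₂ (L₂.L b) (λ r → inner-colour₂ p q r) (C₂.runs b)

  scheme : LScheme H
  scheme = record
    { L = λ v → list v (kind v) ; sig = sig ; sig-sym = sig-sym
    ; L-unique = λ v → list-unique v (kind v)
    ; L-sound = λ v → list-sound v (kind v)
    ; L-complete = λ {a} z t → list-complete (kind a) z t }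

  private
    Covered : Fin K → Set
    Covered i = (∃ λ v → πOf v (kind v) ≡ i) ⊎ (∃ λ f → IsDart H (proj₁ f) × (c f ≡ i))

    cov-proper₁ : ∀ {a b} z → A.Proper a b → Covered (ι₁ (C₁.c ((a , b) , z)))
    cov-proper₁ z pr = inj₂ (_ , edge₁ _ _ (proj₁ pr) , c-left z pr)
    cov-proper₂ : ∀ {a b} z → B.Proper a b → Covered (ι₂ (C₂.c ((a , b) , z)))
    cov-proper₂ z pr = inj₂ (_ , edge₂ _ _ (proj₁ pr) , c-right z pr)

    cov-seen₁ : ∀ {i} → O₁.Seen i → Covered (ι₁ i)
    cov-seen₁ (inj₁ refl) = inj₂ (((x H , y H) , false) , xy-edge , c-terminal {x H} {y H} false xy-same)
    cov-seen₁ (inj₂ (w , p , refl)) with ∈-++⁻ (A.R₁.flags O₁.X) p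
    ... | inj₁ q with soundX₁ q
    ...   | b , z , pr , refl = cov-proper₁ z pr
    cov-seen₁ (inj₂ (w , p , refl)) | inj₂ q with soundY₁ q
    ...   | b , z , pr , refl = cov-proper₁ z pr

    cov-seen₂ : ∀ {i} → O₂.Seen i → Covered (ι₂ i)
    -- The first corner of the second part is identified with the last corner of the first part, and
    -- its colour is seen there.
    cov-seen₂ (inj₁ refl) = subst Covered β₁≡α₂ (cov-seen₁ O₁.seen-β)
    cov-seen₂ (inj₂ (w , p , refl)) with ∈-++⁻ (B.R₁.flags O₂.X) p
    ... | inj₁ q with soundX₂ q
    ...   | b , z , pr , refl = cov-proper₂ z pr
    cov-seen₂ (inj₂ (w , p , refl)) | inj₂ q with soundY₂ q
    ...   | b , z , pr , refl = cov-proper₂ z pr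

    π-inner₁ : ∀ {a} k → a ≢ x H₁ → a ≢ y H₁ → πOf (f₁ a) k ≡ ι₁ (C₁.π a)
    π-inner₁ (inj₁ e) p q = ⊥-elim (p (f₁-inj _ _ (trans e (sym f₁x))))
    π-inner₁ (inj₂ (inj₁ e)) p q = ⊥-elim (q (f₁-inj _ _ (trans e (sym f₁y))))
    π-inner₁ (inj₂ (inj₂ (inj₁ (a' , _ , _ , e)))) p q = cong (ι₁ ∘ C₁.π) (f₁-inj _ _ e)
    π-inner₁ {a} (inj₂ (inj₂ (inj₂ (b , _ , _ , e)))) p q = ⊥-elim ([ (λ r → p (proj₁ r)) , (λ r → q (proj₁ r)) ]′ (overlap₁₂ a b (sym e)))
    π-inner₂ : ∀ {a} k → a ≢ x H₂ → a ≢ y H₂ → πOf (f₂ a) k ≡ ι₂ (C₂.π a)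
    π-inner₂ (inj₁ e) p q = ⊥-elim (p (f₂-inj _ _ (trans e (sym f₂x))))
    π-inner₂ (inj₂ (inj₁ e)) p q = ⊥-elim (q (f₂-inj _ _ (trans e (sym f₂y))))
    π-inner₂ (inj₂ (inj₂ (inj₂ (a' , _ , _ , e)))) p q = cong (ι₂ ∘ C₂.π) (f₂-inj _ _ e)
    π-inner₂ {a} (inj₂ (inj₂ (inj₁ (b , _ , _ , e)))) p q = ⊥-elim ([ (λ r → p (proj₂ r)) , (λ r → q (proj₂ r)) ]′ (overlap₁₂ b a e))

    cov-π₁ : ∀ a → Covered (ι₁ (C₁.π a))
    cov-π₁ a with a ≟ᶠ x H₁ | a ≟ᶠ y H₁
    ... | yes refl | _ = cov-seen₁ O₁.seen-πx
    ... | no _ | yes refl = cov-seen₁ O₁.seen-πy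
    ... | no p | no q = inj₁ (f₁ a , π-inner₁ (kind (f₁ a)) p q)
    cov-π₂ : ∀ a → Covered (ι₂ (C₂.π a))
    cov-π₂ a with a ≟ᶠ x H₂ | a ≟ᶠ y H₂
    ... | yes refl | _ = cov-seen₂ O₂.seen-πx
    ... | no _ | yes refl = cov-seen₂ O₂.seen-πy
    ... | no p | no q = inj₁ (f₂ a , π-inner₂ (kind (f₂ a)) p q)

    cov-dart₁ : ∀ a b z → T (Edge H₁ a b) → Dec (T (samePair a b (x H₁) (y H₁))) → Covered (ι₁ (C₁.c ((a , b) , z)))
    cov-dart₁ a b z t (no h) = cov-proper₁ z (t , h)
    cov-dart₁ a b z t (yes q) with samePair⁻ {a = a} q
    ... | inj₁ (refl , refl) = cov-seen₁ (O₁.seen-x (L₁.L-complete z t))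
    ... | inj₂ (refl , refl) = cov-seen₁ (O₁.seen-y (L₁.L-complete z t))
    cov-dart₂ : ∀ a b z → T (Edge H₂ a b) → Dec (T (samePair a b (x H₂) (y H₂))) → Covered (ι₂ (C₂.c ((a , b) , z)))
    cov-dart₂ a b z t (no h) = cov-proper₂ z (t , h)
    cov-dart₂ a b z t (yes q) with samePair⁻ {a = a} q
    ... | inj₁ (refl , refl) = cov-seen₂ (O₂.seen-x (L₂.L-complete z t))
    ... | inj₂ (refl , refl) = cov-seen₂ (O₂.seen-y (L₂.L-complete z t))

    cov₁ : ∀ j → Covered (ι₁ j)
    cov₁ j = [ (λ (a , e) → subst (Covered ∘ ι₁) e (cov-π₁ a)) ,
      (λ (((a , b) , z) , t , e) → subst (Covered ∘ ι₁) e (cov-dart₁ a b z t (T? (samePair a b (x H₁) (y H₁))))) ]′ (C₁.cover j)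
    cov₂ : ∀ j → Covered (ι₂ j)
    cov₂ j = [ (λ (a , e) → subst (Covered ∘ ι₂) e (cov-π₂ a)) ,
      (λ (((a , b) , z) , t , e) → subst (Covered ∘ ι₂) e (cov-dart₂ a b z t (T? (samePair a b (x H₂) (y H₂))))) ]′ (C₂.cover j)

    cov : ∀ i → Covered i
    cov i = let (m , e) = proj₂ (proj₂ (proj₂ (proj₂ merged))) i in subst Covered e (by-side m (splitAt k₁ m) refl)
      where
      by-side : ∀ m z → splitAt k₁ m ≡ z → Covered (h m)
      by-side m (inj₁ j) eq = subst (Covered ∘ h) (Finₚ.splitAt⁻¹-↑ˡ eq) (cov₁ j)
      by-side m (inj₂ j) eq = subst (Covered ∘ h) (Finₚ.splitAt⁻¹-↑ʳ eq) (cov₂ j)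

  colouring : Colouring H scheme K
  colouring = record
    { c = c ; π = λ v → πOf v (kind v) ; opposite-inv = opp ; runs = λ v → closedOf v (kind v) ; cover = cov }

  enough : k₁ + k₂ ≤ suc K
  enough = proj₁ (proj₂ merged)

-- Additivity of the Euler genus

module _ {H H₁ H₂ : TGraph} (s : IsXYSum H H₁ H₂) (e₁ : XYEdge H₁) (e₂ : XYEdge H₂) where

  open SumCounts s e₁ e₂

  private
    numerator : TGraph → ℕ
    numerator G = 2 * components G + edgeCount G

    -- Two from the doubled component and one from the doubled edge. The subtracted terms also
    -- differ by three, two vertices and one face, so the genera add up without a correction.
    numerators : 3 + numerator H ≡ numerator H₁ + numerator H₂
    numerators = begin
      3 + (2 * components H + edgeCount H)                   ≡⟨ solve 2 (λ c e → con 3 :+ (con 2 :* c :+ e) := con 2 :* (con 1 :+ c) :+ (con 1 :+ e)) refl (components H) (edgeCount H) ⟩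
      2 * suc (components H) + suc (edgeCount H)             ≡⟨ cong₂ (λ c e → 2 * c + e) component-count edge-count ⟩
      2 * (components H₁ + components H₂) + (edgeCount H₁ + edgeCount H₂)
        ≡⟨ solve 4 (λ c d e f → con 2 :* (c :+ d) :+ (e :+ f) := con 2 :* c :+ e :+ (con 2 :* d :+ f)) refl (components H₁) (components H₂) (edgeCount H₁) (edgeCount H₂) ⟩
      numerator H₁ + numerator H₂                            ∎
      where
      open ≡-Reasoning
      open import Data.Nat.Solver using (module +-*-Solver)
      open +-*-Solver

    denominators : ∀ F₁ F₂ → n H₁ + F₁ + (n H₂ + F₂) ≡ suc (suc (n H)) + (F₁ + F₂)
    denominators F₁ F₂ = trans (solve 4 (λ a b c d → a :+ b :+ (c :+ d) := (a :+ c) :+ (b :+ d)) refl (n H₁) F₁ (n H₂) F₂)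
      (cong (_+ (F₁ + F₂)) (sym vertex-count))
      where
      open import Data.Nat.Solver using (module +-*-Solver)
      open +-*-Solver

    shift₃ : ∀ m F → suc (suc m) + suc F ≡ 3 + (m + F)
    shift₃ m F = cong (λ z → suc (suc z)) (ℕₚ.+-suc m F)

    -- Truncation may lose something on the left, so only this inequality is available; it is the
    -- one that the upper bound needs.
    ∸-sum : ∀ p₁ p₂ q₁ q₂ → (p₁ + p₂) ∸ (q₁ + q₂) ≤ (p₁ ∸ q₁) + (p₂ ∸ q₂)
    ∸-sum p₁ p₂ q₁ q₂ = ℕₚ.m≤n+o⇒m∸n≤o (p₁ + p₂) (q₁ + q₂) (begin
      p₁ + p₂                                 ≤⟨ ℕₚ.+-mono-≤ (ℕₚ.m≤n+m∸n p₁ q₁) (ℕₚ.m≤n+m∸n p₂ q₂) ⟩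
      (q₁ + (p₁ ∸ q₁)) + (q₂ + (p₂ ∸ q₂))     ≡⟨ solve 4 (λ a b c d → (a :+ b) :+ (c :+ d) := (a :+ c) :+ (b :+ d)) refl q₁ (p₁ ∸ q₁) q₂ (p₂ ∸ q₂) ⟩
      (q₁ + q₂) + ((p₁ ∸ q₁) + (p₂ ∸ q₂))     ∎)
      where
      open ℕₚ.≤-Reasoning
      open import Data.Nat.Solver using (module +-*-Solver)
      open +-*-Solver

    euler : ∀ {G} (S : Scheme G) → n G + faces S ≤ numerator G
    euler {G} S = let (ls , col) = fromScheme G S in
      ≤-trans (≤-reflexive (ℕₚ.+-comm (n G) (faces S))) (EulerInequality.euler-inequality G ls col)

  genus-upper : (S₁ : Scheme H₁) (S₂ : Scheme H₂) →
    Σ (Scheme H) λ S → schemeGenus S ≤ schemeGenus S₁ + schemeGenus S₂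
  genus-upper S₁ S₂ = S , (begin
      numerator H ∸ (n H + faces S)                                       ≡⟨ sym (ℕₚ.[m+n]∸[m+o]≡n∸o 3 (numerator H) (n H + faces S)) ⟩
      (3 + numerator H) ∸ (3 + (n H + faces S))                           ≤⟨ ℕₚ.∸-monoʳ-≤ (3 + numerator H) dens ⟩
      (3 + numerator H) ∸ (n H₁ + faces S₁ + (n H₂ + faces S₂))           ≡⟨ cong (_∸ (n H₁ + faces S₁ + (n H₂ + faces S₂))) numerators ⟩
      (numerator H₁ + numerator H₂) ∸ (n H₁ + faces S₁ + (n H₂ + faces S₂)) ≤⟨ ∸-sum (numerator H₁) (numerator H₂) (n H₁ + faces S₁) (n H₂ + faces S₂) ⟩
      schemeGenus S₁ + schemeGenus S₂                                     ∎)
    where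
    open ℕₚ.≤-Reasoning
    l₁ = fromScheme H₁ S₁
    l₂ = fromScheme H₂ S₂
    module P = Glue s e₁ e₂ (proj₁ l₁) (proj₂ l₁) (proj₁ l₂) (proj₂ l₂)
    S : Scheme H
    S = toScheme H P.scheme
    dens : n H₁ + faces S₁ + (n H₂ + faces S₂) ≤ 3 + (n H + faces S)
    dens = ≤-trans (≤-reflexive (denominators (faces S₁) (faces S₂)))
      (≤-trans (ℕₚ.+-monoʳ-≤ (suc (suc (n H))) (≤-trans P.enough (s≤s (colours≤faces H P.scheme P.colouring))))
        (≤-reflexive (shift₃ (n H) (faces S))))

  genus-lower : (S : Scheme H) → Σ (Scheme H₁) λ S₁ → Σ (Scheme H₂) λ S₂ →
    schemeGenus S₁ + schemeGenus S₂ ≤ schemeGenus S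
  genus-lower S = conclude (Split.split s e₁ e₂ (proj₁ l) (proj₂ l))
    where
    l = fromScheme H S
    conclude : (∃ λ k₁ → ∃ λ k₂ → Σ (LScheme H₁) λ ls₁ → Σ (LScheme H₂) λ ls₂ →
      Colouring H₁ ls₁ k₁ × Colouring H₂ ls₂ k₂ × (suc (faces S) ≤ k₁ + k₂)) → _
    conclude (k₁ , k₂ , ls₁ , ls₂ , col₁ , col₂ , le) = S₁ , S₂ ,
        ℕₚ.m+n≤o⇒m≤o∸n (schemeGenus S₁ + schemeGenus S₂) (ℕₚ.+-cancelˡ-≤ 3 _ _ (begin
          3 + (g₁ + g₂ + (n H + faces S))                     ≡⟨ solve 3 (λ a b q → con 3 :+ (a :+ b :+ q) := a :+ b :+ (con 3 :+ q)) refl g₁ g₂ (n H + faces S) ⟩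
          g₁ + g₂ + (3 + (n H + faces S))                     ≤⟨ ℕₚ.+-monoʳ-≤ (g₁ + g₂) dens ⟩
          g₁ + g₂ + (n H₁ + faces S₁ + (n H₂ + faces S₂))     ≡⟨ solve 4 (λ a b c d → a :+ b :+ (c :+ d) := (a :+ c) :+ (b :+ d)) refl g₁ g₂ (n H₁ + faces S₁) (n H₂ + faces S₂) ⟩
          -- Euler's inequality for the two summands shows that nothing was truncated.
          (g₁ + (n H₁ + faces S₁)) + (g₂ + (n H₂ + faces S₂)) ≡⟨ cong₂ _+_ (ℕₚ.m∸n+n≡m (euler S₁)) (ℕₚ.m∸n+n≡m (euler S₂)) ⟩
          numerator H₁ + numerator H₂                         ≡⟨ sym numerators ⟩
          3 + numerator H                                     ∎))
      where
      open ℕₚ.≤-Reasoning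
      open import Data.Nat.Solver using (module +-*-Solver)
      open +-*-Solver
      S₁ : Scheme H₁
      S₁ = toScheme H₁ ls₁
      S₂ : Scheme H₂
      S₂ = toScheme H₂ ls₂
      g₁ = schemeGenus S₁
      g₂ = schemeGenus S₂
      dens : 3 + (n H + faces S) ≤ n H₁ + faces S₁ + (n H₂ + faces S₂)
      dens = ≤-trans (≤-reflexive (sym (shift₃ (n H) (faces S))))
        (≤-trans (ℕₚ.+-monoʳ-≤ (suc (suc (n H))) (≤-trans le (ℕₚ.+-mono-≤ (colours≤faces H₁ ls₁ col₁) (colours≤faces H₂ ls₂ col₂))))
          (≤-reflexive (sym (denominators (faces S₁) (faces S₂)))))

  eulerGenus-additive : ∀ {a b} → EulerGenus H₁ a → EulerGenus H₂ b → EulerGenus H (a + b)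
  eulerGenus-additive {a} {b} ((S₁ , g₁) , min₁) ((S₂ , g₂) , min₂) =
      (S , ℕₚ.≤-antisym (≤-trans le (≤-reflexive (cong₂ _+_ g₁ g₂))) (bound S)) , bound
    where
    bound : ∀ S → a + b ≤ schemeGenus S
    bound S = let (T₁ , T₂ , l) = genus-lower S in ≤-trans (ℕₚ.+-mono-≤ (min₁ T₁) (min₂ T₂)) l
    S = proj₁ (genus-upper S₁ S₂)
    le = proj₂ (genus-upper S₁ S₂)

-- Uniqueness and existence of the minimum

eulerGenus-unique : ∀ {G a b} → EulerGenus G a → EulerGenus G b → a ≡ b
eulerGenus-unique ((S , refl) , min) ((S' , refl) , min') = ℕₚ.≤-antisym (min S') (min' S)

-- Descent from a given scheme would have to decide whether one of smaller genus exists. Under a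
-- double negation no decision is required: if no minimum exists, every scheme can be improved, down
-- to below zero.
eulerGenus-exists : ∀ {G} → Scheme G → ¬ ¬ (∃ (EulerGenus G))
eulerGenus-exists {G} S = go (schemeGenus S) S ≤-refl
  where
  go : ∀ N (S : Scheme G) → schemeGenus S ≤ N → ¬ ¬ (∃ (EulerGenus G))
  go N S le none = none (schemeGenus S , (S , refl) , λ S' → ℕₚ.≮⇒≥ (λ lt → smaller N le S' lt))
    where
    smaller : ∀ N → schemeGenus S ≤ N → ∀ S' → schemeGenus S' < schemeGenus S → ⊥
    smaller zero le S' lt = ℕₚ.n≮0 (≤-trans lt le)
    smaller (suc N) le S' lt = go N S' (ℕₚ.≤-pred (≤-trans lt le)) none

scheme-exists : ∀ G → Scheme G
scheme-exists G = toScheme G record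
  { L = L ; sig = λ _ _ → false ; sig-sym = λ _ _ _ → refl
  ; L-unique = λ v → unique-listed (unique-select (Edge G v))
  ; L-sound = λ v {f} p → sound v {f} (∈-listed⁻ v (select (Edge G v)) p)
  ; L-complete = λ {a} {b} z t → ∈-listed⁺ z (∈-select⁺ (Edge G a) t) }
  where
  open Strands (_≟ᶠˡ_ {G}) (flip {G}) (flip-flip {G})
  listed : Fin (n G) → List (Fin (n G)) → List (Flag G)
  listed v = map (λ b → (v , b) , true)
  L : Fin (n G) → List (Flag G)
  L v = listed v (select (Edge G v))
  ∈-listed⁺ : ∀ {v b bs} z → b ∈ bs → ((v , b) , z) ∈ flags (listed v bs)
  ∈-listed⁺ true (here refl) = here refl
  ∈-listed⁺ false (here refl) = there (here refl)
  ∈-listed⁺ z (there p) = there (there (∈-listed⁺ z p))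
  ∈-listed⁻ : ∀ v {f} bs → f ∈ flags (listed v bs) → ∃ λ b → (b ∈ bs) × (proj₁ f ≡ (v , b))
  ∈-listed⁻ v (b ∷ bs) (here refl) = b , here refl , refl
  ∈-listed⁻ v (b ∷ bs) (there (here refl)) = b , here refl , refl
  ∈-listed⁻ v (b ∷ bs) (there (there p)) = let (b' , q , e) = ∈-listed⁻ v bs p in b' , there q , e
  unique-listed : ∀ {v bs} → Unique bs → Unique (flags (listed v bs))
  unique-listed {v} {[]} u = []
  unique-listed {v} {b ∷ bs} u = ((λ ()) ∷ out true) ∷ out false ∷ unique-listed (unique-tail u)
    where
    out : ∀ z → All (((v , b) , z) ≢_) (flags (listed v bs))
    out z = All.tabulate λ p e → let (b' , q , e') = ∈-listed⁻ v bs p in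
      unique-head u (subst (_∈ bs) (sym (cong proj₂ (trans (cong proj₁ e) e'))) q)
  sound : ∀ v {f : Flag G} → (∃ λ b → (b ∈ select (Edge G v)) × (proj₁ f ≡ (v , b))) → (proj₁ (proj₁ f) ≡ v) × IsDart G (proj₁ f)
  sound v (b , p , refl) = refl , ∈-select⁻ (Edge G v) p

-- Minor operations on xy-sums

edge⁺ : ∀ G {a b} → a ≢ b → T (adj G a b) ⊎ T (adj G b a) → T (Edge G a b)
edge⁺ G {a} {b} a≢b o = ∧⁺ (not⁺ λ t → a≢b (=ᶠ⁻ t)) ([ ∨⁺ˡ , ∨⁺ʳ {adj G a b} ]′ o)

edge⁻ : ∀ G {a b} → T (Edge G a b) → T (adj G a b) ⊎ T (adj G b a)
edge⁻ G {a} {b} t = ∨⁻ {adj G a b} (∧⁻ʳ {not (a =ᶠ b)} t)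

module _ (G : TGraph) where

  plus-edge : ∀ {a b} → T (Edge G a b) → T (Edge (plus G) a b)
  plus-edge {a} {b} t = edge⁺ (plus G) (edge-≢ G t) ([ (λ p → inj₁ (∨⁺ˡ p)) , (λ p → inj₂ (∨⁺ˡ p)) ]′ (edge⁻ G t))

  plus-xy : ∀ {a b} → a ≢ b → T (samePair a b (x G) (y G)) → T (Edge (plus G) a b)
  plus-xy {a} {b} a≢b t = edge⁺ (plus G) a≢b (inj₁ (∨⁺ʳ {adj G a b} t))

  plus-edge⁻ : ∀ {a b} → T (Edge (plus G) a b) → T (Edge G a b) ⊎ T (samePair a b (x G) (y G))
  plus-edge⁻ {a} {b} t with edge⁻ (plus G) {a} {b} t
  ... | inj₁ p = [ (λ q → inj₁ (edge⁺ G (edge-≢ (plus G) t) (inj₁ q))) , inj₂ ]′ (∨⁻ {adj G a b} p)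
  ... | inj₂ p = [ (λ q → inj₁ (edge⁺ G (edge-≢ (plus G) t) (inj₂ q))) , (λ q → inj₂ (samePair-sym b a q)) ]′ (∨⁻ {adj G b a} p)

  plus-XYEdge : x G ≢ y G → XYEdge (plus G)
  plus-XYEdge h = plus-xy h (samePair⁺ {a = x G} (inj₁ (refl , refl)))

-- The edges added to `G₁`, `G₂` and `G` coincide in `G`, and `IsXYSum` admits such a common edge.
xySum-plus : ∀ {G G₁ G₂} → IsXYSum G G₁ G₂ → x G₁ ≢ y G₁ → IsXYSum (plus G) (plus G₁) (plus G₂)
xySum-plus {G} {G₁} {G₂} s x≢y = record
  { f₁ = f₁ ; f₂ = f₂ ; f₁-inj = f₁-inj ; f₂-inj = f₂-inj ; f₁x = f₁x ; f₁y = f₁y ; f₂x = f₂x ; f₂y = f₂y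
  ; cover = cover ; overlap₁₂ = overlap₁₂
  ; edge→ = λ u v t → [ (λ t' → [ (λ (a , b , p , q , r) → inj₁ (a , b , p , q , plus-edge G₁ {a} {b} r)) ,
                                   (λ (a , b , p , q , r) → inj₂ (a , b , p , q , plus-edge G₂ {a} {b} r)) ]′ (edge→ u v t')) ,
                         (λ t' → inj₁ (terminal t')) ]′ (plus-edge⁻ G {u} {v} t)
  ; edge₁ = λ a b t → [ (λ r → plus-edge G {f₁ a} {f₁ b} (edge₁ a b r)) ,
      (λ r → plus-xy G (λ e → edge-≢ (plus G₁) t (f₁-inj _ _ e)) (samePair-map f₁ f₁x f₁y a b r)) ]′ (plus-edge⁻ G₁ {a} {b} t)
  ; edge₂ = λ a b t → [ (λ r → plus-edge G {f₂ a} {f₂ b} (edge₂ a b r)) ,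
      (λ r → plus-xy G (λ e → edge-≢ (plus G₂) t (f₂-inj _ _ e)) (samePair-map f₂ f₂x f₂y a b r)) ]′ (plus-edge⁻ G₂ {a} {b} t) }
  where
  open IsXYSum s
  terminal : ∀ {u v} → T (samePair u v (x G) (y G)) →
    ∃ λ a → ∃ λ b → (f₁ a ≡ u) × (f₁ b ≡ v) × T (Edge (plus G₁) a b)
  terminal {u} t with samePair⁻ {a = u} t
  ... | inj₁ (refl , refl) = x G₁ , y G₁ , f₁x , f₁y , plus-XYEdge G₁ x≢y
  ... | inj₂ (refl , refl) = y G₁ , x G₁ , f₁y , f₁x , edge-sym (plus G₁) {x G₁} {y G₁} (plus-XYEdge G₁ x≢y)

plusGenus-additive : ∀ {G G₁ G₂ a b} → IsXYSum G G₁ G₂ → x G₁ ≢ y G₁ → x G₂ ≢ y G₂ →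
  EulerGenus⁺ G₁ a → EulerGenus⁺ G₂ b → EulerGenus⁺ G (a + b)
plusGenus-additive {G₁ = G₁} {G₂} s h₁ h₂ = eulerGenus-additive (xySum-plus s h₁) (plus-XYEdge G₁ h₁) (plus-XYEdge G₂ h₂)

module _ (G : TGraph) (u v : Fin (n G)) where

  delete-edge⁺ : ∀ {a b} → T (Edge G a b) → ¬ T (samePair a b u v) → T (Edge (deleteEdge G u v) a b)
  delete-edge⁺ {a} {b} t h = edge⁺ (deleteEdge G u v) (edge-≢ G t) (inj₁ (∧⁺ {Edge G a b} t (not⁺ h)))

  delete-edge⁻ : ∀ {a b} → T (Edge (deleteEdge G u v) a b) → T (Edge G a b) × ¬ T (samePair a b u v)
  delete-edge⁻ {a} {b} t with edge⁻ (deleteEdge G u v) {a} {b} t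
  ... | inj₁ p = ∧⁻ˡ {Edge G a b} p , not⁻ (∧⁻ʳ {Edge G a b} p)
  ... | inj₂ p = edge-sym G {b} {a} (∧⁻ˡ {Edge G b a} p) , λ q → not⁻ (∧⁻ʳ {Edge G b a} p)
        (samePair-sym a b q)

-- An edge of `G₂` with both ends in `G₁` would join x and y. There is none, so the deletion does
-- not touch `G₂`.
xySum-delete : ∀ {G G₁ G₂} (s : IsXYSum G G₁ G₂) → ¬ XYEdge G₂ → ∀ a b → T (Edge G₁ a b) →
  IsXYSum (deleteEdge G (IsXYSum.f₁ s a) (IsXYSum.f₁ s b)) (deleteEdge G₁ a b) G₂
xySum-delete {G} {G₁} {G₂} s no-xy a b ab = record
  { f₁ = f₁ ; f₂ = f₂ ; f₁-inj = f₁-inj ; f₂-inj = f₂-inj ; f₁x = f₁x ; f₁y = f₁y ; f₂x = f₂x ; f₂y = f₂y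
  ; cover = cover ; overlap₁₂ = overlap₁₂
  ; edge→ = λ u v t → from u v (delete-edge⁻ G (f₁ a) (f₁ b) {u} {v} t)
  ; edge₁ = λ c d t → let (p , q) = delete-edge⁻ G₁ a b {c} {d} t in
      delete-edge⁺ G (f₁ a) (f₁ b) {f₁ c} {f₁ d} (edge₁ c d p) λ r → q (samePair-reflect f₁ f₁-inj refl refl c d r)
  ; edge₂ = λ c d t → delete-edge⁺ G (f₁ a) (f₁ b) {f₂ c} {f₂ d} (edge₂ c d t) λ r →
      [ (λ (p , q) → clash c d t (overlap₁₂ a c (sym p)) (overlap₁₂ b d (sym q))) ,
        (λ (p , q) → clash c d t (overlap₁₂ b c (sym p)) (overlap₁₂ a d (sym q))) ]′ (samePair⁻ {a = f₂ c} r) }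
  where
  open IsXYSum s
  clash : ∀ {a b} c d → T (Edge G₂ c d) → (a ≡ x G₁ × c ≡ x G₂) ⊎ (a ≡ y G₁ × c ≡ y G₂) →
    (b ≡ x G₁ × d ≡ x G₂) ⊎ (b ≡ y G₁ × d ≡ y G₂) → ⊥
  clash c d t (inj₁ (_ , refl)) (inj₁ (_ , refl)) = edge-≢ G₂ t refl
  clash c d t (inj₂ (_ , refl)) (inj₂ (_ , refl)) = edge-≢ G₂ t refl
  clash c d t (inj₁ (_ , refl)) (inj₂ (_ , refl)) = no-xy t
  clash c d t (inj₂ (_ , refl)) (inj₁ (_ , refl)) = no-xy (edge-sym G₂ {c} {d} t)
  from : ∀ u v → T (Edge G u v) × ¬ T (samePair u v (f₁ a) (f₁ b)) →
    (∃ λ c → ∃ λ d → (f₁ c ≡ u) × (f₁ d ≡ v) × T (Edge (deleteEdge G₁ a b) c d)) ⊎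
    (∃ λ c → ∃ λ d → (f₂ c ≡ u) × (f₂ d ≡ v) × T (Edge G₂ c d))
  from u v (t , h) with edge→ u v t
  ... | inj₂ r = inj₂ r
  ... | inj₁ (c , d , refl , refl , r) = inj₁ (c , d , refl , refl , delete-edge⁺ G₁ a b {c} {d} r λ q → h (samePair-map f₁ refl refl c d q))

-- The quotient map is described by its properties: it identifies `u` with `v` and nothing else. The
-- contractions in `G` and in `G₁` number their vertices differently, so they are compared through
-- these properties and not through `squash`.
record Contraction (G G' : TGraph) (u v : Fin (n G)) : Set where
  field
    q : Fin (n G) → Fin (n G')
    section : Fin (n G') → Fin (n G)
    q-section : ∀ w → q (section w) ≡ w
    q-uv : q u ≡ q v
    q-ker : ∀ {i j} → q i ≡ q j → i ≡ j ⊎ T (samePair i j u v)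
    qx : q (x G) ≡ x G'
    qy : q (y G) ≡ y G'
    edge-image : ∀ {i j} → q i ≢ q j → T (Edge G i j) → T (Edge G' (q i) (q j))
    edge-lift : ∀ {a b} → T (Edge G' a b) → ∃ λ i → ∃ λ j → (q i ≡ a) × (q j ≡ b) × T (Edge G i j)

  q-pair : ∀ {i j} → T (samePair i j u v) → q i ≡ q j
  q-pair {i} t = [ (λ (p , r) → trans (cong q p) (trans q-uv (cong q (sym r)))) ,
                   (λ (p , r) → trans (cong q p) (trans (sym q-uv) (cong q (sym r)))) ]′ (samePair⁻ {a = i} t)

contract-contraction : ∀ G u v (u≢v : u ≢ v) → Contraction G (contract G u v u≢v) u v
contract-contraction (tgraph zero adj () y) u v u≢v
contract-contraction G@(tgraph (suc k) adj x y) u v u≢v = record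
  { q = sq ; section = punchIn v ; q-section = sec ; q-uv = trans (sq-other u≢v) (trans (Finₚ.punchOut-cong v refl) (sym sq-v))
  ; q-ker = ker ; qx = refl ; qy = refl
  ; edge-image = λ {i} {j} ne t → edge⁺ (contract G u v u≢v) ne
      (inj₁ (anyFin⁺ {f = λ i' → anyFin λ j' → (sq i' =ᶠ sq i) ∧ (sq j' =ᶠ sq j) ∧ EdgeRaw adj i' j'} i
        (anyFin⁺ {f = λ j' → (sq i =ᶠ sq i) ∧ (sq j' =ᶠ sq j) ∧ EdgeRaw adj i j'} j
          (∧⁺ {sq i =ᶠ sq i} (=ᶠ⁺ refl) (∧⁺ {sq j =ᶠ sq j} (=ᶠ⁺ refl) t)))))
  ; edge-lift = lift }
  where
  u' : Fin k
  u' = punchOut {i = v} {j = u} (λ eq → u≢v (sym eq))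
  sq : Fin (suc k) → Fin k
  sq = squash v u'
  sq-v : sq v ≡ u'
  sq-v with v ≟ᶠ v
  ... | yes _ = refl
  ... | no h = ⊥-elim (h refl)
  sq-other : ∀ {w} (h : w ≢ v) → sq w ≡ punchOut {i = v} {j = w} (λ eq → h (sym eq))
  sq-other {w} h with w ≟ᶠ v
  ... | yes e = ⊥-elim (h e)
  ... | no h' = Finₚ.punchOut-cong v refl
  sec : ∀ w → sq (punchIn v w) ≡ w
  sec w = trans (sq-other (Finₚ.punchInᵢ≢i v w)) (Finₚ.punchOut-punchIn v)
  hits-u : ∀ {w} → w ≢ v → sq w ≡ u' → w ≡ u
  hits-u h e = Finₚ.punchOut-injective (λ eq → h (sym eq)) (λ eq → u≢v (sym eq)) (trans (sym (sq-other h)) e)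
  ker : ∀ {i j} → sq i ≡ sq j → i ≡ j ⊎ T (samePair i j u v)
  ker {i} {j} e = cases (i ≟ᶠ v) (j ≟ᶠ v)
    where
    cases : Dec (i ≡ v) → Dec (j ≡ v) → i ≡ j ⊎ T (samePair i j u v)
    cases (yes p) (yes r) = inj₁ (trans p (sym r))
    cases (yes p) (no r) = inj₂ (samePair⁺ {a = i} (inj₂ (p , hits-u r (trans (sym e) (trans (cong sq p) sq-v)))))
    cases (no p) (yes r) = inj₂ (samePair⁺ {a = i} (inj₁ (hits-u p (trans e (trans (cong sq r) sq-v)) , r)))
    cases (no p) (no r) = inj₁ (Finₚ.punchOut-injective (λ eq → p (sym eq)) (λ eq → r (sym eq))
      (trans (sym (sq-other p)) (trans e (sq-other r))))
  half : ∀ {a b} → T (TGraph.adj (contract G u v u≢v) a b) → ∃ λ i → ∃ λ j → (sq i ≡ a) × (sq j ≡ b) × T (Edge G i j)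
  half {a} {b} t with anyFin⁻ {f = λ i → anyFin λ j → (sq i =ᶠ a) ∧ (sq j =ᶠ b) ∧ EdgeRaw adj i j} t
  ... | i , t' with anyFin⁻ {f = λ j → (sq i =ᶠ a) ∧ (sq j =ᶠ b) ∧ EdgeRaw adj i j} t'
  ... | j , t'' = i , j , =ᶠ⁻ (∧⁻ˡ {sq i =ᶠ a} t'') , =ᶠ⁻ (∧⁻ˡ {sq j =ᶠ b} (∧⁻ʳ {sq i =ᶠ a} t'')) ,
        ∧⁻ʳ {sq j =ᶠ b} (∧⁻ʳ {sq i =ᶠ a} t'')
  lift : ∀ {a b} → T (Edge (contract G u v u≢v) a b) → ∃ λ i → ∃ λ j → (sq i ≡ a) × (sq j ≡ b) × T (Edge G i j)
  lift {a} {b} t with edge⁻ (contract G u v u≢v) {a} {b} t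
  ... | inj₁ p = half p
  ... | inj₂ p = let (i , j , e , e' , r) = half p in j , i , e' , e , edge-sym G {i} {j} r

-- The kernels of the two quotient maps correspond under `f₁`, which therefore descends to an
-- injection. The map `f₂` stays injective because the ends of the contracted edge are not both
-- terminals.
xySum-contract : ∀ {G G₁ G₂ G' G₁'} (s : IsXYSum G G₁ G₂) {a b} → a ≢ b → ¬ T (samePair a b (x G₁) (y G₁)) →
  Contraction G G' (IsXYSum.f₁ s a) (IsXYSum.f₁ s b) → Contraction G₁ G₁' a b → IsXYSum G' G₁' G₂
xySum-contract {G} {G₁} {G₂} {G'} {G₁'} s {a} {b} a≢b not-xy C C₁ = record
  { f₁ = g₁ ; f₂ = g₂ ; f₁-inj = g₁-inj ; f₂-inj = g₂-inj
  ; f₁x = trans (cong g₁ (sym D.qx)) (trans (g₁-q (x G₁)) (trans (cong q f₁x) qx))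
  ; f₁y = trans (cong g₁ (sym D.qy)) (trans (g₁-q (y G₁)) (trans (cong q f₁y) qy))
  ; f₂x = trans (cong q f₂x) qx
  ; f₂y = trans (cong q f₂y) qy
  ; cover = cov
  ; overlap₁₂ = over
  ; edge→ = λ u v t → e→ u v t (edge-lift t)
  ; edge₁ = λ w w' t → e₁ w w' t (D.edge-lift t)
  ; edge₂ = λ c d t → edge-image (λ e → edge-≢ G₂ t (g₂-inj c d e)) (edge₂ c d t) }
  where
  open IsXYSum s
  open Contraction C
  module D = Contraction C₁
  g₁ : Fin (n G₁') → Fin (n G')
  g₁ w = q (f₁ (D.section w))
  g₂ : Fin (n G₂) → Fin (n G')
  g₂ c = q (f₂ c)
  push : ∀ {i j} → T (samePair i j a b) → T (samePair (f₁ i) (f₁ j) (f₁ a) (f₁ b))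
  push {i} {j} = samePair-map f₁ refl refl i j
  pull : ∀ {i j} → T (samePair (f₁ i) (f₁ j) (f₁ a) (f₁ b)) → T (samePair i j a b)
  pull {i} {j} = samePair-reflect f₁ f₁-inj refl refl i j
  transfer : ∀ {i j} → D.q i ≡ D.q j → q (f₁ i) ≡ q (f₁ j)
  transfer e = [ (λ p → cong (q ∘ f₁) p) , (λ p → q-pair (push p)) ]′ (D.q-ker e)
  untransfer : ∀ {i j} → q (f₁ i) ≡ q (f₁ j) → D.q i ≡ D.q j
  untransfer e = [ (λ p → cong D.q (f₁-inj _ _ p)) , (λ p → D.q-pair (pull p)) ]′ (q-ker e)
  g₁-q : ∀ i → g₁ (D.q i) ≡ q (f₁ i)
  g₁-q i = transfer (D.q-section (D.q i))
  g₁-inj : ∀ w w' → g₁ w ≡ g₁ w' → w ≡ w'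
  g₁-inj w w' e = trans (sym (D.q-section w)) (trans (untransfer e) (D.q-section w'))
  terminals : ∀ {c d} → f₂ c ≡ f₁ a → f₂ d ≡ f₁ b → ⊥
  terminals {c} {d} p r with overlap₁₂ a c (sym p) | overlap₁₂ b d (sym r)
  ... | inj₁ (i , _) | inj₁ (j , _) = a≢b (trans i (sym j))
  ... | inj₂ (i , _) | inj₂ (j , _) = a≢b (trans i (sym j))
  ... | inj₁ (i , _) | inj₂ (j , _) = not-xy (samePair⁺ {a = a} (inj₁ (i , j)))
  ... | inj₂ (i , _) | inj₁ (j , _) = not-xy (samePair⁺ {a = a} (inj₂ (i , j)))
  g₂-inj : ∀ c d → g₂ c ≡ g₂ d → c ≡ d
  g₂-inj c d e = [ f₂-inj c d , (λ t → ⊥-elim ([ (λ (p , r) → terminals p r) , (λ (p , r) → terminals r p) ]′ (samePair⁻ {a = f₂ c} t))) ]′ (q-ker e)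
  cov : ∀ v → (∃ λ w → g₁ w ≡ v) ⊎ (∃ λ c → g₂ c ≡ v)
  cov v = [ (λ (i , e) → inj₁ (D.q i , trans (g₁-q i) (trans (cong q e) (q-section v)))) ,
            (λ (c , e) → inj₂ (c , trans (cong q e) (q-section v))) ]′ (cover (section v))
  at-terminal : ∀ {i c} → f₁ i ≡ f₂ c → (D.q i ≡ x G₁' × c ≡ x G₂) ⊎ (D.q i ≡ y G₁' × c ≡ y G₂)
  at-terminal {i} {c} e = [ (λ (p , r) → inj₁ (trans (cong D.q p) D.qx , r)) , (λ (p , r) → inj₂ (trans (cong D.q p) D.qy , r)) ]′ (overlap₁₂ i c e)
  over : ∀ w c → g₁ w ≡ g₂ c → (w ≡ x G₁' × c ≡ x G₂) ⊎ (w ≡ y G₁' × c ≡ y G₂)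
  -- If `section w` and `f₂ c` are different ends of the contracted edge, the end shared with `G₂`
  -- is a terminal, and hence so is the merged vertex.
  over w c e = subst (λ z → (z ≡ x G₁' × c ≡ x G₂) ⊎ (z ≡ y G₁' × c ≡ y G₂)) (D.q-section w)
    ([ at-terminal , (λ t → [
         (λ (p , r) → subst Goal (trans (sym D.q-uv) (cong D.q (sym (f₁-inj _ _ p)))) (at-terminal {b} {c} (sym r))) ,
         (λ (p , r) → subst Goal (trans D.q-uv (cong D.q (sym (f₁-inj _ _ p)))) (at-terminal {a} {c} (sym r))) ]′
       (samePair⁻ {a = f₁ (D.section w)} t)) ]′ (q-ker e))
    where
    Goal : Fin (n G₁') → Set
    Goal z = (z ≡ x G₁' × c ≡ x G₂) ⊎ (z ≡ y G₁' × c ≡ y G₂)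
  e→ : ∀ u v → T (Edge G' u v) → (∃ λ i → ∃ λ j → (q i ≡ u) × (q j ≡ v) × T (Edge G i j)) →
    (∃ λ w → ∃ λ w' → (g₁ w ≡ u) × (g₁ w' ≡ v) × T (Edge G₁' w w')) ⊎
    (∃ λ c → ∃ λ d → (g₂ c ≡ u) × (g₂ d ≡ v) × T (Edge G₂ c d))
  e→ u v t (i , j , refl , refl , r) with edge→ i j r
  ... | inj₁ (c , d , refl , refl , r') = inj₁ (D.q c , D.q d , g₁-q c , g₁-q d ,
        D.edge-image (λ e → edge-≢ G' t (transfer e)) r')
  ... | inj₂ (c , d , refl , refl , r') = inj₂ (c , d , refl , refl , r')
  e₁ : ∀ w w' → T (Edge G₁' w w') → (∃ λ i → ∃ λ j → (D.q i ≡ w) × (D.q j ≡ w') × T (Edge G₁ i j)) → T (Edge G' (g₁ w) (g₁ w'))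
  e₁ w w' t (i , j , refl , refl , r) = subst₂ (λ u v → T (Edge G' u v)) (sym (g₁-q i)) (sym (g₁-q j))
    (edge-image (λ e → edge-≢ G₁' t (untransfer e)) (edge₁ i j r))

-- Additivity for the minors requires that adding `xy` really creates an edge, hence `distinct`. It
-- holds because the pair `xy` is never contracted.
record Corresponding {G G₁ G₂ : TGraph} (s : IsXYSum G G₁ G₂) (μ : MinorOp G) (μ₁ : MinorOp G₁) : Set where
  field
    sum : IsXYSum (applyOp G μ) (applyOp G₁ μ₁) G₂
    distinct : x (applyOp G₁ μ₁) ≢ y (applyOp G₁ μ₁)

module _ {G G₁ G₂ : TGraph} (s : IsXYSum G G₁ G₂) (c₁ : InGxy° G₁) (c₂ : InGxy° G₂) where

  open IsXYSum s

  private
    delete-corresponding : ∀ a b t (t₁ : T (Edge G₁ a b)) → Corresponding s (deleteOp (f₁ a) (f₁ b) t) (deleteOp a b t₁)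
    delete-corresponding a b t t₁ = record { sum = xySum-delete s (proj₂ c₂) a b t₁ ; distinct = proj₁ c₁ }

    contract-corresponding : ∀ a b t h (t₁ : T (Edge G₁ a b)) h₁ →
      Corresponding s (contractOp (f₁ a) (f₁ b) t h) (contractOp a b t₁ h₁)
    contract-corresponding a b t h t₁ h₁ = record
      { sum = xySum-contract s (edge-≢ G₁ t₁) (not⁻ h₁) (contract-contraction G (f₁ a) (f₁ b) (edge⇒≢ t)) C₁
      ; distinct = λ e → [ proj₁ c₁ , (λ q → not⁻ h₁ (samePair⁺ {a = a}
          ([ (λ (p , r) → inj₁ (sym p , sym r)) , (λ (p , r) → inj₂ (sym r , sym p)) ]′ (samePair⁻ {a = x G₁} q)))) ]′
          (Contraction.q-ker C₁ (trans (Contraction.qx C₁) (trans e (sym (Contraction.qy C₁))))) }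
      where
      C₁ = contract-contraction G₁ a b (edge⇒≢ t₁)

  restrictOp : ∀ μ → InG₁ s (opEdge μ) → Σ (MinorOp G₁) (Corresponding s μ)
  restrictOp (deleteOp u v t) (a , b , refl , refl , t₁) = deleteOp a b t₁ , delete-corresponding a b t t₁
  restrictOp (contractOp u v t h) (a , b , refl , refl , t₁) =
    contractOp a b t₁ h₁ , contract-corresponding a b t h t₁ h₁
    where
    h₁ : T (not (samePair a b (x G₁) (y G₁)))
    h₁ = not⁺ λ q → not⁻ h (samePair-map f₁ f₁x f₁y a b q)

  extendOp : ∀ μ₁ → Σ (MinorOp G) λ μ → InG₁ s (opEdge μ) × Corresponding s μ μ₁
  extendOp (deleteOp a b t₁) = deleteOp (f₁ a) (f₁ b) (edge₁ a b t₁) , (a , b , refl , refl , t₁) ,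
    delete-corresponding a b (edge₁ a b t₁) t₁
  extendOp (contractOp a b t₁ h₁) = contractOp (f₁ a) (f₁ b) (edge₁ a b t₁) h , (a , b , refl , refl , t₁) ,
    contract-corresponding a b (edge₁ a b t₁) h t₁ h₁
    where
    h : T (not (samePair (f₁ a) (f₁ b) (x G) (y G)))
    h = not⁺ λ q → not⁻ h₁ (samePair-reflect f₁ f₁-inj f₁x f₁y a b q)

<-stable : ∀ {a b} → ¬ ¬ (a < b) → a < b
<-stable {a} {b} h = decidable-stable (a <? b) h

theorem4p9 : (G G₁ G₂ : TGraph) (s : IsXYSum G G₁ G₂) →
    InGxy° G₁ → InGxy° G₂ → Connected G₁ → Connected G₂ →
    (G₁-Tight s → InC° G₁) × (InC° G₁ → G₁-Tight s)
theorem4p9 G G₁ G₂ s c₁ c₂ _ _ = tight⇒critical , critical⇒tight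
  where
  exists : ∀ K → ¬ ¬ (∃ (EulerGenus⁺ K))
  exists K = eulerGenus-exists (scheme-exists (plus K))
  add : ∀ {a b} → EulerGenus⁺ G₁ a → EulerGenus⁺ G₂ b → EulerGenus⁺ G (a + b)
  add = plusGenus-additive s (proj₁ c₁) (proj₁ c₂)
  tight⇒critical : G₁-Tight s → InC° G₁
  -- Both genera are shifted by the same value `c` of `G₂`, which is cancelled after tightness has
  -- been applied in `G`.
  tight⇒critical tight = c₁ , λ μ₁ a b ga gb → <-stable λ not< →
    let (μ , inG₁ , cor) = extendOp s c₁ c₂ μ₁ in
    exists G₂ λ (c , gc) → not< (ℕₚ.+-cancelʳ-< c a b
      (tight μ inG₁ (a + c) (b + c)
        (plusGenus-additive (Corresponding.sum cor) (Corresponding.distinct cor) (proj₁ c₂) ga gc) (add gb gc)))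
  critical⇒tight : InC° G₁ → G₁-Tight s
  critical⇒tight (_ , critical) μ inG₁ a b ga gb = <-stable λ not< →
    let (μ₁ , cor) = restrictOp s c₁ c₂ μ inG₁ in
    -- The given values belong to `G` and its minor, so those of `G₁` and its minor have to be
    -- supplied. Uniqueness then identifies their sums with the given values.
    exists G₂ λ (c , gc) → exists G₁ λ (b₁ , gb₁) → exists (applyOp G₁ μ₁) λ (a₁ , ga₁) →
      not< (subst₂ _<_
        (eulerGenus-unique (plusGenus-additive (Corresponding.sum cor) (Corresponding.distinct cor) (proj₁ c₂) ga₁ gc) ga)
        (eulerGenus-unique (add gb₁ gc) gb)
        (ℕₚ.+-monoˡ-< c (critical μ₁ a₁ b₁ ga₁ gb₁)))
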